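{- Let $G$ be a finite simple graph that contains no triangle and no ISK4. Then $G$ is series-parallel, or $G$ is a complete bipartite graph, or $G$ has a clique cutset of size at most two, or $G$ has a wheel decomposition.
   Context: $G$ contains $H$ if $H$ is isomorphic to an induced subgraph of $G$. A subdivision of a graph is obtained by repeatedly replacing an edge $vw$ by a path $vuw$ through a new vertex $u$. An ISK4 is an induced subgraph that is a subdivision of $K_4$. A graph is series-parallel if no subgraph of it is a subdivision of $K_4$. A cutset is a set $C$ of vertices with $G\setminus C$ disconnected. A hole is a chordless cycle of length at least 4. A wheel $(H,x)$ of $G$ is an induced subgraph consisting of a hole $H$ and a vertex $x\notin V(H)$ having at least three neighbors on $H$; let $x_1,\dots,x_n$ be the neighbors of $x$ on $H$ in the order along $H$, and for $i=1,\dots,n$ (indices mod $n$) let the sector $S_i$ be the subpath of $H$ with ends $x_i,x_{i+1}$ whose interior vertices are not adjacent to $x$. With $N[x]=N(x)\cup\{x\}$, $G$ has a wheel decomposition if for some wheel $(H,x)$ of $G$, for every $i\in\{1,\dots,n\}$, the set $(N[x]\setminus V(H))\cup\{x_i,x_{i+1}\}$ is a cutset separating $S_i$ from $H\setminus S_i$. -}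

module Defs where

open import Data.Nat using (ℕ; zero; suc; _+_; _≤_; _<_)
open import Data.Fin using (Fin; zero; suc; _≟_)
open import Data.Bool using (Bool; true; false; _∧_; _∨_; not; _xor_)
open import Data.Bool.Properties using (∧-comm; ∨-comm)
open import Data.List using (List; length)
open import Data.List.Membership.Propositional using (_∈_)
open import Data.Product using (Σ; ∃; ∃-syntax; _×_; _,_)
open import Data.Sum using (_⊎_)
open import Relation.Nullary using (¬_; yes; no)
open import Data.Empty using (⊥; ⊥-elim)
open import Relation.Nullary.Decidable using (⌊_⌋)
open import Relation.Binary.PropositionalEquality using (_≡_; _≢_; refl; sym; cong)
open import Function.Definitions using (Injective)

record Graph : Set where
  field
    n      : ℕ
    adj    : Fin n → Fin n → Bool
    adj-sym    : ∀ u v → adj u v ≡ adj v u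
    adj-irrefl : ∀ u → adj u u ≡ false

open Graph public

V : Graph → Set
V G = Fin (n G)

eqb : ∀ {m} → Fin m → Fin m → Bool
eqb x y = ⌊ x ≟ y ⌋

eqb-sym : ∀ {m} (x y : Fin m) → eqb x y ≡ eqb y x
eqb-sym x y with x ≟ y | y ≟ x
... | yes _ | yes _ = refl
... | no _  | no _  = refl
... | yes p | no ¬q = ⊥-elim (¬q (sym p))
... | no ¬p | yes q = ⊥-elim (¬p (sym q))

eqb-refl : ∀ {m} (x : Fin m) → eqb x x ≡ false → Data.Empty.⊥
eqb-refl x e with x ≟ x
eqb-refl x () | yes _
... | no ¬p = ¬p refl
 
open import Data.Empty using (⊥)

K : ℕ → Graph
K m = record
  { n = m
  ; adj = λ u v → not (eqb u v)
  ; adj-sym = λ u v → cong not (eqb-sym u v)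
  ; adj-irrefl = irr }
  where
  irr : ∀ (u : Fin m) → not (eqb u u) ≡ false
  irr u with u ≟ u
  ... | yes _ = refl
  ... | no ¬p = ⊥-elim (¬p refl)

record _⊑_ (H G : Graph) : Set where
  field
    emb     : V H → V G
    emb-inj : Injective _≡_ _≡_ emb
    emb-adj : ∀ u v → adj H u v ≡ adj G (emb u) (emb v)

record _⊆ₛ_ (H G : Graph) : Set where
  field
    emb     : V H → V G
    emb-inj : Injective _≡_ _≡_ emb
    emb-adj : ∀ u v → adj H u v ≡ true → adj G (emb u) (emb v) ≡ true

-- Subdivision: replace edge vw by path v u w through a new vertex u
-- (the new vertex is zero, old vertex x becomes suc x)

module _ (G : Graph) (v w : V G) where
  private
    hit : V G → V G → Bool
    hit x y = (eqb x v ∧ eqb y w) ∨ (eqb x w ∧ eqb y v)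

    hit-sym : ∀ x y → hit x y ≡ hit y x
    hit-sym x y rewrite ∧-comm (eqb x v) (eqb y w) | ∧-comm (eqb x w) (eqb y v)
      = ∨-comm (eqb y w ∧ eqb x v) (eqb y v ∧ eqb x w)

    sadj : Fin (suc (n G)) → Fin (suc (n G)) → Bool
    sadj zero zero = false
    sadj zero (suc y) = eqb y v ∨ eqb y w
    sadj (suc x) zero = eqb x v ∨ eqb x w
    sadj (suc x) (suc y) = adj G x y ∧ not (hit x y)

    ssym : ∀ a b → sadj a b ≡ sadj b a
    ssym zero zero = refl
    ssym zero (suc y) = refl
    ssym (suc x) zero = refl
    ssym (suc x) (suc y) rewrite adj-sym G x y | hit-sym x y = refl

    sirr : ∀ a → sadj a a ≡ false
    sirr zero = refl
    sirr (suc x) rewrite adj-irrefl G x = refl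

  subdivide : adj G v w ≡ true → Graph
  subdivide _ = record { n = suc (n G) ; adj = sadj ; adj-sym = ssym ; adj-irrefl = sirr }

data SubdivisionOf (G : Graph) : Graph → Set where
  base : SubdivisionOf G G
  step : ∀ {H} → SubdivisionOf G H → (v w : V H) (e : adj H v w ≡ true)
       → SubdivisionOf G (subdivide H v w e)

ContainsISK4 : Graph → Set
ContainsISK4 G = ∃[ H ] (SubdivisionOf (K 4) H × (H ⊑ G))

SeriesParallel : Graph → Set
SeriesParallel G = ¬ (∃[ H ] (SubdivisionOf (K 4) H × (H ⊆ₛ G)))

CompleteBipartite : Graph → Set
CompleteBipartite G =
  Σ (V G → Bool) λ side → ((∃[ a ] side a ≡ true) × (∃[ b ] side b ≡ false)
            × (∀ u v → adj G u v ≡ (side u xor side v)))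

data Reach (G : Graph) (A : V G → Set) : V G → V G → Set where
  here : ∀ {u} → A u → Reach G A u u
  step : ∀ {u v w} → A u → adj G u v ≡ true → Reach G A v w → Reach G A u w

IsCutset : (G : Graph) → (V G → Set) → Set
IsCutset G C = ∃[ u ] ∃[ v ] (¬ C u × ¬ C v × ¬ Reach G (λ z → ¬ C z) u v)

CutsetSeparating : (G : Graph) → (C S T : V G → Set) → Set
CutsetSeparating G C S T =
  IsCutset G C ×
  (∀ u v → S u → T v → ¬ C u → ¬ C v → ¬ Reach G (λ z → ¬ C z) u v)

HasSmallCliqueCutset : Graph → Set
HasSmallCliqueCutset G =
  Σ (List (V G)) λ cs → (length cs ≤ 2
          × (∀ u v → u ∈ cs → v ∈ cs → u ≢ v → adj G u v ≡ true)
          × IsCutset G (λ z → z ∈ cs))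

Consec : ℕ → ℕ → ℕ → Set
Consec len i j = suc i ≡ j ⊎ suc j ≡ i ⊎ (suc i ≡ len × j ≡ 0) ⊎ (suc j ≡ len × i ≡ 0)

record Hole (G : Graph) : Set where
  field
    len      : ℕ
    len≥4    : 4 ≤ len
    vtx      : ℕ → V G
    periodic : ∀ i → vtx (len + i) ≡ vtx i
    distinct : ∀ i j → i < len → j < len → vtx i ≡ vtx j → i ≡ j
    chordless : ∀ i j → i < len → j < len → (adj G (vtx i) (vtx j) ≡ true → Consec len i j)
                                           × (Consec len i j → adj G (vtx i) (vtx j) ≡ true)

open Hole public

OnHole : ∀ {G} → Hole G → V G → Set
OnHole H z = ∃[ i ] (i < len H × z ≡ vtx H i)

IsWheel : (G : Graph) → Hole G → V G → Set
IsWheel G H x =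
  ¬ OnHole H x ×
  ∃[ i ] ∃[ j ] ∃[ k ] (i < j × j < k × k < len H
     × adj G x (vtx H i) ≡ true × adj G x (vtx H j) ≡ true × adj G x (vtx H k) ≡ true)

-- a sector of the wheel (H , x): the subpath vtx p, vtx (p+1), ..., vtx (p+d)
-- between consecutive neighbours x_i = vtx p and x_{i+1} = vtx (p+d) of x
IsSector : (G : Graph) → (H : Hole G) → V G → ℕ → ℕ → Set
IsSector G H x p d =
  p < len H × 1 ≤ d × d < len H
  × adj G x (vtx H p) ≡ true × adj G x (vtx H (p + d)) ≡ true
  × (∀ e → 1 ≤ e → e < d → adj G x (vtx H (p + e)) ≡ false)

SectorSet : ∀ {G} → Hole G → ℕ → ℕ → V G → Set
SectorSet H p d z = ∃[ e ] (e ≤ d × z ≡ vtx H (p + e))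

SectorCut : (G : Graph) → Hole G → V G → ℕ → ℕ → V G → Set
SectorCut G H x p d z =
  ((adj G x z ≡ true ⊎ z ≡ x) × ¬ OnHole H z) ⊎ z ≡ vtx H p ⊎ z ≡ vtx H (p + d)

HasWheelDecomposition : Graph → Set
HasWheelDecomposition G =
  Σ (Hole G) λ H → Σ (V G) λ x → (IsWheel G H x ×
    (∀ p d → IsSector G H x p d →
       CutsetSeparating G (SectorCut G H x p d) (SectorSet H p d)
                          (λ z → OnHole H z × ¬ SectorSet H p d z)))

{-# OPTIONS --safe #-}
-- Idea.  A hole and a vertex sending three internally disjoint induced legs to it, with no further edges, form an ISK4
-- ("tripod"); in particular a wheel has at least four spokes.
--
-- If G contains a wheel, take (H , x) with H shortest.  Then every non-neighbour of x off H has at most two neighbours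
-- on H, since otherwise a sector of one hub gives a shorter wheel, or the interleaving of the neighbours of the two hubs
-- gives a tripod.  Among all wheels with this property take one with fewest spokes, and consider a shortest path P off H
-- and N[x] whose ends attach to H at vertices in no common sector.  Replacing an arc of H by P gives a wheel with the
-- same property and fewer spokes, and the cases where this is impossible contain a tripod.  So there is no such P,
-- which says exactly that (H , x) is a wheel decomposition.
--
-- If G has no wheel but contains a subdivision of K₄ as a subgraph, it has a cycle and a disjoint connected set seeing
-- three of its vertices.  A shortest such cycle is a hole, and a smallest such connected set yields a tripod or a K₃,₃.
-- A K₃,₃ extends to a maximal complete bipartite subgraph; a component outside it attaches to a clique (a clique
-- cutset), because a shortest path between two non-adjacent attachments closes a K₃,₃ minus an edge, an ISK4.
--
-- The three other outcomes are decidable, so everything else can be proved by contradiction.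
module Submission where

open import Defs
open import Data.Bool using (Bool; true; false; _∧_; _∨_; not; _xor_)
import Data.Bool.Properties as Bool
open import Data.Empty using (⊥; ⊥-elim)
open import Data.Fin using (Fin; zero; suc; _≟_)
open import Data.Fin.Properties using (all?; any?; injective⇒≤; ¬∀⟶∃¬)
open import Data.List using (List; []; _∷_; _++_; length; reverse; _ʳ++_; map; lookup)
open import Data.List.Membership.DecPropositional using () renaming (_∈?_ to mem?)
open import Data.List.Membership.Propositional using (_∈_)
open import Data.List.Membership.Propositional.Properties using (∈-++⁺ˡ; ∈-++⁺ʳ; ∈-++⁻; ∈-∃++; ∈-lookup; ∈-map⁺; ∈-map⁻)
open import Data.List.Properties using (++-assoc; ++-identityʳ; reverse-++; unfold-reverse; reverse-involutive; length-++; length-reverse; length-map; map-++; ∷-injective; ∷ʳ-injective)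
open import Data.List.Relation.Binary.Permutation.Propositional using (_↭_; prep; swap; ↭-sym; ↭-reflexive) renaming (refl to ↭-refl; trans to ↭-trans)
open import Data.List.Relation.Binary.Permutation.Propositional.Properties using (∈-resp-↭; ↭-length; ↭-reverse) renaming (++-comm to ↭-++-comm)
import Data.List.Relation.Unary.All as All
open import Data.List.Relation.Unary.AllPairs using (AllPairs)
open import Data.List.Relation.Unary.Any using (here; there)
open import Data.List.Relation.Unary.Unique.Propositional using (Unique)
open import Data.Nat using (ℕ; zero; suc; _+_; _≤_; _<_; z≤n; s≤s)
open import Data.Nat.DivMod using (_%_; [m+n]%n≡m%n; m<n⇒m%n≡m)
open import Data.Nat.Properties using (≤-trans; ≤-refl; ≤-reflexive; ≤-pred; ≰⇒>; <⇒≤; <⇒≱; <-cmp; _≤?_; _<?_; m≤n+m; m≤m+n; n≤1+n; +-mono-≤; +-monoʳ-≤; +-monoˡ-≤; +-comm; +-assoc; +-suc; +-identityʳ; +-cancelˡ-≡; suc-injective; allUpTo?; anyUpTo?)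
open import Data.Product using (Σ; ∃-syntax; _×_; _,_; proj₁; proj₂)
open import Data.Sum using (_⊎_; inj₁; inj₂; [_,_]′)
open import Data.Unit using (⊤; tt)
open import Function using (_∘_)
open import Function.Definitions using (Injective)
open import Relation.Binary.Definitions using (tri<; tri≈; tri>)
open import Relation.Binary.PropositionalEquality using (_≡_; _≢_; refl; sym; trans; cong; cong₂; subst)
open import Relation.Nullary using (¬_; Dec; yes; no)
open import Relation.Nullary.Decidable using (map′; does; ¬?; _×-dec_; _⊎-dec_; _→-dec_)

-- Replacing an arc of a rim by an outside path may lengthen the rim, so shortness of the rim does
-- not survive the second minimisation. Only its consequence `Good` is carried along. The constants
-- fit together: a vertex that spoils `Good` on the new rim has at least four neighbours there,
-- because three already form a tripod; at most two of them lie on the old rim, so at least two lie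
-- on the path, and these lead to a triangle or to a shorter path whose ends lie in no common
-- sector. Every contradiction with the absence of an ISK4 goes through `tripod`, so a subdivision
-- of K₄ is assembled only once, and all later work consists in finding a hole, a centre and three
-- legs. Paths and holes are lists, for which cutting, reversing and rotating are plain list
-- operations. The indexed holes of the statement enter only when sectors are treated.

module _ {A : Set} where

  ++-split : ∀ (N M : List A) {X x Y} → N ++ M ≡ X ++ x ∷ Y →
    (∃[ N′ ] (N ≡ X ++ x ∷ N′ × Y ≡ N′ ++ M)) ⊎ (∃[ X′ ] (X ≡ N ++ X′ × M ≡ X′ ++ x ∷ Y))
  ++-split [] M {X} eq = inj₂ (X , refl , eq)
  ++-split (n ∷ N) M {[]} refl = inj₁ (N , refl , refl)
  ++-split (n ∷ N) M {y ∷ X} eq with ∷-injective eq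
  ... | refl , eq′ with ++-split N M {X} eq′
  ... | inj₁ (N′ , refl , e) = inj₁ (N′ , refl , e)
  ... | inj₂ (X′ , refl , e) = inj₂ (X′ , refl , e)

  first-split : {P : A → Set} → (∀ y → Dec (P y)) → ∀ L →
    (∀ {y} → y ∈ L → ¬ P y) ⊎
    (∃[ X ] ∃[ w ] ∃[ Y ] (L ≡ X ++ w ∷ Y × P w × (∀ {y} → y ∈ X → ¬ P y)))
  first-split P? [] = inj₁ λ ()
  first-split P? (z ∷ L) with P? z
  ... | yes p = inj₂ ([] , z , L , refl , p , λ ())
  ... | no ¬p with first-split P? L
  ...   | inj₁ none = inj₁ λ { (here refl) → ¬p ; (there i) → none i }
  ...   | inj₂ (X , w , Y , refl , p , none) =
          inj₂ (z ∷ X , w , Y , refl , p , λ { (here refl) → ¬p ; (there i) → none i })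

  last-split : {P : A → Set} → (∀ y → Dec (P y)) → ∀ L →
    (∀ {y} → y ∈ L → ¬ P y) ⊎
    (∃[ X ] ∃[ w ] ∃[ Y ] (L ≡ X ++ w ∷ Y × P w × (∀ {y} → y ∈ Y → ¬ P y)))
  last-split P? [] = inj₁ λ ()
  last-split P? (z ∷ L) with last-split P? L
  ... | inj₂ (X , w , Y , refl , p , none) = inj₂ (z ∷ X , w , Y , refl , p , none)
  ... | inj₁ none with P? z
  ...   | yes p = inj₂ ([] , z , L , refl , p , none)
  ...   | no ¬p = inj₁ λ { (here refl) → ¬p ; (there i) → none i }

  ∈-rev⁻ : ∀ {x : A} L → x ∈ reverse L → x ∈ L
  ∈-rev⁻ L = ∈-resp-↭ (↭-reverse L)

  ∈-mid : ∀ (X : List A) {x Y} → x ∈ X ++ x ∷ Y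
  ∈-mid X = ∈-++⁺ʳ X (here refl)

  ∈-ins : ∀ (X : List A) {x Y z} → z ∈ X ++ Y → z ∈ X ++ x ∷ Y
  ∈-ins X i = [ ∈-++⁺ˡ , (λ j → ∈-++⁺ʳ X (there j)) ]′ (∈-++⁻ X i)

  reverse-mid : ∀ (X : List A) {x Y} → reverse (X ++ x ∷ Y) ≡ reverse Y ++ x ∷ reverse X
  reverse-mid X {x} {Y} = trans (reverse-++ X (x ∷ Y))
    (trans (cong (_++ reverse X) (unfold-reverse x Y)) (++-assoc (reverse Y) (x ∷ []) (reverse X)))

  snoc-view : ∀ (x : A) L → ∃[ X ] ∃[ y ] (x ∷ L ≡ X ++ y ∷ [])
  snoc-view x [] = [] , x , refl
  snoc-view x (z ∷ L) with snoc-view z L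
  ... | X , y , eq = x ∷ X , y , cong (x ∷_) eq

-- Induced paths, neighbour counts, holes and walks.

module Paths (G : Graph) where

  E : V G → V G → Set
  E u v = adj G u v ≡ true

  E? : ∀ u v → Dec (E u v)
  E? u v = adj G u v Bool.≟ true

  E-sym : ∀ {u v} → E u v → E v u
  E-sym {u} {v} e = trans (adj-sym G v u) e

  E-irrefl : ∀ {u} → ¬ E u u
  E-irrefl {u} e with trans (sym e) (adj-irrefl G u)
  ... | ()

  E⇒≢ : ∀ {u v} → E u v → u ≢ v
  E⇒≢ e refl = E-irrefl e

  TriangleFree : Set
  TriangleFree = ∀ {a b c} → E a b → E b c → ¬ E a c

  -- Distinctness is asked within each side only, since adjacent vertices differ anyway; without
  -- triangles such a subgraph is automatically induced.
  K₃₃-Free : Set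
  K₃₃-Free = ∀ {a b c d e f} → E a d → E a e → E a f → E b d → E b e → E b f → E c d → E c e → E c f →
    a ≢ b → b ≢ c → a ≢ c → d ≢ e → e ≢ f → d ≢ f → ⊥

  N : V G → V G → Set
  N u v = u ≢ v × ¬ E u v

  N-sym : ∀ {u v} → N u v → N v u
  N-sym (p , q) = p ∘ sym , q ∘ E-sym

  Across : (V G → V G → Set) → List (V G) → List (V G) → Set
  Across R A B = ∀ {x y} → x ∈ A → y ∈ B → R x y

  infix 4 _##_
  _##_ : List (V G) → List (V G) → Set
  A ## B = Across N A B

  ##-sym : ∀ {A B} → A ## B → B ## A
  ##-sym h i j = N-sym (h j i)

  ##-++ˡ : ∀ A {B C} → A ## C → B ## C → (A ++ B) ## C
  ##-++ˡ A h k i j = [ (λ i′ → h i′ j) , (λ i′ → k i′ j) ]′ (∈-++⁻ A i)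

  ##-++ʳ : ∀ {A} B {C} → A ## B → A ## C → A ## (B ++ C)
  ##-++ʳ B h k i j = [ h i , k i ]′ (∈-++⁻ B j)

  ##-∷ˡ : ∀ {x A B} → (x ∷ []) ## B → A ## B → (x ∷ A) ## B
  ##-∷ˡ h k (here e) j = h (here e) j
  ##-∷ˡ h k (there i) j = k i j

  ##-∷ʳ : ∀ {x A B} → A ## (x ∷ []) → A ## B → A ## (x ∷ B)
  ##-∷ʳ h k i (here e) = h i (here e)
  ##-∷ʳ h k i (there j) = k i j

  ##-sing : ∀ {x y} → N x y → (x ∷ []) ## (y ∷ [])
  ##-sing n (here refl) (here refl) = n

  ##-rev : ∀ A {B} → A ## B → reverse A ## B
  ##-rev A h i j = h (∈-rev⁻ A i) j

  -- Consecutive vertices are adjacent and all other pairs are related by R: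
  -- R = N gives induced paths, R = _≢_ gives paths of G as a subgraph.
  data Path (R : V G → V G → Set) : List (V G) → Set where
    nil  : Path R []
    one  : ∀ {x} → Path R (x ∷ [])
    cons : ∀ {x y l} → E x y → (∀ {z} → z ∈ l → R x z) → Path R (y ∷ l) → Path R (x ∷ y ∷ l)

  IPath SPath : List (V G) → Set
  IPath = Path N
  SPath = Path _≢_

  edge : ∀ {R x y} → E x y → Path R (x ∷ y ∷ [])
  edge e = cons e (λ ()) one

  ip-l : ∀ {R} A {B} → Path R (A ++ B) → Path R A
  ip-l [] _ = nil
  ip-l (x ∷ []) _ = one
  ip-l (x ∷ y ∷ A) (cons e n p) = cons e (λ i → n (∈-++⁺ˡ i)) (ip-l (y ∷ A) p)

  ip-r : ∀ {R} A {B} → Path R (A ++ B) → Path R B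
  ip-r [] p = p
  ip-r (x ∷ []) {[]} p = nil
  ip-r (x ∷ []) {y ∷ B} (cons _ _ p) = p
  ip-r (x ∷ y ∷ A) (cons _ _ p) = ip-r (y ∷ A) p

  ip-apart : ∀ {R} A {x B} → Path R (A ++ x ∷ B) → Across R A B
  ip-apart (a ∷ []) (cons e n p) (here refl) j = n j
  ip-apart (a ∷ b ∷ A) (cons e n p) (here refl) j = n (∈-++⁺ʳ A (there j))
  ip-apart (a ∷ b ∷ A) (cons e n p) (there i) j = ip-apart (b ∷ A) p i j

  ip-glue : ∀ {R} A {x B} → Path R (A ++ x ∷ []) → Path R (x ∷ B) → Across R A B → Path R (A ++ x ∷ B)
  ip-glue [] _ q _ = q
  ip-glue (a ∷ []) (cons e _ _) q n = cons e (n (here refl)) q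
  ip-glue {R} (a ∷ b ∷ A) {x} {B} (cons e m p) q n =
    cons e m′ (ip-glue (b ∷ A) p q (λ i → n (there i)))
    where
    m′ : ∀ {z} → z ∈ A ++ x ∷ B → R a z
    m′ j with ∈-++⁻ A j
    ... | inj₁ i = m (∈-++⁺ˡ i)
    ... | inj₂ (here refl) = m (∈-mid A)
    ... | inj₂ (there i) = n (here refl) i

  ip-edge : ∀ {R} A {x y B} → Path R (A ++ x ∷ y ∷ B) → E x y
  ip-edge A p with ip-r A p
  ... | cons e _ _ = e

  ip-mid : ∀ {R} A {x M y B} → Path R (A ++ x ∷ M ++ y ∷ B) → Path R (x ∷ M ++ y ∷ [])
  ip-mid {R} A {x} {M} {y} {B} p =
    ip-l (x ∷ M ++ y ∷ []) (subst (Path R) (cong (x ∷_) (sym (++-assoc M (y ∷ []) B))) (ip-r A p))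

  ip-∉ʳ : ∀ A {x B} → IPath (A ++ x ∷ B) → ¬ (x ∈ B)
  ip-∉ʳ A p i with ip-r A p
  ip-∉ʳ A p (here refl) | cons e n q = E-irrefl e
  ip-∉ʳ A p (there i) | cons e n q = proj₁ (n i) refl

  ip-rev : ∀ {l} → IPath l → IPath (reverse l)
  ip-rev nil = nil
  ip-rev one = one
  ip-rev (cons {x} {y} {l} e n p) =
    subst IPath (sym (trans (unfold-reverse x (y ∷ l))
      (trans (cong (_++ x ∷ []) (unfold-reverse y l)) (++-assoc (reverse l) (y ∷ []) (x ∷ [])))))
      (ip-glue (reverse l) (subst IPath (unfold-reverse y l) (ip-rev p)) (edge (E-sym e))
        λ { i (here refl) → N-sym (n (∈-rev⁻ l i)) })

  ip-rev′ : ∀ {a} A {b} → IPath (a ∷ A ++ b ∷ []) → IPath (b ∷ reverse A ++ a ∷ [])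
  ip-rev′ {a} A {b} p = subst IPath (trans (reverse-mid (a ∷ A)) (cong (b ∷_) (unfold-reverse a A))) (ip-rev p)

  b2n : Bool → ℕ
  b2n true = 1
  b2n false = 0

  -- Counts add up over arcs and are invariant under permutation (`cnt-↭`), so spokes can be counted
  -- on whichever rotation or reflection of a rim is at hand.
  cnt : V G → List (V G) → ℕ
  cnt z [] = 0
  cnt z (y ∷ l) = b2n (adj G z y) + cnt z l

  cnt-++ : ∀ z A B → cnt z (A ++ B) ≡ cnt z A + cnt z B
  cnt-++ z [] B = refl
  cnt-++ z (y ∷ A) B = trans (cong (b2n (adj G z y) +_) (cnt-++ z A B)) (sym (+-assoc (b2n (adj G z y)) (cnt z A) (cnt z B)))

  cnt-yes : ∀ {z y} l → E z y → cnt z (y ∷ l) ≡ suc (cnt z l)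
  cnt-yes l e rewrite e = refl

  cnt-no : ∀ {z y} l → ¬ E z y → cnt z (y ∷ l) ≡ cnt z l
  cnt-no {z} {y} l ¬e with adj G z y
  ... | true = ⊥-elim (¬e refl)
  ... | false = refl

  cnt-none : ∀ {z} l → (∀ {y} → y ∈ l → ¬ E z y) → cnt z l ≡ 0
  cnt-none [] h = refl
  cnt-none (y ∷ l) h = trans (cnt-no l (h (here refl))) (cnt-none l (h ∘ there))

  cnt-∈ : ∀ {z y} l → y ∈ l → E z y → 1 ≤ cnt z l
  cnt-∈ (y ∷ l) (here refl) e = ≤-trans (s≤s z≤n) (≤-reflexive (sym (cnt-yes l e)))
  cnt-∈ {z} (y ∷ l) (there i) e = ≤-trans (cnt-∈ l i e) (m≤n+m (cnt z l) _)

  cnt-↭ : ∀ z {A B} → A ↭ B → cnt z A ≡ cnt z B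
  cnt-↭ z ↭-refl = refl
  cnt-↭ z (prep x p) = cong (b2n (adj G z x) +_) (cnt-↭ z p)
  cnt-↭ z (swap {ys = B} x y p) rewrite cnt-↭ z p =
    trans (sym (+-assoc (b2n (adj G z x)) (b2n (adj G z y)) _))
      (trans (cong (_+ cnt z B) (+-comm (b2n (adj G z x)) (b2n (adj G z y)))) (+-assoc (b2n (adj G z y)) (b2n (adj G z x)) _))
  cnt-↭ z (↭-trans p q) = trans (cnt-↭ z p) (cnt-↭ z q)

  cnt-first : ∀ z L → 1 ≤ cnt z L → ∃[ X ] ∃[ w ] ∃[ Y ]
    (L ≡ X ++ w ∷ Y × E z w × (∀ {y} → y ∈ X → ¬ E z y) × cnt z L ≡ suc (cnt z Y))
  cnt-first z L h with first-split (E? z) L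
  ... | inj₁ none with subst (1 ≤_) (cnt-none L none) h
  ...   | ()
  cnt-first z L h | inj₂ (X , w , Y , refl , e , none) =
    X , w , Y , refl , e , none , trans (cnt-++ z X (w ∷ Y)) (trans (cong (_+ cnt z (w ∷ Y)) (cnt-none X none)) (cnt-yes Y e))

  cnt-last : ∀ z L → 1 ≤ cnt z L → ∃[ X ] ∃[ w ] ∃[ Y ]
    (L ≡ X ++ w ∷ Y × E z w × (∀ {y} → y ∈ Y → ¬ E z y) × cnt z L ≡ suc (cnt z X))
  cnt-last z L h with last-split (E? z) L
  ... | inj₁ none with subst (1 ≤_) (cnt-none L none) h
  ...   | ()
  cnt-last z L h | inj₂ (X , w , Y , refl , e , none) =
    X , w , Y , refl , e , none ,
    trans (cnt-++ z X (w ∷ Y)) (trans (cong (cnt z X +_) (trans (cnt-yes Y e) (cong suc (cnt-none Y none))))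
      (+-comm (cnt z X) 1))

  cnt-mem : ∀ {z} A → 1 ≤ cnt z A → ∃[ w ] (w ∈ A × E z w)
  cnt-mem {z} A c with cnt-first z A c
  ... | X , w , Y , refl , e , _ = w , ∈-mid X , e

  None : V G → List (V G) → Set
  None x A = ∀ {z} → z ∈ A → ¬ E x z

  not-cnt : ∀ {z} A → ¬ (1 ≤ cnt z A) → None z A
  not-cnt A ¬c i e = ¬c (cnt-∈ A i e)

  -- A hole is recorded through the fact that deleting any vertex leaves an induced path,
  -- a formulation that is invariant under rotation.
  record IsHole (L : List (V G)) : Set where
    field
      len4 : 4 ≤ length L
      cut  : ∀ A x B → L ≡ A ++ x ∷ B → IPath (B ++ A)

  open IsHole

  rot : ∀ M {K} → IsHole (M ++ K) → IsHole (K ++ M)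
  len4 (rot M {K} h) = subst (4 ≤_) (↭-length (↭-++-comm M K)) (len4 h)
  cut (rot M {K} h) A x B eq with ++-split K M {A} eq
  ... | inj₁ (N′ , refl , refl) =
        subst IPath (sym (++-assoc N′ M A)) (cut h (M ++ A) x N′ (sym (++-assoc M A (x ∷ N′))))
  ... | inj₂ (A′ , refl , refl) =
        subst IPath (++-assoc B K A′) (cut h A′ x (B ++ K) (++-assoc A′ (x ∷ B) K))

  hole-rev : ∀ {L} → IsHole L → IsHole (reverse L)
  len4 (hole-rev {L} h) = subst (4 ≤_) (sym (length-reverse L)) (len4 h)
  cut (hole-rev {L} h) A x B eq =
    subst IPath (trans (cong reverse (sym (reverse-++ B A))) (reverse-involutive (B ++ A)))
      (ip-rev (cut h (reverse B) x (reverse A)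
        (trans (sym (reverse-involutive L)) (trans (cong reverse eq) (reverse-mid A)))))

  hole-at : ∀ {L x} → IsHole L → x ∈ L → ∃[ M ] (IsHole (x ∷ M) × x ∷ M ↭ L)
  hole-at {x = x} h i with ∈-∃++ i
  ... | A , B , refl = B ++ A , rot A h , ↭-++-comm (x ∷ B) A

  hole-tail : ∀ {u M} → IsHole (u ∷ M) → IPath M
  hole-tail {u} {M} h = subst IPath (++-identityʳ M) (cut h [] u M refl)

  hole-## : ∀ {u} A {v B} → IsHole (u ∷ A ++ v ∷ B) → A ## B
  hole-## A h = ip-apart A (hole-tail h)

  -- Deleting z from the other arc leaves an induced path that contains this one. With an empty
  -- other arc, u and v would be adjacent and the arc would not be induced.
  hole-arc : ∀ {u} A {v B z} → IsHole (u ∷ A ++ v ∷ B) → z ∈ B → IPath (u ∷ A ++ v ∷ [])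
  hole-arc {u} A {v} h i with ∈-∃++ i
  ... | B₁ , B₂ , refl = ip-mid [] (ip-r B₂ (cut h (u ∷ A ++ v ∷ B₁) _ B₂ (cong (u ∷_) (sym (++-assoc A (v ∷ B₁) _)))))

  hole-∉ : ∀ {u M} → IsHole (u ∷ M) → ¬ (u ∈ M)
  hole-∉ {u} h i with ∈-∃++ i
  hole-∉ {u} h i | A , b ∷ B , refl = ip-∉ʳ [] (hole-arc A h (here refl)) (∈-mid A)
  hole-∉ {u} h i | a ∷ A , [] , refl = ip-∉ʳ [] (hole-arc [] (rot (u ∷ a ∷ A) h) (here refl)) (here refl)
  hole-∉ {u} h i | [] , [] , refl with len4 h
  ... | s≤s (s≤s ())

  hole-edge : ∀ {u} A {v w B} → IsHole (u ∷ A ++ v ∷ w ∷ B) → E v w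
  hole-edge {u} A h = ip-edge A (hole-tail h)

  hole-edge₀ : ∀ {u v M} → IsHole (u ∷ v ∷ M) → E u v
  hole-edge₀ {u} {v} {[]} h with len4 h
  ... | s≤s (s≤s ())
  hole-edge₀ {u} {v} {m ∷ M} h = ip-edge [] (hole-arc [] h (here refl))

  hole-edgeₑ : ∀ {u} M {w} → IsHole (u ∷ M ++ w ∷ []) → E w u
  hole-edgeₑ {u} M h = hole-edge₀ (rot (u ∷ M) h)

  private
    -- The deleted vertex is a, lies in P, is b, or lies in Q. The whole arc `a P b` is induced only
    -- if a and b are not adjacent, which fails when Q is empty; it enters only in the last case,
    -- where `h₃` shows a and b to be apart.
    mkHole′ : ∀ {a b} P Q → IPath (a ∷ P) → IPath (P ++ b ∷ []) → (N a b → IPath (a ∷ P ++ b ∷ [])) →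
      IPath (b ∷ Q ++ a ∷ []) → P ## Q → 4 ≤ length (a ∷ P ++ b ∷ Q) → IsHole (a ∷ P ++ b ∷ Q)
    len4 (mkHole′ P Q h₁ h₂ aPb h₃ ap l) = l
    cut (mkHole′ {a} {b} P Q h₁ h₂ aPb h₃ ap l) A x B eq with ++-split (a ∷ P) (b ∷ Q) {A} eq
    cut (mkHole′ {a} {b} P Q h₁ h₂ aPb h₃ ap l) [] x B eq | inj₁ (_ , refl , refl) =
      subst IPath (sym (++-identityʳ _)) (ip-glue P h₂ (ip-l (b ∷ Q) h₃) ap)
    cut (mkHole′ {a} {b} P Q h₁ h₂ aPb h₃ ap l) (.a ∷ A) x B eq | inj₁ (N′ , refl , refl) =
      subst IPath (sym (++-assoc N′ (b ∷ Q) (a ∷ A)))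
        (ip-glue N′ (ip-r (x ∷ []) (ip-r A h₂′)) (ip-glue (b ∷ Q) h₃ (ip-l (a ∷ A) h₁) sep₁) sep₂)
      where
      h₂′ : IPath (A ++ x ∷ N′ ++ b ∷ [])
      h₂′ = subst IPath (++-assoc A (x ∷ N′) (b ∷ [])) h₂
      sep₁ : (b ∷ Q) ## A
      sep₁ (here refl) j = N-sym (ip-apart A h₂′ j (∈-++⁺ʳ N′ (here refl)))
      sep₁ (there i) j = N-sym (ap (∈-++⁺ˡ j) i)
      sep₂ : N′ ## (Q ++ a ∷ A)
      sep₂ = ##-++ʳ Q (λ i j → ap (∈-++⁺ʳ A (there i)) j) (##-sym (ip-apart (a ∷ A) h₁))
    cut (mkHole′ {a} {b} P Q h₁ h₂ aPb h₃ ap l) A x B eq | inj₂ ([] , refl , refl) =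
      subst (λ K → IPath (Q ++ K)) (sym (++-identityʳ (a ∷ P)))
        (ip-glue Q (ip-r (b ∷ []) h₃) h₁ λ i j → N-sym (ap j i))
    cut (mkHole′ {a} {b} P Q h₁ h₂ aPb h₃ ap l) A x B eq | inj₂ (.b ∷ Q₁ , refl , refl) =
      ip-glue B (ip-r (x ∷ []) (ip-r (b ∷ Q₁) h₃′))
        (ip-glue (a ∷ P) (aPb (N-sym (bQ (here refl) (∈-mid B)))) (ip-l (b ∷ Q₁) h₃′) sep₁) sep₂
      where
      h₃′ : IPath (b ∷ Q₁ ++ x ∷ B ++ a ∷ [])
      h₃′ = subst IPath (cong (b ∷_) (++-assoc Q₁ (x ∷ B) (a ∷ []))) h₃
      bQ : (b ∷ Q₁) ## (B ++ a ∷ [])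
      bQ = ip-apart (b ∷ Q₁) h₃′
      sep₁ : (a ∷ P) ## Q₁
      sep₁ (here refl) j = N-sym (bQ (there j) (∈-mid B))
      sep₁ (there i) j = ap i (∈-++⁺ˡ j)
      sep₂ : B ## (P ++ b ∷ Q₁)
      sep₂ = ##-++ʳ P (λ i j → N-sym (ap j (∈-++⁺ʳ Q₁ (there i)))) (λ i j → N-sym (bQ j (∈-++⁺ˡ i)))

  mkHole : ∀ {a p b} P Q → IPath (a ∷ p ∷ P) → IPath (p ∷ P ++ b ∷ []) → IPath (b ∷ Q ++ a ∷ []) →
    (p ∷ P) ## Q → 4 ≤ length (a ∷ p ∷ P ++ b ∷ Q) → IsHole (a ∷ p ∷ P ++ b ∷ Q)
  mkHole {a} {p} {b} P Q h₁@(cons e n _) h₂ h₃ ap l = mkHole′ (p ∷ P) Q h₁ h₂ aPb h₃ ap l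
    where
    aPb : N a b → IPath (a ∷ p ∷ P ++ b ∷ [])
    aPb ab = cons e (λ i → [ n , (λ { (here refl) → ab }) ]′ (∈-++⁻ P i)) h₂

  cnt-ip : ∀ {z l} → IPath (z ∷ l) → cnt z l ≤ 1
  cnt-ip one = z≤n
  cnt-ip (cons {l = l} e n p) =
    ≤-reflexive (trans (cnt-yes l e) (cong suc (cnt-none l λ i → proj₂ (n i))))

  -- Once the hole starts at z, deleting its last vertex leaves an induced path from z, on which z
  -- has at most one neighbour; the deleted vertex adds at most one more.
  hole-cnt : ∀ {L z} → IsHole L → z ∈ L → cnt z L ≤ 2
  hole-cnt {L} {z} h i with hole-at h i
  ... | [] , h′ , p with len4 h′
  ...   | s≤s ()
  hole-cnt {L} {z} h i | m ∷ M , h′ , p with snoc-view m M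
  ... | X , y , eq = ≤-trans (≤-reflexive (trans (sym (cnt-↭ z p))
          (trans (cnt-no (m ∷ M) E-irrefl) (trans (cong (cnt z) eq) (cnt-++ z X (y ∷ []))))))
      (+-mono-≤ (cnt-ip (cut h′ (z ∷ X) y [] (cong (z ∷_) eq))) (b≤1 y))
    where
    b≤1 : ∀ y → cnt z (y ∷ []) ≤ 1
    b≤1 y with adj G z y
    ... | true = s≤s z≤n
    ... | false = z≤n

  WheelFree : Set
  WheelFree = ∀ {L z} → IsHole L → ¬ (z ∈ L) → cnt z L ≤ 2

  data Walk (D : V G → Set) : V G → List (V G) → V G → Set where
    stop : ∀ {u} → D u → Walk D u (u ∷ []) u
    go   : ∀ {u v l w} → D u → E u v → Walk D v l w → Walk D u (u ∷ l) w

  reach⇒walk : ∀ {D u v} → Reach G D u v → ∃[ l ] Walk D u l v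
  reach⇒walk (here d) = _ , stop d
  reach⇒walk (step d e r) = _ , go d e (proj₂ (reach⇒walk r))

  walk⇒reach : ∀ {D u l v} → Walk D u l v → Reach G D u v
  walk⇒reach (stop d) = here d
  walk⇒reach (go d e w) = step d e (walk⇒reach w)

  walk-all : ∀ {D u l v z} → Walk D u l v → z ∈ l → D z
  walk-all (stop d) (here refl) = d
  walk-all (go d e w) (here refl) = d
  walk-all (go d e w) (there i) = walk-all w i

  walk-map : ∀ {D D′ u l v} → (∀ {z} → z ∈ l → D z → D′ z) → Walk D u l v → Walk D′ u l v
  walk-map f (stop d) = stop (f (here refl) d)
  walk-map f (go d e w) = go (f (here refl) d) e (walk-map (f ∘ there) w)

  walk-++ : ∀ {D u l x y m v} → Walk D u l x → E x y → Walk D y m v → Walk D u (l ++ m) v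
  walk-++ (stop d) e w′ = go d e w′
  walk-++ (go d e w) e′ w′ = go d e (walk-++ w e′ w′)

  walk-trans : ∀ {D u l x m v} → Walk D u l x → Walk D x m v → ∃[ k ] Walk D u k v
  walk-trans w (stop _) = _ , w
  walk-trans w (go _ e w′) = _ , walk-++ w e w′

  walk-end∈ : ∀ {D u l v} → Walk D u l v → v ∈ l
  walk-end∈ (stop _) = here refl
  walk-end∈ (go _ _ w) = there (walk-end∈ w)

  walk-start∈ : ∀ {D u l v} → Walk D u l v → u ∈ l
  walk-start∈ (stop _) = here refl
  walk-start∈ (go _ _ w) = here refl

  walk-l : ∀ {D u v} A {x B} → Walk D u (A ++ x ∷ B) v → Walk D u (A ++ x ∷ []) x
  walk-l [] (stop d) = stop d
  walk-l [] (go d e w) = stop d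
  walk-l (a ∷ []) (go d e w) = go d e (walk-l [] w)
  walk-l (a ∷ b ∷ A) (go d e w) = go d e (walk-l (b ∷ A) w)

  walk-r : ∀ {D u v} A {x B} → Walk D u (A ++ x ∷ B) v → Walk D x (x ∷ B) v
  walk-r [] (stop d) = stop d
  walk-r [] (go d e w) = go d e w
  walk-r (a ∷ []) (go d e w) = walk-r [] w
  walk-r (a ∷ b ∷ A) (go d e w) = walk-r (b ∷ A) w

  walk-rev : ∀ {D u l v} → Walk D u l v → Walk D v (reverse l) u
  walk-rev (stop d) = stop d
  walk-rev {D} (go {u} {v} {l} d e w) =
    subst (λ k → Walk D _ k u) (sym (unfold-reverse u l)) (walk-++ (walk-rev w) (E-sym e) (stop d))

  walk-view : ∀ {D u l v} → Walk D u l v → (l ≡ u ∷ [] × u ≡ v) ⊎ (∃[ M ] l ≡ u ∷ M ++ v ∷ [])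
  walk-view (stop d) = inj₁ (refl , refl)
  walk-view (go d e w) with walk-view w
  ... | inj₁ (refl , refl) = inj₂ ([] , refl)
  ... | inj₂ (M , refl) = inj₂ (_ ∷ M , refl)

  walk-head : ∀ {D u l v} → Walk D u l v → ∃[ M ] l ≡ u ∷ M
  walk-head (stop d) = _ , refl
  walk-head (go d e w) = _ , refl

  ip-walk : ∀ {R} {D : V G → Set} {u} M {v} → Path R (u ∷ M ++ v ∷ []) → (∀ {z} → z ∈ u ∷ M ++ v ∷ [] → D z) →
    Walk D u (u ∷ M ++ v ∷ []) v
  ip-walk [] (cons e _ _) d = go (d (here refl)) e (stop (d (there (here refl))))
  ip-walk (m ∷ M) (cons e _ p) d = go (d (here refl)) e (ip-walk M p (d ∘ there))

  -- The tail is shortened first. If u already lies on the result, everything before it is dropped;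
  -- otherwise u jumps to its last neighbour there, which leaves no chord at u.
  shorten : ∀ {D u l v} → Walk D u l v → ∃[ l′ ] (IPath l′ × Walk D u l′ v × length l′ ≤ length l)
  shorten (stop d) = _ , one , stop d , ≤-refl
  shorten {D} (go {u} d e w) with shorten w
  ... | l′ , p , w′ , le with first-split (u ≟_) l′
  ...   | inj₂ (A , _ , B , refl , refl , _) =
          u ∷ B , ip-r A p , walk-r A w′ ,
          ≤-trans (≤-trans (≤-trans (m≤n+m _ (length A)) (≤-reflexive (sym (length-++ A)))) le) (n≤1+n _)
  ...   | inj₁ u∉ with last-split (E? u) l′
  ...     | inj₁ none with walk-head w′
  ...       | _ , refl = ⊥-elim (none (here refl) e)
  shorten {D} (go {u} d e w) | l′ , p , w′ , le | inj₁ u∉ | inj₂ (A , x , B , refl , ex , none) =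
          u ∷ x ∷ B , cons ex (λ i → (λ { refl → u∉ (∈-++⁺ʳ A (there i)) refl }) , none i) (ip-r A p) ,
          go d ex (walk-r A w′) ,
          s≤s (≤-trans (≤-trans (m≤n+m _ (length A)) (≤-reflexive (sym (length-++ A)))) le)

  -- Covers both orders of a and b on the path. The length bound is what lets minimality of a path
  -- be applied to any two of its vertices.
  ip-between : ∀ {R} {D : V G → Set} {l a b} → Path R l → (∀ {z} → z ∈ l → D z) → a ∈ l → b ∈ l →
    ∃[ l′ ] (Walk D a l′ b × length l′ ≤ length l)
  ip-between {R} {D} {l} {a} {b} p d a∈ b∈ with ∈-∃++ a∈
  ... | X , Y , refl with ∈-++⁻ X b∈
  ...   | inj₂ (here refl) = a ∷ [] , stop (d a∈) , ≤-trans (s≤s z≤n)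
          (≤-trans (m≤n+m _ (length X)) (≤-reflexive (sym (length-++ X))))
  ...   | inj₂ (there i) with ∈-∃++ i
  ...     | Y₁ , Y₂ , refl = a ∷ Y₁ ++ b ∷ [] , ip-walk Y₁ (ip-mid X p) sub ,
            ≤-trans (s≤s (≤-trans (≤-reflexive (length-++ Y₁)) (≤-trans (+-monoʳ-≤ (length Y₁) (s≤s z≤n))
                (≤-reflexive (sym (length-++ Y₁))))))
              (≤-trans (m≤n+m _ (length X)) (≤-reflexive (sym (length-++ X))))
    where
    sub : ∀ {z} → z ∈ a ∷ Y₁ ++ b ∷ [] → D z
    sub {z} i = d (∈-++⁺ʳ X (subst (z ∈_) (++-assoc (a ∷ Y₁) (b ∷ []) Y₂) (∈-++⁺ˡ i)))
  ip-between {R} {D} {l} {a} {b} p d a∈ b∈ | X , Y , refl | inj₁ i with ∈-∃++ i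
  ...     | X₁ , X₂ , refl = reverse (b ∷ X₂ ++ a ∷ []) , walk-rev (ip-walk X₂ (ip-mid X₁ p′) sub) ,
            ≤-trans (≤-reflexive (length-reverse (b ∷ X₂ ++ a ∷ [])))
            (≤-trans (s≤s (≤-trans (≤-reflexive (length-++ X₂)) (≤-trans (+-monoʳ-≤ (length X₂) (s≤s z≤n))
                (≤-reflexive (sym (length-++ X₂))))))
              (≤-trans (m≤n+m _ (length X₁)) (≤-reflexive (sym (trans (cong length (++-assoc X₁ (b ∷ X₂) (a ∷ Y)))
                  (length-++ X₁))))))
    where
    p′ : Path R (X₁ ++ b ∷ X₂ ++ a ∷ Y)
    p′ = subst (Path R) (++-assoc X₁ (b ∷ X₂) (a ∷ Y)) p
    sub : ∀ {z} → z ∈ b ∷ X₂ ++ a ∷ [] → D z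
    sub {z} i = d (subst (z ∈_) (sym (++-assoc X₁ (b ∷ X₂) (a ∷ Y)))
        (∈-++⁺ʳ X₁ (subst (z ∈_) (++-assoc (b ∷ X₂) (a ∷ []) Y) (∈-++⁺ˡ i))))

-- Recognising an induced subdivision of K₄.

module Detect (G : Graph) where
  open Paths G

  eqb-yes : ∀ {m} {x y : Fin m} → x ≡ y → eqb x y ≡ true
  eqb-yes {x = x} {y} e with x ≟ y
  ... | yes _ = refl
  ... | no ¬e = ⊥-elim (¬e e)

  eqb-no : ∀ {m} {x y : Fin m} → x ≢ y → eqb x y ≡ false
  eqb-no {x = x} {y} ne with x ≟ y
  ... | yes e = ⊥-elim (ne e)
  ... | no _ = refl

  eqb-inj : ∀ {m k} (f : Fin m → Fin k) → Injective _≡_ _≡_ f → ∀ x y → eqb x y ≡ eqb (f x) (f y)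
  eqb-inj f inj x y with x ≟ y
  ... | yes refl = sym (eqb-yes refl)
  ... | no ne = sym (eqb-no (ne ∘ inj))

  ¬true : ∀ {b} → b ≢ true → b ≡ false
  ¬true {true} h = ⊥-elim (h refl)
  ¬true {false} h = refl

  hit : V G → V G → V G → V G → Bool
  hit v w x y = (eqb x v ∧ eqb y w) ∨ (eqb x w ∧ eqb y v)

  hit-yes : ∀ v w → hit v w v w ≡ true
  hit-yes v w rewrite eqb-yes {x = v} refl | eqb-yes {x = w} refl = refl

  hit-yes′ : ∀ v w → hit v w w v ≡ true
  hit-yes′ v w rewrite eqb-yes {x = v} refl | eqb-yes {x = w} refl with eqb w v ∧ eqb v w
  ... | true = refl
  ... | false = refl

  hit-true : ∀ v w x y → hit v w x y ≡ true → (x ≡ v × y ≡ w) ⊎ (x ≡ w × y ≡ v)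
  hit-true v w x y h with x ≟ v | y ≟ w | x ≟ w | y ≟ v
  ... | yes p | yes q | _ | _ = inj₁ (p , q)
  ... | _ | _ | yes p | yes q = inj₂ (p , q)
  hit-true v w x y () | yes _ | no _ | yes _ | no _
  hit-true v w x y () | yes _ | no _ | no _ | _
  hit-true v w x y () | no _ | _ | yes _ | no _
  hit-true v w x y () | no _ | _ | no _ | _

  hit-no : ∀ {v w x y} → ¬ (x ≡ v × y ≡ w) → ¬ (x ≡ w × y ≡ v) → hit v w x y ≡ false
  hit-no {v} {w} {x} {y} p q = ¬true λ h → [ p , q ]′ (hit-true v w x y h)

  -- B is an adjacency in which some induced paths of G are still contracted to single edges.
  record Realises (B : V G → V G → Bool) (X : List (V G)) : Set where
    field
      H     : Graph
      sub   : SubdivisionOf (K 4) H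
      f     : V H → V G
      inj   : Injective _≡_ _≡_ f
      f∈    : ∀ h → f h ∈ X
      onto  : ∀ {x} → x ∈ X → ∃[ h ] f h ≡ x
      exact : ∀ u v → adj H u v ≡ B (f u) (f v)

  open Realises

  or-step : ∀ p q → (q ≡ true → p ≡ false) → (p ∨ q) ∧ not q ≡ p
  or-step p true h = trans (∧-f (p ∨ true)) (sym (h refl))
    where
    ∧-f : ∀ b → b ∧ false ≡ false
    ∧-f true = refl
    ∧-f false = refl
  or-step true false h = refl
  or-step false false h = refl

  module _ (B : V G → V G → Bool) (B-sym : ∀ x y → B x y ≡ B y x) where

    -- `B′` has the edge vw that `B` lacks. Subdividing it by a vertex sent to z turns `B′` into
    -- `B`; since a subdivision deletes the old edge, `B` must not contain it.
    insert : ∀ {B′ X z v w} → Realises B′ X → v ∈ X → w ∈ X → ¬ (z ∈ X) →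
      (∀ {x y} → x ∈ X → y ∈ X → B′ x y ≡ B x y ∨ hit v w x y) →
      B v w ≡ false → B z z ≡ false → B z v ≡ true → B z w ≡ true →
      (∀ {x} → x ∈ X → x ≢ v → x ≢ w → B z x ≡ false) → Realises B (z ∷ X)
    insert {B′} {X} {z} {v} {w} R v∈ w∈ z∉ spec vw zz zv zw zo with onto R v∈ | onto R w∈
    ... | v′ , refl | w′ , refl = record
        { H = subdivide (H R) v′ w′ e
        ; sub = SubdivisionOf.step (sub R) v′ w′ e
        ; f = g ; inj = g-inj ; f∈ = g∈ ; onto = g-onto ; exact = g-exact }
      where
      e : adj (H R) v′ w′ ≡ true
      e rewrite exact R v′ w′ | spec (f∈ R v′) (f∈ R w′) | vw = hit-yes v w
      g : Fin (suc (n (H R))) → V G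
      g zero = z
      g (suc h) = f R h
      g-inj : Injective _≡_ _≡_ g
      g-inj {zero} {zero} _ = refl
      g-inj {zero} {suc y} q = ⊥-elim (z∉ (subst (_∈ X) (sym q) (f∈ R y)))
      g-inj {suc x} {zero} q = ⊥-elim (z∉ (subst (_∈ X) q (f∈ R x)))
      g-inj {suc x} {suc y} q = cong suc (inj R q)
      g∈ : ∀ h → g h ∈ z ∷ X
      g∈ zero = here refl
      g∈ (suc h) = there (f∈ R h)
      g-onto : ∀ {x} → x ∈ z ∷ X → ∃[ h ] g h ≡ x
      g-onto (here refl) = zero , refl
      g-onto (there i) = suc (proj₁ (onto R i)) , proj₂ (onto R i)
      new : ∀ y → eqb y v′ ∨ eqb y w′ ≡ B z (f R y)
      new y with y ≟ v′ | y ≟ w′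
      ... | yes refl | _ = sym zv
      ... | no _ | yes refl = sym zw
      ... | no p | no q = sym (zo (f∈ R y) (p ∘ inj R) (q ∘ inj R))
      blocked : ∀ x y → hit v w (f R x) (f R y) ≡ true → B (f R x) (f R y) ≡ false
      blocked x y h with hit-true v w (f R x) (f R y) h
      ... | inj₁ (p , q) rewrite p | q = vw
      ... | inj₂ (p , q) rewrite p | q = trans (B-sym w v) vw
      old : ∀ x y → adj (H R) x y ∧ not ((eqb x v′ ∧ eqb y w′) ∨ (eqb x w′ ∧ eqb y v′)) ≡ B (f R x) (f R y)
      old x y rewrite exact R x y | spec (f∈ R x) (f∈ R y) | eqb-inj (f R) (inj R) x v′ | eqb-inj (f R) (inj R) y w′
        | eqb-inj (f R) (inj R) x w′ | eqb-inj (f R) (inj R) y v′ = or-step (B (f R x) (f R y)) _ (blocked x y)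
      g-exact : ∀ x y → adj (subdivide (H R) v′ w′ e) x y ≡ B (g x) (g y)
      g-exact zero zero = sym zz
      g-exact zero (suc y) = new y
      g-exact (suc x) zero = trans (new x) (B-sym z (f R x))
      g-exact (suc x) (suc y) = old x y

  hit-sym : ∀ v w x y → hit v w x y ≡ hit v w y x
  hit-sym v w x y with hit v w x y in p | hit v w y x in q
  ... | true | true = refl
  ... | false | false = refl
  ... | true | false with hit-true v w x y p
  ...   | inj₁ (refl , refl) = trans (sym (hit-yes′ v w)) q
  ...   | inj₂ (refl , refl) = trans (sym (hit-yes v w)) q
  hit-sym v w x y | false | true with hit-true v w y x q
  ...   | inj₁ (refl , refl) = trans (sym p) (hit-yes′ v w)
  ...   | inj₂ (refl , refl) = trans (sym p) (hit-yes v w)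

  ∨-f : ∀ b → b ∨ false ≡ b
  ∨-f true = refl
  ∨-f false = refl

  ∨-t : ∀ b → b ∨ true ≡ true
  ∨-t true = refl
  ∨-t false = refl

  -- Replace the virtual edge vw by the induced path v L w of G, one vertex at a time.
  expand : ∀ (B : V G → V G → Bool) (B-sym : ∀ x y → B x y ≡ B y x) {B′ X v w} L →
    Realises B′ X → v ∈ X → w ∈ X →
    (∀ {x y} → x ∈ X → y ∈ X → B′ x y ≡ B x y ∨ hit v w x y) →
    IPath (v ∷ L ++ w ∷ []) → B v w ≡ adj G v w → (∀ {l} → l ∈ L → ∀ y → B l y ≡ adj G l y) →
    (∀ {l x} → l ∈ L → x ∈ X → x ≢ v → x ≢ w → N l x) →
    Realises B (L ʳ++ X)
  expand B B-sym {B′} {X} {v} {w} [] R v∈ w∈ spec (cons e _ _) vw ag off = record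
    { H = H R ; sub = sub R ; f = f R ; inj = inj R ; f∈ = f∈ R ; onto = onto R
    ; exact = λ x y → trans (exact R x y) (trans (spec (f∈ R x) (f∈ R y)) (fix (f R x) (f R y))) }
    where
    fix : ∀ x y → B x y ∨ hit v w x y ≡ B x y
    fix x y with hit v w x y in p
    ... | false = ∨-f (B x y)
    ... | true with hit-true v w x y p
    ...   | inj₁ (refl , refl) = trans (∨-t (B v w)) (sym (trans vw e))
    ...   | inj₂ (refl , refl) = trans (∨-t (B w v)) (sym (trans (B-sym w v) (trans vw e)))
  expand B B-sym {B′} {X} {v} {w} (z ∷ L) R v∈ w∈ spec (cons e far q) vw ag off =
    expand B B-sym L R″ (here refl) (there w∈) (λ _ _ → refl) q (ag (here refl) w) (λ i → ag (there i)) off′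
    where
    -- Once z is placed next to v, the part that is still virtual is the edge from z to w.
    B″ : V G → V G → Bool
    B″ x y = B x y ∨ hit z w x y
    B″-sym : ∀ x y → B″ x y ≡ B″ y x
    B″-sym x y = cong₂ _∨_ (B-sym x y) (hit-sym z w x y)
    z≢v : z ≢ v
    z≢v refl = E-irrefl e
    z≢w : z ≢ w
    z≢w refl = ip-∉ʳ [] q (∈-mid L)
    ¬vw : adj G v w ≡ false
    ¬vw = ¬true (proj₂ (far (∈-mid L)))
    z∉ : ¬ (z ∈ X)
    z∉ i = proj₁ (off (here refl) i z≢v z≢w) refl
    hz : ∀ {x y} → x ≢ z → y ≢ z → hit z w x y ≡ false
    hz a b = hit-no (a ∘ proj₁) (b ∘ proj₂)
    z∈⇒ : ∀ {x} → x ∈ X → x ≢ z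
    z∈⇒ i refl = z∉ i
    R″ : Realises B″ (z ∷ X)
    R″ = insert B″ B″-sym R v∈ w∈ z∉
      (λ {x} {y} i j → trans (spec i j) (cong (_∨ hit v w x y) (sym
          (trans (cong (B x y ∨_) (hz (z∈⇒ i) (z∈⇒ j))) (∨-f (B x y))))))
      (trans (cong₂ _∨_ (trans vw ¬vw) (hz (z≢v ∘ sym) (z≢w ∘ sym))) refl)
      (trans (cong₂ _∨_ (trans (ag (here refl) z) (adj-irrefl G z)) (hit-no (z≢w ∘ proj₂) (z≢w ∘ proj₁))) refl)
      (trans (cong (_∨ hit z w z v) (trans (ag (here refl) v) (E-sym e))) refl)
      (trans (cong (B z w ∨_) (hit-yes z w)) (∨-t (B z w)))
      (λ {x} i x≢v x≢w → trans (cong₂ _∨_ (trans (ag (here refl) x) (¬true (proj₂ (off (here refl) i x≢v x≢w))))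
        (hit-no (x≢w ∘ proj₂) (z≢w ∘ proj₁))) refl)
    off′ : ∀ {l x} → l ∈ L → x ∈ z ∷ X → x ≢ z → x ≢ w → N l x
    off′ i (here refl) x≢z _ = ⊥-elim (x≢z refl)
    off′ {l} {x} i (there j) x≢z x≢w with x ≟ v
    ... | yes refl = N-sym (far (∈-++⁺ˡ i))
    ... | no x≢v = off (there i) j x≢v x≢w

  Leg : Set
  Leg = V G × List (V G) × V G

  -- The legs still in the list are contracted to edges. Expansion consumes the list from its head,
  -- so each intermediate stage is described by a suffix.
  adjL : List Leg → V G → V G → Bool
  adjL [] x y = adj G x y
  adjL ((v , _ , w) ∷ r) x y = adjL r x y ∨ hit v w x y

  adjL-sym : ∀ r x y → adjL r x y ≡ adjL r y x
  adjL-sym [] x y = adj-sym G x y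
  adjL-sym ((v , _ , w) ∷ r) x y = cong₂ _∨_ (adjL-sym r x y) (hit-sym v w x y)

  Miss : List Leg → V G → V G → Set
  Miss [] x y = ⊤
  Miss ((v , _ , w) ∷ r) x y = (¬ (x ≡ v × y ≡ w) × ¬ (x ≡ w × y ≡ v)) × Miss r x y

  adjL-miss : ∀ r {x y} → Miss r x y → adjL r x y ≡ adj G x y
  adjL-miss [] _ = refl
  adjL-miss ((v , _ , w) ∷ r) ((p , q) , m) = trans (cong₂ _∨_ (adjL-miss r m) (hit-no p q)) (∨-f _)

  Ends : (V G → Set) → List Leg → Set
  Ends P [] = ⊤
  Ends P ((v , _ , w) ∷ r) = P v × P w × Ends P r

  ends-miss : ∀ {l} r → Ends (l ≢_) r → ∀ y → Miss r l y
  ends-miss [] _ y = tt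
  ends-miss (_ ∷ r) (p , q , e) y = (p ∘ proj₁ , q ∘ proj₁) , ends-miss r e y

  -- `L ʳ++ X` is the vertex list that `expand` produces, so each leg is required to avoid the legs
  -- before it. `Miss r v w` says that no later leg joins the same ends, whence the contracted
  -- adjacency of v and w is that of G.
  Fits : List (V G) → List Leg → Set
  Fits X [] = ⊤
  Fits X ((v , L , w) ∷ r) =
    (v ∈ X × w ∈ X × IPath (v ∷ L ++ w ∷ []) × Miss r v w ×
     (∀ {l} → l ∈ L → Ends (l ≢_) r) × (∀ {l x} → l ∈ L → x ∈ X → x ≢ v → x ≢ w → N l x)) ×
    Fits (L ʳ++ X) r

  expand-all : ∀ legs {X} → Realises (adjL legs) X → Fits X legs → ∃[ Y ] Realises (adj G) Y
  expand-all [] R _ = _ , R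
  expand-all ((v , L , w) ∷ r) R ((v∈ , w∈ , p , m , e , off) , fits) =
    expand-all r (expand (adjL r) (adjL-sym r) L R v∈ w∈ (λ _ _ → refl) p (adjL-miss r m)
      (λ i y → adjL-miss r (ends-miss r (e i) y)) off) fits

  realised⇒ISK4 : ∀ {Y} → Realises (adj G) Y → ContainsISK4 G
  realised⇒ISK4 R = H R , sub R , record { emb = f R ; emb-inj = inj R ; emb-adj = exact R }

  diag : ∀ r x → Ends (λ _ → ⊤) r → (∀ {v L w} → (v , L , w) ∈ r → v ≢ w) → adjL r x x ≡ false
  diag [] x _ _ = adj-irrefl G x
  diag ((v , L , w) ∷ r) x (_ , _ , e) h =
    cong₂ _∨_ (diag r x e (h ∘ there)) (hit-no {v} {w} {x} {x} (λ { (p , q) → h (here refl) (trans (sym p) q) })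
        (λ { (p , q) → h (here refl) (trans (sym q) p) }))

  on-leg : ∀ r {v L w} → (v , L , w) ∈ r → adjL r v w ≡ true × adjL r w v ≡ true
  on-leg (_ ∷ r) {v} {L} {w} (here refl) =
    trans (cong (adjL r v w ∨_) (hit-yes v w)) (∨-t _) , trans (cong (adjL r w v ∨_) (hit-yes′ v w)) (∨-t _)
  on-leg (_ ∷ r) (there i) with on-leg r i
  ... | p , q rewrite p | q = refl , refl

  ∈-ʳ++⁺ : ∀ {x} L {X : List (V G)} → x ∈ X → x ∈ L ʳ++ X
  ∈-ʳ++⁺ [] i = i
  ∈-ʳ++⁺ (z ∷ L) i = ∈-ʳ++⁺ L (there i)

  ∈-ʳ++⁻ : ∀ {x} L {X : List (V G)} → x ∈ L ʳ++ X → x ∈ L ⊎ x ∈ X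
  ∈-ʳ++⁻ [] i = inj₂ i
  ∈-ʳ++⁻ (z ∷ L) i with ∈-ʳ++⁻ L i
  ... | inj₁ j = inj₁ (there j)
  ... | inj₂ (here e) = inj₁ (here e)
  ... | inj₂ (there j) = inj₂ j

  Off : List (V G) → List (V G) → V G → V G → Set
  Off L X v w = ∀ {l x} → l ∈ L → x ∈ X → x ≢ v → x ≢ w → N l x

  infixr 5 _◂_
  _◂_ : ∀ {L M X v w} → L ## M → Off L X v w → Off L (M ʳ++ X) v w
  _◂_ {M = M} h k i j p q = [ h i , (λ j′ → k i j′ p q) ]′ (∈-ʳ++⁻ M j)

  inner : ∀ {v L w l} → IPath (v ∷ L ++ w ∷ []) → l ∈ L → l ≢ v × l ≢ w
  inner {v} {L} {w} p i = (λ { refl → ip-∉ʳ [] p (∈-++⁺ˡ i) }) , λ { refl → dup p i }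
    where
    dup : ∀ {w L} → IPath (v ∷ L ++ w ∷ []) → ¬ (w ∈ L)
    dup {w} q i with ∈-∃++ i
    ... | L₁ , L₂ , refl = ip-∉ʳ (v ∷ L₁) (subst IPath (cong (v ∷_) (++-assoc L₁ (w ∷ L₂) (w ∷ []))) q) (∈-mid L₂)

  -- The cycle of the K₄ is a A₁ b A₂ c A₃, its fourth branch vertex t is joined to a, b, c by R₁, R₂, R₃.
  record Layout : Set where
    constructor layout
    field
      {a b c t} : V G
      {A₁ A₂ A₃ R₁ R₂ R₃} : List (V G)
      a≢b : a ≢ b
      b≢c : b ≢ c
      a≢c : a ≢ c
      t≢a : t ≢ a
      t≢b : t ≢ b
      t≢c : t ≢ c
      pab : IPath (a ∷ A₁ ++ b ∷ [])
      pbc : IPath (b ∷ A₂ ++ c ∷ [])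
      pca : IPath (c ∷ A₃ ++ a ∷ [])
      pta : IPath (t ∷ R₁ ++ a ∷ [])
      ptb : IPath (t ∷ R₂ ++ b ∷ [])
      ptc : IPath (t ∷ R₃ ++ c ∷ [])
      A₁c : A₁ ## (c ∷ [])
      A₂a : A₂ ## (a ∷ [])
      A₃b : A₃ ## (b ∷ [])
      A₁t : A₁ ## (t ∷ [])
      A₂t : A₂ ## (t ∷ [])
      A₃t : A₃ ## (t ∷ [])
      R₁b : R₁ ## (b ∷ [])
      R₁c : R₁ ## (c ∷ [])
      R₂a : R₂ ## (a ∷ [])
      R₂c : R₂ ## (c ∷ [])
      R₃a : R₃ ## (a ∷ [])
      R₃b : R₃ ## (b ∷ [])
      A₂A₁ : A₂ ## A₁
      A₃A₁ : A₃ ## A₁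
      A₃A₂ : A₃ ## A₂
      R₁A₁ : R₁ ## A₁
      R₁A₂ : R₁ ## A₂
      R₁A₃ : R₁ ## A₃
      R₂A₁ : R₂ ## A₁
      R₂A₂ : R₂ ## A₂
      R₂A₃ : R₂ ## A₃
      R₃A₁ : R₃ ## A₁
      R₃A₂ : R₃ ## A₂
      R₃A₃ : R₃ ## A₃
      R₂R₁ : R₂ ## R₁
      R₃R₁ : R₃ ## R₁
      R₃R₂ : R₃ ## R₂

  module K4Layout (ly : Layout) where
    open Layout ly

    X₀ : List (V G)
    X₀ = a ∷ b ∷ c ∷ t ∷ []

    legs : List Leg
    legs = (a , A₁ , b) ∷ (b , A₂ , c) ∷ (c , A₃ , a) ∷ (t , R₁ , a) ∷ (t , R₂ , b) ∷ (t , R₃ , c) ∷ []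

    branch : Fin 4 → V G
    branch zero = a
    branch (suc zero) = b
    branch (suc (suc zero)) = c
    branch (suc (suc (suc zero))) = t

    distinct-ends : ∀ {v L w} → (v , L , w) ∈ legs → v ≢ w
    distinct-ends (here refl) = a≢b
    distinct-ends (there (here refl)) = b≢c
    distinct-ends (there (there (here refl))) = a≢c ∘ sym
    distinct-ends (there (there (there (here refl)))) = t≢a
    distinct-ends (there (there (there (there (here refl))))) = t≢b
    distinct-ends (there (there (there (there (there (here refl)))))) = t≢c

    base-exact : ∀ u v → adj (K 4) u v ≡ adjL legs (branch u) (branch v)
    base-exact zero zero = sym (diag legs a _ distinct-ends)
    base-exact (suc zero) (suc zero) = sym (diag legs b _ distinct-ends)
    base-exact (suc (suc zero)) (suc (suc zero)) = sym (diag legs c _ distinct-ends)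
    base-exact (suc (suc (suc zero))) (suc (suc (suc zero))) = sym (diag legs t _ distinct-ends)
    base-exact zero (suc zero) = sym (proj₁ (on-leg legs (here refl)))
    base-exact (suc zero) zero = sym (proj₂ (on-leg legs (here refl)))
    base-exact (suc zero) (suc (suc zero)) = sym (proj₁ (on-leg legs (there (here refl))))
    base-exact (suc (suc zero)) (suc zero) = sym (proj₂ (on-leg legs (there (here refl))))
    base-exact (suc (suc zero)) zero = sym (proj₁ (on-leg legs (there (there (here refl)))))
    base-exact zero (suc (suc zero)) = sym (proj₂ (on-leg legs (there (there (here refl)))))
    base-exact (suc (suc (suc zero))) zero = sym (proj₁ (on-leg legs (there (there (there (here refl))))))
    base-exact zero (suc (suc (suc zero))) = sym (proj₂ (on-leg legs (there (there (there (here refl))))))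
    base-exact (suc (suc (suc zero))) (suc zero) = sym (proj₁ (on-leg legs (there (there (there (there (here refl)))))))
    base-exact (suc zero) (suc (suc (suc zero))) = sym (proj₂ (on-leg legs (there (there (there (there (here refl)))))))
    base-exact (suc (suc (suc zero))) (suc (suc zero)) = sym (proj₁
        (on-leg legs (there (there (there (there (there (here refl))))))))
    base-exact (suc (suc zero)) (suc (suc (suc zero))) = sym (proj₂
        (on-leg legs (there (there (there (there (there (here refl))))))))

    branch-inj : Injective _≡_ _≡_ branch
    branch-inj {zero} {zero} _ = refl
    branch-inj {suc zero} {suc zero} _ = refl
    branch-inj {suc (suc zero)} {suc (suc zero)} _ = refl
    branch-inj {suc (suc (suc zero))} {suc (suc (suc zero))} _ = refl
    branch-inj {zero} {suc zero} e = ⊥-elim (a≢b e)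
    branch-inj {suc zero} {zero} e = ⊥-elim (a≢b (sym e))
    branch-inj {suc zero} {suc (suc zero)} e = ⊥-elim (b≢c e)
    branch-inj {suc (suc zero)} {suc zero} e = ⊥-elim (b≢c (sym e))
    branch-inj {zero} {suc (suc zero)} e = ⊥-elim (a≢c e)
    branch-inj {suc (suc zero)} {zero} e = ⊥-elim (a≢c (sym e))
    branch-inj {suc (suc (suc zero))} {zero} e = ⊥-elim (t≢a e)
    branch-inj {zero} {suc (suc (suc zero))} e = ⊥-elim (t≢a (sym e))
    branch-inj {suc (suc (suc zero))} {suc zero} e = ⊥-elim (t≢b e)
    branch-inj {suc zero} {suc (suc (suc zero))} e = ⊥-elim (t≢b (sym e))
    branch-inj {suc (suc (suc zero))} {suc (suc zero)} e = ⊥-elim (t≢c e)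
    branch-inj {suc (suc zero)} {suc (suc (suc zero))} e = ⊥-elim (t≢c (sym e))

    branch∈ : ∀ h → branch h ∈ X₀
    branch∈ zero = here refl
    branch∈ (suc zero) = there (here refl)
    branch∈ (suc (suc zero)) = there (there (here refl))
    branch∈ (suc (suc (suc zero))) = there (there (there (here refl)))

    branch-onto : ∀ {x} → x ∈ X₀ → ∃[ h ] branch h ≡ x
    branch-onto (here refl) = zero , refl
    branch-onto (there (here refl)) = suc zero , refl
    branch-onto (there (there (here refl))) = suc (suc zero) , refl
    branch-onto (there (there (there (here refl)))) = suc (suc (suc zero)) , refl

    off₁ : Off A₁ X₀ a b
    off₁ i (here refl) p q = ⊥-elim (p refl)
    off₁ i (there (here refl)) p q = ⊥-elim (q refl)
    off₁ i (there (there (here refl))) p q = A₁c i (here refl)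
    off₁ i (there (there (there (here refl)))) p q = A₁t i (here refl)
    off₂ : Off A₂ X₀ b c
    off₂ i (here refl) p q = A₂a i (here refl)
    off₂ i (there (here refl)) p q = ⊥-elim (p refl)
    off₂ i (there (there (here refl))) p q = ⊥-elim (q refl)
    off₂ i (there (there (there (here refl)))) p q = A₂t i (here refl)
    off₃ : Off A₃ X₀ c a
    off₃ i (here refl) p q = ⊥-elim (q refl)
    off₃ i (there (here refl)) p q = A₃b i (here refl)
    off₃ i (there (there (here refl))) p q = ⊥-elim (p refl)
    off₃ i (there (there (there (here refl)))) p q = A₃t i (here refl)
    off₄ : Off R₁ X₀ t a
    off₄ i (here refl) p q = ⊥-elim (q refl)
    off₄ i (there (here refl)) p q = R₁b i (here refl)
    off₄ i (there (there (here refl))) p q = R₁c i (here refl)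
    off₄ i (there (there (there (here refl)))) p q = ⊥-elim (p refl)
    off₅ : Off R₂ X₀ t b
    off₅ i (here refl) p q = R₂a i (here refl)
    off₅ i (there (here refl)) p q = ⊥-elim (q refl)
    off₅ i (there (there (here refl))) p q = R₂c i (here refl)
    off₅ i (there (there (there (here refl)))) p q = ⊥-elim (p refl)
    off₆ : Off R₃ X₀ t c
    off₆ i (here refl) p q = R₃a i (here refl)
    off₆ i (there (here refl)) p q = R₃b i (here refl)
    off₆ i (there (there (here refl))) p q = ⊥-elim (q refl)
    off₆ i (there (there (there (here refl)))) p q = ⊥-elim (p refl)

    Ne : V G → Set
    Ne l = l ≢ a × l ≢ b × l ≢ c × l ≢ t

    ne₁ : ∀ {l} → l ∈ A₁ → Ne l
    ne₁ i = proj₁ (inner pab i) , proj₂ (inner pab i) , proj₁ (A₁c i (here refl)) , proj₁ (A₁t i (here refl))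
    ne₂ : ∀ {l} → l ∈ A₂ → Ne l
    ne₂ i = proj₁ (A₂a i (here refl)) , proj₁ (inner pbc i) , proj₂ (inner pbc i) , proj₁ (A₂t i (here refl))
    ne₃ : ∀ {l} → l ∈ A₃ → Ne l
    ne₃ i = proj₂ (inner pca i) , proj₁ (A₃b i (here refl)) , proj₁ (inner pca i) , proj₁ (A₃t i (here refl))
    ne₄ : ∀ {l} → l ∈ R₁ → Ne l
    ne₄ i = proj₂ (inner pta i) , proj₁ (R₁b i (here refl)) , proj₁ (R₁c i (here refl)) , proj₁ (inner pta i)
    ne₅ : ∀ {l} → l ∈ R₂ → Ne l
    ne₅ i = proj₁ (R₂a i (here refl)) , proj₂ (inner ptb i) , proj₁ (R₂c i (here refl)) , proj₁ (inner ptb i)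

    e₅ : ∀ {l} → Ne l → Ends (l ≢_) ((t , R₃ , c) ∷ [])
    e₅ (_ , _ , c′ , t′) = t′ , c′ , tt
    e₄ : ∀ {l} → Ne l → Ends (l ≢_) ((t , R₂ , b) ∷ (t , R₃ , c) ∷ [])
    e₄ h@(_ , b′ , _ , t′) = t′ , b′ , e₅ h
    e₃ : ∀ {l} → Ne l → Ends (l ≢_) ((t , R₁ , a) ∷ (t , R₂ , b) ∷ (t , R₃ , c) ∷ [])
    e₃ h@(a′ , _ , _ , t′) = t′ , a′ , e₄ h
    e₂ : ∀ {l} → Ne l → Ends (l ≢_) ((c , A₃ , a) ∷ (t , R₁ , a) ∷ (t , R₂ , b) ∷ (t , R₃ , c) ∷ [])
    e₂ h@(a′ , _ , c′ , _) = c′ , a′ , e₃ h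
    e₁ : ∀ {l} → Ne l → Ends (l ≢_) ((b , A₂ , c) ∷ (c , A₃ , a) ∷ (t , R₁ , a) ∷ (t , R₂ , b) ∷ (t , R₃ , c) ∷ [])
    e₁ h@(_ , b′ , c′ , _) = b′ , c′ , e₂ h

    fits : Fits X₀ legs
    fits =
      (here refl , there (here refl) , pab ,
        ((a≢b ∘ proj₁ , a≢c ∘ proj₁) , (a≢c ∘ proj₁ , b≢c ∘ proj₂) , (t≢a ∘ sym ∘ proj₁ , t≢b ∘ sym ∘ proj₂) ,
         (t≢a ∘ sym ∘ proj₁ , a≢b ∘ proj₁) , (t≢a ∘ sym ∘ proj₁ , a≢c ∘ proj₁) , tt) ,
        (λ i → e₁ (ne₁ i)) , off₁) ,
      (∈-ʳ++⁺ A₁ (there (here refl)) , ∈-ʳ++⁺ A₁ (there (there (here refl))) , pbc ,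
        ((b≢c ∘ proj₁ , a≢b ∘ sym ∘ proj₁) , (t≢b ∘ sym ∘ proj₁ , t≢c ∘ sym ∘ proj₂) ,
         (t≢b ∘ sym ∘ proj₁ , t≢c ∘ sym ∘ proj₂) , (t≢b ∘ sym ∘ proj₁ , t≢c ∘ sym ∘ proj₂) , tt) ,
        (λ i → e₂ (ne₂ i)) , A₂A₁ ◂ off₂) ,
      (∈-ʳ++⁺ A₂ (∈-ʳ++⁺ A₁ (there (there (here refl)))) , ∈-ʳ++⁺ A₂ (∈-ʳ++⁺ A₁ (here refl)) , pca ,
        ((t≢c ∘ sym ∘ proj₁ , t≢a ∘ sym ∘ proj₂) , (t≢c ∘ sym ∘ proj₁ , t≢a ∘ sym ∘ proj₂) ,
         (t≢c ∘ sym ∘ proj₁ , t≢a ∘ sym ∘ proj₂) , tt) ,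
        (λ i → e₃ (ne₃ i)) , A₃A₂ ◂ A₃A₁ ◂ off₃) ,
      (up (there (there (there (here refl)))) , up (here refl) , pta ,
        ((a≢b ∘ proj₂ , t≢b ∘ proj₁) , (a≢c ∘ proj₂ , t≢c ∘ proj₁) , tt) ,
        (λ i → e₄ (ne₄ i)) , R₁A₃ ◂ R₁A₂ ◂ R₁A₁ ◂ off₄) ,
      (∈-ʳ++⁺ R₁ (up (there (there (there (here refl))))) , ∈-ʳ++⁺ R₁ (up (there (here refl))) , ptb ,
        ((b≢c ∘ proj₂ , t≢c ∘ proj₁) , tt) ,
        (λ i → e₅ (ne₅ i)) , R₂R₁ ◂ R₂A₃ ◂ R₂A₂ ◂ R₂A₁ ◂ off₅) ,
      (∈-ʳ++⁺ R₂ (∈-ʳ++⁺ R₁ (up (there (there (there (here refl)))))) , ∈-ʳ++⁺ R₂ (∈-ʳ++⁺ R₁ (up (there (there (here refl))))) ,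
          ptc ,
        tt , (λ _ → tt) , R₃R₂ ◂ R₃R₁ ◂ R₃A₃ ◂ R₃A₂ ◂ R₃A₁ ◂ off₆) ,
      tt
      where
      up : ∀ {x} → x ∈ X₀ → x ∈ A₃ ʳ++ (A₂ ʳ++ (A₁ ʳ++ X₀))
      up i = ∈-ʳ++⁺ A₃ (∈-ʳ++⁺ A₂ (∈-ʳ++⁺ A₁ i))

    layout-ISK4 : ContainsISK4 G
    layout-ISK4 = realised⇒ISK4 (proj₂ (expand-all legs
      (record { H = K 4 ; sub = base ; f = branch ; inj = branch-inj ; f∈ = branch∈ ; onto = branch-onto ; exact = base-exact })
          fits))

  -- Only the inner vertices of the leg are kept off the hole; the contacts of the centre t are
  -- controlled once for all three legs in `tripod`.
  Spoke : List (V G) → V G → List (V G) → V G → Set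
  Spoke L t R a = IPath (t ∷ R ++ a ∷ []) × (∀ {r z} → r ∈ R → z ∈ L → z ≢ a → N r z)

  direct : ∀ {L t a} → E t a → Spoke L t [] a
  direct e = edge e , λ ()

  private
    tripod′ : ∀ {a} A₁ {b} A₂ {c} A₃ {t R₁ R₂ R₃} → let L = a ∷ A₁ ++ b ∷ A₂ ++ c ∷ A₃ in IsHole L →
      Spoke L t R₁ a → Spoke L t R₂ b → Spoke L t R₃ c → R₁ ## R₂ → R₁ ## R₃ → R₂ ## R₃ →
      (∀ {z} → z ∈ L → z ≢ a → z ≢ b → z ≢ c → N t z) → ContainsISK4 G
    tripod′ {a} A₁ {b} A₂ {c} A₃ {t} {R₁} {R₂} {R₃} h (p₁ , o₁) (p₂ , o₂) (p₃ , o₃) r₁₂ r₁₃ r₂₃ tz =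
      K4Layout.layout-ISK4 (layout a≢b b≢c a≢c (ends p₁) (ends p₂) (ends p₃)
        (hole-arc A₁ h (∈-mid A₂)) (hole-arc A₂ h₂ (∈-mid A₃)) (hole-arc A₃ h₃ (∈-mid A₁)) p₁ p₂ p₃
        (λ { i (here refl) → hole-## A₁ h i (∈-mid A₂) }) (λ { i (here refl) → hole-## A₂ h₂ i (∈-mid A₃) })
        (λ { i (here refl) → hole-## A₃ h₃ i (∈-mid A₁) })
        (λ { i (here refl) → N-sym (tz (in₁ i) (na₁ i) (nb₁ i) (nc₁ i)) })
        (λ { i (here refl) → N-sym (tz (in₂ i) (na₂ i) (nb₂ i) (nc₂ i)) })
        (λ { i (here refl) → N-sym (tz (in₃ i) (na₃ i) (nb₃ i) (nc₃ i)) })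
        (λ { i (here refl) → o₁ i b∈ (a≢b ∘ sym) }) (λ { i (here refl) → o₁ i c∈ (a≢c ∘ sym) })
        (λ { i (here refl) → o₂ i (here refl) a≢b }) (λ { i (here refl) → o₂ i c∈ (b≢c ∘ sym) })
        (λ { i (here refl) → o₃ i (here refl) a≢c }) (λ { i (here refl) → o₃ i b∈ b≢c })
        (λ i j → N-sym (hole-## A₁ h j (∈-++⁺ˡ i)))
        (λ i j → N-sym (hole-## A₁ h j (∈-++⁺ʳ A₂ (there i))))
        (λ i j → N-sym (hole-## A₂ h₂ j (∈-++⁺ˡ i)))
        (λ i j → o₁ i (in₁ j) (na₁ j)) (λ i j → o₁ i (in₂ j) (na₂ j)) (λ i j → o₁ i (in₃ j) (na₃ j))
        (λ i j → o₂ i (in₁ j) (nb₁ j)) (λ i j → o₂ i (in₂ j) (nb₂ j)) (λ i j → o₂ i (in₃ j) (nb₃ j))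
        (λ i j → o₃ i (in₁ j) (nc₁ j)) (λ i j → o₃ i (in₂ j) (nc₂ j)) (λ i j → o₃ i (in₃ j) (nc₃ j))
        (##-sym r₁₂) (##-sym r₁₃) (##-sym r₂₃))
      where
      h₂ : IsHole (b ∷ A₂ ++ c ∷ A₃ ++ a ∷ A₁)
      h₂ = subst IsHole (cong (b ∷_) (++-assoc A₂ (c ∷ A₃) (a ∷ A₁))) (rot (a ∷ A₁) h)
      h₃ : IsHole (c ∷ A₃ ++ a ∷ A₁ ++ b ∷ A₂)
      h₃ = subst IsHole (cong (c ∷_) (++-assoc A₃ (a ∷ A₁) (b ∷ A₂))) (rot (b ∷ A₂) h₂)
      b∈ : b ∈ a ∷ A₁ ++ b ∷ A₂ ++ c ∷ A₃
      b∈ = there (∈-mid A₁)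
      c∈ : c ∈ a ∷ A₁ ++ b ∷ A₂ ++ c ∷ A₃
      c∈ = there (∈-++⁺ʳ A₁ (there (∈-mid A₂)))
      in₁ : ∀ {z} → z ∈ A₁ → z ∈ a ∷ A₁ ++ b ∷ A₂ ++ c ∷ A₃
      in₁ i = there (∈-++⁺ˡ i)
      in₂ : ∀ {z} → z ∈ A₂ → z ∈ a ∷ A₁ ++ b ∷ A₂ ++ c ∷ A₃
      in₂ i = there (∈-++⁺ʳ A₁ (there (∈-++⁺ˡ i)))
      in₃ : ∀ {z} → z ∈ A₃ → z ∈ a ∷ A₁ ++ b ∷ A₂ ++ c ∷ A₃
      in₃ i = there (∈-++⁺ʳ A₁ (there (∈-++⁺ʳ A₂ (there i))))
      a≢b : a ≢ b
      a≢b refl = hole-∉ h (∈-mid A₁)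
      b≢c : b ≢ c
      b≢c refl = hole-∉ h₂ (∈-mid A₂)
      a≢c : a ≢ c
      a≢c refl = hole-∉ h (∈-++⁺ʳ A₁ (there (∈-mid A₂)))
      na₁ : ∀ {z} → z ∈ A₁ → z ≢ a
      na₁ i refl = hole-∉ h (∈-++⁺ˡ i)
      na₂ : ∀ {z} → z ∈ A₂ → z ≢ a
      na₂ i refl = hole-∉ h (∈-++⁺ʳ A₁ (there (∈-++⁺ˡ i)))
      na₃ : ∀ {z} → z ∈ A₃ → z ≢ a
      na₃ i refl = hole-∉ h (∈-++⁺ʳ A₁ (there (∈-++⁺ʳ A₂ (there i))))
      nb₁ : ∀ {z} → z ∈ A₁ → z ≢ b
      nb₁ i refl = hole-∉ h₂ (∈-++⁺ʳ A₂ (there (∈-++⁺ʳ A₃ (there i))))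
      nb₂ : ∀ {z} → z ∈ A₂ → z ≢ b
      nb₂ i refl = hole-∉ h₂ (∈-++⁺ˡ i)
      nb₃ : ∀ {z} → z ∈ A₃ → z ≢ b
      nb₃ i refl = hole-∉ h₂ (∈-++⁺ʳ A₂ (there (∈-++⁺ˡ i)))
      nc₁ : ∀ {z} → z ∈ A₁ → z ≢ c
      nc₁ i refl = hole-∉ h₃ (∈-++⁺ʳ A₃ (there (∈-++⁺ˡ i)))
      nc₂ : ∀ {z} → z ∈ A₂ → z ≢ c
      nc₂ i refl = hole-∉ h₃ (∈-++⁺ʳ A₃ (there (∈-++⁺ʳ A₁ (there i))))
      nc₃ : ∀ {z} → z ∈ A₃ → z ≢ c
      nc₃ i refl = hole-∉ h₃ (∈-++⁺ˡ i)
      ends : ∀ {t R x} → IPath (t ∷ R ++ x ∷ []) → t ≢ x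
      ends {R = R} p refl = ip-∉ʳ [] p (∈-mid R)

    tripod″ : ∀ {a} A₁ {b} A₂ {c} A₃ {t R₁ R₂ R₃ L} → L ≡ a ∷ A₁ ++ b ∷ A₂ ++ c ∷ A₃ → IsHole L →
      Spoke L t R₁ a → Spoke L t R₂ b → Spoke L t R₃ c → R₁ ## R₂ → R₁ ## R₃ → R₂ ## R₃ →
      (∀ {z} → z ∈ L → z ≢ a → z ≢ b → z ≢ c → N t z) → ContainsISK4 G
    tripod″ A₁ A₂ A₃ refl = tripod′ A₁ A₂ A₃

  -- After rotating the hole to start at a, the other feet appear in the order b, c or c, b; the
  -- second order is the first with two legs exchanged.
  tripod : ∀ {L a b c t R₁ R₂ R₃} → IsHole L → a ∈ L → b ∈ L → c ∈ L → a ≢ b → b ≢ c → a ≢ c →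
    Spoke L t R₁ a → Spoke L t R₂ b → Spoke L t R₃ c → R₁ ## R₂ → R₁ ## R₃ → R₂ ## R₃ →
    (∀ {z} → z ∈ L → z ≢ a → z ≢ b → z ≢ c → N t z) → ContainsISK4 G
  tripod {L} {a} {b} {c} {t} h a∈ b∈ c∈ a≢b b≢c a≢c s₁ s₂ s₃ r₁₂ r₁₃ r₂₃ tz with hole-at h a∈
  ... | M , h′ , perm = found
    where
    mv : ∀ {R x} → Spoke L t R x → Spoke (a ∷ M) t R x
    mv (p , o) = p , λ i j → o i (∈-resp-↭ perm j)
    tz′ : ∀ {z} → z ∈ a ∷ M → z ≢ a → z ≢ b → z ≢ c → N t z
    tz′ i = tz (∈-resp-↭ perm i)
    tl : ∀ {x} → x ∈ L → a ≢ x → x ∈ M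
    tl i ne with ∈-resp-↭ (↭-sym perm) i
    ... | here refl = ⊥-elim (ne refl)
    ... | there j = j
    found : ContainsISK4 G
    found with ∈-∃++ (tl b∈ a≢b)
    ... | A₁ , B , refl with ∈-++⁻ A₁ (tl c∈ a≢c)
    ...   | inj₂ (here refl) = ⊥-elim (b≢c refl)
    ...   | inj₂ (there i) with ∈-∃++ i
    ...     | A₂ , A₃ , refl = tripod′ A₁ A₂ A₃ h′ (mv s₁) (mv s₂) (mv s₃) r₁₂ r₁₃ r₂₃ tz′
    found | A₁ , B , refl | inj₁ i with ∈-∃++ i
    ...     | A₂ , A₃ , refl =
              tripod″ A₂ A₃ B (cong (a ∷_) (++-assoc A₂ (c ∷ A₃) (b ∷ B))) h′ (mv s₁) (mv s₃) (mv s₂) r₁₃ r₁₂ (##-sym r₂₃)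
                  (λ i p q r → tz′ i p r q)

-- Wheels on a shortest rim.

module Wheels (G : Graph) (tri : Paths.TriangleFree G) (isk : ¬ ContainsISK4 G) where
  open Paths G
  open Detect G
  open IsHole

  record Wheel (L : List (V G)) (x : V G) : Set where
    constructor mkWheel
    field
      rim    : IsHole L
      hub∉   : ¬ (x ∈ L)
      spokes : 3 ≤ cnt x L

  open Wheel

  ∉⇒≢ : ∀ {x z : V G} {L} → ¬ (x ∈ L) → z ∈ L → x ≢ z
  ∉⇒≢ x∉ i refl = x∉ i

  wheel-4 : ∀ {L x} → Wheel L x → 4 ≤ cnt x L
  wheel-4 {L} {x} (mkWheel h x∉ c) with 4 ≤? cnt x L
  ... | yes p = p
  ... | no ¬p with cnt-first x L (≤-trans (s≤s z≤n) c)
  ... | X , a , Y , refl , ea , nX , c₁ with cnt-first x Y (≤-trans (s≤s z≤n) (≤-pred (subst (3 ≤_) c₁ c)))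
  ... | X₂ , b , Y₂ , refl , eb , nX₂ , c₂ with cnt-first x Y₂ (≤-pred (≤-pred (subst (3 ≤_) (trans c₁ (cong suc c₂)) c)))
  ... | X₃ , d , Y₃ , refl , ed , nX₃ , c₃ with cnt x Y₃ in c₄
  ... | suc k = ⊥-elim (¬p (subst (4 ≤_) (sym (trans c₁ (cong suc (trans c₂ (cong suc c₃))))) (s≤s (s≤s (s≤s (s≤s z≤n))))))
  ... | zero = ⊥-elim (isk (tripod h a∈ b∈ d∈ a≢b b≢d a≢d (direct ea) (direct eb) (direct ed)
                 (λ ()) (λ ()) (λ ()) λ i p q r → ∉⇒≢ x∉ i , far i p q r))
    where
    a∈ : a ∈ X ++ a ∷ X₂ ++ b ∷ X₃ ++ d ∷ Y₃
    a∈ = ∈-mid X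
    b∈ : b ∈ X ++ a ∷ X₂ ++ b ∷ X₃ ++ d ∷ Y₃
    b∈ = ∈-++⁺ʳ X (there (∈-mid X₂))
    d∈ : d ∈ X ++ a ∷ X₂ ++ b ∷ X₃ ++ d ∷ Y₃
    d∈ = ∈-++⁺ʳ X (there (∈-++⁺ʳ X₂ (there (∈-mid X₃))))
    h₁ : IsHole (a ∷ (X₂ ++ b ∷ X₃ ++ d ∷ Y₃) ++ X)
    h₁ = rot X h
    h₂ : IsHole (b ∷ (X₃ ++ d ∷ Y₃) ++ X ++ a ∷ X₂)
    h₂ = rot (X ++ a ∷ X₂) (subst IsHole (sym (++-assoc X (a ∷ X₂) (b ∷ X₃ ++ d ∷ Y₃))) h)
    a≢b : a ≢ b
    a≢b refl = hole-∉ h₁ (∈-++⁺ˡ (∈-mid X₂))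
    a≢d : a ≢ d
    a≢d refl = hole-∉ h₁ (∈-++⁺ˡ (∈-++⁺ʳ X₂ (there (∈-mid X₃))))
    b≢d : b ≢ d
    b≢d refl = hole-∉ h₂ (∈-++⁺ˡ (∈-mid X₃))
    nY₃ : None x Y₃
    nY₃ i e with subst (1 ≤_) c₄ (cnt-∈ Y₃ i e)
    ... | ()
    far : ∀ {z} → z ∈ X ++ a ∷ X₂ ++ b ∷ X₃ ++ d ∷ Y₃ → z ≢ a → z ≢ b → z ≢ d → ¬ E x z
    far i p q r with ∈-++⁻ X i
    ... | inj₁ j = nX j
    ... | inj₂ (here e) = λ _ → p e
    ... | inj₂ (there j) with ∈-++⁻ X₂ j
    ...   | inj₁ k = nX₂ k
    ...   | inj₂ (here e) = λ _ → q e
    ...   | inj₂ (there k) with ∈-++⁻ X₃ k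
    ...     | inj₁ l = nX₃ l
    ...     | inj₂ (here e) = λ _ → r e
    ...     | inj₂ (there l) = nY₃ l

  ip-snoc : ∀ Z {w x} → IPath (Z ++ w ∷ []) → E w x → Z ## (x ∷ []) → IPath ((Z ++ w ∷ []) ++ x ∷ [])
  ip-snoc Z {w} {x} p e z = subst IPath (sym (++-assoc Z (w ∷ []) (x ∷ []))) (ip-glue Z p (edge e) z)

  length-++-< : ∀ (P : List (V G)) {X Y} → length X < length Y → length (P ++ X) < length (P ++ Y)
  length-++-< [] h = h
  length-++-< (p ∷ P) h = s≤s (length-++-< P h)

  NoSmaller : List (V G) → Set
  NoSmaller L = ∀ {L′ x′} → Wheel L′ x′ → length L′ < length L → ⊥

  -- The hole is T₁ u A v T₂ R.  The neighbours u, v of x are consecutive, the part from a (on T₁ u) to b (on v T₂)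
  -- is the sector of y around them, and R is the rest.
  record SharedSector : Set where
    constructor shared-sector
    field
      {x y u v b a} : V G
      A T₂ R T₁ T₀ W₂ : List (V G)
    L : List (V G)
    L = u ∷ A ++ v ∷ T₂ ++ R ++ T₁
    field
      eq₂ : v ∷ T₂ ≡ T₀ ++ b ∷ []
      eq₁ : T₁ ++ u ∷ [] ≡ a ∷ W₂
      h : IsHole L
      x∉ : ¬ (x ∈ L)
      y∉ : ¬ (y ∈ L)
      nxy : N x y
      xu : E x u
      xv : E x v
      xA : None x A
      yA : None y A
      yb : E y b
      yT₀ : None y T₀
      ya : E y a
      yW₂ : None y W₂
      cy : 1 ≤ cnt y R
      cx : 4 ≤ cnt x L
      small : NoSmaller L

  module Consecutive (sh : SharedSector) where
    open SharedSector sh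

    inA : ∀ {z} → z ∈ A → z ∈ L
    inA i = there (∈-++⁺ˡ i)
    inT₂ : ∀ {z} → z ∈ v ∷ T₂ → z ∈ L
    inT₂ i = there (∈-++⁺ʳ A (∈-++⁺ˡ i))
    inR : ∀ {z} → z ∈ R → z ∈ L
    inR i = there (∈-++⁺ʳ A (there (∈-++⁺ʳ T₂ (∈-++⁺ˡ i))))
    inT₁ : ∀ {z} → z ∈ T₁ → z ∈ L
    inT₁ i = there (∈-++⁺ʳ A (there (∈-++⁺ʳ T₂ (∈-++⁺ʳ R i))))
    inT₁u : ∀ {z} → z ∈ T₁ ++ u ∷ [] → z ∈ L
    inT₁u i = [ inT₁ , (λ { (here refl) → here refl }) ]′ (∈-++⁻ T₁ i)

    A≢[] : ∃[ z ] ∃[ A′ ] A ≡ z ∷ A′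
    A≢[] = view A h
      where
      view : ∀ A → IsHole (u ∷ A ++ v ∷ T₂ ++ R ++ T₁) → ∃[ z ] ∃[ A′ ] A ≡ z ∷ A′
      view [] h = ⊥-elim (tri xu (hole-edge₀ h) xv)
      view (z ∷ A′) h = z , A′ , refl

    W : IPath ((v ∷ T₂) ++ R ++ T₁ ++ u ∷ [])
    W = subst IPath (cong (v ∷_) (trans (++-assoc T₂ (R ++ T₁) (u ∷ [])) (cong (T₂ ++_) (++-assoc R T₁ (u ∷ [])))))
          (hole-arc (T₂ ++ R ++ T₁) (rot (u ∷ A) h) (subst (proj₁ A≢[] ∈_) (sym (proj₂ (proj₂ A≢[]))) (here refl)))

    A## : A ## (T₂ ++ R ++ T₁)
    A## = hole-## A h

    after : ∀ R₁ {r R₂} → R ≡ R₁ ++ r ∷ R₂ → (v ∷ T₂) ## (R₂ ++ T₁ ++ u ∷ [])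
    after R₁ {r} {R₂} refl i j = ip-apart ((v ∷ T₂) ++ R₁)
      (subst IPath (trans (cong ((v ∷ T₂) ++_) (++-assoc R₁ (r ∷ R₂) (T₁ ++ u ∷ [])))
          (sym (++-assoc (v ∷ T₂) R₁ (r ∷ R₂ ++ T₁ ++ u ∷ [])))) W)
      (∈-++⁺ˡ i) j

    before : ∀ R₁ {r R₂} → R ≡ R₁ ++ r ∷ R₂ → R₁ ## (T₁ ++ u ∷ [])
    before R₁ {r} {R₂} refl i j = ip-apart R₁ {B = R₂ ++ T₁ ++ u ∷ []}
      (subst IPath (++-assoc R₁ (r ∷ R₂) (T₁ ++ u ∷ [])) (ip-r (v ∷ T₂) W)) i (∈-++⁺ʳ R₂ j)

    pR : IPath R
    pR = ip-l R (ip-r (v ∷ T₂) W)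

    W₀ : IPath (T₀ ++ b ∷ R ++ T₁ ++ u ∷ [])
    W₀ = subst IPath (trans (cong (_++ (R ++ T₁ ++ u ∷ [])) eq₂) (++-assoc T₀ (b ∷ []) (R ++ T₁ ++ u ∷ []))) W

    -- The first vertex of R follows b on the hole, so y seeing it would close a triangle with b.
    head-R : ∀ {r R₂} → R ≡ r ∷ R₂ → ¬ E y r
    head-R refl e = tri yb (ip-edge T₀ W₀) e

    last-R : ∀ R₁ {t} → R ≡ R₁ ++ t ∷ [] → ¬ E y t
    last-R R₁ {t} refl e = tri (E-sym e) ya (ip-edge ((v ∷ T₂) ++ R₁)
      (subst IPath (trans (cong ((v ∷ T₂) ++_) (trans (++-assoc R₁ (t ∷ []) (T₁ ++ u ∷ [])) (cong (λ K → R₁ ++ t ∷ K) eq₁)))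
        (sym (++-assoc (v ∷ T₂) R₁ (t ∷ a ∷ W₂)))) W))

    R-long : ∃[ r ] ∃[ r′ ] ∃[ R′ ] R ≡ r ∷ r′ ∷ R′
    R-long = view R cy head-R
      where
      view : ∀ R → 1 ≤ cnt y R → (∀ {r R₂} → R ≡ r ∷ R₂ → ¬ E y r) → ∃[ r ] ∃[ r′ ] ∃[ R′ ] R ≡ r ∷ r′ ∷ R′
      view (r ∷ []) c hd with subst (1 ≤_) (cnt-no [] (hd refl)) c
      ... | ()
      view (r ∷ r′ ∷ R′) c hd = r , r′ , R′ , refl

    Q : List (V G)
    Q = T₂ ++ y ∷ T₁

    yT₂ : IPath ((v ∷ T₂) ++ y ∷ [])
    yT₂ = subst IPath (cong (_++ y ∷ []) (sym eq₂))
      (ip-snoc T₀ (ip-l (T₀ ++ b ∷ []) (subst IPath (sym (++-assoc T₀ (b ∷ []) (R ++ T₁ ++ u ∷ []))) W₀)) (E-sym yb)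
        λ { i (here refl) → N-sym (∉⇒≢ y∉ (inT₂ (subst (_ ∈_) (sym eq₂) (∈-++⁺ˡ i))) , yT₀ i) })

    yT₁ : IPath (y ∷ T₁ ++ u ∷ [])
    yT₁ = subst (λ K → IPath (y ∷ K)) (sym eq₁)
      (cons ya (λ i → ∉⇒≢ y∉ (inT₁u (subst (_ ∈_) (sym eq₁) (there i))) , yW₂ i)
        (subst IPath eq₁ (ip-r R (ip-r (v ∷ T₂) W))))

    arcQ : IPath (v ∷ Q ++ u ∷ [])
    arcQ = subst IPath (cong (v ∷_) (sym (++-assoc T₂ (y ∷ T₁) (u ∷ []))))
      (ip-glue (v ∷ T₂) yT₂ yT₁ λ i j → after [] (proj₂ (proj₂ (proj₂ R-long))) i
          (there (∈-++⁺ʳ (proj₁ (proj₂ (proj₂ R-long))) j)))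

    A##Q : A ## Q
    A##Q = ##-++ʳ T₂ (λ i j → A## i (∈-++⁺ˡ j))
      (##-∷ʳ (λ { i (here refl) → N-sym (∉⇒≢ y∉ (inA i) , yA i) }) (λ i j → A## i (∈-++⁺ʳ T₂ (∈-++⁺ʳ R j))))

    -- The vertex y takes the place of R. As y sees R but not its first vertex, R has at least two
    -- vertices and this hole is shorter than L. By minimality x sees nothing on it besides u and v,
    -- which leaves at least two spokes of x inside R.
    C₀ : List (V G)
    C₀ = u ∷ A ++ v ∷ Q

    C₀∋ : ∀ {z} → z ∈ C₀ → z ≡ y ⊎ z ∈ L
    C₀∋ (here refl) = inj₂ (here refl)
    C₀∋ (there i) with ∈-++⁻ A i
    ... | inj₁ j = inj₂ (inA j)
    ... | inj₂ (here refl) = inj₂ (inT₂ (here refl))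
    ... | inj₂ (there j) with ∈-++⁻ T₂ j
    ...   | inj₁ k = inj₂ (inT₂ (there k))
    ...   | inj₂ (here refl) = inj₁ refl
    ...   | inj₂ (there k) = inj₂ (inT₁ k)

    x∉C₀ : ¬ (x ∈ C₀)
    x∉C₀ i = [ proj₁ nxy , x∉ ]′ (C₀∋ i)

    hole₀ : IsHole C₀
    hole₀ = build A refl
      where
      build : ∀ A′ → A ≡ A′ → IsHole (u ∷ A′ ++ v ∷ Q)
      build [] e with trans (sym e) (proj₂ (proj₂ A≢[]))
      ... | ()
      build (z ∷ A′) refl = mkHole A′ Q (hole-arc-l h) (subst IPath refl (ip-mid′ (hole-tail h))) arcQ A##Q (s≤s (s≤s ln))
        where
        hole-arc-l : IsHole (u ∷ z ∷ A′ ++ v ∷ T₂ ++ R ++ T₁) → IPath (u ∷ z ∷ A′)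
        hole-arc-l h = ip-l (u ∷ z ∷ A′) (hole-arc (z ∷ A′) h (∈-++⁺ʳ T₂
            (∈-++⁺ˡ (subst (proj₁ R-long ∈_) (sym (proj₂ (proj₂ (proj₂ R-long)))) (here refl)))))
        ip-mid′ : IPath (z ∷ A′ ++ v ∷ T₂ ++ R ++ T₁) → IPath (z ∷ A′ ++ v ∷ [])
        ip-mid′ = ip-mid []
        ln : 2 ≤ length (A′ ++ v ∷ T₂ ++ y ∷ T₁)
        ln = ≤-trans (≤-trans (s≤s (subst (1 ≤_) (sym (length-++ T₂)) (≤-trans (s≤s z≤n) (m≤n+m _ (length T₂)))))
            (m≤n+m _ (length A′)))
               (≤-reflexive (sym (length-++ A′)))

    shorter : length C₀ < length L
    shorter = s≤s (length-++-< A (s≤s (length-++-< T₂ lt)))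
      where
      lt : length (y ∷ T₁) < length (R ++ T₁)
      lt rewrite proj₂ (proj₂ (proj₂ R-long)) = s≤s (s≤s (≤-trans (m≤n+m _ _)
          (≤-reflexive (sym (length-++ (proj₁ (proj₂ (proj₂ R-long))))))))

    cnt-C : ∀ K → cnt x (u ∷ A ++ v ∷ K) ≡ 2 + cnt x K
    cnt-C K = trans (cnt-yes (A ++ v ∷ K) xu) (cong suc (trans (cnt-++ x A (v ∷ K))
      (trans (cong (_+ cnt x (v ∷ K)) (cnt-none A xA)) (cnt-yes K xv))))

    xQ : None x Q
    xQ i e = small (mkWheel hole₀ x∉C₀ (subst (3 ≤_) (sym (cnt-C Q)) (s≤s (s≤s (cnt-∈ Q i e))))) shorter

    cxR : 2 ≤ cnt x R
    cxR = ≤-trans (≤-pred (≤-pred (subst (4 ≤_) (cnt-C (T₂ ++ R ++ T₁)) cx)))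
      (≤-reflexive (trans (cnt-++ x T₂ (R ++ T₁)) (trans (cong₂ _+_ (cnt-none T₂ (λ i → xQ (∈-++⁺ˡ i)))
        (trans (cnt-++ x R T₁) (trans (cong (cnt x R +_) (cnt-none T₁ (λ i → xQ (∈-++⁺ʳ T₂ (there i))))) (+-identityʳ _))))
            refl)))

    -- Centre x on `C₀`: u and v are direct feet, and Z is the leg to the third foot y.
    through : ∀ Z → IPath (x ∷ Z ++ y ∷ []) → (∀ {z} → z ∈ Z → z ∈ R) → (v ∷ T₂) ## Z → Z ## (T₁ ++ u ∷ []) → ⊥
    through Z pZ Z⊆ T₂Z ZT₁ = isk (tripod hole₀ (here refl) v∈ y∈ u≢v v≢y u≢y (direct xu) (direct xv)
      (pZ , off) (λ ()) (λ ()) (λ ()) tz)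
      where
      v∈ : v ∈ C₀
      v∈ = there (∈-mid A)
      y∈ : y ∈ C₀
      y∈ = there (∈-++⁺ʳ A (there (∈-mid T₂)))
      u≢v : u ≢ v
      u≢v refl = hole-∉ h (∈-mid A)
      v≢y : v ≢ y
      v≢y refl = y∉ (inT₂ (here refl))
      u≢y : u ≢ y
      u≢y refl = y∉ (here refl)
      off : ∀ {r z} → r ∈ Z → z ∈ C₀ → z ≢ y → N r z
      off i (here refl) _ = ZT₁ i (∈-mid T₁)
      off i (there j) ne with ∈-++⁻ A j
      ... | inj₁ k = N-sym (A## k (∈-++⁺ʳ T₂ (∈-++⁺ˡ (Z⊆ i))))
      ... | inj₂ (here refl) = N-sym (T₂Z (here refl) i)
      ... | inj₂ (there k) with ∈-++⁻ T₂ k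
      ...   | inj₁ l = N-sym (T₂Z (there l) i)
      ...   | inj₂ (here e) = ⊥-elim (ne e)
      ...   | inj₂ (there l) = ZT₁ i (∈-++⁺ˡ l)
      tz : ∀ {z} → z ∈ C₀ → z ≢ u → z ≢ v → z ≢ y → N x z
      tz i p q r = ∉⇒≢ x∉C₀ i , far i p q r
        where
        far : ∀ {z} → z ∈ C₀ → z ≢ u → z ≢ v → z ≢ y → ¬ E x z
        far (here e) p q r = λ _ → p e
        far (there i) p q r with ∈-++⁻ A i
        ... | inj₁ j = xA j
        ... | inj₂ (here e) = λ _ → q e
        ... | inj₂ (there j) = xQ j

    -- A vertex of R before the segment keeps it away from `v T₂`, and r after it keeps it away from
    -- `T₁ u`. Either orientation of the segment is accepted.
    through′ : ∀ {p} P Z {r R₂} → R ≡ P ++ Z ++ r ∷ R₂ → p ∈ P →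
      IPath (x ∷ Z ++ y ∷ []) ⊎ IPath (y ∷ Z ++ x ∷ []) → ⊥
    through′ P Z {r} {R₂} eq p∈ = [ (λ q → through Z q ⊆R T₂Z ZT₁) ,
        (λ q → through (reverse Z) (ip-rev′ Z q) (⊆R ∘ ∈-rev⁻ Z) (λ i j → T₂Z i (∈-rev⁻ Z j)) (##-rev Z ZT₁)) ]′
      where
      ⊆R : ∀ {z} → z ∈ Z → z ∈ R
      ⊆R i = subst (_ ∈_) (sym eq) (∈-++⁺ʳ P (∈-++⁺ˡ i))
      T₂Z : (v ∷ T₂) ## Z
      T₂Z i j with ∈-∃++ p∈
      ... | P₁ , P₂ , refl = after P₁ (trans eq (++-assoc P₁ (_ ∷ P₂) _)) i (∈-++⁺ˡ (∈-++⁺ʳ P₂ (∈-++⁺ˡ j)))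
      ZT₁ : Z ## (T₁ ++ u ∷ [])
      ZT₁ i j = before (P ++ Z) (trans eq (sym (++-assoc P Z (r ∷ R₂)))) (∈-++⁺ʳ P i) j

    capped : ∀ {p q t Z₂ Z′ w} → t ∷ Z₂ ≡ Z′ ++ w ∷ [] → IPath (t ∷ Z₂) → E p t → (p ∷ []) ## Z₂ →
      E w q → Z′ ## (q ∷ []) → N p q → IPath (p ∷ (t ∷ Z₂) ++ q ∷ [])
    capped {p} {q} {t} {Z₂} {Z′} {w} eq pZ pt pZ₂ wq Z′q npq =
      subst (λ K → IPath (p ∷ K ++ q ∷ [])) (sym eq)
        (ip-snoc (p ∷ Z′) (subst (λ K → IPath (p ∷ K)) eq (cons pt (pZ₂ (here refl)) pZ)) wq
          (##-∷ˡ (##-sing npq) Z′q))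

    ny : ∀ {z} → z ∈ R → ¬ E y z → N y z
    ny i ¬e = ∉⇒≢ y∉ (inR i) , ¬e

    nx : ∀ {z} → z ∈ R → ¬ E x z → N x z
    nx i ¬e = ∉⇒≢ x∉ (inR i) , ¬e

    -- From s on, take the first neighbour w of x and, up to it, the last neighbour t of y; the
    -- stretch from t to w joins the hubs inside R. It does not start R by `head-R`, and it does not
    -- end R because x has a second spoke there after w.
    caseY : ∀ R₀ {s} R₁ → R ≡ R₀ ++ s ∷ R₁ → None x R₀ → E y s → ⊥
    caseY [] R₁ eq _ ys = head-R eq ys
    caseY R₀@(r ∷ _) {s} R₁ eq xR₀ ys with cnt-first x (s ∷ R₁) (≤-trans (n≤1+n 1) two)
      where
      two : 2 ≤ cnt x (s ∷ R₁)
      two = subst (2 ≤_) (trans (cong (cnt x) eq) (trans (cnt-++ x R₀ (s ∷ R₁)) (cong (_+ cnt x (s ∷ R₁)) (cnt-none R₀ xR₀)))) cxR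
    ... | S₁ , w , [] , eqS , xw , xS₁ , c = absurd (subst (2 ≤_) (trans (sym (cnt-first-R)) c) cxR)
      where
      cnt-first-R : cnt x (s ∷ R₁) ≡ cnt x R
      cnt-first-R = sym (trans (cong (cnt x) eq) (trans (cnt-++ x R₀ (s ∷ R₁)) (cong (_+ cnt x (s ∷ R₁)) (cnt-none R₀ xR₀))))
      absurd : ¬ (2 ≤ 1)
      absurd (s≤s ())
    ... | S₁ , w , s₂ ∷ S₂ , eqS , xw , xS₁ , c with last-split (E? y) (S₁ ++ w ∷ [])
    ...   | inj₁ none = none (head∈ S₁ eqS) ys
      where
      head∈ : ∀ {s R₁} S₁ {w S₂} → s ∷ R₁ ≡ S₁ ++ w ∷ S₂ → s ∈ S₁ ++ w ∷ []
      head∈ [] refl = here refl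
      head∈ (_ ∷ _) refl = here refl
    ...   | inj₂ (Z₁ , t , Z₂ , eqZ , yt , yZ₂) with snoc-view t Z₂
    ...     | Z′ , w′ , eqt with ∷ʳ-injective S₁ (Z₁ ++ Z′) (trans eqZ
            (trans (cong (Z₁ ++_) eqt) (sym (++-assoc Z₁ Z′ (w′ ∷ [])))))
    ...       | refl , refl = through′ (R₀ ++ Z₁) (t ∷ Z₂) eqR (here refl)
                  (inj₂ (capped eqt (ip-l (t ∷ Z₂) (ip-r (R₀ ++ Z₁) (subst IPath eqR pR))) yt
                    (λ { (here refl) i → ny (inZ (there i)) (yZ₂ i) }) (E-sym xw)
                    (λ { i (here refl) → N-sym (nx (inZ (subst (_ ∈_) (sym eqt) (∈-++⁺ˡ i))) (xS₁ (∈-++⁺ʳ Z₁ i))) }) (N-sym nxy)))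
      where
      eqR : R ≡ (R₀ ++ Z₁) ++ (t ∷ Z₂) ++ s₂ ∷ S₂
      eqR = trans eq (trans (cong (R₀ ++_) (trans eqS (trans (sym (++-assoc (Z₁ ++ Z′) (w ∷ []) (s₂ ∷ S₂)))
              (trans (cong (_++ s₂ ∷ S₂) eqZ) (++-assoc Z₁ (t ∷ Z₂) (s₂ ∷ S₂)))))) (sym (++-assoc R₀ Z₁ _)))
      inZ : ∀ {z} → z ∈ t ∷ Z₂ → z ∈ R
      inZ i = subst (_ ∈_) (sym eqR) (∈-++⁺ʳ (R₀ ++ Z₁) (∈-++⁺ˡ i))

    hole₁ : IsHole (u ∷ x ∷ v ∷ Q)
    hole₁ = mkHole [] Q (edge (E-sym xu)) (edge xv) arcQ
      (λ { (here refl) j → ∉⇒≢ x∉C₀ (there (∈-++⁺ʳ A (there j))) , xQ j })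
      (s≤s (s≤s (s≤s (subst (1 ≤_) (sym (length-++ T₂)) (≤-trans (s≤s z≤n) (m≤n+m _ (length T₂)))))))

    C₁∋ : ∀ {z} → z ∈ u ∷ x ∷ v ∷ Q → z ∈ T₁ ++ u ∷ [] ⊎ z ≡ x ⊎ z ∈ v ∷ T₂ ⊎ z ≡ y
    C₁∋ (here refl) = inj₁ (∈-mid T₁)
    C₁∋ (there (here refl)) = inj₂ (inj₁ refl)
    C₁∋ (there (there (here refl))) = inj₂ (inj₂ (inj₁ (here refl)))
    C₁∋ (there (there (there i))) with ∈-++⁻ T₂ i
    ... | inj₁ j = inj₂ (inj₂ (inj₁ (there j)))
    ... | inj₂ (here refl) = inj₂ (inj₂ (inj₂ refl))
    ... | inj₂ (there j) = inj₁ (∈-++⁺ˡ j)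

    -- Centre s on the hole `u x v T₂ y T₁` through both hubs: one leg runs back along R₀ to b, x is
    -- a direct foot, and the stretch `S₁ t` leads on to y.
    crossing : ∀ R₀ {s} S₁ {t s₂} S₂ → R ≡ R₀ ++ s ∷ S₁ ++ t ∷ s₂ ∷ S₂ → None x R₀ → None y R₀ →
      E x s → ¬ E y s → None y S₁ → E y t → None x (S₁ ++ t ∷ []) → ⊥
    crossing R₀ {s} S₁ {t} {s₂} S₂ eq xR₀ yR₀ xs ¬ys yS₁ yt xS =
      isk (tripod hole₁ b∈ (there (here refl)) y∈ b≢x (proj₁ nxy) b≢y
        (ip-rev′ R₀ pb , offb) (direct (E-sym xs)) (py , offy) (λ _ ()) apart (λ ())
        λ i p q r → ts i p q r)
      where
      b∈T₂ : b ∈ v ∷ T₂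
      b∈T₂ = subst (b ∈_) (sym eq₂) (∈-mid T₀)
      b∈ : b ∈ u ∷ x ∷ v ∷ Q
      b∈ = there (there (∈-++⁺ˡ b∈T₂))
      y∈ : y ∈ u ∷ x ∷ v ∷ Q
      y∈ = there (there (there (∈-mid T₂)))
      b≢x : b ≢ x
      b≢x refl = x∉ (inT₂ b∈T₂)
      b≢y : b ≢ y
      b≢y refl = y∉ (inT₂ b∈T₂)
      Wb : IPath (T₀ ++ b ∷ R₀ ++ s ∷ (S₁ ++ t ∷ s₂ ∷ S₂) ++ T₁ ++ u ∷ [])
      Wb = subst IPath (cong (λ K → T₀ ++ b ∷ K) (trans (cong (_++ T₁ ++ u ∷ []) eq) (++-assoc R₀ _ (T₁ ++ u ∷ [])))) W₀
      pb : IPath (b ∷ R₀ ++ s ∷ [])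
      pb = ip-mid T₀ Wb
      pR′ : IPath (R₀ ++ s ∷ S₁ ++ t ∷ s₂ ∷ S₂)
      pR′ = subst IPath eq pR
      in₀ : ∀ {z} → z ∈ R₀ → z ∈ R
      in₀ i = subst (_ ∈_) (sym eq) (∈-++⁺ˡ i)
      inS : ∀ {z} → z ∈ s ∷ S₁ ++ t ∷ [] → z ∈ R
      inS {z} i = subst (z ∈_) (sym eq) (∈-++⁺ʳ R₀ (subst (z ∈_) (++-assoc (s ∷ S₁) (t ∷ []) (s₂ ∷ S₂)) (∈-++⁺ˡ i)))
      py : IPath (s ∷ (S₁ ++ t ∷ []) ++ y ∷ [])
      py = ip-snoc (s ∷ S₁) (ip-mid R₀ pR′) (E-sym yt)
        λ { (here refl) (here refl) → N-sym (ny (inS (here refl)) ¬ys)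
          ; (there i) (here refl) → N-sym (ny (inS (there (∈-++⁺ˡ i))) (yS₁ i)) }
      T₀-far : ∀ {z w} → z ∈ v ∷ T₂ → z ≢ b → w ∈ R₀ ++ s ∷ (S₁ ++ t ∷ s₂ ∷ S₂) ++ T₁ ++ u ∷ [] → N z w
      T₀-far i ne j with ∈-++⁻ T₀ (subst (_ ∈_) eq₂ i)
      ... | inj₁ k = ip-apart T₀ Wb k j
      ... | inj₂ (here e) = ⊥-elim (ne e)
      offb : ∀ {r z} → r ∈ reverse R₀ → z ∈ u ∷ x ∷ v ∷ Q → z ≢ b → N r z
      offb i′ j ne with ∈-rev⁻ R₀ i′ | C₁∋ j
      ... | i | inj₁ k = before R₀ eq i k
      ... | i | inj₂ (inj₁ refl) = N-sym (nx (in₀ i) (xR₀ i))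
      ... | i | inj₂ (inj₂ (inj₁ k)) = N-sym (T₀-far k ne (∈-++⁺ˡ i))
      ... | i | inj₂ (inj₂ (inj₂ refl)) = N-sym (ny (in₀ i) (yR₀ i))
      eq′ : R ≡ (R₀ ++ s ∷ S₁ ++ t ∷ []) ++ s₂ ∷ S₂
      eq′ = trans eq (trans (cong (λ K → R₀ ++ s ∷ K) (sym (++-assoc S₁ (t ∷ []) (s₂ ∷ S₂)))) (sym (++-assoc R₀ _ (s₂ ∷ S₂))))
      offy : ∀ {r z} → r ∈ S₁ ++ t ∷ [] → z ∈ u ∷ x ∷ v ∷ Q → z ≢ y → N r z
      offy i j ne with C₁∋ j
      ... | inj₁ k = before _ eq′ (∈-++⁺ʳ R₀ (there i)) k
      ... | inj₂ (inj₁ refl) = N-sym (nx (inS (there i)) (xS i))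
      ... | inj₂ (inj₂ (inj₁ k)) = N-sym (after R₀ eq k (∈-++⁺ˡ (subst (_ ∈_) (++-assoc S₁ (t ∷ []) (s₂ ∷ S₂)) (∈-++⁺ˡ i))))
      ... | inj₂ (inj₂ (inj₂ e)) = ⊥-elim (ne e)
      apart : reverse R₀ ## (S₁ ++ t ∷ [])
      apart i j = ip-apart R₀ pR′ (∈-rev⁻ R₀ i) (subst (_ ∈_) (++-assoc S₁ (t ∷ []) (s₂ ∷ S₂)) (∈-++⁺ˡ j))
      ts : ∀ {z} → z ∈ u ∷ x ∷ v ∷ Q → z ≢ b → z ≢ x → z ≢ y → N s z
      ts j p q r with C₁∋ j
      ... | inj₁ k = before _ eq′ (∈-++⁺ʳ R₀ (here refl)) k
      ... | inj₂ (inj₁ e) = ⊥-elim (q e)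
      ... | inj₂ (inj₂ (inj₁ k)) = N-sym (T₀-far k p (∈-mid R₀))
      ... | inj₂ (inj₂ (inj₂ e)) = ⊥-elim (r e)

    -- After s comes a first neighbour t of y, which is not the end of R by `last-R`. If x has
    -- another neighbour up to and including t, the last one starts a stretch for `through′`;
    -- otherwise `crossing` applies.
    caseX : ∀ R₀ {s} R₁ → R ≡ R₀ ++ s ∷ R₁ → None x R₀ → None y R₀ → E x s → ¬ E y s → ⊥
    caseX R₀ {s} R₁ eq xR₀ yR₀ xs ¬ys with cnt-first y R₁ one-left
      where
      one-left : 1 ≤ cnt y R₁
      one-left = subst (1 ≤_) (trans (cong (cnt y) eq) (trans (cnt-++ y R₀ (s ∷ R₁))
          (trans (cong (_+ cnt y (s ∷ R₁)) (cnt-none R₀ yR₀)) (cnt-no R₁ ¬ys)))) cy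
    ... | S₁ , t , [] , refl , yt , yS₁ , _ = last-R (R₀ ++ s ∷ S₁) (trans eq (sym (++-assoc R₀ (s ∷ S₁) (t ∷ [])))) yt
    ... | S₁ , t , s₂ ∷ S₂ , refl , yt , yS₁ , _ with last-split (E? x) (S₁ ++ t ∷ [])
    ...   | inj₁ none = crossing R₀ S₁ S₂ eq xR₀ yR₀ xs ¬ys yS₁ yt none
    ...   | inj₂ (Z₁ , w , Z₂ , eqZ , xw , xZ₂) with snoc-view w Z₂
    ...     | Z′ , t′ , eqt with ∷ʳ-injective S₁ (Z₁ ++ Z′) (trans eqZ
            (trans (cong (Z₁ ++_) eqt) (sym (++-assoc Z₁ Z′ (t′ ∷ [])))))
    ...       | refl , refl = through′ (R₀ ++ s ∷ Z₁) (w ∷ Z₂) eqR (∈-mid R₀)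
                  (inj₁ (capped eqt (ip-l (w ∷ Z₂) (ip-r (R₀ ++ s ∷ Z₁) (subst IPath eqR pR))) xw
                    (λ { (here refl) i → nx (inZ (there i)) (xZ₂ i) }) (E-sym yt)
                    (λ { i (here refl) → N-sym (ny (inZ (subst (_ ∈_) (sym eqt) (∈-++⁺ˡ i))) (yS₁ (∈-++⁺ʳ Z₁ i))) }) nxy))
      where
      eqR : R ≡ (R₀ ++ s ∷ Z₁) ++ (w ∷ Z₂) ++ s₂ ∷ S₂
      eqR = trans eq (trans (cong (λ K → R₀ ++ s ∷ K) (trans (sym (++-assoc (Z₁ ++ Z′) (t ∷ []) (s₂ ∷ S₂)))
              (trans (cong (_++ s₂ ∷ S₂) eqZ) (++-assoc Z₁ (w ∷ Z₂) (s₂ ∷ S₂))))) (sym (++-assoc R₀ (s ∷ Z₁) _)))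
      inZ : ∀ {z} → z ∈ w ∷ Z₂ → z ∈ R
      inZ i = subst (_ ∈_) (sym eqR) (∈-++⁺ʳ (R₀ ++ s ∷ Z₁) (∈-++⁺ˡ i))

    impossible : ⊥
    impossible with first-split (λ z → E? x z ⊎-dec E? y z) R
    ... | inj₁ none with subst (2 ≤_) (cnt-none R (λ i e → none i (inj₁ e))) cxR
    ...   | ()
    impossible | inj₂ (R₀ , s , R₁ , eq , lab , none) with E? y s
    ... | yes ys = caseY R₀ R₁ eq (λ i e → none i (inj₁ e)) ys
    ... | no ¬ys = caseX R₀ R₁ eq (λ i e → none i (inj₁ e)) (λ i e → none i (inj₂ e)) ([ (λ e → e) , ⊥-elim ∘ ¬ys ]′ lab) ¬ys

  record Rivals (L : List (V G)) (x y : V G) : Set where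
    field
      hubˣ  : ¬ (x ∈ L)
      hubʸ  : ¬ (y ∈ L)
      apart : N x y
      cntˣ  : 4 ≤ cnt x L
      cntʸ  : 4 ≤ cnt y L
      small : NoSmaller L

  open Rivals

  rivals-sym : ∀ {L x y} → Rivals L x y → Rivals L y x
  rivals-sym r = record { hubˣ = hubʸ r ; hubʸ = hubˣ r ; apart = N-sym (apart r) ; cntˣ = cntʸ r ; cntʸ = cntˣ r ; small = small
      r }

  cnt-around : ∀ {L y u} A {v B} → None y A → u ∷ A ++ v ∷ B ↭ L → cnt y (v ∷ B ++ u ∷ []) ≡ cnt y L
  cnt-around {L} {y} {u} A {v} {B} yA perm = sym (trans (sym (cnt-↭ y perm)) (trans (cnt-↭ y (↭-++-comm (u ∷ A) (v ∷ B)))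
    (trans (cnt-++ y (v ∷ B) (u ∷ A)) (trans (cong (λ k → cnt y (v ∷ B) + (_ + k)) (cnt-none A yA))
        (sym (cnt-++ y (v ∷ B) (u ∷ [])))))))

  -- The sector of y around u and v ends at its first neighbour b from v on and its last neighbour a
  -- up to u; b may be v and a may be u. Since y has four neighbours, at least one is left in R.
  consecutive : ∀ {L x y u} A {v} B → Rivals L x y → IsHole (u ∷ A ++ v ∷ B) → u ∷ A ++ v ∷ B ↭ L →
    E x u → E x v → None x A → None y A → ⊥
  consecutive {L} {x} {y} {u} A {v} B rv h perm xu xv xA yA with cnt-first y (v ∷ B ++ u ∷ [])
      (≤-trans (s≤s z≤n) (subst (4 ≤_) (sym (cnt-around A yA perm)) (cntʸ rv)))
  ... | W₁ , b , R′ , eqW , yb , yW₁ , c₁ with cnt-last y R′ (≤-pred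
          (≤-trans (s≤s (s≤s z≤n)) (subst (4 ≤_) (trans (sym (cnt-around A yA perm)) c₁) (cntʸ rv))))
  ... | R , a , W₂ , refl , ya , yW₂ , c₂ = go-on
    where
    c₄ : 4 ≤ cnt y (v ∷ B ++ u ∷ [])
    c₄ = subst (4 ≤_) (sym (cnt-around A yA perm)) (cntʸ rv)
    cR : 1 ≤ cnt y R
    cR = ≤-trans (s≤s z≤n) (≤-pred (≤-pred (subst (4 ≤_) (trans c₁ (cong suc c₂)) c₄)))
    split₂ : ∀ W₁ → v ∷ B ++ u ∷ [] ≡ W₁ ++ b ∷ R ++ a ∷ W₂ → ∃[ T₂ ] (v ∷ T₂ ≡ W₁ ++ b ∷ [] × B ++ u ∷ [] ≡ T₂ ++ R ++ a ∷ W₂)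
    split₂ [] eq with ∷-injective eq
    ... | refl , eq′ = [] , refl , eq′
    split₂ (w ∷ W) eq with ∷-injective eq
    ... | refl , eq′ = W ++ b ∷ [] , refl , trans eq′ (sym (++-assoc W (b ∷ []) _))
    go-on : ⊥
    go-on with split₂ W₁ eqW | snoc-view a W₂
    ... | T₂ , eq₂ , eqB | T₁ , u′ , eq₁ with ∷ʳ-injective B (T₂ ++ R ++ T₁) (trans eqB (trans (cong (λ K → T₂ ++ R ++ K) eq₁)
            (trans (cong (T₂ ++_) (sym (++-assoc R T₁ (u′ ∷ [])))) (sym (++-assoc T₂ (R ++ T₁) (u′ ∷ []))))))
    ... | refl , refl = Consecutive.impossible (shared-sector A T₂ R T₁ W₁ W₂ eq₂ (sym eq₁) h (hubˣ rv ∘ ∈-resp-↭ perm)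
            (hubʸ rv ∘ ∈-resp-↭ perm)
          (apart rv) xu xv xA yA yb yW₁ ya yW₂ cR (subst (4 ≤_) (sym (cnt-↭ x perm)) (cntˣ rv))
          (λ wh lt → small rv wh (subst (_ <_) (↭-length perm) lt)))

  -- This consequence of a shortest rim is what gets carried over to rerouted rims. Neighbours of
  -- the hub off the rim are exempt, as they belong to the cutset.
  Good : List (V G) → V G → Set
  Good L x = ∀ {z} → ¬ (z ∈ L) → z ≢ x → ¬ E z x → cnt z L ≤ 2

  -- Centre y on the hole `x₁ C₁ y₁ C₂ x₂ x`: y₁ is a direct foot, and y₀ and y₂ start legs along
  -- the rim to x₁ and x₂. The spoke x₃ lies between these legs and keeps them apart.
  alternating : ∀ {L x y x₁ y₁ x₂ y₂ x₃ x₀ y₀} C₁ C₂ D₁ D₂ B₃ F₁ F₂ → Rivals L x y →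
    IsHole (x₁ ∷ C₁ ++ y₁ ∷ C₂ ++ x₂ ∷ D₁ ++ y₂ ∷ D₂ ++ x₃ ∷ B₃ ++ x₀ ∷ F₁ ++ y₀ ∷ F₂) →
    x₁ ∷ C₁ ++ y₁ ∷ C₂ ++ x₂ ∷ D₁ ++ y₂ ∷ D₂ ++ x₃ ∷ B₃ ++ x₀ ∷ F₁ ++ y₀ ∷ F₂ ↭ L →
    E x x₁ → E x x₂ → E y y₁ → E y y₂ → E y y₀ → ¬ E y x₁ → ¬ E y x₂ →
    None x C₁ → None x C₂ → ¬ E x y₁ → None y C₁ → None y C₂ →
    None x D₁ → None y D₁ → ¬ E x y₂ → None x F₂ → None y F₂ → ¬ E x y₀ → ⊥
  alternating {L} {x} {y} {x₁} {y₁} {x₂} {y₂} {x₃} {x₀} {y₀} C₁ C₂ D₁ D₂ B₃ F₁ F₂ rv h perm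
      ex₁ ex₂ ey₁ ey₂ ey₀ ¬yx₁ ¬yx₂ xC₁ xC₂ ¬xy₁ yC₁ yC₂ xD₁ yD₁ ¬xy₂ xF₂ yF₂ ¬xy₀ =
    isk (tripod hole (there (∈-++⁺ˡ (∈-mid C₁))) (here refl) (there (∈-mid A)) y₁≢x₁ x₁≢x₂ y₁≢x₂
      (direct ey₁) (p₁ , off₁) (p₂ , off₂) (λ ()) (λ ()) R₁₂ ty)
    where
    big : List (V G)
    big = x₁ ∷ C₁ ++ y₁ ∷ C₂ ++ x₂ ∷ D₁ ++ y₂ ∷ D₂ ++ x₃ ∷ B₃ ++ x₀ ∷ F₁ ++ y₀ ∷ F₂
    A : List (V G)
    A = C₁ ++ y₁ ∷ C₂
    rest : List (V G)
    rest = D₁ ++ y₂ ∷ D₂ ++ x₃ ∷ B₃ ++ x₀ ∷ F₁ ++ y₀ ∷ F₂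
    eqA : big ≡ x₁ ∷ A ++ x₂ ∷ rest
    eqA = cong (x₁ ∷_) (sym (++-assoc C₁ (y₁ ∷ C₂) (x₂ ∷ rest)))
    hA : IsHole (x₁ ∷ A ++ x₂ ∷ rest)
    hA = subst IsHole eqA h
    inA : ∀ {z} → z ∈ A → z ∈ L
    inA {z} i = ∈-resp-↭ perm (subst (z ∈_) (sym eqA) (there (∈-++⁺ˡ i)))
    inRest : ∀ {z} → z ∈ x₂ ∷ rest → z ∈ L
    inRest {z} i = ∈-resp-↭ perm (subst (z ∈_) (sym eqA) (there (∈-++⁺ʳ A i)))
    xA : None x A
    xA i with ∈-++⁻ C₁ i
    ... | inj₁ j = xC₁ j
    ... | inj₂ (here refl) = ¬xy₁
    ... | inj₂ (there j) = xC₂ j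
    inF : ∀ {z} → z ∈ y₀ ∷ F₂ → z ∈ rest
    inF i = ∈-++⁺ʳ D₁ (there (∈-++⁺ʳ D₂ (there (∈-++⁺ʳ B₃ (there (∈-++⁺ʳ F₁ i))))))
    inD : ∀ {z} → z ∈ D₁ ++ y₂ ∷ [] → z ∈ rest
    inD i = [ ∈-++⁺ˡ , (λ { (here refl) → ∈-mid D₁ }) ]′ (∈-++⁻ D₁ i)
    nx : ∀ {z} → z ∈ L → ¬ E x z → N x z
    nx i ne = ∉⇒≢ (hubˣ rv) i , ne
    ny : ∀ {z} → z ∈ L → ¬ E y z → N y z
    ny i ne = ∉⇒≢ (hubʸ rv) i , ne
    x₁∈ : x₁ ∈ L
    x₁∈ = ∈-resp-↭ perm (here refl)
    hole : IsHole (x₁ ∷ A ++ x₂ ∷ x ∷ [])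
    hole = build A refl hA
      where
      build : ∀ A′ → A ≡ A′ → IsHole (x₁ ∷ A′ ++ x₂ ∷ rest) → IsHole (x₁ ∷ A′ ++ x₂ ∷ x ∷ [])
      build [] e h′ = ⊥-elim (tri ex₁ (hole-edge₀ h′) ex₂)
      build (z ∷ A′) e h′ = mkHole A′ (x ∷ []) (ip-l (x₁ ∷ z ∷ A′) (hole-arc (z ∷ A′) h′ (inF (here refl))))
        (ip-mid [] (hole-tail h′)) (cons (E-sym ex₂) (λ { (here refl) → N-sym x₁x₂ }) (edge ex₁))
        (λ { i (here refl) → N-sym (nx (inA (back i)) (xA (back i))) })
        (s≤s (s≤s (≤-trans (m≤n+m 2 (length A′)) (≤-reflexive (sym (length-++ A′))))))
        where
        back : ∀ {w} → w ∈ z ∷ A′ → w ∈ A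
        back {w} = subst (w ∈_) (sym e)
        x₁x₂ : N x₁ x₂
        x₁x₂ with hole-arc (z ∷ A′) h′ (inF (here refl))
        ... | cons _ far _ = far (∈-mid A′)
    y₁≢x₁ : y₁ ≢ x₁
    y₁≢x₁ refl = hole-∉ h (∈-mid C₁)
    y₁≢x₂ : y₁ ≢ x₂
    y₁≢x₂ refl = ¬yx₂ ey₁
    x₁≢x₂ : x₁ ≢ x₂
    x₁≢x₂ refl = hole-∉ hA (∈-mid A)
    hB : IsHole (x₂ ∷ rest ++ x₁ ∷ A)
    hB = rot (x₁ ∷ A) hA
    pRest : IPath (x₂ ∷ rest ++ x₁ ∷ [])
    pRest = hole-arc rest hB (∈-mid C₁)
    eqR : x₂ ∷ rest ++ x₁ ∷ [] ≡ (x₂ ∷ D₁ ++ y₂ ∷ D₂ ++ x₃ ∷ B₃ ++ x₀ ∷ F₁) ++ y₀ ∷ F₂ ++ x₁ ∷ []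
    eqR = cong (x₂ ∷_) (trans (++-assoc D₁ _ _) (trans (cong (λ K → D₁ ++ y₂ ∷ K)
        (trans (++-assoc D₂ _ _) (trans (cong (λ K → D₂ ++ x₃ ∷ K)
            (trans (++-assoc B₃ _ _) (trans (cong (λ K → B₃ ++ x₀ ∷ K) (++-assoc F₁ _ _)) (sym (++-assoc B₃ _ _)))))
                (sym (++-assoc D₂ _ _))))) (sym (++-assoc D₁ _ _))))
    pR : IPath ((x₂ ∷ D₁ ++ y₂ ∷ D₂ ++ x₃ ∷ B₃ ++ x₀ ∷ F₁) ++ y₀ ∷ F₂ ++ x₁ ∷ [])
    pR = subst IPath eqR pRest
    x₂F : (x₂ ∷ D₁ ++ y₂ ∷ []) ## (y₀ ∷ F₂ ++ x₁ ∷ [])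
    x₂F i j = ip-apart (x₂ ∷ D₁ ++ y₂ ∷ D₂) {x₃} {(B₃ ++ x₀ ∷ F₁) ++ y₀ ∷ F₂ ++ x₁ ∷ []}
      (subst IPath (cong (x₂ ∷_) (trans (cong (_++ y₀ ∷ F₂ ++ x₁ ∷ []) (sym (++-assoc D₁ (y₂ ∷ D₂) _)))
          (++-assoc (D₁ ++ y₂ ∷ D₂) _ _))) pR)
      ([ (λ { (here refl) → here refl ; (there k) → there (∈-++⁺ˡ k) }) , (λ { (here refl) → there (∈-mid D₁) }) ]′
          (∈-++⁻ (x₂ ∷ D₁) i))
      (∈-++⁺ʳ (B₃ ++ x₀ ∷ F₁) j)
    p₁ : IPath (y ∷ (y₀ ∷ F₂) ++ x₁ ∷ [])
    p₁ = cons ey₀ (λ i → [ (λ j → ny (inRest (there (inF (there j)))) (yF₂ j)) , (λ { (here refl) → ny x₁∈ ¬yx₁ }) ]′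
        (∈-++⁻ F₂ i))
      (ip-r (x₂ ∷ D₁ ++ y₂ ∷ D₂ ++ x₃ ∷ B₃ ++ x₀ ∷ F₁) pR)
    p₂ : IPath (y ∷ reverse (D₁ ++ y₂ ∷ []) ++ x₂ ∷ [])
    p₂ = ip-rev′ (D₁ ++ y₂ ∷ []) (ip-snoc (x₂ ∷ D₁) (ip-mid [] pRest′) (E-sym ey₂)
      λ { (here refl) (here refl) → N-sym (ny (inRest (here refl)) ¬yx₂)
        ; (there i) (here refl) → N-sym (ny (inRest (there (∈-++⁺ˡ i))) (yD₁ i)) })
      where
      pRest′ : IPath (x₂ ∷ D₁ ++ y₂ ∷ (D₂ ++ x₃ ∷ B₃ ++ x₀ ∷ F₁ ++ y₀ ∷ F₂) ++ x₁ ∷ [])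
      pRest′ = subst IPath (cong (x₂ ∷_) (++-assoc D₁ _ _)) pRest
    R₁₂ : (y₀ ∷ F₂) ## reverse (D₁ ++ y₂ ∷ [])
    R₁₂ i j = N-sym (x₂F (there (∈-rev⁻ (D₁ ++ y₂ ∷ []) j)) (∈-++⁺ˡ i))
    C∋ : ∀ {z} → z ∈ x₁ ∷ A ++ x₂ ∷ x ∷ [] → z ≡ x₁ ⊎ z ∈ A ⊎ z ≡ x₂ ⊎ z ≡ x
    C∋ (here e) = inj₁ e
    C∋ (there i) with ∈-++⁻ A i
    ... | inj₁ j = inj₂ (inj₁ j)
    ... | inj₂ (here e) = inj₂ (inj₂ (inj₁ e))
    ... | inj₂ (there (here e)) = inj₂ (inj₂ (inj₂ e))
    off₁ : ∀ {r z} → r ∈ y₀ ∷ F₂ → z ∈ x₁ ∷ A ++ x₂ ∷ x ∷ [] → z ≢ x₁ → N r z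
    off₁ i j ne with C∋ j
    ... | inj₁ e = ⊥-elim (ne e)
    ... | inj₂ (inj₁ k) = N-sym (hole-## A hA k (inF i))
    ... | inj₂ (inj₂ (inj₁ refl)) = N-sym (x₂F (here refl) (∈-++⁺ˡ i))
    ... | inj₂ (inj₂ (inj₂ refl)) = N-sym (nx (inRest (there (inF i))) (xyF i))
      where
      xyF : None x (y₀ ∷ F₂)
      xyF (here refl) = ¬xy₀
      xyF (there k) = xF₂ k
    off₂ : ∀ {r z} → r ∈ reverse (D₁ ++ y₂ ∷ []) → z ∈ x₁ ∷ A ++ x₂ ∷ x ∷ [] → z ≢ x₂ → N r z
    off₂ i′ j ne with ∈-rev⁻ (D₁ ++ y₂ ∷ []) i′ | C∋ j
    ... | i | inj₁ refl = x₂F (there i) (∈-++⁺ʳ (y₀ ∷ F₂) (here refl))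
    ... | i | inj₂ (inj₁ k) = N-sym (hole-## A hA k (inD i))
    ... | i | inj₂ (inj₂ (inj₁ e)) = ⊥-elim (ne e)
    ... | i | inj₂ (inj₂ (inj₂ refl)) = N-sym (nx (inRest (there (inD i))) ([ xD₁ , (λ { (here refl) → ¬xy₂ }) ]′ (∈-++⁻ D₁ i)))
    ty : ∀ {z} → z ∈ x₁ ∷ A ++ x₂ ∷ x ∷ [] → z ≢ y₁ → z ≢ x₁ → z ≢ x₂ → N y z
    ty j p q r with C∋ j
    ... | inj₁ e = ⊥-elim (q e)
    ... | inj₂ (inj₁ k) = ny (inA k) ([ yC₁ , (λ { (here e) → λ _ → p e ; (there l) → yC₂ l }) ]′ (∈-++⁻ C₁ k))
    ... | inj₂ (inj₂ (inj₁ e)) = ⊥-elim (r e)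
    ... | inj₂ (inj₂ (inj₂ refl)) = N-sym (apart rv)

  consecutive-at : ∀ {L K x y} P {u} A {v} B → Rivals L x y → IsHole K → K ↭ L → K ≡ P ++ u ∷ A ++ v ∷ B →
    E x u → E x v → None x A → None y A → ⊥
  consecutive-at P {u} A {v} B rv h perm refl = consecutive A (B ++ P) rv (subst IsHole eq (rot P h))
    (↭-trans (↭-reflexive (sym eq)) (↭-trans (↭-++-comm (u ∷ A ++ v ∷ B) P) perm))
    where
    eq : (u ∷ A ++ v ∷ B) ++ P ≡ u ∷ A ++ v ∷ B ++ P
    eq = cong (u ∷_) (++-assoc A (v ∷ B) P)

  -- Three successive spokes x₁, x₂, x₃ and the last spoke x₀ suffice. If y sees nothing inside one
  -- of the sectors x₁x₂, x₂x₃, x₀x₁, or sees two vertices of the closed sector from x₁ to x₂, then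
  -- `consecutive` applies to one hub or the other. Otherwise y has exactly one neighbour between x₁
  -- and x₂ and some in both adjacent sectors, the pattern of `alternating`.
  no-rivals′ : ∀ {L x y x₁} M → Rivals L x y → IsHole (x₁ ∷ M) → x₁ ∷ M ↭ L → E x x₁ → 3 ≤ cnt x M → ⊥
  no-rivals′ {L} {x} {y} {x₁} M rv h perm ex₁ c with cnt-first x M (≤-trans (s≤s z≤n) c)
  ... | A , x₂ , B , refl , ex₂ , xA , c₂ with cnt-first x B (≤-trans (s≤s z≤n) (≤-pred (subst (3 ≤_) c₂ c)))
  ... | A₂ , x₃ , B₂ , refl , ex₃ , xA₂ , c₃ with cnt-last x B₂ (≤-pred (≤-pred (subst (3 ≤_) (trans c₂ (cong suc c₃)) c)))
  ... | B₃ , x₀ , A₀ , refl , ex₀ , xA₀ , c₄ with first-split (E? y) A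
  ... | inj₁ yA = consecutive A _ rv h perm ex₁ ex₂ xA yA
  ... | inj₂ (C₁ , y₁ , C₂ , refl , ey₁ , yC₁) with E? y x₁ | first-split (E? y) C₂ | E? y x₂
  ... | yes yx₁ | _ | _ = consecutive-at [] C₁ _ (rivals-sym rv) h perm (cong (x₁ ∷_) (++-assoc C₁ (y₁ ∷ C₂) _)) yx₁ ey₁ yC₁
          (λ i → xA (∈-++⁺ˡ i))
  ... | no _ | inj₂ (C₃ , y₁′ , C₄ , refl , ey₁′ , yC₃) | _ =
        consecutive-at (x₁ ∷ C₁) C₃ _ (rivals-sym rv) h perm
          (cong (x₁ ∷_) (trans (++-assoc C₁ _ _) (cong (λ K → C₁ ++ y₁ ∷ K) (++-assoc C₃ _ _))))
          ey₁ ey₁′ yC₃ (λ i → xA (∈-++⁺ʳ C₁ (there (∈-++⁺ˡ i))))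
  ... | no _ | inj₁ yC₂ | yes yx₂ =
        consecutive-at (x₁ ∷ C₁) C₂ _ (rivals-sym rv) h perm (cong (x₁ ∷_) (++-assoc C₁ _ _)) ey₁ yx₂ yC₂
            (λ i → xA (∈-++⁺ʳ C₁ (there i)))
  ... | no ¬yx₁ | inj₁ yC₂ | no ¬yx₂ with first-split (E? y) A₂ | last-split (E? y) A₀
  ...   | inj₁ yA₂ | _ = consecutive-at (x₁ ∷ C₁ ++ y₁ ∷ C₂) A₂ _ rv h perm refl ex₂ ex₃ xA₂ yA₂
  ...   | inj₂ _ | inj₁ yA₀ =
          consecutive A₀ _ rv (rot (x₁ ∷ pre) h′) (↭-trans (↭-++-comm (x₀ ∷ A₀) (x₁ ∷ pre)) (↭-trans (↭-reflexive (sym eq)) perm))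
              ex₀ ex₁ xA₀ yA₀
    where
    pre : List (V G)
    pre = (C₁ ++ y₁ ∷ C₂) ++ x₂ ∷ A₂ ++ x₃ ∷ B₃
    eq : x₁ ∷ (C₁ ++ y₁ ∷ C₂) ++ x₂ ∷ A₂ ++ x₃ ∷ B₃ ++ x₀ ∷ A₀ ≡ (x₁ ∷ pre) ++ x₀ ∷ A₀
    eq = cong (x₁ ∷_) (trans (cong (λ K → (C₁ ++ y₁ ∷ C₂) ++ x₂ ∷ K) (sym (++-assoc A₂ _ _)))
        (sym (++-assoc (C₁ ++ y₁ ∷ C₂) _ _)))
    h′ : IsHole ((x₁ ∷ pre) ++ x₀ ∷ A₀)
    h′ = subst IsHole eq h
  ...   | inj₂ (D₁ , y₂ , D₂ , refl , ey₂ , yD₁) | inj₂ (F₁ , y₀ , F₂ , refl , ey₀ , yF₂) =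
          alternating C₁ C₂ D₁ D₂ B₃ F₁ F₂ rv (subst IsHole eq h) (↭-trans (↭-reflexive (sym eq)) perm) ex₁ ex₂ ey₁ ey₂ ey₀ ¬yx₁
              ¬yx₂
            (λ i → xA (∈-++⁺ˡ i)) (λ i → xA (∈-++⁺ʳ C₁ (there i))) (xA (∈-mid C₁)) yC₁ yC₂
            (λ i → xA₂ (∈-++⁺ˡ i)) yD₁ (xA₂ (∈-mid D₁)) (λ i → xA₀ (∈-++⁺ʳ F₁ (there i))) yF₂ (xA₀ (∈-mid F₁))
    where
    eq : x₁ ∷ (C₁ ++ y₁ ∷ C₂) ++ x₂ ∷ (D₁ ++ y₂ ∷ D₂) ++ x₃ ∷ B₃ ++ x₀ ∷ F₁ ++ y₀ ∷ F₂ ≡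
         x₁ ∷ C₁ ++ y₁ ∷ C₂ ++ x₂ ∷ D₁ ++ y₂ ∷ D₂ ++ x₃ ∷ B₃ ++ x₀ ∷ F₁ ++ y₀ ∷ F₂
    eq = cong (x₁ ∷_) (trans (++-assoc C₁ _ _) (cong (λ K → C₁ ++ y₁ ∷ C₂ ++ x₂ ∷ K) (++-assoc D₁ _ _)))

  no-rivals : ∀ {L x y} → IsHole L → Rivals L x y → ⊥
  no-rivals {L} {x} h rv with cnt-first x L (≤-trans (s≤s z≤n) (cntˣ rv))
  ... | X , x₁ , Y , refl , ex₁ , _ , _ = no-rivals′ (Y ++ X) rv (rot X h) (↭-++-comm (x₁ ∷ Y) X) ex₁
    (≤-pred (subst (4 ≤_) (trans (cnt-↭ x (↭-++-comm X (x₁ ∷ Y))) (cnt-yes (Y ++ X) ex₁)) (cntˣ rv)))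

  smallest⇒good : ∀ {L x} → Wheel L x → NoSmaller L → Good L x
  smallest⇒good {L} {x} w small {y} y∉ y≢x ¬yx with cnt y L ≤? 2
  ... | yes p = p
  ... | no ¬p = ⊥-elim (no-rivals (rim w) record
    { hubˣ = hub∉ w ; hubʸ = y∉ ; apart = y≢x ∘ sym , ¬yx ∘ E-sym
    ; cntˣ = wheel-4 w ; cntʸ = wheel-4 (mkWheel (rim w) y∉ (≰⇒> ¬p)) ; small = small })

-- Outside paths attached to a good wheel with fewest spokes.

module GoodWheels (G : Graph) (tri : Paths.TriangleFree G) (isk : ¬ ContainsISK4 G) where
  open Paths G
  open Detect G
  open Wheels G tri isk
  open IsHole
  open Wheel

  three-cnt : ∀ {z a b c K} → a ≢ b → b ≢ c → a ≢ c → a ∈ K → b ∈ K → c ∈ K → E z a → E z b → E z c → 3 ≤ cnt z K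
  three-cnt {z} {a} {b} {c} {K} a≢b b≢c a≢c a∈ b∈ c∈ za zb zc with drop a∈
    where
    drop : ∀ {a K} → a ∈ K → ∃[ K′ ] (K ↭ a ∷ K′)
    drop {a} i with ∈-∃++ i
    ... | X , Y , refl = Y ++ X , ↭-++-comm X (a ∷ Y)
  ... | K₁ , p₁ with drop′ (∈-resp-↭ p₁ b∈) (a≢b ∘ sym)
    where
    drop′ : ∀ {a b K} → b ∈ a ∷ K → b ≢ a → ∃[ K′ ] (K ↭ b ∷ K′)
    drop′ (here e) ne = ⊥-elim (ne e)
    drop′ {b = b} (there i) ne with ∈-∃++ i
    ... | X , Y , refl = Y ++ X , ↭-++-comm X (b ∷ Y)
  ... | K₂ , p₂ = ≤-trans (s≤s (s≤s (cnt-∈ K₂ c∈₂ zc)))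
      (≤-reflexive (sym (trans (cnt-↭ z p₁) (trans (cnt-yes K₁ za) (cong suc (trans (cnt-↭ z p₂) (cnt-yes K₂ zb)))))))
    where
    c∈₂ : c ∈ K₂
    c∈₂ with ∈-resp-↭ p₁ c∈
    ... | here e = ⊥-elim (a≢c (sym e))
    ... | there i with ∈-resp-↭ p₂ i
    ...   | here e = ⊥-elim (b≢c (sym e))
    ...   | there j = j

  -- Centre p: its two neighbours are direct feet, and M followed by q is the leg to c.
  fork : ∀ {K p q a b c} M → IsHole K → IPath (p ∷ M ++ q ∷ []) → ¬ (p ∈ K) → ¬ (q ∈ K) → M ## K →
    a ∈ K → b ∈ K → c ∈ K → a ≢ b → b ≢ c → a ≢ c → E p a → E p b → E q c →
    (∀ {z} → z ∈ K → E p z → z ≡ a ⊎ z ≡ b) → (∀ {z} → z ∈ K → E q z → z ≡ c) → ⊥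
  fork {K} {p} {q} {a} {b} {c} M h pM p∉ q∉ MK a∈ b∈ c∈ a≢b b≢c a≢c pa pb qc only-p only-q =
    isk (tripod h a∈ b∈ c∈ a≢b b≢c a≢c (direct pa) (direct pb) (leg , off) (λ ()) (λ ()) (λ ())
      λ {z} i na nb _ → ∉⇒≢ p∉ i , λ e → [ na , nb ]′ (only-p i e))
    where
    leg : IPath (p ∷ (M ++ q ∷ []) ++ c ∷ [])
    leg = ip-snoc (p ∷ M) pM qc (##-∷ˡ (##-sing (∉⇒≢ p∉ c∈ , λ e → [ a≢c ∘ sym , b≢c ∘ sym ]′ (only-p c∈ e)))
      λ { i (here refl) → MK i c∈ })
    off : ∀ {r z} → r ∈ M ++ q ∷ [] → z ∈ K → z ≢ c → N r z
    off i j ne = [ (λ k → MK k j) , (λ { (here refl) → ∉⇒≢ q∉ j , λ e → ne (only-q j e) }) ]′ (∈-++⁻ M i)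

  -- The arc `g D u` closes through p to a hole, with centre q, direct feet c and d, and M leading
  -- to p. An empty C or D would make a triangle at p.
  double-fork : ∀ {p q u g c d} M C D → IsHole (u ∷ C ++ g ∷ D) → IPath (p ∷ M ++ q ∷ []) →
    ¬ (p ∈ u ∷ C ++ g ∷ D) → ¬ (q ∈ u ∷ C ++ g ∷ D) → M ## (g ∷ D ++ u ∷ []) →
    E p u → E p g → (∀ {z} → z ∈ D → ¬ E p z) → c ∈ g ∷ D ++ u ∷ [] → d ∈ g ∷ D ++ u ∷ [] → c ≢ d → E q c → E q d →
    (∀ {z} → z ∈ g ∷ D ++ u ∷ [] → E q z → z ≡ c ⊎ z ≡ d) → ⊥
  double-fork M [] D h _ _ _ _ pu pg _ _ _ _ _ _ _ = tri pu (hole-edge₀ h) pg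
  double-fork {u = u} {g} M C@(_ ∷ _) [] h _ _ _ _ pu pg _ _ _ _ _ _ _ = tri pg (hole-edge₀ (rot (u ∷ C) h)) pu
  double-fork {p} {q} {u} {g} {c} {d} M C@(z₀ ∷ _) D@(d₀ ∷ D′) h pM p∉ q∉ MK pu pg pD c∈ d∈ c≢d qc qd only =
    isk (tripod hole (up c∈) (up d∈) p∈ c≢d (≢p d∈) (≢p c∈) (direct qc) (direct qd) (ip-rev′ M pM , off) (λ ()) (λ ()) (λ ()) tq)
    where
    J : List (V G)
    J = g ∷ D ++ u ∷ []
    arc : IPath J
    arc = hole-arc D (rot (u ∷ C) h) (here refl)
    ⊆K : ∀ {z} → z ∈ J → z ∈ u ∷ C ++ g ∷ D
    ⊆K i = [ (λ j → ∈-++⁺ʳ (u ∷ C) j) , (λ { (here refl) → here refl }) ]′ (∈-++⁻ (g ∷ D) i)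
    gu : N g u
    gu with arc
    ... | cons _ far _ = far (∈-mid D′)
    hole : IsHole (g ∷ D ++ u ∷ p ∷ [])
    hole = mkHole D′ (p ∷ []) (ip-l (g ∷ D) arc) (ip-r (g ∷ []) arc) (cons (E-sym pu) (λ { (here refl) → N-sym gu }) (edge pg))
      (λ { i (here refl) → N-sym (∉⇒≢ p∉ (⊆K (there (∈-++⁺ˡ i))) , pD i) })
      (s≤s (s≤s (≤-trans (m≤n+m 2 (length D′)) (≤-reflexive (sym (length-++ D′))))))
    up : ∀ {z} → z ∈ J → z ∈ g ∷ D ++ u ∷ p ∷ []
    up i = [ ∈-++⁺ˡ , (λ { (here refl) → ∈-mid (g ∷ D) }) ]′ (∈-++⁻ (g ∷ D) i)
    down : ∀ {z} → z ∈ g ∷ D ++ u ∷ p ∷ [] → z ∈ J ⊎ z ≡ p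
    down i with ∈-++⁻ (g ∷ D) i
    ... | inj₁ j = inj₁ (∈-++⁺ˡ j)
    ... | inj₂ (here refl) = inj₁ (∈-mid (g ∷ D))
    ... | inj₂ (there (here e)) = inj₂ e
    p∈ : p ∈ g ∷ D ++ u ∷ p ∷ []
    p∈ = ∈-++⁺ʳ (g ∷ D) (there (here refl))
    ≢p : ∀ {z} → z ∈ J → z ≢ p
    ≢p i refl = p∉ (⊆K i)
    off : ∀ {r z} → r ∈ reverse M → z ∈ g ∷ D ++ u ∷ p ∷ [] → z ≢ p → N r z
    off i j ne with down j
    ... | inj₁ k = MK (∈-rev⁻ M i) k
    ... | inj₂ e = ⊥-elim (ne e)
    tq : ∀ {z} → z ∈ g ∷ D ++ u ∷ p ∷ [] → z ≢ c → z ≢ d → z ≢ p → N q z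
    tq j nc nd np with down j
    ... | inj₁ k = ∉⇒≢ q∉ (⊆K k) , λ e → [ nc , nd ]′ (only k e)
    ... | inj₂ e = ⊥-elim (np e)

  Free : List (V G) → V G → V G → Set
  Free L x z = ¬ (z ∈ L) × z ≢ x × ¬ E z x

  module Rings (L : List (V G)) (x : V G) where

    record Ring (u : V G) (A : List (V G)) (v : V G) (B : List (V G)) : Set where
      constructor ring
      field
        hole : IsHole (u ∷ A ++ v ∷ B)
        perm : u ∷ A ++ v ∷ B ↭ L
        cntᴬ : 1 ≤ cnt x A
        cntᴮ : 1 ≤ cnt x B

    open Ring

    -- u and v lie in no common sector of the wheel (L , x).
    Sep : V G → V G → Set
    Sep u v = ∃[ A ] ∃[ B ] Ring u A v B

    turn : ∀ {u A v B} → Ring u A v B → Ring v B u A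
    turn {u} {A} {v} {B} (ring h p a b) = ring (rot (u ∷ A) h) (↭-trans (↭-++-comm (v ∷ B) (u ∷ A)) p) b a

    cnt-rev : ∀ z A → cnt z (reverse A) ≡ cnt z A
    cnt-rev z A = cnt-↭ z (↭-reverse A)

    flip : ∀ {u A v B} → Ring u A v B → Ring u (reverse B) v (reverse A)
    flip {u} {A} {v} {B} (ring h p a b) = ring
      (rot (reverse B ++ v ∷ reverse A) (subst IsHole eq (hole-rev h)))
      (↭-trans (↭-++-comm (u ∷ []) (reverse B ++ v ∷ reverse A)) (↭-trans (↭-reflexive (sym eq))
          (↭-trans (↭-reverse (u ∷ A ++ v ∷ B)) p)))
      (subst (1 ≤_) (sym (cnt-rev x B)) b) (subst (1 ≤_) (sym (cnt-rev x A)) a)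
      where
      eq : reverse (u ∷ A ++ v ∷ B) ≡ (reverse B ++ v ∷ reverse A) ++ u ∷ []
      eq = trans (reverse-mid (u ∷ A)) (trans (cong (λ K → reverse B ++ v ∷ K) (unfold-reverse u A))
          (sym (++-assoc (reverse B) (v ∷ reverse A) (u ∷ []))))

    mirror : ∀ {u A v B} → Ring u A v B → Ring v (reverse A) u (reverse B)
    mirror r = flip (turn r)

    cnt-ring : ∀ {u A v B} z → Ring u A v B → cnt z L ≡ b2n (adj G z u) + (cnt z A + (b2n (adj G z v) + cnt z B))
    cnt-ring {u} {A} {v} {B} z r = trans (sym (cnt-↭ z (perm r))) (cong (b2n (adj G z u) +_) (cnt-++ z A (v ∷ B)))

    inᵘ : ∀ {u A v B} → Ring u A v B → u ∈ L
    inᵘ r = ∈-resp-↭ (perm r) (here refl)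
    inᵛ : ∀ {u A v B} → Ring u A v B → v ∈ L
    inᵛ {A = A} r = ∈-resp-↭ (perm r) (there (∈-mid A))
    inᴬ : ∀ {u A v B z} → Ring u A v B → z ∈ A → z ∈ L
    inᴬ r i = ∈-resp-↭ (perm r) (there (∈-++⁺ˡ i))
    inᴮ : ∀ {u A v B z} → Ring u A v B → z ∈ B → z ∈ L
    inᴮ {A = A} r i = ∈-resp-↭ (perm r) (there (∈-++⁺ʳ A (there i)))

    cnt-≤ˡ : ∀ z A {B} → cnt z A ≤ cnt z (A ++ B)
    cnt-≤ˡ z A {B} = ≤-trans (m≤m+n _ _) (≤-reflexive (sym (cnt-++ z A B)))
    cnt-≤ʳ : ∀ z A {B} → cnt z B ≤ cnt z (A ++ B)
    cnt-≤ʳ z A {B} = ≤-trans (m≤n+m _ (cnt z A)) (≤-reflexive (sym (cnt-++ z A B)))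

    ring-left : ∀ {u v B} C {g} D → Ring u (C ++ g ∷ D) v B → 1 ≤ cnt x C → Ring u C g (D ++ v ∷ B)
    ring-left {u} {v} {B} C {g} D (ring h p a b) c = ring (subst IsHole eq h) (↭-trans (↭-reflexive (sym eq)) p) c
      (≤-trans b (≤-trans (m≤n+m _ (b2n (adj G x v))) (cnt-≤ʳ x D)))
      where
      eq : u ∷ (C ++ g ∷ D) ++ v ∷ B ≡ u ∷ C ++ g ∷ D ++ v ∷ B
      eq = cong (u ∷_) (++-assoc C (g ∷ D) (v ∷ B))

    spin : ∀ {u v B} C {g} D → Ring u (C ++ g ∷ D) v B → IsHole (g ∷ D ++ v ∷ B ++ u ∷ C) × g ∷ D ++ v ∷ B ++ u ∷ C ↭ L
    spin {u} {v} {B} C {g} D (ring h p a b) = subst IsHole eq₂ (rot (u ∷ C) (subst IsHole eq₁ h)) ,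
      ↭-trans (↭-reflexive (sym eq₂)) (↭-trans (↭-++-comm (g ∷ D ++ v ∷ B) (u ∷ C)) (↭-trans (↭-reflexive (sym eq₁)) p))
      where
      eq₁ : u ∷ (C ++ g ∷ D) ++ v ∷ B ≡ (u ∷ C) ++ g ∷ D ++ v ∷ B
      eq₁ = cong (u ∷_) (++-assoc C (g ∷ D) (v ∷ B))
      eq₂ : (g ∷ D ++ v ∷ B) ++ u ∷ C ≡ g ∷ D ++ v ∷ B ++ u ∷ C
      eq₂ = cong (g ∷_) (++-assoc D (v ∷ B) (u ∷ C))

    ring-right : ∀ {u v B} C {g} D → Ring u (C ++ g ∷ D) v B → 1 ≤ cnt x D → Ring g D v (B ++ u ∷ C)
    ring-right {B = B} C D r c = ring (proj₁ (spin C D r)) (proj₂ (spin C D r)) c (≤-trans (cntᴮ r) (cnt-≤ˡ x B))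

  len-mid : ∀ (X : List (V G)) {a} Y {b} Z → length (X ++ a ∷ []) < length (X ++ a ∷ Y ++ b ∷ Z)
  len-mid X Y {b} Z = length-++-< X (s≤s (≤-trans (s≤s z≤n) (≤-trans (m≤n+m _ (length Y)) (≤-reflexive (sym (length-++ Y))))))

  len-end : ∀ (X : List (V G)) {a} Y Z → length Z < length (X ++ a ∷ Y ++ Z)
  len-end X Y Z = ≤-trans (s≤s (≤-trans (m≤n+m _ (length Y)) (≤-reflexive (sym (length-++ Y)))))
      (≤-trans (m≤n+m _ (length X)) (≤-reflexive (sym (length-++ X))))

  private
    ≥2 : ∀ c {r} → 4 ≤ c + r → r ≤ 2 → 2 ≤ c
    ≥2 zero p q with ≤-trans p q
    ... | s≤s (s≤s ())
    ≥2 (suc zero) (s≤s p) q with ≤-trans p q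
    ... | s≤s (s≤s ())
    ≥2 (suc (suc c)) p q = s≤s (s≤s z≤n)

    bring : ∀ a c r → a + (c + r) ≡ c + (a + r)
    bring a c r = trans (sym (+-assoc a c r)) (trans (cong (_+ r) (+-comm a c)) (+-assoc c a r))

    -- Here a and b tell whether the hub sees the two ends, and c and d count the spokes inside the
    -- two arcs. Replacing either arc leaves at most two spokes although the wheel has at least
    -- four, which forces two in each arc and none at the ends.
    balance : ∀ a c b d → 4 ≤ a + (c + (b + d)) → a + (b + d) ≤ 2 → a + (b + c) ≤ 2 → a ≡ 0 × c ≡ 2 × b ≡ 0 × d ≡ 2
    balance zero zero zero d p q _ with ≤-trans p q
    ... | s≤s (s≤s ())
    balance zero (suc zero) zero d (s≤s p) q _ with ≤-trans p q
    ... | s≤s (s≤s ())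
    balance zero (suc (suc zero)) zero (suc (suc zero)) p q r = refl , refl , refl , refl
    balance zero (suc (suc zero)) zero zero (s≤s (s≤s ())) q r
    balance zero (suc (suc zero)) zero (suc zero) (s≤s (s≤s (s≤s ()))) q r
    balance zero (suc (suc zero)) zero (suc (suc (suc d))) p (s≤s (s≤s ())) r
    balance zero (suc (suc (suc c))) zero d p q (s≤s (s≤s ()))
    balance zero c (suc b) d p (s≤s q) (s≤s r) = ⊥-elim (absurd (≤-trans (subst (4 ≤_) (bring c 1 (b + d)) p)
        (s≤s (+-mono-≤ (≤-trans (m≤n+m c b) r) q))))
      where
      absurd : ¬ (4 ≤ 3)
      absurd (s≤s (s≤s (s≤s ())))
    balance (suc a) c b d (s≤s p) (s≤s q) (s≤s r) = ⊥-elim (absurd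
        (≤-trans (subst (3 ≤_) (bring a c (b + d)) p) (+-mono-≤ (≤-trans (m≤n+m c b) (≤-trans (m≤n+m (b + c) a) r)) q)))
      where
      absurd : ¬ (3 ≤ 2)
      absurd (s≤s (s≤s ()))

  module Violations {L : List (V G)} {x : V G} (w : Wheel L x) (good : Good L x)
    (fewer : ∀ {L′} → Wheel L′ x → Good L′ x → cnt x L′ < cnt x L → ⊥) where
    open Rings L x public
    open Ring

    Short : ℕ → Set
    Short k = ∀ {p q u v l} → Walk (Free L x) p l q → E p u → E q v → Sep u v → length l < k → ⊥

    module Reroute {u A v B p q} P (r : Ring u A v B) (wk : Walk (Free L x) p (p ∷ P) q) (pu : E p u) (qv : E q v)
      (uP : IPath (u ∷ p ∷ P)) (Pv : IPath (p ∷ P ++ v ∷ [])) (PB : (p ∷ P) ## B) (short : Short (length (p ∷ P))) where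

      P₀ H′ : List (V G)
      P₀ = p ∷ P
      H′ = u ∷ P₀ ++ v ∷ B

      arc : IPath (v ∷ B ++ u ∷ [])
      arc = hole-arc B (rot (u ∷ A) (hole r)) (proj₁ (proj₂ (cnt-mem A (cntᴬ r))))

      hole′ : IsHole H′
      hole′ = mkHole P B uP Pv arc PB (s≤s (s≤s (≤-trans (s≤s (1≤len (proj₁ (proj₂ (cnt-mem B (cntᴮ r))))))
          (≤-trans (m≤n+m _ (length P)) (≤-reflexive (sym (length-++ P)))))))
        where
        1≤len : ∀ {z : V G} {B} → z ∈ B → 1 ≤ length B
        1≤len (here _) = s≤s z≤n
        1≤len (there _) = s≤s z≤n

      free : ∀ {z} → z ∈ P₀ → Free L x z
      free = walk-all wk

      H′∋ : ∀ {z} → z ∈ H′ → z ∈ P₀ ⊎ z ∈ L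
      H′∋ (here refl) = inj₂ (inᵘ r)
      H′∋ (there i) with ∈-++⁻ P₀ i
      ... | inj₁ j = inj₁ j
      ... | inj₂ (here refl) = inj₂ (inᵛ r)
      ... | inj₂ (there j) = inj₂ (inᴮ r j)

      cntH : ∀ z → cnt z H′ ≡ cnt z P₀ + cnt z (u ∷ v ∷ B)
      cntH z = trans (cong (b2n (adj G z u) +_) (cnt-++ z P₀ (v ∷ B))) (bring (b2n (adj G z u)) (cnt z P₀) (cnt z (v ∷ B)))

      cntL : ∀ z → cnt z L ≡ cnt z A + cnt z (u ∷ v ∷ B)
      cntL z = trans (cnt-ring z r) (bring (b2n (adj G z u)) (cnt z A) (cnt z (v ∷ B)))

      cntxH : cnt x H′ ≡ cnt x (u ∷ v ∷ B)
      cntxH = trans (cntH x) (cong (_+ cnt x (u ∷ v ∷ B)) (cnt-none P₀ (λ i e → proj₂ (proj₂ (free i)) (E-sym e))))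

      module Extra {z} (z∉ : ¬ (z ∈ H′)) (z≢x : z ≢ x) (¬zx : ¬ E z x) (four : 4 ≤ cnt z H′) where

        rest≤ : cnt z L ≤ 2 → cnt z (u ∷ v ∷ B) ≤ 2
        rest≤ = ≤-trans (≤-trans (m≤n+m _ (cnt z A)) (≤-reflexive (sym (cntL z))))

        two : cnt z L ≤ 2 → 2 ≤ cnt z P₀
        two c = ≥2 (cnt z P₀) (subst (4 ≤_) (cntH z) four) (rest≤ c)

        -- The arc A has a spoke on one side of z. On the side of u, the part of P up to a is a
        -- shorter path from u to z with separated ends; on the side of v, the part from b on is one
        -- from z to v.
        on-A : z ∈ A → ∀ X {a} Mid {b} Z → P₀ ≡ X ++ a ∷ Mid ++ b ∷ Z → E z a → E z b → ⊥
        on-A i X {a} Mid {b} Z eq za zb with ∈-∃++ i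
        ... | C , D , refl with cnt-mem (C ++ z ∷ D) (cntᴬ r)
        ...   | y , y∈ , xy with ∈-++⁻ C y∈
        ...     | inj₁ j = short (walk-l X (subst (λ K → Walk (Free L x) p K q) eq wk)) pu (E-sym za)
                    (_ , _ , ring-left C D r (cnt-∈ C j xy)) (subst (length (X ++ a ∷ []) <_) (sym (cong length eq))
                        (len-mid X Mid Z))
        ...     | inj₂ (here refl) = ¬zx (E-sym xy)
        ...     | inj₂ (there j) = short (walk-r (X ++ a ∷ Mid) (subst (λ K → Walk (Free L x) p K q)
                (trans eq (sym (++-assoc X (a ∷ Mid) (b ∷ Z)))) wk))
                    (E-sym zb) qv (_ , _ , ring-right C D r (cnt-∈ D j xy))
                        (subst (length (b ∷ Z) <_) (sym (cong length eq)) (len-end X Mid (b ∷ Z)))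

        -- With two or more vertices between a and b the detour through z shortens P; with none
        -- there is a triangle. With exactly one, z misses it, so z has two neighbours among u, v
        -- and B; then z is itself attached to the rim, and a walk ending or starting at z is a
        -- shorter violation.
        off-L : ¬ (z ∈ L) → ∀ X {a} Mid {b} Z → P₀ ≡ X ++ a ∷ Mid ++ b ∷ Z → E z a → E z b → cnt z P₀ ≡ 2 + cnt z Mid → ⊥
        off-L z∉L X {a} Mid {b} Z eq za zb cP = middle Mid eq cP
          where
          fz : Free L x z
          fz = z∉L , z≢x , ¬zx
          fromz : Walk (Free L x) z (z ∷ b ∷ Z) q
          fromz = go fz zb (walk-r (X ++ a ∷ Mid) (subst (λ K → Walk (Free L x) p K q)
              (trans eq (sym (++-assoc X (a ∷ Mid) (b ∷ Z)))) wk))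
          toz : Walk (Free L x) p ((X ++ a ∷ []) ++ z ∷ []) z
          toz = walk-++ (walk-l X (subst (λ K → Walk (Free L x) p K q) eq wk)) (E-sym za) (stop fz)
          jump : Walk (Free L x) p ((X ++ a ∷ []) ++ z ∷ b ∷ Z) q
          jump = walk-++ (walk-l X (subst (λ K → Walk (Free L x) p K q) eq wk)) (E-sym za) fromz
          ends : ∀ Mid → P₀ ≡ X ++ a ∷ Mid ++ b ∷ Z → 1 ≤ length Mid → 2 ≤ cnt z (u ∷ v ∷ B) → ⊥
          ends Mid eq l c₂ with E? z u | E? z v
          ... | yes zu | _ = short fromz zu qv (_ , _ , r) (subst (length (z ∷ b ∷ Z) <_) (sym (cong length eq))
                 (≤-trans (s≤s (≤-trans (+-monoˡ-≤ (suc (length Z)) l) (≤-reflexive (sym (length-++ Mid)))))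
                     (≤-trans (m≤n+m _ (length X)) (≤-reflexive (sym (length-++ X))))))
          ... | no _ | yes zv = short toz pu zv (_ , _ , r) (subst (length ((X ++ a ∷ []) ++ z ∷ []) <_) (sym (cong length eq))
                 (subst (λ K → length K < length (X ++ a ∷ Mid ++ b ∷ Z)) (sym (++-assoc X (a ∷ []) (z ∷ [])))
                   (length-++-< X (s≤s (≤-trans (s≤s (s≤s z≤n)) (≤-trans (+-mono-≤ l (s≤s z≤n))
                       (≤-reflexive (sym (length-++ Mid {b ∷ Z})))))))))
          ... | no ¬zu | no ¬zv = clash
            where
            cB : 2 ≤ cnt z B
            cB = subst (2 ≤_) (trans (cnt-no (v ∷ B) ¬zu) (cnt-no B ¬zv)) c₂
            clear : ∀ C {g} D → B ≡ C ++ g ∷ D → E z g → None x C × None x D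
            clear C {g} D refl zg =
              (λ i e → short fromz zg qv (_ , _ , turn (ring-left C D (turn r) (cnt-∈ C i e))) lt₁) ,
              (λ i e → short toz pu zg (_ , _ , turn (ring-right C D (turn r) (cnt-∈ D i e))) lt₂)
              where
              lt₁ : length (z ∷ b ∷ Z) < length P₀
              lt₁ = subst (length (z ∷ b ∷ Z) <_) (sym (cong length eq))
                 (≤-trans (s≤s (≤-trans (+-monoˡ-≤ (suc (length Z)) l) (≤-reflexive (sym (length-++ Mid)))))
                     (≤-trans (m≤n+m _ (length X)) (≤-reflexive (sym (length-++ X)))))
              lt₂ : length ((X ++ a ∷ []) ++ z ∷ []) < length P₀
              lt₂ = subst (length ((X ++ a ∷ []) ++ z ∷ []) <_) (sym (cong length eq))
                 (subst (λ K → length K < length (X ++ a ∷ Mid ++ b ∷ Z)) (sym (++-assoc X (a ∷ []) (z ∷ [])))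
                   (length-++-< X (s≤s (≤-trans (s≤s (s≤s z≤n)) (≤-trans (+-mono-≤ l (s≤s z≤n))
                       (≤-reflexive (sym (length-++ Mid {b ∷ Z}))))))))
            clash : ⊥
            clash with cnt-first z B (≤-trans (s≤s z≤n) cB)
            ... | C , g , Y , eqB , zg , _ , c₁ with cnt-mem Y (≤-pred (subst (2 ≤_) c₁ cB))
            ...   | g′ , i , zg′ with ∈-∃++ i
            ...     | C′ , D′ , refl with cnt-mem B (cntᴮ r)
            ...       | y , y∈ , xy with ∈-++⁻ C (subst (y ∈_) eqB y∈)
            ...         | inj₁ j = proj₁ (clear C _ eqB zg) j xy
            ...         | inj₂ (there j) = proj₂ (clear C _ eqB zg) j xy
            ...         | inj₂ (here refl) = proj₁ (clear (C ++ g ∷ C′) D′ (trans eqB (sym (++-assoc C (g ∷ C′) (g′ ∷ D′)))) zg′)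
                    (∈-mid C) xy
          middle : ∀ Mid → P₀ ≡ X ++ a ∷ Mid ++ b ∷ Z → cnt z P₀ ≡ 2 + cnt z Mid → ⊥
          middle [] eq c = tri za (ip-edge X (subst IPath eq (ip-r (u ∷ []) uP))) zb
          middle (m ∷ []) eq c = ends (m ∷ []) eq (s≤s z≤n)
            (≥2 (cnt z (u ∷ v ∷ B)) (subst (4 ≤_) (trans (cntH z) (+-comm (cnt z P₀) _)) four)
              (≤-reflexive (trans c (cong (2 +_) (cnt-no [] λ zm → tri za (ip-edge X (subst IPath eq (ip-r (u ∷ []) uP))) zm)))))
          middle (m ∷ m′ ∷ Mid) eq c = short jump pu qv (_ , _ , r)
            (subst (length ((X ++ a ∷ []) ++ z ∷ b ∷ Z) <_) (sym (cong length eq))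
              (subst (λ K → length K < length (X ++ a ∷ m ∷ m′ ∷ Mid ++ b ∷ Z)) (sym (++-assoc X (a ∷ []) (z ∷ b ∷ Z)))
                (length-++-< X (s≤s (s≤s (s≤s (≤-trans (m≤n+m _ (length Mid)) (≤-reflexive (sym (length-++ Mid))))))))))

        -- At most two of the four neighbours of z on `H′` lie off P, because these are on the old
        -- rim; so z has a first and a different last neighbour on P.
        none : ⊥
        none with mem? _≟_ z L
        ... | yes z∈L with cnt-first z P₀ (≤-trans (s≤s z≤n) (two cz))
          where
          cz : cnt z L ≤ 2
          cz = hole-cnt (rim w) z∈L
        ...   | X , a , Y , eq , za , _ , c₁ with cnt-last z Y (≤-pred (subst (2 ≤_) c₁ (two (hole-cnt (rim w) z∈L))))
        ...     | Mid , b , Z , refl , zb , _ , c₂ = on-A (inA (∈-resp-↭ (↭-sym (perm r)) z∈L)) X Mid Z eq za zb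
          where
          inA : z ∈ u ∷ A ++ v ∷ B → z ∈ A
          inA (here e) = ⊥-elim (z∉ (here e))
          inA (there i) with ∈-++⁻ A i
          ... | inj₁ j = j
          ... | inj₂ j = ⊥-elim (z∉ (there (∈-++⁺ʳ P₀ j)))
        none | no z∉L with cnt-first z P₀ (≤-trans (s≤s z≤n) (two (good z∉L z≢x ¬zx)))
        ...   | X , a , Y , eq , za , _ , c₁ with cnt-last z Y (≤-pred (subst (2 ≤_) c₁ (two (good z∉L z≢x ¬zx))))
        ...     | Mid , b , Z , refl , zb , _ , c₂ = off-L z∉L X Mid Z eq za zb (trans c₁ (cong suc c₂))

      -- Otherwise `H′` is the rim of a wheel with hub x, good by `Extra`. It has lost the spokes
      -- inside A, of which there is at least one, against the choice of the wheel.
      few-spokes : cnt x (u ∷ v ∷ B) ≤ 2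
      few-spokes with cnt x (u ∷ v ∷ B) ≤? 2
      ... | yes c = c
      ... | no ¬c = ⊥-elim (fewer wheel′ good′ lt)
        where
        wheel′ : Wheel H′ x
        wheel′ = mkWheel hole′ (λ i → [ (λ j → proj₁ (proj₂ (free j)) refl) , hub∉ w ]′ (H′∋ i))
            (subst (3 ≤_) (sym cntxH) (≰⇒> ¬c))
        good′ : Good H′ x
        good′ {z} z∉ z≢x ¬zx with cnt z H′ ≤? 2
        ... | yes c = c
        ... | no ¬c = ⊥-elim (Extra.none z∉ z≢x ¬zx (wheel-4 (mkWheel hole′ z∉ (≰⇒> ¬c))))
        lt : cnt x H′ < cnt x L
        lt = ≤-trans (s≤s (≤-reflexive cntxH)) (≤-trans (+-monoˡ-≤ (cnt x (u ∷ v ∷ B)) (cntᴬ r)) (≤-reflexive (sym (cntL x))))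

    b2n≤1 : ∀ b → b2n b ≤ 1
    b2n≤1 true = s≤s z≤n
    b2n≤1 false = z≤n

    b2n-0 : ∀ {z y} → b2n (adj G z y) ≡ 0 → ¬ E z y
    b2n-0 eq e with trans (sym (cong b2n e)) eq
    ... | ()

    -- Nothing inside either arc is attached, so either arc can be replaced, and `balance` leaves
    -- two spokes in each. The hole is P with the arc B and the centre is x: the spokes of B are
    -- direct feet, and the last spoke σ of A continues along A to v. The other spoke y of A keeps
    -- this leg away from u.
    plain : ∀ {u A v B p q} P → Ring u A v B → Walk (Free L x) p (p ∷ P) q → E p u → E q v →
      IPath (u ∷ p ∷ P) → IPath (p ∷ P ++ v ∷ []) → (p ∷ P) ## A → (p ∷ P) ## B → Short (length (p ∷ P)) → ⊥
    plain {u} {A} {v} {B} {p} {q} P r wk pu qv uP Pv PA PB short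
      with balance (b2n (adj G x u)) (cnt x A) (b2n (adj G x v)) (cnt x B) (subst (4 ≤_) (cnt-ring x r) (wheel-4 w))
             (Reroute.few-spokes P r wk pu qv uP Pv PB short)
             (subst (λ c → b2n (adj G x u) + (b2n (adj G x v) + c) ≤ 2) (cnt-rev x A)
               (Reroute.few-spokes P (flip r) wk pu qv uP Pv (λ i j → PA i (∈-rev⁻ A j)) short))
    ... | bu , cA , bv , cB with cnt-last x A (cntᴬ r) | cnt-first x B (cntᴮ r)
    ... | X , σ , A₃ , refl , xσ , xA₃ , cX | B₁ , τ₁ , Y , refl , xτ₁ , xB₁ , cY
      with cnt-mem X (subst (1 ≤_) (suc-injective (trans (sym cA) cX)) (s≤s z≤n)) | cnt-first x Y
          (subst (1 ≤_) (suc-injective (trans (sym cB) cY)) (s≤s z≤n))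
    ... | y , y∈ , _ | B₂ , τ₂ , B₃ , refl , xτ₂ , xB₂ , cB₃ with ∈-∃++ y∈
    ... | X₁ , X₂ , refl =
      isk (tripod R.hole′ τ₁∈ τ₂∈ v∈ τ₁≢τ₂ (≢v (∈-++⁺ʳ B₁ (there (∈-mid B₂)))) (≢v (∈-mid B₁)) (direct xτ₁) (direct xτ₂)
          (leg , off)
        (λ ()) (λ ()) (λ ()) tx)
      where
      Aˣ = (X₁ ++ y ∷ X₂) ++ σ ∷ A₃
      Bˣ = B₁ ++ τ₁ ∷ B₂ ++ τ₂ ∷ B₃
      module R = Reroute P r wk pu qv uP Pv PB short
      τ₁∈ : τ₁ ∈ R.H′
      τ₁∈ = there (∈-++⁺ʳ R.P₀ (there (∈-mid B₁)))
      τ₂∈ : τ₂ ∈ R.H′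
      τ₂∈ = there (∈-++⁺ʳ R.P₀ (there (∈-++⁺ʳ B₁ (there (∈-mid B₂)))))
      v∈ : v ∈ R.H′
      v∈ = there (∈-mid R.P₀)
      hB : IsHole (v ∷ Bˣ ++ u ∷ Aˣ)
      hB = rot (u ∷ Aˣ) (hole r)
      ≢v : ∀ {z} → z ∈ Bˣ → z ≢ v
      ≢v i refl = hole-∉ hB (∈-++⁺ˡ i)
      τ₁≢τ₂ : τ₁ ≢ τ₂
      τ₁≢τ₂ refl = ip-∉ʳ B₁ (ip-l Bˣ (hole-tail hB)) (∈-mid B₂)
      xB₃ : None x B₃
      xB₃ i e with subst (1 ≤_) (suc-injective (suc-injective (sym (trans (sym cB) (trans cY (cong suc cB₃)))))) (cnt-∈ B₃ i e)
      ... | ()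
      arcA : IPath (u ∷ X₁ ++ y ∷ X₂ ++ σ ∷ A₃ ++ v ∷ [])
      arcA = subst IPath (cong (u ∷_) (trans (++-assoc (X₁ ++ y ∷ X₂) (σ ∷ A₃) (v ∷ [])) (++-assoc X₁ (y ∷ X₂) _)))
          (hole-arc Aˣ (hole r) (∈-mid B₁))
      pσ : IPath (σ ∷ A₃ ++ v ∷ [])
      pσ = ip-r (u ∷ X₁ ++ y ∷ X₂) (subst IPath (cong (u ∷_) (sym (++-assoc X₁ (y ∷ X₂) _))) arcA)
      leg : IPath (x ∷ (σ ∷ A₃) ++ v ∷ [])
      leg = cons xσ (λ i → [ (λ j → ∉⇒≢ (hub∉ w) (inᴬ r (∈-++⁺ʳ (X₁ ++ y ∷ X₂) (there j))) , xA₃ j) ,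
        (λ { (here refl) → ∉⇒≢ (hub∉ w) (inᵛ r) , b2n-0 bv }) ]′ (∈-++⁻ A₃ i)) pσ
      off : ∀ {t z} → t ∈ σ ∷ A₃ → z ∈ R.H′ → z ≢ v → N t z
      off i (here refl) ne = N-sym (ip-apart (u ∷ X₁) arcA (here refl) (∈-++⁺ʳ X₂ (∈-++⁺ˡ i)))
      off i (there j) ne with ∈-++⁻ R.P₀ j
      ... | inj₁ k = N-sym (PA k (∈-++⁺ʳ (X₁ ++ y ∷ X₂) i))
      ... | inj₂ (here e) = ⊥-elim (ne e)
      ... | inj₂ (there k) = hole-## Aˣ (hole r) (∈-++⁺ʳ (X₁ ++ y ∷ X₂) i) k
      tx : ∀ {z} → z ∈ R.H′ → z ≢ τ₁ → z ≢ τ₂ → z ≢ v → N x z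
      tx (here refl) _ _ _ = ∉⇒≢ (hub∉ w) (inᵘ r) , b2n-0 bu
      tx (there i) n₁ n₂ nv with ∈-++⁻ R.P₀ i
      ... | inj₁ k = proj₁ (proj₂ (R.free k)) ∘ sym , proj₂ (proj₂ (R.free k)) ∘ E-sym
      ... | inj₂ (here e) = ⊥-elim (nv e)
      ... | inj₂ (there k) = ∉⇒≢ (hub∉ w) (inᴮ r k) , xB k n₁ n₂
        where
        xB : ∀ {z} → z ∈ Bˣ → z ≢ τ₁ → z ≢ τ₂ → ¬ E x z
        xB k n₁ n₂ with ∈-++⁻ B₁ k
        ... | inj₁ l = xB₁ l
        ... | inj₂ (here e) = λ _ → n₁ e
        ... | inj₂ (there l) with ∈-++⁻ B₂ l
        ...   | inj₁ m = xB₂ m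
        ...   | inj₂ (here e) = λ _ → n₂ e
        ...   | inj₂ (there m) = xB₃ m

    -- If g is the only spoke on the first arc, an attachment g₁ on the second arc can replace the end u.
    shift : ∀ {u v B g g₁} C D → Ring u (C ++ g ∷ D) v B → 3 ≤ cnt x (u ∷ v ∷ B) → g₁ ∈ B → ¬ Sep g₁ u → ¬ Sep g g₁ →
      ∃[ A′ ] ∃[ B′ ] (Ring g₁ A′ v B′ × (∀ {z} → z ∈ C ++ g ∷ D → z ∈ A′) × length B′ < length B)
    shift {u} {v} {B} {g} {g₁} C D r c₃ i ¬s₁ ¬s₂ with ∈-∃++ i
    ... | E₁ , F , refl with E? x u | 1 ≤? cnt x E₁
    ... | no ¬xu | yes cE = F ++ u ∷ C ++ g ∷ D , E₁ , turn (ring-left E₁ F (turn r) cE) , (λ j → ∈-++⁺ʳ F (there j)) ,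
          ≤-trans (s≤s (m≤m+n (length E₁) (length F))) (≤-reflexive
              (trans (sym (+-suc (length E₁) (length F))) (sym (length-++ E₁))))
    ... | no ¬xu | no ¬cE = ⊥-elim (low (cnt x E₁) ¬cE (subst (3 ≤_)
            (trans (cnt-no (v ∷ E₁ ++ g₁ ∷ F) ¬xu) (cong (b2n (adj G x v) +_) (cnt-++ x E₁ (g₁ ∷ F)))) c₃))
      where
      xF : None x F
      xF j e = ¬s₁ (_ , _ , ring-right E₁ F (turn r) (cnt-∈ F j e))
      low : ∀ e → ¬ (1 ≤ e) → 3 ≤ b2n (adj G x v) + (e + (b2n (adj G x g₁) + cnt x F)) → ⊥
      low (suc _) ¬p _ = ¬p (s≤s z≤n)
      low zero _ c with ≤-trans c (+-mono-≤ (b2n≤1 (adj G x v)) (+-mono-≤ (b2n≤1 (adj G x g₁)) (≤-reflexive (cnt-none F xF))))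
      ... | s≤s (s≤s ())
    ... | yes xu | _ = ⊥-elim (¬s₂ (_ , _ , ring (subst IsHole eq (proj₁ sp)) (↭-trans (↭-reflexive (sym eq)) (proj₂ sp))
          (≤-trans cvE (cnt-≤ʳ x D)) (≤-trans (subst (1 ≤_) (sym (cnt-yes C xu)) (s≤s z≤n)) (cnt-≤ʳ x F))))
      where
      sp : IsHole (g ∷ D ++ v ∷ (E₁ ++ g₁ ∷ F) ++ u ∷ C) × g ∷ D ++ v ∷ (E₁ ++ g₁ ∷ F) ++ u ∷ C ↭ L
      sp = spin C D r
      eq : g ∷ D ++ v ∷ (E₁ ++ g₁ ∷ F) ++ u ∷ C ≡ g ∷ (D ++ v ∷ E₁) ++ g₁ ∷ F ++ u ∷ C
      eq = cong (g ∷_) (trans (cong (λ K → D ++ v ∷ K) (++-assoc E₁ (g₁ ∷ F) (u ∷ C))) (sym (++-assoc D (v ∷ E₁) _)))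
      xF : None x F
      xF j e = ¬s₁ (_ , _ , ring-right E₁ F (turn r) (cnt-∈ F j e))
      cvE : 1 ≤ cnt x (v ∷ E₁)
      cvE = low (≤-pred (subst (3 ≤_) (trans (cnt-yes (v ∷ E₁ ++ g₁ ∷ F) xu) (cong suc (cnt-++ x (v ∷ E₁) (g₁ ∷ F)))) c₃))
        where
        low : 2 ≤ cnt x (v ∷ E₁) + (b2n (adj G x g₁) + cnt x F) → 1 ≤ cnt x (v ∷ E₁)
        low c with cnt x (v ∷ E₁)
        ... | suc _ = s≤s z≤n
        ... | zero with ≤-trans c (+-mono-≤ (b2n≤1 (adj G x g₁)) (≤-reflexive (cnt-none F xF)))
        ...   | s≤s ()

    module Long {p q} M (wk : Walk (Free L x) p (p ∷ M ++ q ∷ []) q) (pP : IPath (p ∷ M ++ q ∷ []))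
      (short : Short (length (p ∷ M ++ q ∷ []))) where

      free : ∀ {z} → z ∈ p ∷ M ++ q ∷ [] → Free L x z
      free = walk-all wk

      -- Attachments of the path without q are joined by a shorter walk, so minimality of the path
      -- keeps them within one sector; `together-r` does the same without p.
      together-l : ∀ {a b g g′} → a ∈ p ∷ M → b ∈ p ∷ M → E a g → E b g′ → ¬ Sep g g′
      together-l i j ag bg s with ip-between (ip-l (p ∷ M) pP) (λ k → free (∈-++⁺ˡ k)) i j
      ... | l , wk′ , le = short wk′ ag bg s (s≤s (≤-trans le (≤-trans (≤-reflexive (+-comm 1 (length M)))
              (≤-reflexive (sym (length-++ M))))))

      together-r : ∀ {a b g g′} → a ∈ M ++ q ∷ [] → b ∈ M ++ q ∷ [] → E a g → E b g′ → ¬ Sep g g′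
      together-r i j ag bg s with ip-between (ip-r (p ∷ []) pP) (λ k → free (there k)) i j
      ... | l , wk′ , le = short wk′ ag bg s (s≤s le)

      q∈ : q ∈ M ++ q ∷ []
      q∈ = ∈-mid M

      p∉ : ¬ (p ∈ L)
      p∉ = proj₁ (free (here refl))
      q∉ : ¬ (q ∈ L)
      q∉ = proj₁ (free (there q∈))
      M∉ : ∀ {m} → m ∈ M → ¬ (m ∈ L)
      M∉ i = proj₁ (free (there (∈-++⁺ˡ i)))

      module AtEnds {u A v B} (r : Ring u A v B) (pu : E p u) (qv : E q v) where

        ¬pv : ¬ E p v
        ¬pv e = together-l (here refl) (here refl) pu e (_ , _ , r)
        ¬qu : ¬ E q u
        ¬qu e = together-r q∈ q∈ e qv (_ , _ , r)
        ¬Mu : ∀ {m} → m ∈ M → ¬ E m u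
        ¬Mu i e = together-r (∈-++⁺ˡ i) q∈ e qv (_ , _ , r)
        ¬Mv : ∀ {m} → m ∈ M → ¬ E m v
        ¬Mv i e = together-l (here refl) (there i) pu e (_ , _ , r)

        uP : IPath (u ∷ p ∷ M ++ q ∷ [])
        uP = cons (E-sym pu) (λ i → [ (λ j → N-sym (∉⇒≢ (M∉ j) (inᵘ r) , ¬Mu j)) ,
            (λ { (here refl) → N-sym (∉⇒≢ q∉ (inᵘ r) , ¬qu) }) ]′ (∈-++⁻ M i)) pP

        Pv : IPath ((p ∷ M ++ q ∷ []) ++ v ∷ [])
        Pv = ip-snoc (p ∷ M) pP qv (##-∷ˡ (##-sing (∉⇒≢ p∉ (inᵛ r) , ¬pv)) λ { j (here refl) → ∉⇒≢ (M∉ j) (inᵛ r) , ¬Mv j })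

        clear : ∀ {Q} → (∀ {z} → z ∈ Q → z ∈ L) → None p Q → (∀ {m} → m ∈ M → None m Q) → None q Q → (p ∷ M ++ q ∷ []) ## Q
        clear Q⊆ pQ MQ qQ (here refl) j = ∉⇒≢ p∉ (Q⊆ j) , pQ j
        clear Q⊆ pQ MQ qQ (there i) j with ∈-++⁻ M i
        ... | inj₁ k = ∉⇒≢ (M∉ k) (Q⊆ j) , MQ k j
        ... | inj₂ (here refl) = ∉⇒≢ q∉ (Q⊆ j) , qQ j

      -- By minimality no spoke lies on either side of g in A, so x has at least three neighbours
      -- among u, v and B. If p or q is attached to B, `shift` moves that end of the ring and
      -- shortens B, whence the bound k. If an inner vertex is attached to B, then u and v turn out
      -- to be spokes and separate g from that attachment. If nothing is attached to B, `few-spokes`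
      -- is violated.
      inner-att : ∀ k {u A v B g m} → length B ≤ k → Ring u A v B → E p u → E q v → m ∈ M → E m g → g ∈ A → ⊥
      inner-att zero {B = []} le r with cntᴮ r
      ... | ()
      inner-att (suc k) {u} {A} {v} {B} {g} {m} le r pu qv m∈ mg g∈ with ∈-∃++ g∈
      ... | C , D , refl = cases (first-split (E? p) B) (first-split (E? q) B) (first-split (λ m′ → 1 ≤? cnt m′ B) M)
        where
        open AtEnds r pu qv
        xC : None x C
        xC i e = together-l (here refl) (there m∈) pu mg (_ , _ , ring-left C D r (cnt-∈ C i e))
        xD : None x D
        xD i e = together-r (∈-++⁺ˡ m∈) q∈ mg qv (_ , _ , ring-right C D r (cnt-∈ D i e))
        cA : cnt x (C ++ g ∷ D) ≤ 1
        cA = ≤-trans (≤-reflexive (trans (cnt-++ x C (g ∷ D)) (cong₂ _+_ (cnt-none C xC)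
            (cong (b2n (adj G x g) +_) (cnt-none D xD)))))
               (≤-trans (≤-reflexive (+-identityʳ _)) (b2n≤1 (adj G x g)))
        c₃ : 3 ≤ cnt x (u ∷ v ∷ B)
        c₃ = ≤-pred (≤-trans (subst (4 ≤_) (trans (cnt-ring x r) (bring (b2n (adj G x u)) (cnt x (C ++ g ∷ D)) (cnt x (v ∷ B))))
            (wheel-4 w))
               (+-monoˡ-≤ (cnt x (u ∷ v ∷ B)) cA))
        attached : ∀ {m′ g′} → m′ ∈ M → E m′ g′ → g′ ∈ B → ⊥
        attached {m′} {g′} i e j with ∈-∃++ j
        ... | E₁ , F , refl = together-l (there m∈) (there i) mg e
              (_ , _ , ring (subst IsHole eq (proj₁ sp)) (↭-trans (↭-reflexive (sym eq)) (proj₂ sp))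
                (≤-trans (subst (1 ≤_) (sym (cnt-yes E₁ xv)) (s≤s z≤n)) (cnt-≤ʳ x D))
                (≤-trans (subst (1 ≤_) (sym (cnt-yes C xu)) (s≤s z≤n)) (cnt-≤ʳ x F)))
          where
          xE : None x E₁
          xE k e′ = together-r (∈-++⁺ˡ i) q∈ e qv (_ , _ , turn (ring-left E₁ F (turn r) (cnt-∈ E₁ k e′)))
          xF : None x F
          xF k e′ = together-l (here refl) (there i) pu e (_ , _ , turn (ring-right E₁ F (turn r) (cnt-∈ F k e′)))
          cB : cnt x (E₁ ++ g′ ∷ F) ≤ 1
          cB = ≤-trans (≤-reflexive (trans (cnt-++ x E₁ (g′ ∷ F)) (cong₂ _+_ (cnt-none E₁ xE)
              (cong (b2n (adj G x g′) +_) (cnt-none F xF)))))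
                 (≤-trans (≤-reflexive (+-identityʳ _)) (b2n≤1 (adj G x g′)))
          all-one : ∀ {b c d} → 3 ≤ b2n b + (b2n c + d) → d ≤ 1 → b ≡ true × c ≡ true
          all-one {true} {true} p q = refl , refl
          all-one {true} {false} p q with ≤-trans p (s≤s q)
          ... | s≤s (s≤s ())
          all-one {false} {true} p q with ≤-trans p (s≤s q)
          ... | s≤s (s≤s ())
          all-one {false} {false} p q with ≤-trans p q
          ... | s≤s ()
          xu : E x u
          xu = proj₁ (all-one c₃ cB)
          xv : E x v
          xv = proj₂ (all-one {adj G x u} c₃ cB)
          sp : IsHole (g ∷ D ++ v ∷ (E₁ ++ g′ ∷ F) ++ u ∷ C) × g ∷ D ++ v ∷ (E₁ ++ g′ ∷ F) ++ u ∷ C ↭ L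
          sp = spin C D r
          eq : g ∷ D ++ v ∷ (E₁ ++ g′ ∷ F) ++ u ∷ C ≡ g ∷ (D ++ v ∷ E₁) ++ g′ ∷ F ++ u ∷ C
          eq = cong (g ∷_) (trans (cong (λ K → D ++ v ∷ K) (++-assoc E₁ (g′ ∷ F) (u ∷ C))) (sym (++-assoc D (v ∷ E₁) _)))
        cases : _ → _ → _ → ⊥
        cases (inj₂ (E₁ , g₁ , F , eqB , pg₁ , _)) _ _
          with shift C D r c₃ (subst (g₁ ∈_) (sym eqB) (∈-mid E₁))
                 (together-l (here refl) (here refl) pg₁ pu) (together-l (there m∈) (here refl) mg pg₁)
        ... | A′ , B′ , r′ , ⊆A′ , lt = inner-att k (≤-pred (≤-trans lt le)) r′ pg₁ qv m∈ mg (⊆A′ (∈-mid C))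
        cases (inj₁ _) (inj₂ (E₁ , g₂ , F , eqB , qg₂ , _)) _
          with shift (reverse D) (reverse C) (subst (λ K → Ring v K u (reverse B)) (reverse-mid C) (mirror r))
                 (subst (3 ≤_) (trans (bring (b2n (adj G x u)) (b2n (adj G x v)) (cnt x B))
                     (cong (λ c → b2n (adj G x v) + (b2n (adj G x u) + c)) (sym (cnt-rev x B)))) c₃)
                 (∈-resp-↭ (↭-sym (↭-reverse B)) (subst (g₂ ∈_) (sym eqB) (∈-mid E₁)))
                 (together-r q∈ q∈ qg₂ qv) (together-r (∈-++⁺ˡ m∈) q∈ mg qg₂)
        ... | A′ , B′ , r′ , ⊆A′ , lt = inner-att k (≤-pred (≤-trans
                (subst (_< length B) (sym (length-reverse B′)) (subst (length B′ <_) (length-reverse B) lt)) le)) (mirror r′) pu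
                qg₂ m∈ mg (∈-resp-↭ (↭-sym (↭-reverse A′)) (⊆A′ (∈-mid (reverse D))))
        cases (inj₁ _) (inj₁ _) (inj₂ (_ , m′ , _ , eqM , c , _)) with cnt-mem B c
        ... | g′ , j , e = attached (subst (m′ ∈_) (sym eqM) (∈-mid _)) e j
        cases (inj₁ pB) (inj₁ qB) (inj₁ MB)
          with ≤-trans c₃ (Reroute.few-spokes (M ++ q ∷ []) r wk pu qv uP Pv (clear (inᴮ r) pB (λ i j e → MB i (cnt-∈ B j e)) qB)
              short)
        ... | s≤s (s≤s ())

      only-two : ∀ {t a b z} → ¬ (t ∈ L) → t ≢ x → ¬ E t x → a ∈ L → b ∈ L → a ≢ b → E t a → E t b → z ∈ L → E t z → z ≡ a ⊎ z ≡ b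
      only-two {t} {a} {b} {z} t∉ t≢x ¬tx a∈ b∈ a≢b ta tb z∈ tz with z ≟ a | z ≟ b
      ... | yes e | _ = inj₁ e
      ... | no _ | yes e = inj₂ e
      ... | no z≢a | no z≢b with ≤-trans (three-cnt a≢b (z≢b ∘ sym) (z≢a ∘ sym) a∈ b∈ z∈ ta tb tz) (good t∉ t≢x ¬tx)
      ...   | s≤s (s≤s ())

      ring-≢ : ∀ {u A v B} → Ring u A v B → (∀ {z} → z ∈ A ++ B → u ≢ z × v ≢ z) × u ≢ v
      ring-≢ {u} {A} {v} {B} r = (λ i → (λ { refl → hole-∉ (hole r) (∈-ins A i) }) ,
          λ { refl → hole-∉ (rot (u ∷ A) (hole r)) ([ (λ j → ∈-++⁺ʳ B (there j)) , ∈-++⁺ˡ ]′ (∈-++⁻ A i)) }) ,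
        λ { refl → hole-∉ (hole r) (∈-mid A) }

      -- No spoke of A comes before g, as p would see separated vertices u and g. So there is a
      -- spoke of A at or after g, and q, which sees v, has no neighbour before g. Both its
      -- neighbours therefore lie on the arc from g over v to u, as `double-fork` asks.
      both : ∀ {u A v B g g′} → Ring u A v B → E p u → E q v → (∀ {m} → m ∈ M → None m L) → g ∈ A → E p g → g′ ∈ A ++ B → E q g′ →
          ⊥
      both {u} {A} {v} {B} {g} {g′} r pu qv ML g∈ pg g′∈ qg′ with ∈-∃++ g∈
      ... | C , D , refl = double-fork M C (D ++ v ∷ B) (subst IsHole eq (hole r)) pP (p∉ ∘ ⊆L) (q∉ ∘ ⊆L)
              (λ i j → ∉⇒≢ (M∉ i) (⊆L′ j) , ML i (⊆L′ j)) pu pg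
              (λ j e → [ (λ { refl → hole-∉ (hole r) (inDB j) }) , (λ { refl → hole-∉ (proj₁ (spin C D r)) (inDB′ j) }) ]′
                  (only-two p∉ p≢x ¬px (inᵘ r) g∈L u≢g pu pg (⊆L (∈-++⁺ʳ (u ∷ C) (there j))) e))
              (there (∈-++⁺ˡ (∈-mid D))) g′-in (v≢ g′∈) qv qg′
              (λ j e → only-two q∉ q≢x ¬qx (inᵛ r) g′∈L (v≢ g′∈) qv qg′ (⊆L′ j) e)
        where
        open AtEnds r pu qv
        p≢x : p ≢ x
        p≢x = proj₁ (proj₂ (free (here refl)))
        ¬px : ¬ E p x
        ¬px = proj₂ (proj₂ (free (here refl)))
        q≢x : q ≢ x
        q≢x = proj₁ (proj₂ (free (there q∈)))
        ¬qx : ¬ E q x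
        ¬qx = proj₂ (proj₂ (free (there q∈)))
        eq : u ∷ (C ++ g ∷ D) ++ v ∷ B ≡ u ∷ C ++ g ∷ D ++ v ∷ B
        eq = cong (u ∷_) (++-assoc C (g ∷ D) (v ∷ B))
        ⊆L : ∀ {z} → z ∈ u ∷ C ++ g ∷ D ++ v ∷ B → z ∈ L
        ⊆L {z} i = ∈-resp-↭ (perm r) (subst (z ∈_) (sym eq) i)
        ⊆L′ : ∀ {z} → z ∈ g ∷ (D ++ v ∷ B) ++ u ∷ [] → z ∈ L
        ⊆L′ i = ⊆L ([ (λ j → ∈-++⁺ʳ (u ∷ C) j) , (λ { (here refl) → here refl }) ]′ (∈-++⁻ (g ∷ D ++ v ∷ B) i))
        g∈L : g ∈ L
        g∈L = inᴬ r (∈-mid C)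
        g′∈L : g′ ∈ L
        g′∈L = [ inᴬ r , inᴮ r ]′ (∈-++⁻ (C ++ g ∷ D) g′∈)
        u≢g : u ≢ g
        u≢g = proj₁ (proj₁ (ring-≢ r) (∈-++⁺ˡ (∈-mid C)))
        v≢ : ∀ {z} → z ∈ (C ++ g ∷ D) ++ B → v ≢ z
        v≢ i = proj₂ (proj₁ (ring-≢ r) i)
        inDB : ∀ {z} → z ∈ D ++ v ∷ B → z ∈ (C ++ g ∷ D) ++ v ∷ B
        inDB {z} j = subst (z ∈_) (sym (++-assoc C (g ∷ D) (v ∷ B))) (∈-++⁺ʳ C (there j))
        inDB′ : ∀ {z} → z ∈ D ++ v ∷ B → z ∈ D ++ v ∷ B ++ u ∷ C
        inDB′ {z} j = subst (z ∈_) (++-assoc D (v ∷ B) (u ∷ C)) (∈-++⁺ˡ j)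
        xC : None x C
        xC i e = together-l (here refl) (here refl) pu pg (_ , _ , ring-left C D r (cnt-∈ C i e))
        g′∉C : ¬ (g′ ∈ C)
        g′∉C i with ∈-∃++ i | cnt-mem (C ++ g ∷ D) (cntᴬ r)
        ... | C₁ , C₂ , refl | y , y∈ , xy with ∈-++⁻ (C₁ ++ g′ ∷ C₂) y∈
        ...   | inj₁ j = xC j xy
        ...   | inj₂ j = together-r q∈ q∈ qg′ qv (_ , _ , ring-right C₁ (C₂ ++ g ∷ D)
                  (subst (λ K → Ring u K v B) (++-assoc C₁ (g′ ∷ C₂) (g ∷ D)) r) (≤-trans (cnt-∈ (g ∷ D) j xy) (cnt-≤ʳ x C₂)))
        g′-in : g′ ∈ g ∷ (D ++ v ∷ B) ++ u ∷ []
        g′-in with ∈-++⁻ (C ++ g ∷ D) g′∈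
        ... | inj₂ j = there (∈-++⁺ˡ (∈-++⁺ʳ D (there j)))
        ... | inj₁ j with ∈-++⁻ C j
        ...   | inj₁ k = ⊥-elim (g′∉C k)
        ...   | inj₂ (here e) = here e
        ...   | inj₂ (there k) = there (∈-++⁺ˡ (∈-++⁺ˡ k))

      -- An attached inner vertex is excluded by `inner-att`, on the second arc after a flip.
      -- Otherwise it matters whether p and q see a second rim vertex: neither leads to `plain`, one
      -- of them to `fork`, the two together to `both`.
      long : ∀ {u A v B} → Ring u A v B → E p u → E q v → ⊥
      long {u} {A} {v} {B} r pu qv with first-split (λ m → 1 ≤? cnt m L) M
      ... | inj₂ (M₁ , m , M₂ , eqM , c , _) with cnt-mem L c
      ...   | g , g∈ , mg with ∈-resp-↭ (↭-sym (perm r)) g∈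
      ...     | here refl = AtEnds.¬Mu r pu qv (subst (m ∈_) (sym eqM) (∈-mid M₁)) mg
      ...     | there i with ∈-++⁻ A i
      ...       | inj₁ j = inner-att (length B) ≤-refl r pu qv (subst (m ∈_) (sym eqM) (∈-mid M₁)) mg j
      ...       | inj₂ (here refl) = AtEnds.¬Mv r pu qv (subst (m ∈_) (sym eqM) (∈-mid M₁)) mg
      ...       | inj₂ (there j) = inner-att (length (reverse A)) ≤-refl (flip r) pu qv (subst (m ∈_) (sym eqM) (∈-mid M₁)) mg
              (∈-resp-↭ (↭-sym (↭-reverse B)) j)
      long {u} {A} {v} {B} r pu qv | inj₁ noM = cases (first-split (E? p) (A ++ B)) (first-split (E? q) (A ++ B))
        where
        open AtEnds r pu qv
        ML : ∀ {m} → m ∈ M → None m L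
        ML i j e = noM i (cnt-∈ L j e)
        AB : ∀ {z} → z ∈ A ++ B → z ∈ L
        AB i = [ inᴬ r , inᴮ r ]′ (∈-++⁻ A i)
        u≢v : u ≢ v
        u≢v = proj₂ (ring-≢ r)
        ⊇ : ∀ {z} → z ∈ L → z ≢ u → z ≢ v → z ∈ A ++ B
        ⊇ i nu nv with ∈-resp-↭ (↭-sym (perm r)) i
        ... | here e = ⊥-elim (nu e)
        ... | there j with ∈-++⁻ A j
        ...   | inj₁ k = ∈-++⁺ˡ k
        ...   | inj₂ (here e) = ⊥-elim (nv e)
        ...   | inj₂ (there k) = ∈-++⁺ʳ A k
        free-p : Free L x p
        free-p = free (here refl)
        free-q : Free L x q
        free-q = free (there q∈)
        lone : ∀ {t a b} → None t (A ++ B) → ¬ E t b → (∀ {z} → z ∈ L → z ≢ a → z ≢ b → z ∈ A ++ B) → ∀ {z} → z ∈ L → E t z → z ≡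
            a
        lone {t} {a} {b} no-t ¬tb ⊇′ {z} i e with z ≟ a | z ≟ b
        ... | yes eq | _ = eq
        ... | no _ | yes refl = ⊥-elim (¬tb e)
        ... | no na | no nb = ⊥-elim (no-t (⊇′ i na nb) e)
        cases : _ → _ → ⊥
        cases (inj₁ pN) (inj₁ qN) = plain (M ++ q ∷ []) r wk pu qv uP Pv
          (clear (inᴬ r) (λ i → pN (∈-++⁺ˡ i)) (λ i j → ML i (inᴬ r j)) (λ i → qN (∈-++⁺ˡ i)))
          (clear (inᴮ r) (λ i → pN (∈-++⁺ʳ A i)) (λ i j → ML i (inᴮ r j)) (λ i → qN (∈-++⁺ʳ A i))) short
        cases (inj₂ (X , g , Y , eq , pg , _)) (inj₁ qN) =
          fork M (rim w) pP p∉ q∉ (λ i j → ∉⇒≢ (M∉ i) j , ML i j) (inᵘ r) (AB g∈) (inᵛ r)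
            (proj₁ (proj₁ (ring-≢ r) g∈)) (proj₂ (proj₁ (ring-≢ r) g∈) ∘ sym) u≢v pu pg qv
            (only-two p∉ (proj₁ (proj₂ free-p)) (proj₂ (proj₂ free-p)) (inᵘ r) (AB g∈) (proj₁ (proj₁ (ring-≢ r) g∈)) pu pg)
            (lone qN ¬qu (λ i nv nu → ⊇ i nu nv))
          where
          g∈ : g ∈ A ++ B
          g∈ = subst (g ∈_) (sym eq) (∈-mid X)
        cases (inj₁ pN) (inj₂ (X , g , Y , eq , qg , _)) =
          fork (reverse M) (rim w) (ip-rev′ M pP) q∉ p∉ (λ i j → ∉⇒≢ (M∉ (∈-rev⁻ M i)) j , ML (∈-rev⁻ M i) j) (inᵛ r) (AB g∈)
              (inᵘ r)
            (proj₂ (proj₁ (ring-≢ r) g∈)) (proj₁ (proj₁ (ring-≢ r) g∈) ∘ sym) (u≢v ∘ sym) qv qg pu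
            (only-two q∉ (proj₁ (proj₂ free-q)) (proj₂ (proj₂ free-q)) (inᵛ r) (AB g∈) (proj₂ (proj₁ (ring-≢ r) g∈)) qv qg)
            (lone pN ¬pv ⊇)
          where
          g∈ : g ∈ A ++ B
          g∈ = subst (g ∈_) (sym eq) (∈-mid X)
        cases (inj₂ (X , g , Y , eq , pg , _)) (inj₂ (X′ , g′ , Y′ , eq′ , qg′ , _)) with ∈-++⁻ A
            (subst (g ∈_) (sym eq) (∈-mid X))
        ... | inj₁ i = both r pu qv ML i pg (subst (g′ ∈_) (sym eq′) (∈-mid X′)) qg′
        ... | inj₂ i = both (flip r) pu qv ML (∈-resp-↭ (↭-sym (↭-reverse B)) i) pg
                ([ (λ j → ∈-++⁺ʳ (reverse B) (∈-resp-↭ (↭-sym (↭-reverse A)) j)) ,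
                    (λ j → ∈-++⁺ˡ (∈-resp-↭ (↭-sym (↭-reverse B)) j)) ]′
                  (∈-++⁻ A (subst (g′ ∈_) (sym eq′) (∈-mid X′)))) qg′

    -- Goodness leaves p no third neighbour on the rim, so this is the unattached case.
    single : ∀ {u A v B p} → Ring u A v B → Free L x p → E p u → E p v → Short 1 → ⊥
    single {u} {A} {v} {B} {p} r f pu pv short = plain [] r (stop f) pu pv (edge (E-sym pu)) (edge pv)
      (λ { (here refl) j → far (inᴬ r j) (λ { refl → hole-∉ (hole r) (∈-++⁺ˡ j) })
          (λ { refl → hole-∉ (rot (u ∷ A) (hole r)) (∈-++⁺ʳ B (there j)) }) })
      (λ { (here refl) j → far (inᴮ r j) (λ { refl → hole-∉ (hole r) (∈-++⁺ʳ A (there j)) })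
          (λ { refl → hole-∉ (rot (u ∷ A) (hole r)) (∈-++⁺ˡ j) }) }) short
      where
      far : ∀ {z} → z ∈ L → u ≢ z → v ≢ z → N p z
      far i nu nv = ∉⇒≢ (proj₁ f) i , λ e → 3≰2 (≤-trans (three-cnt (λ { refl → hole-∉ (hole r) (∈-mid A) }) nv nu (inᵘ r) (inᵛ r)
          i pu pv e)
          (good (proj₁ f) (proj₁ (proj₂ f)) (proj₂ (proj₂ f))))
        where
        3≰2 : ¬ (3 ≤ 2)
        3≰2 (s≤s (s≤s ()))

    -- The walk is first replaced by an induced one that is no longer, so the induction hypothesis
    -- still states its minimality.
    short-all : ∀ k → Short k
    short-all zero _ _ _ _ ()
    short-all (suc k) wk pu qv (A , B , r) lt with shorten wk
    ... | l′ , pl , wk′ , le = by-shape (walk-view wk′)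
      where
      short′ : Short (length l′)
      short′ wk₁ e₁ e₂ s lt′ = short-all k wk₁ e₁ e₂ s (≤-trans lt′ (≤-trans le (≤-pred lt)))
      by-shape : _ → ⊥
      by-shape (inj₁ (refl , refl)) = single r (walk-all wk′ (here refl)) pu qv short′
      by-shape (inj₂ (M , refl)) = Long.long M wk′ pl short′ r pu qv

    no-violation : ∀ {p q u v l} → Walk (Free L x) p l q → E p u → E q v → ¬ Sep u v
    no-violation {l = l} wk pu qv s = short-all (suc (length l)) wk pu qv s ≤-refl

-- Paths seeing three vertices of a hole, in the absence of wheels and K₃,₃.

module Attach (G : Graph) (tri : Paths.TriangleFree G) (isk : ¬ ContainsISK4 G)
  (no-wheel : Paths.WheelFree G) (no-K₃₃ : Paths.K₃₃-Free G) where
  open Paths G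
  open Detect G
  open Wheels G tri isk
  open GoodWheels G tri isk
  open IsHole

  only-two : ∀ {L t a b z} → IsHole L → ¬ (t ∈ L) → a ∈ L → b ∈ L → a ≢ b → E t a → E t b → z ∈ L → E t z → z ≡ a ⊎ z ≡ b
  only-two {L} {t} {a} {b} {z} h t∉ a∈ b∈ a≢b ta tb z∈ tz with z ≟ a | z ≟ b
  ... | yes e | _ = inj₁ e
  ... | no _ | yes e = inj₂ e
  ... | no z≢a | no z≢b with ≤-trans (three-cnt a≢b (z≢b ∘ sym) (z≢a ∘ sym) a∈ b∈ z∈ ta tb tz) (no-wheel h t∉)
  ...   | s≤s (s≤s ())

  order : ∀ {L a b c} → IsHole L → a ∈ L → b ∈ L → c ∈ L → a ≢ b → b ≢ c → a ≢ c →
    ∃[ A₁ ] ∃[ A₂ ] ∃[ A₃ ] (IsHole (c ∷ A₁ ++ b ∷ A₂ ++ a ∷ A₃) × c ∷ A₁ ++ b ∷ A₂ ++ a ∷ A₃ ↭ L)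
  order {L} {a} {b} {c} h a∈ b∈ c∈ a≢b b≢c a≢c with hole-at h c∈
  ... | M , h′ , perm with ∈-∃++ (tl b∈ b≢c)
    where
    tl : ∀ {z} → z ∈ L → z ≢ c → z ∈ M
    tl i ne with ∈-resp-↭ (↭-sym perm) i
    ... | here e = ⊥-elim (ne e)
    ... | there j = j
  ... | X , Y , refl with ∈-++⁻ X (tl a∈ a≢c)
    where
    tl : ∀ {z} → z ∈ L → z ≢ c → z ∈ X ++ b ∷ Y
    tl i ne with ∈-resp-↭ (↭-sym perm) i
    ... | here e = ⊥-elim (ne e)
    ... | there j = j
  ...   | inj₂ (here e) = ⊥-elim (a≢b e)
  ...   | inj₂ (there i) with ∈-∃++ i
  ...     | Y₁ , Y₂ , refl = X , Y₁ , Y₂ , h′ , perm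
  order {L} {a} {b} {c} h a∈ b∈ c∈ a≢b b≢c a≢c | M , h′ , perm | X , Y , refl | inj₁ i with ∈-∃++ i
  ...     | X₁ , X₂ , refl = reverse Y , reverse X₂ , reverse X₁ , rot (reverse Y ++ b ∷ reverse X₂ ++ a ∷ reverse X₁)
          (subst IsHole eq (hole-rev h′)) ,
            ↭-trans (↭-++-comm (c ∷ []) _) (↭-trans (↭-reflexive (sym eq)) (↭-trans (↭-reverse _) perm))
    where
    eq : reverse (c ∷ (X₁ ++ a ∷ X₂) ++ b ∷ Y) ≡ (reverse Y ++ b ∷ reverse X₂ ++ a ∷ reverse X₁) ++ c ∷ []
    eq = trans (reverse-mid (c ∷ X₁ ++ a ∷ X₂)) (trans (cong (λ K → reverse Y ++ b ∷ K)
           (trans (unfold-reverse c (X₁ ++ a ∷ X₂)) (cong (_++ c ∷ []) (reverse-mid X₁))))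
           (sym (++-assoc (reverse Y) _ _)))

  record Crossing (L : List (V G)) (p q : V G) (M : List (V G)) (a c b d : V G) : Set where
    field
      path   : IPath (p ∷ M ++ q ∷ [])
      p∉     : ¬ (p ∈ L)
      q∉     : ¬ (q ∈ L)
      M##    : M ## L
      pa     : E p a
      pc     : E p c
      qb     : E q b
      qd     : E q d
      only-p : ∀ {z} → z ∈ L → E p z → z ≡ a ⊎ z ≡ c
      only-q : ∀ {z} → z ∈ L → E q z → z ≡ b ⊎ z ≡ d

  open Crossing

  cross-swap : ∀ {L p q M a c b d} → Crossing L p q M a c b d → Crossing L p q M c a d b
  cross-swap x = record { path = path x ; p∉ = p∉ x ; q∉ = q∉ x ; M## = M## x ; pa = pc x ; pc = pa x ; qb = qd x ; qd = qb x
    ; only-p = λ i e → [ inj₂ , inj₁ ]′ (only-p x i e) ; only-q = λ i e → [ inj₂ , inj₁ ]′ (only-q x i e) }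

  cross-swapᵖ : ∀ {L p q M a c b d} → Crossing L p q M a c b d → Crossing L p q M c a b d
  cross-swapᵖ x = record { path = path x ; p∉ = p∉ x ; q∉ = q∉ x ; M## = M## x ; pa = pc x ; pc = pa x ; qb = qb x ; qd = qd x
    ; only-p = λ i e → [ inj₂ , inj₁ ]′ (only-p x i e) ; only-q = only-q x }

  -- Centre q on the hole `a A₁ c p`: b is a direct foot, M leads to p, and the rim from d over D₂
  -- leads to a. The vertex e between c and d keeps that last leg off c.
  crossing-gap : ∀ {L p q M a c b d e} A₁ D₁ D₂ → Crossing L p q M a c b d → IsHole (a ∷ A₁ ++ c ∷ D₁ ++ d ∷ D₂) →
    a ∷ A₁ ++ c ∷ D₁ ++ d ∷ D₂ ↭ L → b ∈ A₁ → e ∈ D₁ → ⊥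
  crossing-gap {L} {p} {q} {M} {a} {c} {b} {d} {e} A₁ D₁ D₂ x h perm b∈ e∈ =
    isk (tripod hole (there (∈-++⁺ˡ b∈)) p∈ (here refl) (≢p (inA b∈)) (≢p a∈L ∘ sym) b≢a (direct (qb x))
        (ip-rev′ M (path x) , offp) (leg , offa)
      (λ ()) (λ ()) (λ i j → M## x (∈-rev⁻ M i) (inD j)) tq)
    where
    up : ∀ {z} → z ∈ a ∷ A₁ ++ c ∷ D₁ ++ d ∷ D₂ → z ∈ L
    up = ∈-resp-↭ perm
    a∈L : a ∈ L
    a∈L = up (here refl)
    inA : ∀ {z} → z ∈ A₁ → z ∈ L
    inA i = up (there (∈-++⁺ˡ i))
    c∈L : c ∈ L
    c∈L = up (there (∈-mid A₁))
    inD : ∀ {z} → z ∈ d ∷ D₂ → z ∈ L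
    inD i = up (there (∈-++⁺ʳ A₁ (there (∈-++⁺ʳ D₁ i))))
    ≢p : ∀ {z} → z ∈ L → z ≢ p
    ≢p i refl = p∉ x i
    hc : IsHole (c ∷ (D₁ ++ d ∷ D₂) ++ a ∷ A₁)
    hc = rot (a ∷ A₁) h
    arc : IPath (c ∷ D₁ ++ d ∷ D₂ ++ a ∷ [])
    arc = subst IPath (cong (c ∷_) (++-assoc D₁ (d ∷ D₂) (a ∷ []))) (hole-arc (D₁ ++ d ∷ D₂) hc b∈)
    cD : (c ∷ []) ## (d ∷ D₂ ++ a ∷ [])
    cD i j with ∈-∃++ e∈
    ... | D₁′ , D₁″ , refl = ip-apart (c ∷ D₁′) (subst IPath (cong (c ∷_) (++-assoc D₁′ (e ∷ D₁″) _)) arc)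
            (∈-++⁺ˡ i) (∈-++⁺ʳ D₁″ j)
    pA : ∀ {z} → z ∈ A₁ → N p z
    pA i = ∉⇒≢ (p∉ x) (inA i) , λ e → [ (λ { refl → hole-∉ h (∈-++⁺ˡ i) }) ,
        (λ { refl → hole-∉ hc (∈-++⁺ʳ (D₁ ++ d ∷ D₂) (there i)) }) ]′ (only-p x (inA i) e)
    hole : IsHole (a ∷ A₁ ++ c ∷ p ∷ [])
    hole = build A₁ b∈ h pA
      where
      build : ∀ A₁ → b ∈ A₁ → IsHole (a ∷ A₁ ++ c ∷ D₁ ++ d ∷ D₂) → (∀ {z} → z ∈ A₁ → N p z) → IsHole (a ∷ A₁ ++ c ∷ p ∷ [])
      build (z ∷ A) _ h pA = mkHole A (p ∷ []) (ip-l (a ∷ z ∷ A) (hole-arc (z ∷ A) h (∈-mid D₁))) (ip-mid [] (hole-tail h))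
        (cons (E-sym (pc x)) (λ { (here refl) → cD (here refl) (∈-mid (d ∷ D₂)) }) (edge (pa x)))
        (λ { i (here refl) → N-sym (pA i) })
        (s≤s (s≤s (≤-trans (m≤n+m 2 (length A)) (≤-reflexive (sym (length-++ A))))))
    p∈ : p ∈ a ∷ A₁ ++ c ∷ p ∷ []
    p∈ = there (∈-++⁺ʳ A₁ (there (here refl)))
    b≢a : b ≢ a
    b≢a refl = hole-∉ h (∈-++⁺ˡ b∈)
    C∋ : ∀ {z} → z ∈ a ∷ A₁ ++ c ∷ p ∷ [] → z ≡ p ⊎ z ∈ a ∷ A₁ ++ c ∷ []
    C∋ (here e) = inj₂ (here e)
    C∋ (there i) with ∈-++⁻ A₁ i
    ... | inj₁ j = inj₂ (there (∈-++⁺ˡ j))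
    ... | inj₂ (here refl) = inj₂ (there (∈-mid A₁))
    ... | inj₂ (there (here e)) = inj₁ e
    ⊆L : ∀ {z} → z ∈ a ∷ A₁ ++ c ∷ [] → z ∈ L
    ⊆L (here refl) = a∈L
    ⊆L (there i) = [ inA , (λ { (here refl) → c∈L }) ]′ (∈-++⁻ A₁ i)
    offp : ∀ {r z} → r ∈ reverse M → z ∈ a ∷ A₁ ++ c ∷ p ∷ [] → z ≢ p → N r z
    offp i j ne with C∋ j
    ... | inj₁ e = ⊥-elim (ne e)
    ... | inj₂ k = M## x (∈-rev⁻ M i) (⊆L k)
    d≢ : ∀ {z} → z ∈ a ∷ A₁ ++ c ∷ [] → z ≢ d
    d≢ (here refl) refl = hole-∉ h (∈-++⁺ʳ A₁ (there (∈-mid D₁)))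
    d≢ (there i) with ∈-++⁻ A₁ i
    ... | inj₁ j = λ { refl → proj₁ (hole-## A₁ h j (∈-mid D₁)) refl }
    ... | inj₂ (here refl) = λ { refl → hole-∉ hc (∈-++⁺ˡ (∈-mid D₁)) }
    leg : IPath (q ∷ (d ∷ D₂) ++ a ∷ [])
    leg = cons (qd x) (λ i → ∉⇒≢ (q∉ x) (inDa i) , λ e → [ nb i , nd i ]′ (only-q x (inDa i) e)) (ip-r (c ∷ D₁) arc)
      where
      inDa : ∀ {z} → z ∈ D₂ ++ a ∷ [] → z ∈ L
      inDa i = [ (λ j → inD (there j)) , (λ { (here refl) → a∈L }) ]′ (∈-++⁻ D₂ i)
      nb : ∀ {z} → z ∈ D₂ ++ a ∷ [] → z ≢ b
      nb i refl with ∈-++⁻ D₂ i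
      ... | inj₁ j = proj₁ (hole-## A₁ h b∈ (∈-++⁺ʳ D₁ (there j))) refl
      ... | inj₂ (here e) = b≢a e
      nd : ∀ {z} → z ∈ D₂ ++ a ∷ [] → z ≢ d
      nd i refl = ip-∉ʳ (c ∷ D₁) arc i
    offa : ∀ {r z} → r ∈ d ∷ D₂ → z ∈ a ∷ A₁ ++ c ∷ p ∷ [] → z ≢ a → N r z
    offa {r} i j ne with C∋ j
    ... | inj₁ refl = N-sym (∉⇒≢ (p∉ x) (inD i) , λ e → [ na , nc ]′ (only-p x (inD i) e))
      where
      na : r ≢ a
      na refl = hole-∉ h (∈-++⁺ʳ A₁ (there (∈-++⁺ʳ D₁ i)))
      nc : r ≢ c
      nc refl = hole-∉ hc (∈-++⁺ˡ (∈-++⁺ʳ D₁ i))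
    ... | inj₂ (here e) = ⊥-elim (ne e)
    ... | inj₂ (there k) with ∈-++⁻ A₁ k
    ...   | inj₁ l = N-sym (hole-## A₁ h l (∈-++⁺ʳ D₁ i))
    ...   | inj₂ (here refl) = N-sym (cD (here refl) (∈-++⁺ˡ i))
    tq : ∀ {z} → z ∈ a ∷ A₁ ++ c ∷ p ∷ [] → z ≢ b → z ≢ p → z ≢ a → N q z
    tq j nb np na with C∋ j
    ... | inj₁ e = ⊥-elim (np e)
    ... | inj₂ k = ∉⇒≢ (q∉ x) (⊆L k) , λ e → [ nb , d≢ k ]′ (only-q x (⊆L k) e)

  -- Unless the rim is the square abcd, one of the four gaps is non-empty, and renaming and
  -- reversing bring it into the position of `crossing-gap`. On the square, adjacent p and q give a
  -- K₃,₃ with sides a, c, q and b, d, p. Otherwise d is the centre on the square a p c b, with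
  -- direct feet a and c and a leg through q to b.
  no-crossing : ∀ {L p q M a c b d} A₁ A₂ → Crossing L p q M a c b d → IsHole (a ∷ A₁ ++ c ∷ A₂) →
    a ∷ A₁ ++ c ∷ A₂ ↭ L → b ∈ A₁ → d ∈ A₂ → ⊥
  no-crossing {L} {p} {q} {M} {a} {c} {b} {d} A₁ A₂ x h perm b∈ d∈ with ∈-∃++ b∈ | ∈-∃++ d∈
  ... | B₁ , B₂ , refl | e ∷ D₁ , D₂ , refl = crossing-gap (B₁ ++ b ∷ B₂) (e ∷ D₁) D₂ x h perm b∈ (here refl)
  ... | e ∷ B₁ , B₂ , refl | [] , D₂ , refl =
        crossing-gap (d ∷ D₂) (e ∷ B₁) B₂ (cross-swap x) (rot (a ∷ (e ∷ B₁) ++ b ∷ B₂) h)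
            (↭-trans (↭-++-comm (c ∷ d ∷ D₂) (a ∷ (e ∷ B₁) ++ b ∷ B₂)) perm) (here refl) (here refl)
  ... | [] , e ∷ B₂ , refl | [] , D₂ , refl =
        crossing-gap (reverse (d ∷ D₂)) (reverse (e ∷ B₂)) [] (cross-swapᵖ (cross-swap x)) h₁ p₁
            (∈-resp-↭ (↭-sym (↭-reverse (d ∷ D₂))) (here refl)) (∈-resp-↭ (↭-sym (↭-reverse (e ∷ B₂))) (here refl))
    where
    eq : reverse (a ∷ (b ∷ e ∷ B₂) ++ c ∷ d ∷ D₂) ≡ (reverse (d ∷ D₂) ++ c ∷ reverse (e ∷ B₂) ++ b ∷ []) ++ a ∷ []
    eq = trans (reverse-mid (a ∷ b ∷ e ∷ B₂)) (trans (cong (λ K → reverse (d ∷ D₂) ++ c ∷ K)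
           (trans (unfold-reverse a (b ∷ e ∷ B₂)) (cong (_++ a ∷ []) (unfold-reverse b (e ∷ B₂)))))
               (sym (++-assoc (reverse (d ∷ D₂)) _ _)))
    h₁ : IsHole (a ∷ reverse (d ∷ D₂) ++ c ∷ reverse (e ∷ B₂) ++ b ∷ [])
    h₁ = rot (reverse (d ∷ D₂) ++ c ∷ reverse (e ∷ B₂) ++ b ∷ []) (subst IsHole eq (hole-rev h))
    p₁ : a ∷ reverse (d ∷ D₂) ++ c ∷ reverse (e ∷ B₂) ++ b ∷ [] ↭ L
    p₁ = ↭-trans (↭-++-comm (a ∷ []) _) (↭-trans (↭-reflexive (sym eq))
        (↭-trans (↭-reverse (a ∷ (b ∷ e ∷ B₂) ++ c ∷ d ∷ D₂)) perm))
  ... | [] , [] , refl | [] , e ∷ D₂ , refl =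
        crossing-gap (b ∷ []) (reverse (e ∷ D₂)) [] (cross-swapᵖ x) h₁ p₁ (here refl)
            (∈-resp-↭ (↭-sym (↭-reverse (e ∷ D₂))) (here refl))
    where
    eq : reverse (a ∷ b ∷ c ∷ d ∷ e ∷ D₂) ≡ (reverse (e ∷ D₂) ++ d ∷ []) ++ c ∷ b ∷ a ∷ []
    eq = trans (reverse-mid (a ∷ b ∷ c ∷ []) {d} {e ∷ D₂}) (sym (++-assoc (reverse (e ∷ D₂)) (d ∷ []) (c ∷ b ∷ a ∷ [])))
    h₁ : IsHole (c ∷ (b ∷ []) ++ a ∷ reverse (e ∷ D₂) ++ d ∷ [])
    h₁ = rot (reverse (e ∷ D₂) ++ d ∷ []) (subst IsHole eq (hole-rev h))
    p₁ : c ∷ (b ∷ []) ++ a ∷ reverse (e ∷ D₂) ++ d ∷ [] ↭ L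
    p₁ = ↭-trans (↭-++-comm (c ∷ b ∷ a ∷ []) (reverse (e ∷ D₂) ++ d ∷ []))
        (↭-trans (↭-reflexive (sym eq)) (↭-trans (↭-reverse (a ∷ b ∷ c ∷ d ∷ e ∷ D₂)) perm))
  ... | [] , [] , refl | [] , [] , refl = square M (path x) (M## x)
    where
    ab : E a b
    ab = hole-edge₀ h
    bc : E b c
    bc = hole-edge [] h
    cd : E c d
    cd = hole-edge (b ∷ []) h
    da : E d a
    da = hole-edgeₑ (b ∷ c ∷ []) h
    on : ∀ {z} → z ∈ a ∷ b ∷ c ∷ d ∷ [] → z ∈ L
    on = ∈-resp-↭ perm
    a≢c : a ≢ c
    a≢c refl = hole-∉ h (there (here refl))
    b≢d : b ≢ d
    b≢d refl = hole-∉ (rot (a ∷ []) h) (there (here refl))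
    a≢d : a ≢ d
    a≢d refl = hole-∉ h (there (there (here refl)))
    c≢d : c ≢ d
    c≢d e = E⇒≢ cd e
    ≢q : ∀ {z} → z ∈ L → z ≢ q
    ≢q i refl = q∉ x i
    ≢p : ∀ {z} → z ∈ L → z ≢ p
    ≢p i refl = p∉ x i
    square : ∀ M → IPath (p ∷ M ++ q ∷ []) → M ## L → ⊥
    square [] (cons pq _ _) _ = no-K₃₃ ab (E-sym da) (E-sym (pa x)) (E-sym bc) cd (E-sym (pc x)) (qb x) (qd x) (E-sym pq)
      a≢c (≢q (on (there (there (here refl))))) (≢q (on (here refl))) b≢d (≢p (on (there (there (there (here refl))))))
          (≢p (on (there (here refl))))
    square (m ∷ M) (cons _ far _) _ =
      isk (tripod {t = d} {R₃ = q ∷ []} hole (here refl) (there (there (here refl))) (there (there (there (here refl)))) a≢c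
          (E⇒≢ (E-sym bc)) (E⇒≢ ab)
        (direct da) (direct (E-sym cd)) (cons (E-sym (qd x)) (λ { (here refl) → N-sym nbd }) (edge (qb x)) , offq) (λ ()) (λ ())
            (λ ()) td)
      where
      npq : N p q
      npq = far (∈-mid M)
      nbd : N b d
      nbd = b≢d , λ e → tri ab e (E-sym da)
      np : ∀ {z} → z ∈ L → z ≢ a → z ≢ c → N p z
      np i na nc = ∉⇒≢ (p∉ x) i , λ e → [ na , nc ]′ (only-p x i e)
      hole : IsHole (a ∷ p ∷ c ∷ b ∷ [])
      hole = mkHole [] (b ∷ []) (edge (E-sym (pa x))) (edge (pc x))
          (cons (E-sym bc) (λ { (here refl) → a≢c ∘ sym , λ e → tri ab bc (E-sym e) }) (edge (E-sym ab)))
        (λ { (here refl) (here refl) → np (on (there (here refl))) (E⇒≢ (E-sym ab)) (E⇒≢ bc) }) (s≤s (s≤s (s≤s (s≤s z≤n))))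
      nq : ∀ {z} → z ∈ L → z ≢ b → z ≢ d → N q z
      nq i nb nd = ∉⇒≢ (q∉ x) i , λ e → [ nb , nd ]′ (only-q x i e)
      offq : ∀ {r z} → r ∈ q ∷ [] → z ∈ a ∷ p ∷ c ∷ b ∷ [] → z ≢ b → N r z
      offq (here refl) (here refl) _ = nq (on (here refl)) (E⇒≢ ab) a≢d
      offq (here refl) (there (here refl)) _ = N-sym npq
      offq (here refl) (there (there (here refl))) _ = nq (on (there (there (here refl)))) (E⇒≢ (E-sym bc)) c≢d
      offq (here refl) (there (there (there (here e)))) ne = ⊥-elim (ne e)
      td : ∀ {z} → z ∈ a ∷ p ∷ c ∷ b ∷ [] → z ≢ a → z ≢ c → z ≢ b → N d z
      td (here e) na _ _ = ⊥-elim (na e)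
      td (there (here refl)) _ _ _ = N-sym (np (on (there (there (there (here refl))))) (a≢d ∘ sym) (c≢d ∘ sym))
      td (there (there (here e))) _ nc _ = ⊥-elim (nc e)
      td (there (there (there (here e)))) _ _ nb = ⊥-elim (nb e)

  record Three (L P : List (V G)) (a b c : V G) : Set where
    constructor mkThree
    field
      a∈ : a ∈ L
      b∈ : b ∈ L
      c∈ : c ∈ L
      a≢b : a ≢ b
      b≢c : b ≢ c
      a≢c : a ≢ c
      ta : 1 ≤ cnt a P
      tb : 1 ≤ cnt b P
      tc : 1 ≤ cnt c P

  swap₁₂ : ∀ {L P a b c} → Three L P a b c → Three L P b a c
  swap₁₂ (mkThree i j k ab bc ac x y z) = mkThree j i k (ab ∘ sym) ac bc y x z

  swap₂₃ : ∀ {L P a b c} → Three L P a b c → Three L P a c b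
  swap₂₃ (mkThree i j k ab bc ac x y z) = mkThree i k j ac (bc ∘ sym) ab x z y

  -- A vertex of M attached to the hole would give, with a and c, a triple seen from `p M`, so M is
  -- unattached. If q sees b alone, this is a `fork`. If it also sees d, then b and d lie on one arc
  -- between a and c (`double-fork`) or on different ones (`no-crossing`).
  two-private : ∀ {L p q a b c} M → IsHole L → IPath (p ∷ M ++ q ∷ []) → (∀ {z} → z ∈ p ∷ M ++ q ∷ [] → ¬ (z ∈ L)) →
    (∀ {x y z} → ¬ Three L (p ∷ M) x y z) → a ∈ L → b ∈ L → c ∈ L → a ≢ b → b ≢ c → a ≢ c →
    E a p → None a (M ++ q ∷ []) → E c p → None c (M ++ q ∷ []) → E b q → ⊥
  two-private {L} {p} {q} {a} {b} {c} M h pP off no-left a∈ b∈ c∈ a≢b b≢c a≢c ap aR cp cR bq =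
    cases (first-split (λ z → E? q z ×-dec ¬? (z ≟ b)) L)
    where
    p∉L : ¬ (p ∈ L)
    p∉L = off (here refl)
    q∉L : ¬ (q ∈ L)
    q∉L = off (there (∈-mid M))
    ML : M ## L
    ML {m} {d} i j = ∉⇒≢ (off (there (∈-++⁺ˡ i))) j , λ e → no-left (mkThree a∈ c∈ j a≢c
      (λ { refl → cR (∈-++⁺ˡ i) (E-sym e) }) (λ { refl → aR (∈-++⁺ˡ i) (E-sym e) })
      (cnt-∈ (p ∷ M) (here refl) ap) (cnt-∈ (p ∷ M) (here refl) cp) (cnt-∈ (p ∷ M) (there i) (E-sym e)))
    onlyp : ∀ {z} → z ∈ L → E p z → z ≡ a ⊎ z ≡ c
    onlyp = only-two h p∉L a∈ c∈ a≢c (E-sym ap) (E-sym cp)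
    cases : _ → ⊥
    cases (inj₁ none) = fork M h pP p∉L q∉L ML a∈ c∈ b∈ a≢c (b≢c ∘ sym) a≢b (E-sym ap) (E-sym cp) (E-sym bq) onlyp onlyq
      where
      onlyq : ∀ {z} → z ∈ L → E q z → z ≡ b
      onlyq {z} i e with z ≟ b
      ... | yes r = r
      ... | no ne = ⊥-elim (none i (e , ne))
    cases (inj₂ (X , d , Y , eqL , (qd , d≢b) , _)) = place (hole-at h a∈)
      where
      d∈ : d ∈ L
      d∈ = subst (d ∈_) (sym eqL) (∈-mid X)
      onlyq : ∀ {z} → z ∈ L → E q z → z ≡ b ⊎ z ≡ d
      onlyq = only-two h q∉L b∈ d∈ (d≢b ∘ sym) (E-sym bq) qd
      d≢a : d ≢ a
      d≢a refl = aR (∈-mid M) (E-sym qd)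
      d≢c : d ≢ c
      d≢c refl = cR (∈-mid M) (E-sym qd)
      cr : Crossing L p q M a c b d
      cr = record { path = pP ; p∉ = p∉L ; q∉ = q∉L ; M## = ML ; pa = E-sym ap ; pc = E-sym cp ; qb = E-sym bq ; qd = qd ;
          only-p = onlyp ; only-q = onlyq }
      cr′ : Crossing L p q M a c d b
      cr′ = cross-swapᵖ (cross-swap cr)
      place : ∃[ K ] (IsHole (a ∷ K) × a ∷ K ↭ L) → ⊥
      place (K , h′ , perm) with ∈-∃++ (tl K perm c∈ (a≢c ∘ sym))
        where
        tl : ∀ K → a ∷ K ↭ L → ∀ {z} → z ∈ L → z ≢ a → z ∈ K
        tl K perm i ne with ∈-resp-↭ (↭-sym perm) i
        ... | here e = ⊥-elim (ne e)
        ... | there j = j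
      ... | A₁ , A₂ , refl = sides (side b∈ (a≢b ∘ sym) b≢c) (side d∈ d≢a d≢c)
        where
        side : ∀ {z} → z ∈ L → z ≢ a → z ≢ c → z ∈ A₁ ⊎ z ∈ A₂
        side i na nc with ∈-resp-↭ (↭-sym perm) i
        ... | here e = ⊥-elim (na e)
        ... | there j with ∈-++⁻ A₁ j
        ...   | inj₁ k = inj₁ k
        ...   | inj₂ (here e) = ⊥-elim (nc e)
        ...   | inj₂ (there k) = inj₂ k
        hc : IsHole (c ∷ A₂ ++ a ∷ A₁)
        hc = rot (a ∷ A₁) h′
        permc : c ∷ A₂ ++ a ∷ A₁ ↭ L
        permc = ↭-trans (↭-++-comm (c ∷ A₂) (a ∷ A₁)) perm
        sides : _ → _ → ⊥
        sides (inj₁ i) (inj₂ j) = no-crossing A₁ A₂ cr h′ perm i j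
        sides (inj₂ i) (inj₁ j) = no-crossing A₁ A₂ cr′ h′ perm j i
        sides (inj₂ i) (inj₂ j) = double-fork M A₁ A₂ h′ pP (p∉L ∘ ∈-resp-↭ perm) (q∉L ∘ ∈-resp-↭ perm)
          (λ k l → ML k (⊆L l)) (E-sym ap) (E-sym cp)
          (λ k e → [ (λ { refl → hole-∉ h′ (∈-++⁺ʳ A₁ (there k)) }) , (λ { refl → hole-∉ hc (∈-++⁺ˡ k) }) ]′
              (onlyp (∈-resp-↭ perm (∈-++⁺ʳ (a ∷ A₁) (there k))) e))
          (there (∈-++⁺ˡ i)) (there (∈-++⁺ˡ j)) (d≢b ∘ sym) (E-sym bq) qd (λ k → onlyq (⊆L k))
          where
          ⊆L : ∀ {z} → z ∈ c ∷ A₂ ++ a ∷ [] → z ∈ L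
          ⊆L k = ∈-resp-↭ perm ([ ∈-++⁺ʳ (a ∷ A₁) , (λ { (here refl) → here refl }) ]′ (∈-++⁻ (c ∷ A₂) k))
        sides (inj₁ i) (inj₁ j) = double-fork M A₂ A₁ hc pP (p∉L ∘ ∈-resp-↭ permc) (q∉L ∘ ∈-resp-↭ permc)
          (λ k l → ML k (⊆L l)) (E-sym cp) (E-sym ap)
          (λ k e → [ (λ { refl → hole-∉ h′ (∈-++⁺ˡ k) }) , (λ { refl → hole-∉ hc (∈-++⁺ʳ A₂ (there k)) }) ]′
              (onlyp (∈-resp-↭ permc (∈-++⁺ʳ (c ∷ A₂) (there k))) e))
          (there (∈-++⁺ˡ i)) (there (∈-++⁺ˡ j)) (d≢b ∘ sym) (E-sym bq) qd (λ k → onlyq (⊆L k))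
          where
          ⊆L : ∀ {z} → z ∈ a ∷ A₁ ++ c ∷ [] → z ∈ L
          ⊆L k = ∈-resp-↭ permc ([ ∈-++⁺ʳ (c ∷ A₂) , (λ { (here refl) → here refl }) ]′ (∈-++⁻ (a ∷ A₁) k))

  -- If c sees a single vertex t of the path, t is the centre, with legs along the path to a and b
  -- and direct foot c. If c sees more, the path and the arc A₂ between b and a that avoids c form a
  -- hole. Without wheels c sees exactly two of its vertices; with these as direct feet and the arc
  -- A₁ leading to b, c is the centre.
  shared : ∀ {L p q a b c} M → IsHole L → IPath (p ∷ M ++ q ∷ []) → (∀ {z} → z ∈ p ∷ M ++ q ∷ [] → ¬ (z ∈ L)) →
    Three L (p ∷ M ++ q ∷ []) a b c → (∀ {d t} → d ∈ L → t ∈ p ∷ M ++ q ∷ [] → E t d → d ≡ a ⊎ d ≡ b ⊎ d ≡ c) →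
    E a p → None a (M ++ q ∷ []) → E b q → None b (p ∷ M) → ⊥
  shared {L} {p} {q} {a} {b} {c} M h pP off (mkThree a∈ b∈ c∈ a≢b b≢c a≢c _ _ tc) only ap aR bq bL
    with cnt-first c (p ∷ M ++ q ∷ []) tc
  ... | X , t , Y , eqP , ct , cX , cY = cases (1 ≤? cnt c Y)
    where
    P : List (V G)
    P = p ∷ M ++ q ∷ []
    aP : IPath (a ∷ P)
    aP = cons ap (λ i → ∉⇒≢ (off (there i)) a∈ ∘ sym , aR i) pP
    Pb : IPath (P ++ b ∷ [])
    Pb = ip-snoc (p ∷ M) pP (E-sym bq) λ { i (here refl) → N-sym ((λ { refl → off (∈-++⁺ˡ i) b∈ }) , bL i) }
    aP′ : IPath (a ∷ X ++ t ∷ Y)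
    aP′ = subst (λ K → IPath (a ∷ K)) eqP aP
    Pb′ : IPath (X ++ t ∷ Y ++ b ∷ [])
    Pb′ = subst IPath (trans (cong (_++ b ∷ []) eqP) (++-assoc X (t ∷ Y) (b ∷ []))) Pb
    up : ∀ {z} → z ∈ X ++ t ∷ Y → z ∈ P
    up {z} = subst (z ∈_) (sym eqP)
    cases : _ → ⊥
    cases (no ¬cY) = isk (tripod h a∈ b∈ c∈ a≢b b≢c a≢c (ip-rev′ X (ip-mid [] aP′) , offX) (ip-r X Pb′ , offY) (direct (E-sym ct))
        (λ i j → ip-apart X (ip-r (a ∷ []) aP′) (∈-rev⁻ X i) j) (λ _ ()) (λ _ ())
        λ i na nb nc → ∉⇒≢ (off (up (∈-mid X))) i , λ e → none₃ (only i (up (∈-mid X)) e) na nb nc)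
      where
      none₃ : ∀ {d} → d ≡ a ⊎ d ≡ b ⊎ d ≡ c → d ≢ a → d ≢ b → d ≢ c → ⊥
      none₃ (inj₁ e) na _ _ = na e
      none₃ (inj₂ (inj₁ e)) _ nb _ = nb e
      none₃ (inj₂ (inj₂ e)) _ _ nc = nc e
      offX : ∀ {r z} → r ∈ reverse X → z ∈ L → z ≢ a → N r z
      offX {r} {z} i j na = ∉⇒≢ (off (up (∈-++⁺ˡ i′))) j , λ e → none₃ (only j (up (∈-++⁺ˡ i′)) e) na
          (λ { refl → proj₂ (ip-apart X Pb′ i′ (∈-mid Y)) e }) (λ { refl → cX i′ (E-sym e) })
        where
        i′ : r ∈ X
        i′ = ∈-rev⁻ X i
      offY : ∀ {r z} → r ∈ Y → z ∈ L → z ≢ b → N r z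
      offY i j nb = ∉⇒≢ (off (up (∈-++⁺ʳ X (there i)))) j , λ e → none₃ (only j (up (∈-++⁺ʳ X (there i))) e)
          (λ { refl → proj₂ (ip-apart (a ∷ X) aP′ (here refl) i) (E-sym e) }) nb (λ { refl → not-cnt Y ¬cY i (E-sym e) })
    cases (yes c₁) with order h a∈ b∈ c∈ a≢b b≢c a≢c | cnt-mem Y c₁
    ... | A₁ , A₂ , A₃ , h′ , perm | t₂ , t₂∈ , ct₂ =
        isk (tripod hole t∈H t₂∈H b∈H t≢t₂ (≢P b∈ (up (∈-++⁺ʳ X (there t₂∈))) ∘ sym) (≢P b∈ (up (∈-mid X)) ∘ sym) (direct ct)
            (direct ct₂) (leg , offA) (λ ()) (λ ()) (λ ()) tc′)
      where
      ⊆L : ∀ {z} → z ∈ c ∷ A₁ ++ b ∷ A₂ ++ a ∷ A₃ → z ∈ L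
      ⊆L = ∈-resp-↭ perm
      ≢P : ∀ {z y} → z ∈ L → y ∈ P → z ≢ y
      ≢P i j refl = off j i
      tail : IPath (A₁ ++ b ∷ A₂ ++ a ∷ A₃)
      tail = hole-tail h′
      in₂ : ∀ {z} → z ∈ A₂ → z ∈ L
      in₂ i = ⊆L (there (∈-++⁺ʳ A₁ (there (∈-++⁺ˡ i))))
      hb : IsHole (b ∷ (A₂ ++ a ∷ A₃) ++ c ∷ A₁)
      hb = rot (c ∷ A₁) h′
      ne₂ : ∀ {z} → z ∈ A₂ → z ≢ a × z ≢ b × z ≢ c
      ne₂ i = (λ { refl → dup (ip-r (b ∷ []) (ip-r A₁ tail)) i }) , (λ { refl → hole-∉ hb (∈-++⁺ˡ (∈-++⁺ˡ i)) }) , λ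
          { refl → hole-∉ h′ (∈-++⁺ʳ A₁ (there (∈-++⁺ˡ i))) }
        where
        dup : ∀ {a A₂ A₃} → IPath (A₂ ++ a ∷ A₃) → ¬ (a ∈ A₂)
        dup p i with ∈-∃++ i
        ... | Z , Z′ , refl = ip-∉ʳ Z (subst IPath (++-assoc Z _ _) p) (∈-mid Z′)
      far : ∀ {z y} → y ∈ P → z ∈ L → z ≢ a × z ≢ b × z ≢ c → N y z
      far i j (na , nb , nc) = ∉⇒≢ (off i) j , λ e → [ na , [ nb , nc ]′ ]′ (only j i e)
      hole : IsHole (a ∷ P ++ b ∷ A₂)
      hole = mkHole (M ++ q ∷ []) A₂ aP Pb (ip-mid A₁ tail) (λ i j → far i (in₂ j) (ne₂ j))
        (s≤s (s≤s (subst (λ k → 2 ≤ k) (sym (trans (length-++ (M ++ q ∷ [])) (cong (_+ _) (length-++ M))))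
            (+-mono-≤ (m≤n+m 1 (length M)) (s≤s z≤n)))))
      t∈H : t ∈ a ∷ P ++ b ∷ A₂
      t∈H = there (∈-++⁺ˡ (up (∈-mid X)))
      t₂∈H : t₂ ∈ a ∷ P ++ b ∷ A₂
      t₂∈H = there (∈-++⁺ˡ (up (∈-++⁺ʳ X (there t₂∈))))
      b∈H : b ∈ a ∷ P ++ b ∷ A₂
      b∈H = there (∈-mid P)
      t≢t₂ : t ≢ t₂
      t≢t₂ refl = ip-∉ʳ X (ip-r (a ∷ []) aP′) t₂∈
      c∉H : ¬ (c ∈ a ∷ P ++ b ∷ A₂)
      c∉H (here e) = a≢c (sym e)
      c∉H (there i) with ∈-++⁻ P i
      ... | inj₁ j = off j c∈
      ... | inj₂ (here e) = b≢c (sym e)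
      ... | inj₂ (there j) = proj₂ (proj₂ (ne₂ j)) refl
      leg : IPath (c ∷ A₁ ++ b ∷ [])
      leg = hole-arc A₁ h′ (∈-mid A₂)
      offA : ∀ {r z} → r ∈ A₁ → z ∈ a ∷ P ++ b ∷ A₂ → z ≢ b → N r z
      offA i (here refl) _ = ip-apart A₁ tail i (∈-mid A₂)
      offA {r} i (there j) nb with ∈-++⁻ P j
      ... | inj₁ k = N-sym (far k (⊆L (there (∈-++⁺ˡ i))) ((λ { refl → proj₁ (ip-apart A₁ tail i (∈-mid A₂)) refl }) ,
                     (λ { refl → hole-∉ hb (∈-++⁺ʳ (A₂ ++ a ∷ A₃) (there i)) }) , (λ { refl → hole-∉ h′ (∈-++⁺ˡ i) })))
      ... | inj₂ (here e) = ⊥-elim (nb e)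
      ... | inj₂ (there k) = ip-apart A₁ tail i (∈-++⁺ˡ k)
      tc′ : ∀ {z} → z ∈ a ∷ P ++ b ∷ A₂ → z ≢ t → z ≢ t₂ → z ≢ b → N c z
      tc′ j n₁ n₂ _ = ∉⇒≢ c∉H j , λ e → [ n₁ , n₂ ]′ (only-two hole c∉H t∈H t₂∈H t≢t₂ ct ct₂ j e)

  module ThreeLong {L p q} M (h : IsHole L) (pP : IPath (p ∷ M ++ q ∷ [])) (off : ∀ {z} → z ∈ p ∷ M ++ q ∷ [] → ¬ (z ∈ L))
    (no-left : ∀ {x y z} → ¬ Three L (p ∷ M) x y z) (no-right : ∀ {x y z} → ¬ Three L (M ++ q ∷ []) x y z) where

    P : List (V G)
    P = p ∷ M ++ q ∷ []

    at-q : ∀ {b} → 1 ≤ cnt b P → ¬ (1 ≤ cnt b (p ∷ M)) → E b q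
    at-q {b} c ¬l with cnt-mem P c
    ... | y , i , e with ∈-++⁻ (p ∷ M) i
    ...   | inj₁ j = ⊥-elim (not-cnt (p ∷ M) ¬l j e)
    ...   | inj₂ (here refl) = e

    at-p : ∀ {a} → 1 ≤ cnt a P → ¬ (1 ≤ cnt a (M ++ q ∷ [])) → E a p
    at-p {a} c ¬r with cnt-mem P c
    ... | y , here refl , e = e
    ... | y , there j , e = ⊥-elim (not-cnt (M ++ q ∷ []) ¬r j e)

    left-or-right : ∀ {d} → 1 ≤ cnt d P → 1 ≤ cnt d (p ∷ M) ⊎ 1 ≤ cnt d (M ++ q ∷ [])
    left-or-right {d} c with cnt-mem P c
    ... | y , here refl , e = inj₁ (cnt-∈ (p ∷ M) (here refl) e)
    ... | y , there j , e = inj₂ (cnt-∈ (M ++ q ∷ []) j e)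

    rev-↭ : q ∷ reverse M ↭ M ++ q ∷ []
    rev-↭ = ↭-trans (prep q (↭-reverse M)) (↭-++-comm (q ∷ []) M)

    -- The third vertex c is private to p, private to q, or seen from both truncated paths. In the
    -- last case a fourth attachment would complete a triple on one truncation, so a, b, c are the
    -- only ones and `shared` applies.
    resolve : ∀ {a b c} → Three L P a b c → ¬ (1 ≤ cnt a (M ++ q ∷ [])) → ¬ (1 ≤ cnt b (p ∷ M)) → ⊥
    resolve {a} {b} {c} T@(mkThree a∈ b∈ c∈ a≢b b≢c a≢c ta tb tc) ¬ar ¬bl with 1 ≤? cnt c (M ++ q ∷ []) | 1 ≤? cnt c (p ∷ M)
    ... | no ¬cr | _ = two-private M h pP off no-left a∈ b∈ c∈ a≢b b≢c a≢c (at-p ta ¬ar) (not-cnt _ ¬ar) (at-p tc ¬cr)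
            (not-cnt _ ¬cr) (at-q tb ¬bl)
    ... | yes cr | no ¬cl = two-private (reverse M) h (ip-rev′ M pP) (off ∘ back) no-left′ b∈ a∈ c∈ (a≢b ∘ sym) a≢c b≢c
          (at-q tb ¬bl) (λ i → not-cnt _ ¬bl (back′ i)) (at-q tc ¬cl) (λ i → not-cnt _ ¬cl (back′ i)) (at-p ta ¬ar)
      where
      back′ : ∀ {z} → z ∈ reverse M ++ p ∷ [] → z ∈ p ∷ M
      back′ i = [ (λ j → there (∈-rev⁻ M j)) , (λ { (here e) → here e }) ]′ (∈-++⁻ (reverse M) i)
      back : ∀ {z} → z ∈ q ∷ reverse M ++ p ∷ [] → z ∈ P
      back (here refl) = there (∈-mid M)
      back (there i) with back′ i
      ... | here e = here e
      ... | there j = there (∈-++⁺ˡ j)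
      no-left′ : ∀ {x y z} → ¬ Three L (q ∷ reverse M) x y z
      no-left′ {x} {y} {z} (mkThree i j k xy yz xz r s t) = no-right (mkThree i j k xy yz xz
        (subst (1 ≤_) (cnt-↭ x rev-↭) r) (subst (1 ≤_) (cnt-↭ y rev-↭) s) (subst (1 ≤_) (cnt-↭ z rev-↭) t))
    ... | yes cr | yes cl = shared M h pP off T only (at-p ta ¬ar) (not-cnt _ ¬ar) (at-q tb ¬bl) (not-cnt _ ¬bl)
      where
      a-left : 1 ≤ cnt a (p ∷ M)
      a-left = cnt-∈ (p ∷ M) (here refl) (at-p ta ¬ar)
      b-right : 1 ≤ cnt b (M ++ q ∷ [])
      b-right = cnt-∈ (M ++ q ∷ []) (∈-mid M) (at-q tb ¬bl)
      only : ∀ {d t} → d ∈ L → t ∈ P → E t d → d ≡ a ⊎ d ≡ b ⊎ d ≡ c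
      only {d} i j e with d ≟ a | d ≟ b | d ≟ c
      ... | yes r | _ | _ = inj₁ r
      ... | no _ | yes r | _ = inj₂ (inj₁ r)
      ... | no _ | no _ | yes r = inj₂ (inj₂ r)
      ... | no na | no nb | no nc with left-or-right (cnt-∈ P j (E-sym e))
      ...   | inj₁ l = ⊥-elim (no-left (mkThree a∈ c∈ i a≢c (nc ∘ sym) (na ∘ sym) a-left cl l))
      ...   | inj₂ r = ⊥-elim (no-right (mkThree b∈ c∈ i b≢c (nc ∘ sym) (nb ∘ sym) b-right cr r))

    -- The path without p still sees b, so by minimality it misses a or c.
    pick : ∀ {a b c} → Three L P a b c → ¬ (1 ≤ cnt b (p ∷ M)) → ⊥
    pick {a} {b} {c} T ¬bl with 1 ≤? cnt a (M ++ q ∷ []) | 1 ≤? cnt c (M ++ q ∷ [])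
    ... | no ¬ar | _ = resolve T ¬ar ¬bl
    ... | yes _ | no ¬cr = resolve (swap₁₂ (swap₂₃ (swap₁₂ T))) ¬cr ¬bl
    ... | yes ar | yes cr = no-right (mkThree (Three.a∈ T) (Three.b∈ T) (Three.c∈ T) (Three.a≢b T) (Three.b≢c T) (Three.a≢c T) ar
            ([ (λ l → ⊥-elim (¬bl l)) , (λ r → r) ]′ (left-or-right (Three.tb T))) cr)

    impossible : ∀ {a b c} → ¬ Three L P a b c
    impossible {a} {b} {c} T with 1 ≤? cnt a (p ∷ M) | 1 ≤? cnt b (p ∷ M) | 1 ≤? cnt c (p ∷ M)
    ... | no ¬al | _ | _ = pick (swap₁₂ T) ¬al
    ... | yes _ | no ¬bl | _ = pick T ¬bl
    ... | yes _ | yes _ | no ¬cl = pick (swap₂₃ T) ¬cl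
    ... | yes al | yes bl | yes cl = no-left (mkThree (Three.a∈ T) (Three.b∈ T) (Three.c∈ T) (Three.a≢b T) (Three.b≢c T)
            (Three.a≢c T) al bl cl)

  -- Induction on the length: dropping either end leaves a path seeing at most two vertices, as
  -- `ThreeLong` assumes. A single vertex seeing three would be the hub of a wheel.
  no-three : ∀ k {L P a b c} → length P ≤ k → IsHole L → IPath P → (∀ {z} → z ∈ P → ¬ (z ∈ L)) → ¬ Three L P a b c
  no-three _ {P = []} _ _ _ _ T with Three.ta T
  ... | ()
  no-three _ {L} {p ∷ []} _ h _ off (mkThree a∈ b∈ c∈ a≢b b≢c a≢c ta tb tc)
    with ≤-trans (three-cnt a≢b b≢c a≢c a∈ b∈ c∈ (at ta) (at tb) (at tc)) (no-wheel h (off (here refl)))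
    where
    at : ∀ {z} → 1 ≤ cnt z (p ∷ []) → E p z
    at c with cnt-mem (p ∷ []) c
    ... | _ , here refl , e = E-sym e
  ... | s≤s (s≤s ())
  no-three (suc k) {L} {p ∷ m ∷ P′} {a} {b} {c} (s≤s le) h pP off T with snoc-view m P′
  ... | M , q , eq = ThreeLong.impossible M h (subst (λ K → IPath (p ∷ K)) eq pP) (λ {z} i → off (back i))
          (no-three k (≤-trans (≤-reflexive (trans (+-comm 1 (length M)) (trans (sym (length-++ M)) (cong length (sym eq))))) le)
              h
            (ip-l (p ∷ M) (subst (λ K → IPath (p ∷ K)) eq pP)) (λ i → off (back (∈-++⁺ˡ i))))
          (no-three k (≤-trans (≤-reflexive (cong length (sym eq))) le) h (subst IPath eq (ip-r (p ∷ []) pP))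
              (λ i → off (back (there i))))
          (subst (λ K → Three L (p ∷ K) a b c) eq T)
    where
    back : ∀ {z} → z ∈ p ∷ M ++ q ∷ [] → z ∈ p ∷ m ∷ P′
    back {z} = subst (λ K → z ∈ p ∷ K) (sym eq)

-- Cycles as subgraphs, and sets attached to them.

module Cycles (G : Graph) where
  open Paths G

  sp-cat : ∀ A {x y B} → SPath (A ++ x ∷ []) → E x y → SPath (y ∷ B) → Across _≢_ (A ++ x ∷ []) (y ∷ B) → SPath (A ++ x ∷ y ∷ B)
  sp-cat A {x} p e q d = ip-glue A p (cons e (λ i → d (∈-mid A) (there i)) q) (λ i j → d (∈-++⁺ˡ i) j)

  sp-disjoint : ∀ A {B} → SPath (A ++ B) → Across _≢_ A B
  sp-disjoint (a ∷ []) {b ∷ B} (cons e f p) (here refl) (here refl) = E⇒≢ e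
  sp-disjoint (a ∷ []) {b ∷ B} (cons e f p) (here refl) (there j) = f j
  sp-disjoint (a ∷ a′ ∷ A) (cons e f p) (here refl) j = f (∈-++⁺ʳ A j)
  sp-disjoint (a ∷ a′ ∷ A) (cons e f p) (there i) j = sp-disjoint (a′ ∷ A) p i j

  -- M may be empty, so that a mere edge counts; where it matters this degenerate case is excluded
  -- by three distinct attachments or by a bound on the length of M.
  record Cycle (a : V G) (M : List (V G)) (b : V G) : Set where
    constructor cycle
    field
      path  : SPath (a ∷ M ++ b ∷ [])
      close : E b a

  open Cycle

  verts : V G → List (V G) → V G → List (V G)
  verts a M b = a ∷ M ++ b ∷ []

  cycle-turn : ∀ {a M b} X {x y} Y → verts a M b ≡ X ++ x ∷ y ∷ Y → Cycle a M b →
    Cycle y (Y ++ X) x × (∀ {z} → z ∈ verts y (Y ++ X) x → z ∈ verts a M b) × (∀ {z} → z ∈ verts a M b → z ∈ verts y (Y ++ X) x)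
  cycle-turn {a} {M} {b} X {x} {y} Y eq (cycle p e) = cycle path′ (ip-edge X p′) , fwd , bwd
    where
    p′ : SPath (X ++ x ∷ y ∷ Y)
    p′ = subst SPath eq p
    p″ : SPath ((X ++ x ∷ []) ++ y ∷ Y)
    p″ = subst SPath (sym (++-assoc X (x ∷ []) (y ∷ Y))) p′
    ends : ∀ X Y → verts a M b ≡ X ++ x ∷ y ∷ Y → ∃[ Y₁ ] ∃[ X₁ ] (y ∷ Y ≡ Y₁ ++ b ∷ [] × X ++ x ∷ [] ≡ a ∷ X₁)
    ends X Y eq with snoc-view y Y
    ... | Y₁ , b′ , eqY with ∷ʳ-injective (a ∷ M) (X ++ x ∷ Y₁) (trans eq
            (trans (cong (λ K → X ++ x ∷ K) eqY) (sym (++-assoc X (x ∷ Y₁) (b′ ∷ [])))))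
    ends [] Y eq | Y₁ , b′ , eqY | eqaM , refl = Y₁ , [] , eqY , cong (_∷ []) (sym (proj₁ (∷-injective eqaM)))
    ends (x₀ ∷ X) Y eq | Y₁ , b′ , eqY | eqaM , refl = Y₁ , X ++ x ∷ [] , eqY , cong (_∷ X ++ x ∷ [])
        (sym (proj₁ (∷-injective eqaM)))
    path′ : SPath (y ∷ (Y ++ X) ++ x ∷ [])
    path′ with ends X Y eq
    ... | Y₁ , X₁ , eqY , eqX = subst SPath (trans (trans (sym (++-assoc Y₁ (b ∷ []) (a ∷ X₁))) (sym (cong₂ _++_ eqY eqX)))
            (cong (y ∷_) (sym (++-assoc Y X (x ∷ [])))))
          (sp-cat Y₁ (subst SPath eqY (ip-r (X ++ x ∷ []) p″)) e (subst SPath eqX (ip-l (X ++ x ∷ []) p″))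
            λ {z} {w} i j r → sp-disjoint (X ++ x ∷ []) p″ (subst (w ∈_) (sym eqX) j) (subst (z ∈_) (sym eqY) i) (sym r))
    fwd : ∀ {z} → z ∈ y ∷ (Y ++ X) ++ x ∷ [] → z ∈ verts a M b
    fwd {z} i = subst (z ∈_) (sym eq) ([ [ (λ k → ∈-++⁺ʳ X (there k)) , ∈-++⁺ˡ ]′ ∘ ∈-++⁻ (y ∷ Y) , (λ { (here refl) → ∈-mid X })
        ]′ (∈-++⁻ (y ∷ Y ++ X) i))
    bwd : ∀ {z} → z ∈ verts a M b → z ∈ y ∷ (Y ++ X) ++ x ∷ []
    bwd {z} i with ∈-++⁻ X (subst (z ∈_) eq i)
    ... | inj₁ j = there (∈-++⁺ˡ (∈-++⁺ʳ Y j))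
    ... | inj₂ (here refl) = ∈-mid (y ∷ Y ++ X)
    ... | inj₂ (there (here e)) = here e
    ... | inj₂ (there (there j)) = there (∈-++⁺ˡ (∈-++⁺ˡ j))

  record Connected (D : V G → Set) : Set where
    field
      root  : V G
      joins : ∀ {z} → D z → ∃[ l ] Walk D z l root

  open Connected

  connect : ∀ {D u v} → Connected D → D u → D v → ∃[ l ] Walk D u l v
  connect C du dv = walk-trans (proj₂ (joins C du)) (walk-rev (proj₂ (joins C dv)))

  record Attached (D : V G → Set) (L : List (V G)) : Set where
    field
      {a b c da db dc} : V G
      a∈ : a ∈ L
      b∈ : b ∈ L
      c∈ : c ∈ L
      a≢b : a ≢ b
      b≢c : b ≢ c
      a≢c : a ≢ c
      Da : D da
      Db : D db
      Dc : D dc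
      ea : E da a
      eb : E db b
      ec : E dc c

-- Connected sets seeing three vertices of a cycle.

module Components (G : Graph) (tri : Paths.TriangleFree G) (isk : ¬ ContainsISK4 G)
  (no-wheel : Paths.WheelFree G) (no-K₃₃ : Paths.K₃₃-Free G) where
  open Paths G
  open Detect G
  open Wheels G tri isk
  open GoodWheels G tri isk
  open Attach G tri isk no-wheel no-K₃₃
  open Cycles G
  open IsHole

  -- P is a path from a to b off the hole, Z a path from c that reaches P only at its last vertex z.
  record TwoPaths : Set where
    constructor two-paths
    field
      {L P T C Z′ Z″} : List (V G)
      {a b c p q z z₁} : V G
      h : IsHole L
      a∈ : a ∈ L
      b∈ : b ∈ L
      c∈ : c ∈ L
      a≢b : a ≢ b
      b≢c : b ≢ c
      a≢c : a ≢ c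
      eqp : P ≡ p ∷ T
      eqq : P ≡ C ++ q ∷ []
      eqz : z₁ ∷ Z′ ≡ Z″ ++ z ∷ []
      pP : IPath P
      pZ : IPath (z₁ ∷ Z′)
      P∉ : ∀ {y} → y ∈ P → ¬ (y ∈ L)
      Z∉ : ∀ {y} → y ∈ z₁ ∷ Z′ → ¬ (y ∈ L)
      ap : E a p
      aT : None a T
      bq : E b q
      bC : None b C
      cz : E c z₁
      cZ : None c Z′
      z∉P : ¬ (z ∈ P)
      tz : 1 ≤ cnt z P
      far : Z″ ## P

  module Tripods (tp : TwoPaths) where
    open TwoPaths tp

    p∈ : p ∈ P
    p∈ = subst (p ∈_) (sym eqp) (here refl)
    q∈ : q ∈ P
    q∈ = subst (q ∈_) (sym eqq) (∈-mid C)

    Pd : ∀ {d t} → d ∈ L → t ∈ P → E t d → d ≡ a ⊎ d ≡ b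
    Pd {d} {t} i j e with d ≟ a | d ≟ b
    ... | yes r | _ = inj₁ r
    ... | no _ | yes r = inj₂ r
    ... | no na | no nb = ⊥-elim (no-three (length P) ≤-refl h pP P∉ (mkThree a∈ b∈ i a≢b (nb ∘ sym) (na ∘ sym)
            (cnt-∈ P p∈ ap) (cnt-∈ P q∈ bq) (cnt-∈ P j (E-sym e))))

    cP : ∀ {t} → t ∈ P → ¬ E t c
    cP i e = [ (λ r → a≢c (sym r)) , (λ r → b≢c (sym r)) ]′ (Pd c∈ i e)

    pZz : IPath (Z″ ++ z ∷ [])
    pZz = subst IPath eqz pZ

    inZ : ∀ {y} → y ∈ Z″ ++ z ∷ [] → y ∈ z₁ ∷ Z′
    inZ {y} = subst (y ∈_) (sym eqz)

    -- Extending Z along an end of P gives an induced path, which can see at most two vertices of L.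
    extend : ∀ {s} S → z ∷ [] ## S → E z s → IPath (s ∷ S) → (∀ {y} → y ∈ s ∷ S → y ∈ P) → IPath (Z″ ++ z ∷ s ∷ S)
    extend S zS zs pS ⊆P = ip-glue Z″ pZz (cons zs (zS (here refl)) pS) (λ i j → far i (⊆P j))

    -- The path along Z and on to y sees c at its start and g at y; by `no-three` it sees no third
    -- vertex of the hole.
    no-extra : ∀ {s y d t} S → z ∷ [] ## S → E z s → IPath (s ∷ S) → (∀ {y} → y ∈ s ∷ S → y ∈ P) → y ∈ s ∷ S →
      ∀ {g} → g ∈ L → g ≢ c → E g y → d ∈ L → t ∈ z₁ ∷ Z′ → E t d → d ≡ g ⊎ d ≡ c
    no-extra {s} {y} {d} {t} S zS zs pS ⊆P y∈ {g} g∈ g≢c gy d∈ t∈ td with d ≟ g | d ≟ c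
    ... | yes r | _ = inj₁ r
    ... | no _ | yes r = inj₂ r
    ... | no ng | no nc = ⊥-elim (no-three (length (Z″ ++ z ∷ s ∷ S)) ≤-refl h (extend S zS zs pS ⊆P) off
          (mkThree g∈ c∈ d∈ g≢c (nc ∘ sym) (ng ∘ sym) (cnt-∈ W (∈-++⁺ʳ Z″ (there y∈)) gy) (cnt-∈ W (inW (here refl)) cz)
              (cnt-∈ W (inW t∈) (E-sym td))))
      where
      W : List (V G)
      W = Z″ ++ z ∷ s ∷ S
      inW : ∀ {y} → y ∈ z₁ ∷ Z′ → y ∈ W
      inW {y} i = [ ∈-++⁺ˡ , (λ { (here refl) → ∈-mid Z″ }) ]′ (∈-++⁻ Z″ (subst (y ∈_) eqz i))
      off : ∀ {y} → y ∈ W → ¬ (y ∈ L)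
      off i with ∈-++⁻ Z″ i
      ... | inj₁ j = Z∉ (inZ (∈-++⁺ˡ j))
      ... | inj₂ (here refl) = Z∉ (inZ (∈-mid Z″))
      ... | inj₂ (there j) = P∉ (⊆P j)

    aP : IPath (a ∷ P)
    aP = subst (λ K → IPath (a ∷ K)) (sym eqp) (cons ap (λ i → ∉⇒≢ (P∉ (inT i)) a∈ ∘ sym , aT i) (subst IPath eqp pP))
      where
      inT : ∀ {y} → y ∈ T → y ∈ P
      inT {y} i = subst (y ∈_) (sym eqp) (there i)

    Pb : IPath (P ++ b ∷ [])
    Pb = subst (λ K → IPath (K ++ b ∷ [])) (sym eqq) (ip-snoc C (subst IPath eqq pP) (E-sym bq)
      λ { i (here refl) → N-sym ((λ { refl → P∉ (inC i) b∈ }) , bC i) })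
      where
      inC : ∀ {y} → y ∈ C → y ∈ P
      inC {y} i = subst (y ∈_) (sym eqq) (∈-++⁺ˡ i)

    cZz : IPath (c ∷ Z″ ++ z ∷ [])
    cZz = subst (λ K → IPath (c ∷ K)) eqz (cons cz (λ i → ∉⇒≢ (Z∉ (there i)) c∈ ∘ sym , cZ i) pZ)

    -- If s is the only neighbour of z on P, then s is the centre, with legs along P to a and b and
    -- along Z to c. Otherwise z is the centre, with legs through its first and last neighbours on
    -- P; these are not adjacent, as there are no triangles, so the legs stay apart.
    split-P : ∀ X {s} Y → P ≡ X ++ s ∷ Y → None z X → E z s → ⊥
    split-P X {s} Y eq zX zs with 1 ≤? cnt z Y
    ... | no ¬c = isk (tripod h a∈ b∈ c∈ a≢b b≢c a≢c (ip-rev′ X (ip-mid [] aP′) , offX) (ip-r X Pb′ , offY)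
            (ip-rev′ (Z″ ++ z ∷ []) cZs , offZ) (λ i j → ip-apart X (subst IPath eq pP) (∈-rev⁻ X i) j)
            (λ i j → N-sym (ZX (∈-rev⁻ (Z″ ++ z ∷ []) j) (∈-rev⁻ X i))) (λ i j → N-sym (ZY (∈-rev⁻ (Z″ ++ z ∷ []) j) i))
            λ i na nb nc → ∉⇒≢ (P∉ s∈) i , λ e → [ na , nb ]′ (Pd i s∈ e))
      where
      up : ∀ {y} → y ∈ X ++ s ∷ Y → y ∈ P
      up {y} = subst (y ∈_) (sym eq)
      s∈ : s ∈ P
      s∈ = up (∈-mid X)
      aP′ : IPath (a ∷ X ++ s ∷ Y)
      aP′ = subst (λ K → IPath (a ∷ K)) eq aP
      Pb′ : IPath (X ++ s ∷ Y ++ b ∷ [])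
      Pb′ = subst IPath (trans (cong (_++ b ∷ []) eq) (++-assoc X (s ∷ Y) (b ∷ []))) Pb
      zY : None z Y
      zY = not-cnt Y ¬c
      ZX : (Z″ ++ z ∷ []) ## X
      ZX = ##-++ˡ Z″ (λ i j → far i (up (∈-++⁺ˡ j))) λ { (here refl) j → (λ { refl → z∉P (up (∈-++⁺ˡ j)) }) , zX j }
      ZY : (Z″ ++ z ∷ []) ## Y
      ZY = ##-++ˡ Z″ (λ i j → far i (up (∈-++⁺ʳ X (there j)))) λ { (here refl) j → (λ { refl → z∉P (up (∈-++⁺ʳ X (there j))) }) ,
          zY j }
      pX : IPath (s ∷ reverse X)
      pX = subst IPath (reverse-mid X) (ip-rev (ip-mid′ (subst IPath eq pP)))
        where
        ip-mid′ : IPath (X ++ s ∷ Y) → IPath (X ++ s ∷ [])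
        ip-mid′ p = ip-l (X ++ s ∷ []) (subst IPath (sym (++-assoc X (s ∷ []) Y)) p)
      p∈X : p ∈ s ∷ reverse X
      p∈X = in-front X eq
        where
        in-front : ∀ X → P ≡ X ++ s ∷ Y → p ∈ s ∷ reverse X
        in-front [] e = here (proj₁ (∷-injective (trans (sym eqp) e)))
        in-front (x ∷ X) e = there (∈-resp-↭ (↭-sym (↭-reverse (x ∷ X))) (here (proj₁ (∷-injective (trans (sym eqp) e)))))
      q∈Y : q ∈ s ∷ Y
      q∈Y with snoc-view s Y
      ... | Y₁ , q′ , eqY with ∷ʳ-injective C (X ++ Y₁) (trans (sym eqq)
              (trans eq (trans (cong (X ++_) eqY) (sym (++-assoc X Y₁ (q′ ∷ []))))))
      ...   | _ , refl = subst (q ∈_) (sym eqY) (∈-mid Y₁)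
      cs : N c s
      cs = ∉⇒≢ (P∉ s∈) c∈ ∘ sym , cP s∈ ∘ E-sym
      cZs : IPath (c ∷ (Z″ ++ z ∷ []) ++ s ∷ [])
      cZs = ip-snoc (c ∷ Z″) cZz zs (##-∷ˡ (##-sing cs) (λ { i (here refl) → far i s∈ }))
      Zd : ∀ {d t} → d ∈ L → t ∈ z₁ ∷ Z′ → E t d → d ≡ c
      -- Extending Z towards a and towards b leaves only a, c and only b, c; since a and b differ, Z
      -- sees c alone.
      Zd i j e with no-extra (reverse X) (λ { (here refl) k → ZX (∈-mid Z″) (∈-rev⁻ X k) }) zs pX
          (λ { (here refl) → s∈ ; (there k) → up (∈-++⁺ˡ (∈-rev⁻ X k)) }) p∈X a∈ a≢c ap i j e
                 | no-extra Y (λ { (here refl) k → ZY (∈-mid Z″) k }) zs (ip-r X (subst IPath eq pP)) (λ k → up (∈-++⁺ʳ X k)) q∈Y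
                     b∈ b≢c bq i j e
      ... | inj₂ r | _ = r
      ... | inj₁ _ | inj₂ r = r
      ... | inj₁ r | inj₁ r′ = ⊥-elim (a≢b (trans (sym r) r′))
      offX : ∀ {r y} → r ∈ reverse X → y ∈ L → y ≢ a → N r y
      offX i j na = ∉⇒≢ (P∉ (up (∈-++⁺ˡ (∈-rev⁻ X i)))) j , λ e → [ na ,
          (λ { refl → proj₂ (ip-apart X Pb′ (∈-rev⁻ X i) (∈-mid Y)) e }) ]′ (Pd j (up (∈-++⁺ˡ (∈-rev⁻ X i))) e)
      offY : ∀ {r y} → r ∈ Y → y ∈ L → y ≢ b → N r y
      offY i j nb = ∉⇒≢ (P∉ (up (∈-++⁺ʳ X (there i)))) j , λ e → [
          (λ { refl → proj₂ (ip-apart (a ∷ X) aP′ (here refl) i) (E-sym e) }) , nb ]′ (Pd j (up (∈-++⁺ʳ X (there i))) e)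
      offZ : ∀ {r y} → r ∈ reverse (Z″ ++ z ∷ []) → y ∈ L → y ≢ c → N r y
      offZ i j nc = ∉⇒≢ (Z∉ (inZ (∈-rev⁻ (Z″ ++ z ∷ []) i))) j , λ e → nc (Zd j (inZ (∈-rev⁻ (Z″ ++ z ∷ []) i)) e)
    ... | yes c₁ with cnt-last z Y c₁
    ... | [] , s′ , Y₂ , refl , zs′ , zY₂ , _ = tri zs (ip-edge X (subst IPath eq pP)) zs′
    ... | m ∷ Mid , s′ , Y₂ , refl , zs′ , zY₂ , _ =
          isk (tripod h a∈ b∈ c∈ a≢b b≢c a≢c (legA , offA) (legB , offB) (ip-rev′ Z″ cZz , offC) AB
            (λ i j → N-sym (far (∈-rev⁻ Z″ j) (inA i))) (λ i j → N-sym (far (∈-rev⁻ Z″ j) (inB i)))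
            λ i na nb nc → ∉⇒≢ (Z∉ (inZ (∈-mid Z″))) i , λ e → nc (Zd i (inZ (∈-mid Z″)) e))
      where
      up : ∀ {y} → y ∈ X ++ s ∷ (m ∷ Mid) ++ s′ ∷ Y₂ → y ∈ P
      up {y} = subst (y ∈_) (sym eq)
      pP′ : IPath (X ++ s ∷ (m ∷ Mid) ++ s′ ∷ Y₂)
      pP′ = subst IPath eq pP
      s∈ : s ∈ P
      s∈ = up (∈-mid X)
      inA : ∀ {y} → y ∈ s ∷ reverse X → y ∈ P
      inA (here refl) = s∈
      inA (there i) = up (∈-++⁺ˡ (∈-rev⁻ X i))
      inB : ∀ {y} → y ∈ s′ ∷ Y₂ → y ∈ P
      inB i = up (∈-++⁺ʳ X (there (∈-++⁺ʳ (m ∷ Mid) i)))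
      aP′ : IPath (a ∷ X ++ s ∷ (m ∷ Mid) ++ s′ ∷ Y₂)
      aP′ = subst (λ K → IPath (a ∷ K)) eq aP
      eqB : P ≡ (X ++ s ∷ m ∷ Mid) ++ s′ ∷ Y₂
      eqB = trans eq (sym (++-assoc X (s ∷ m ∷ Mid) (s′ ∷ Y₂)))
      Pb′ : IPath ((X ++ s ∷ m ∷ Mid) ++ s′ ∷ Y₂ ++ b ∷ [])
      Pb′ = subst IPath (trans (cong (_++ b ∷ []) eqB) (++-assoc (X ++ s ∷ m ∷ Mid) (s′ ∷ Y₂) (b ∷ []))) Pb
      zX′ : z ∷ [] ## reverse X
      zX′ (here refl) j = (λ { refl → z∉P (up (∈-++⁺ˡ (∈-rev⁻ X j))) }) , zX (∈-rev⁻ X j)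
      zY′ : z ∷ [] ## Y₂
      zY′ (here refl) j = (λ { refl → z∉P (inB (there j)) }) , zY₂ j
      pX : IPath (s ∷ reverse X ++ a ∷ [])
      pX = ip-rev′ X (ip-mid [] aP′)
      p∈X : p ∈ s ∷ reverse X
      p∈X = in-front X eq
        where
        in-front : ∀ X → P ≡ X ++ s ∷ (m ∷ Mid) ++ s′ ∷ Y₂ → p ∈ s ∷ reverse X
        in-front [] e = here (proj₁ (∷-injective (trans (sym eqp) e)))
        in-front (x ∷ X) e = there (∈-resp-↭ (↭-sym (↭-reverse (x ∷ X))) (here (proj₁ (∷-injective (trans (sym eqp) e)))))
      q∈Y : q ∈ s′ ∷ Y₂
      q∈Y with snoc-view s′ Y₂
      ... | Y₁ , q′ , eqY with ∷ʳ-injective C ((X ++ s ∷ m ∷ Mid) ++ Y₁)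
              (trans (sym eqq) (trans eqB (trans (cong ((X ++ s ∷ m ∷ Mid) ++_) eqY)
              (sym (++-assoc (X ++ s ∷ m ∷ Mid) Y₁ (q′ ∷ []))))))
      ...   | _ , refl = subst (q ∈_) (sym eqY) (∈-mid Y₁)
      Zd : ∀ {d t} → d ∈ L → t ∈ z₁ ∷ Z′ → E t d → d ≡ c
      Zd i j e with no-extra (reverse X) zX′ zs (ip-l (s ∷ reverse X) pX) inA p∈X a∈ a≢c ap i j e
                 | no-extra Y₂ zY′ zs′ (ip-l (s′ ∷ Y₂) (ip-r (X ++ s ∷ m ∷ Mid) Pb′)) inB q∈Y b∈ b≢c bq i j e
      ... | inj₂ r | _ = r
      ... | inj₁ _ | inj₂ r = r
      ... | inj₁ r | inj₁ r′ = ⊥-elim (a≢b (trans (sym r) r′))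
      nz : ∀ {d} → d ∈ L → d ≢ c → N z d
      nz i nc = ∉⇒≢ (Z∉ (inZ (∈-mid Z″))) i , λ e → nc (Zd i (inZ (∈-mid Z″)) e)
      legA : IPath (z ∷ (s ∷ reverse X) ++ a ∷ [])
      legA = cons zs (λ i → [ zX′ (here refl) , (λ { (here refl) → nz a∈ a≢c }) ]′ (∈-++⁻ (reverse X) i)) pX
      legB : IPath (z ∷ (s′ ∷ Y₂) ++ b ∷ [])
      legB = cons zs′ (λ i → [ zY′ (here refl) , (λ { (here refl) → nz b∈ b≢c }) ]′ (∈-++⁻ Y₂ i)) (ip-r (X ++ s ∷ m ∷ Mid) Pb′)
      AB : (s ∷ reverse X) ## (s′ ∷ Y₂)
      AB (here refl) j = ip-apart (X ++ s ∷ []) (subst IPath (sym (++-assoc X (s ∷ []) _)) pP′) (∈-mid X) (∈-++⁺ʳ Mid j)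
      AB (there i) j = ip-apart X pP′ (∈-rev⁻ X i) (∈-++⁺ʳ (m ∷ Mid) j)
      offA : ∀ {r y} → r ∈ s ∷ reverse X → y ∈ L → y ≢ a → N r y
      offA {r} i j na = ∉⇒≢ (P∉ (inA i)) j , λ e → [ na , (λ { refl → proj₂ (ip-apart (X ++ s ∷ m ∷ Mid) Pb′ (sX i) (∈-mid Y₂)) e
          }) ]′ (Pd j (inA i) e)
        where
        sX : r ∈ s ∷ reverse X → r ∈ X ++ s ∷ m ∷ Mid
        sX (here refl) = ∈-mid X
        sX (there k) = ∈-++⁺ˡ (∈-rev⁻ X k)
      offB : ∀ {r y} → r ∈ s′ ∷ Y₂ → y ∈ L → y ≢ b → N r y
      offB i j nb = ∉⇒≢ (P∉ (inB i)) j , λ e → [ (λ { refl → proj₂ (ip-apart (a ∷ X) aP′ (here refl) (∈-++⁺ʳ (m ∷ Mid) i))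
          (E-sym e) }) , nb ]′ (Pd j (inB i) e)
      offC : ∀ {r y} → r ∈ reverse Z″ → y ∈ L → y ≢ c → N r y
      offC i j nc = ∉⇒≢ (Z∉ (inZ (∈-++⁺ˡ (∈-rev⁻ Z″ i)))) j , λ e → nc (Zd j (inZ (∈-++⁺ˡ (∈-rev⁻ Z″ i))) e)

    impossible : ⊥
    impossible with cnt-first z P tz
    ... | X , s , Y , eq , zs , zX , _ = split-P X Y eq zX zs

  -- On an induced path inside D, P runs from the last neighbour of a to the first neighbour of b
  -- after it. A second induced path, from an attachment of c to p, is cut at its first vertex z on
  -- or next to P, and starts at its last neighbour of c up to there. The vertex z is off P: its
  -- predecessor would have touched P earlier, or c would see P, against `no-three`.
  hole-attached : ∀ {D L} → IsHole L → Connected D → (∀ {z} → D z → ¬ (z ∈ L)) → ¬ Attached D L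
  hole-attached {D} {L} h conn off A with connect conn (Attached.Da A) (Attached.Db A)
  ... | _ , w₀ with shorten w₀
  ... | P₀ , pP₀ , w , _ with cnt-last a P₀ (cnt-∈ P₀ (walk-start∈ w) (E-sym ea))
    where open Attached A
  ... | X , p , B , refl , ap , aB , _ with cnt-first b (p ∷ B) (cnt-∈ (p ∷ B) (walk-end∈ (walk-r X w)) (E-sym eb))
    where open Attached A
  ... | C , q , B₂ , eqB , bq , bC , _ with connect conn (Attached.Dc A) (walk-all w (∈-mid X))
  ... | _ , w₁ with shorten w₁
  ... | W , pW , w₂ , _ = found (first-split (λ y → mem? _≟_ y P ⊎-dec (1 ≤? cnt y P)) W)
    where
    open Attached A
    P : List (V G)
    P = C ++ q ∷ []
    pP : IPath P
    pP = ip-l P (subst IPath (trans eqB (sym (++-assoc C (q ∷ []) B₂))) (ip-r X pP₀))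
    head-P : ∀ C → p ∷ B ≡ C ++ q ∷ B₂ → ∃[ T ] (C ++ q ∷ [] ≡ p ∷ T × (∀ {y} → y ∈ T → y ∈ B))
    head-P [] eq = [] , cong (_∷ []) (sym (proj₁ (∷-injective eq))) , λ ()
    head-P (x ∷ C) eq with ∷-injective eq
    ... | refl , eq′ = C ++ q ∷ [] , refl , λ {y} i → subst (y ∈_) (trans (++-assoc C (q ∷ []) B₂) (sym eq′)) (∈-++⁺ˡ i)
    T : List (V G)
    T = proj₁ (head-P C eqB)
    eqp : P ≡ p ∷ T
    eqp = proj₁ (proj₂ (head-P C eqB))
    aT : None a T
    aT i = aB (proj₂ (proj₂ (head-P C eqB)) i)
    P⊆ : ∀ {y} → y ∈ P → y ∈ X ++ p ∷ B
    P⊆ {y} i = ∈-++⁺ʳ X (subst (y ∈_) (trans (++-assoc C (q ∷ []) B₂) (sym eqB)) (∈-++⁺ˡ i))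
    P∉ : ∀ {y} → y ∈ P → ¬ (y ∈ L)
    P∉ i = off (walk-all w (P⊆ i))
    p∈P : p ∈ P
    p∈P = subst (p ∈_) (sym eqp) (here refl)
    cP : ∀ {y} → y ∈ P → ¬ E c y
    cP i e = no-three (length P) ≤-refl h pP P∉ (mkThree a∈ b∈ c∈ a≢b b≢c a≢c (cnt-∈ P p∈P ap) (cnt-∈ P (∈-mid C) bq)
        (cnt-∈ P i e))
    found : _ → ⊥
    found (inj₁ none) = none (walk-end∈ w₂) (inj₁ p∈P)
    found (inj₂ (W₁ , z , W₂ , eqW , touch , none)) with cnt-last c (W₁ ++ z ∷ [])
        (cnt-∈ (W₁ ++ z ∷ []) (start W₁ eqW w₂) (E-sym ec))
      where
      start : ∀ {D u l v} W₁ {z W₂} → l ≡ W₁ ++ z ∷ W₂ → Walk D u l v → u ∈ W₁ ++ z ∷ []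
      start W₁ eq wk with walk-head wk
      start [] eq wk | _ , refl = here (proj₁ (∷-injective eq))
      start (_ ∷ _) eq wk | _ , refl = here (proj₁ (∷-injective eq))
    ... | Y , z₁ , Z′ , eqY , cz , cZ , _ with snoc-view z₁ Z′
    ... | Z″ , z′ , eqz with ∷ʳ-injective W₁ (Y ++ Z″) (trans eqY (trans (cong (Y ++_) eqz) (sym (++-assoc Y Z″ (z′ ∷ [])))))
    ... | refl , refl = Tripods.impossible (two-paths h a∈ b∈ c∈ a≢b b≢c a≢c eqp refl eqz pP pZ P∉
            (λ i → off (walk-all w₂ (Z⊆ i)))
            ap aT bq bC cz cZ z∉P tz far)
      where
      pW′ : IPath ((Y ++ Z″) ++ z ∷ W₂)
      pW′ = subst IPath eqW pW
      Z⊆′ : ∀ {y} → y ∈ z₁ ∷ Z′ → y ∈ (Y ++ Z″) ++ z ∷ []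
      Z⊆′ {y} i = subst (y ∈_) (sym eqY) (∈-++⁺ʳ Y i)
      Z⊆ : ∀ {y} → y ∈ z₁ ∷ Z′ → y ∈ W
      Z⊆ {y} i = subst (y ∈_) (trans (++-assoc (Y ++ Z″) (z ∷ []) W₂) (sym eqW)) (∈-++⁺ˡ (Z⊆′ i))
      pZ : IPath (z₁ ∷ Z′)
      pZ = ip-r Y (subst IPath eqY (ip-l ((Y ++ Z″) ++ z ∷ []) (subst IPath (sym (++-assoc (Y ++ Z″) (z ∷ []) W₂)) pW′)))
      far : Z″ ## P
      far i j = (λ { refl → none (∈-++⁺ʳ Y i) (inj₁ j) }) , λ e → none (∈-++⁺ʳ Y i) (inj₂ (cnt-∈ P j e))
      z∉P : ¬ (z ∈ P)
      z∉P = aux Z″ eqz (λ i → none (∈-++⁺ʳ Y i))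
        where
        aux : ∀ Z → z₁ ∷ Z′ ≡ Z ++ z ∷ [] → (∀ {y} → y ∈ Z → ¬ (y ∈ P ⊎ 1 ≤ cnt y P)) → ¬ (z ∈ P)
        aux [] eq _ z∈ = cP (subst (_∈ P) (sym (proj₁ (∷-injective eq))) z∈) cz
        aux (x ∷ Z) eq nn z∈ with snoc-view x Z
        ... | Z₀ , y , eqx = nn (subst (y ∈_) (sym eqx) (∈-mid Z₀)) (inj₂ (cnt-∈ P z∈
              (ip-edge Z₀ (subst IPath (trans eq (trans (cong (_++ z ∷ []) eqx) (++-assoc Z₀ (y ∷ []) (z ∷ [])))) pZ))))
      tz : 1 ≤ cnt z P
      tz = [ ⊥-elim ∘ z∉P , (λ c → c) ]′ touch

  -- The chord comes with at least one vertex m between its ends, so it cuts off a genuine cycle.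
  upgrade : ∀ {l} → SPath l → IPath l ⊎ (∃[ X ] ∃[ u ] ∃[ m ] ∃[ M ] ∃[ v ] ∃[ Y ] (l ≡ X ++ u ∷ (m ∷ M) ++ v ∷ Y × E u v))
  upgrade nil = inj₁ nil
  upgrade one = inj₁ one
  upgrade (cons {x} {y} {l} e f p) with upgrade p | first-split (E? x) l
  ... | inj₂ (X , u , m , M , v , Y , eq , uv) | _ = inj₂ (x ∷ X , u , m , M , v , Y , cong (x ∷_) eq , uv)
  ... | inj₁ _ | inj₂ (M , v , Y , refl , xv , _) = inj₂ ([] , x , y , M , v , Y , refl , xv)
  ... | inj₁ q | inj₁ none = inj₁ (cons e (λ i → f i , none i) q)

  module Chord {k} (smaller : ∀ {D a M b} → length M < k → Cycle a M b → Connected D → (∀ {z} → D z → ¬ (z ∈ verts a M b)) → ¬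
      Attached D (verts a M b))
    {D u v} m N X Y (bound : length (m ∷ N) + length (Y ++ X) ≤ k) (out : 1 ≤ length (Y ++ X))
    (inn : Cycle u (m ∷ N) v) (outer : Cycle v (Y ++ X) u) (conn : Connected D)
    (sides : Across _≢_ (m ∷ N) (Y ++ X))
    (off₁ : ∀ {z} → D z → ¬ (z ∈ verts u (m ∷ N) v)) (off₂ : ∀ {z} → D z → ¬ (z ∈ verts v (Y ++ X) u)) where

    lt₁ : length (m ∷ N) < k
    lt₁ = ≤-trans (≤-trans (≤-reflexive (+-comm 1 _)) (+-monoʳ-≤ (length (m ∷ N)) out)) bound

    lt₂ : length (Y ++ X) < k
    lt₂ = ≤-trans (s≤s (m≤n+m (length (Y ++ X)) (length N))) bound

    -- Adding the outer arc to D yields a connected set that sees u and v from the ends of this arc,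
    -- and also g: three attachments on the shorter inner cycle.
    mixed : ∀ {g g′ d d′} → g ∈ m ∷ N → D d → E d g → g′ ∈ Y ++ X → D d′ → E d′ g′ → ⊥
    mixed {g} {g′} {d} {d′} g∈ Dd dg g′∈ Dd′ dg′ = smaller lt₁ inn conn′ off′ (att (Y ++ X) refl)
      where
      D′ : V G → Set
      D′ z = D z ⊎ z ∈ Y ++ X
      conn′ : Connected D′
      Connected.root conn′ = Connected.root conn
      Connected.joins conn′ (inj₁ i) with Connected.joins conn i
      ... | l , w = l , walk-map (λ _ → inj₁) w
      Connected.joins conn′ (inj₂ i) with ip-between {D = D′} (ip-l (Y ++ X) (ip-r (v ∷ []) (Cycle.path outer))) inj₂ i g′∈ |
          Connected.joins conn Dd′
      ... | l , w , _ | l′ , w′ = l ++ l′ , walk-++ w (E-sym dg′) (walk-map (λ _ → inj₁) w′)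
      off′ : ∀ {z} → D′ z → ¬ (z ∈ verts u (m ∷ N) v)
      off′ (inj₁ i) = off₁ i
      off′ (inj₂ i) (here refl) = sp-disjoint (v ∷ Y ++ X) (Cycle.path outer) (there i) (here refl) refl
      off′ (inj₂ i) (there j) with ∈-++⁻ (m ∷ N) j
      ... | inj₁ k = sides k i refl
      ... | inj₂ (here refl) = sp-disjoint (v ∷ []) (Cycle.path outer) (here refl) (∈-++⁺ˡ i) refl
      att : ∀ K → Y ++ X ≡ K → Attached D′ (verts u (m ∷ N) v)
      att [] e with subst (g′ ∈_) e g′∈
      ... | ()
      att (y ∷ K) e with snoc-view y K
      ... | K₁ , y′ , eqK = record
        { a∈ = here refl ; b∈ = ∈-mid (u ∷ m ∷ N) ; c∈ = there (∈-++⁺ˡ g∈)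
        ; a≢b = sp-disjoint (u ∷ m ∷ N) (Cycle.path inn) (here refl) (here refl)
        ; b≢c = λ r → sp-disjoint (u ∷ m ∷ N) (Cycle.path inn) (there g∈) (here refl) (sym r)
        ; a≢c = sp-disjoint (u ∷ []) (Cycle.path inn) (here refl) (∈-++⁺ˡ g∈)
        ; Da = inj₂ (subst (y′ ∈_) (sym (trans e eqK)) (∈-mid K₁)) ; Db = inj₂ (subst (y ∈_) (sym e) (here refl)) ; Dc = inj₁ Dd
        ; ea = ip-edge (v ∷ K₁) (subst SPath (cong (v ∷_) (trans (cong (_++ u ∷ []) (trans e eqK))
            (++-assoc K₁ (y′ ∷ []) (u ∷ [])))) (Cycle.path outer))
        ; eb = E-sym (ip-edge [] (subst (λ Q → SPath (v ∷ Q ++ u ∷ [])) e (Cycle.path outer))) ; ec = dg }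

    -- Once one attachment lies on the outer arc, `mixed` excludes the inner arc for the others, so
    -- all of them lie on the outer cycle, which is shorter too.
    other : ∀ {z g d dz} → z ∈ Y ++ X → D dz → E dz z → g ∈ verts u (m ∷ N) v ⊎ g ∈ Y ++ X → D d → E d g → g ∈ verts v (Y ++ X) u
    other z∈ Dz ez (inj₂ i) _ _ = there (∈-++⁺ˡ i)
    other z∈ Dz ez (inj₁ (here refl)) _ _ = ∈-mid (v ∷ Y ++ X)
    other z∈ Dz ez (inj₁ (there i)) Dd dg with ∈-++⁻ (m ∷ N) i
    ... | inj₁ j = ⊥-elim (mixed j Dd dg z∈ Dz ez)
    ... | inj₂ (here refl) = here refl

    impossible : ∀ {L} → (∀ {z} → z ∈ L → z ∈ verts u (m ∷ N) v ⊎ z ∈ Y ++ X) → ¬ Attached D L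
    impossible cover A = cases (cover a∈) (cover b∈) (cover c∈)
      where
      open Attached A
      cases : _ → _ → _ → ⊥
      cases (inj₁ i) (inj₁ j) (inj₁ k) = smaller lt₁ inn conn off₁
          (record { a∈ = i ; b∈ = j ; c∈ = k ; a≢b = a≢b ; b≢c = b≢c ; a≢c = a≢c ; Da = Da ; Db = Db ; Dc = Dc ; ea = ea ; eb = eb
          ; ec = ec })
      cases (inj₂ i) j k = smaller lt₂ outer conn off₂ (record { a∈ = there (∈-++⁺ˡ i) ; b∈ = other i Da ea j Db eb ; c∈ = other i
          Da ea k Dc ec ; a≢b = a≢b ; b≢c = b≢c ; a≢c = a≢c ; Da = Da ; Db = Db ; Dc = Dc ; ea = ea ; eb = eb ; ec = ec })
      cases i@(inj₁ _) (inj₂ j) k = smaller lt₂ outer conn off₂ (record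
          { a∈ = other j Db eb i Da ea ; b∈ = there (∈-++⁺ˡ j) ; c∈ = other j Db eb k Dc ec ; a≢b = a≢b ; b≢c = b≢c ; a≢c = a≢c ;
          Da = Da ; Db = Db ; Dc = Dc ; ea = ea ; eb = eb ; ec = ec })
      cases i@(inj₁ _) j@(inj₁ _) (inj₂ k) = smaller lt₂ outer conn off₂
          (record { a∈ = other k Dc ec i Da ea ; b∈ = other k Dc ec j Db eb ; c∈ = there (∈-++⁺ˡ k) ; a≢b = a≢b ; b≢c = b≢c ;
          a≢c = a≢c ; Da = Da ; Db = Db ; Dc = Dc ; ea = ea ; eb = eb ; ec = ec })

  chord : ∀ k → (∀ {D a M b} → length M < k → Cycle a M b → Connected D → (∀ {z} → D z → ¬ (z ∈ verts a M b)) → ¬ Attached D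
      (verts a M b)) →
    ∀ {D a M b} → length M ≤ k → Cycle a M b → Connected D → (∀ {z} → D z → ¬ (z ∈ verts a M b)) → Attached D (verts a M b) →
    ∀ X {u} n N {v} Y → verts a M b ≡ X ++ u ∷ (n ∷ N) ++ v ∷ Y → E u v → 1 ≤ length (Y ++ X) → ⊥
  chord k smaller {D} {a} {M} {b} le cy conn off A X {u} n N {v} Y eq uv out =
    Chord.impossible smaller n N X Y len′ out inn outer conn sides (λ d i → off d (⊆₁ i)) (λ d i → off d (⊆₂ i)) cover A
    where
    p : SPath (X ++ u ∷ (n ∷ N) ++ v ∷ Y)
    p = subst SPath eq (Cycle.path cy)
    inn : Cycle u (n ∷ N) v
    inn = cycle (ip-mid X {u} {n ∷ N} {v} {Y} p) (E-sym uv)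
    turned : Cycle n ((N ++ v ∷ Y) ++ X) u × _ × _
    turned = cycle-turn X (N ++ v ∷ Y) eq cy
    p′ : SPath ((n ∷ N) ++ v ∷ (Y ++ X) ++ u ∷ [])
    p′ = subst SPath (cong (n ∷_) (trans (cong (_++ u ∷ []) (++-assoc N (v ∷ Y) X)) (++-assoc N (v ∷ Y ++ X) (u ∷ []))))
        (Cycle.path (proj₁ turned))
    outer : Cycle v (Y ++ X) u
    outer = cycle (ip-r (n ∷ N) p′) uv
    sides : Across _≢_ (n ∷ N) (Y ++ X)
    sides i j = sp-disjoint (n ∷ N) p′ i (there (∈-++⁺ˡ j))
    up : ∀ {z} → z ∈ X ++ u ∷ (n ∷ N) ++ v ∷ Y → z ∈ verts a M b
    up {z} = subst (z ∈_) (sym eq)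
    ⊆₁ : ∀ {z} → z ∈ verts u (n ∷ N) v → z ∈ verts a M b
    ⊆₁ (here refl) = up (∈-mid X)
    ⊆₁ (there i) = up (∈-++⁺ʳ X (there ([ ∈-++⁺ˡ , (λ { (here refl) → ∈-mid (n ∷ N) }) ]′ (∈-++⁻ (n ∷ N) i))))
    inYX : ∀ {z} → z ∈ Y ++ X → z ∈ verts a M b
    inYX i = up ([ (λ j → ∈-++⁺ʳ X (there (∈-++⁺ʳ (n ∷ N) (there j)))) , ∈-++⁺ˡ ]′ (∈-++⁻ Y i))
    ⊆₂ : ∀ {z} → z ∈ verts v (Y ++ X) u → z ∈ verts a M b
    ⊆₂ (here refl) = ⊆₁ (∈-mid (u ∷ n ∷ N))
    ⊆₂ (there i) = [ inYX , (λ { (here refl) → ⊆₁ (here refl) }) ]′ (∈-++⁻ (Y ++ X) i)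
    cover : ∀ {z} → z ∈ verts a M b → z ∈ verts u (n ∷ N) v ⊎ z ∈ Y ++ X
    cover {z} i with ∈-++⁻ X (subst (z ∈_) eq i)
    ... | inj₁ j = inj₂ (∈-++⁺ʳ Y j)
    ... | inj₂ (here e) = inj₁ (here e)
    ... | inj₂ (there j) with ∈-++⁻ (n ∷ N) j
    ...   | inj₁ l = inj₁ (there (∈-++⁺ˡ l))
    ...   | inj₂ (here refl) = inj₁ (∈-mid (u ∷ n ∷ N))
    ...   | inj₂ (there l) = inj₂ (∈-++⁺ˡ l)
    len′ : length (n ∷ N) + length (Y ++ X) ≤ k
    len′ = ≤-trans (≤-reflexive eqlen) le
      where
      eqlen : length (n ∷ N) + length (Y ++ X) ≡ length M
      eqlen = suc-injective (suc-injective (trans (cong (2 +_) (trans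
          (cong (length (n ∷ N) +_) (trans (length-++ Y) (+-comm (length Y) (length X))))
          (bring (length (n ∷ N)) (length X) (length Y))))
        (trans (sym (trans (length-++ X) (trans (cong (length X +_)
            (cong suc (trans (length-++ (n ∷ N)) (+-suc (length (n ∷ N)) (length Y)))))
            (trans (+-suc (length X) _) (cong suc (+-suc (length X) _))))))
          (trans (cong length (sym eq)) (cong suc (trans (length-++ M) (+-comm (length M) 1)))))))
        where
        bring : ∀ a c r → a + (c + r) ≡ c + (a + r)
        bring a c r = trans (sym (+-assoc a c r)) (trans (cong (_+ r) (+-comm a c)) (+-assoc c a r))

  -- Induction on the length. The one pair not covered by the paths `a M` and `M b` is a, b, joined
  -- by the closing edge. So the cycle is a hole if both paths are induced, and otherwise a chord
  -- gives two shorter cycles.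
  cycle-attached : ∀ k {D a M b} → length M < k → Cycle a M b → Connected D → (∀ {z} → D z → ¬ (z ∈ verts a M b)) → ¬ Attached D
      (verts a M b)
  cycle-attached (suc k) {D} {a} {[]} {b} _ _ _ _ A = three-of-two a∈ b∈ c∈ a≢b b≢c a≢c
    where
    open Attached A using (a∈; b∈; c∈; a≢b; b≢c; a≢c)
    three-of-two : ∀ {x y z} → x ∈ a ∷ b ∷ [] → y ∈ a ∷ b ∷ [] → z ∈ a ∷ b ∷ [] → x ≢ y → y ≢ z → x ≢ z → ⊥
    three-of-two (here refl) (here refl) _ p _ _ = p refl
    three-of-two (here refl) (there (here refl)) (here refl) _ _ r = r refl
    three-of-two (here refl) (there (here refl)) (there (here refl)) _ q _ = q refl
    three-of-two (there (here refl)) (there (here refl)) _ p _ _ = p refl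
    three-of-two (there (here refl)) (here refl) (here refl) _ q _ = q refl
    three-of-two (there (here refl)) (here refl) (there (here refl)) _ _ r = r refl
  cycle-attached (suc k) {M = m ∷ []} _ (cycle (cons e₁ _ (cons e₂ _ _)) e₃) _ _ _ = tri e₁ e₂ (E-sym e₃)
  cycle-attached (suc k) {D} {a} {M@(m ∷ m′ ∷ M′)} {b} (s≤s le) cy conn off A
    with upgrade (ip-l (a ∷ M) (Cycle.path cy)) | upgrade (ip-r (a ∷ []) (Cycle.path cy))
  ... | inj₁ p₁ | inj₁ p₂ = hole-attached (mkHole (m′ ∷ M′) [] p₁ p₂ (edge (Cycle.close cy)) (λ _ ())
          (s≤s (s≤s (s≤s (≤-trans (m≤n+m 1 (length M′)) (≤-reflexive (sym (length-++ M′)))))))) conn off A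
  ... | inj₂ (X , u , n , N , v , Y , eq , uv) | _ =
          chord k (cycle-attached k) le cy conn off A X n N (Y ++ b ∷ [])
            (trans (cong (_++ b ∷ []) eq) (trans (++-assoc X _ (b ∷ []))
                (cong (λ K → X ++ u ∷ n ∷ K) (++-assoc N (v ∷ Y) (b ∷ []))))) uv
            (≤-trans (subst (1 ≤_) (sym (length-++ Y)) (m≤n+m 1 (length Y)))
                (≤-trans (m≤m+n _ (length X)) (≤-reflexive (sym (length-++ (Y ++ b ∷ []))))))
  ... | inj₁ _ | inj₂ (X , u , n , N , v , Y , eq , uv) =
          chord k (cycle-attached k) le cy conn off A (a ∷ X) n N Y (cong (a ∷_) eq) uv
            (≤-trans (s≤s z≤n) (≤-trans (m≤n+m _ (length Y)) (≤-reflexive (sym (length-++ Y)))))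

-- K₄ models in subdivisions and supergraphs.

-- A form of K₄ minor that is easily seen to survive subdivision and passing to a supergraph.
record Model (H : Graph) : Set₁ where
  field
    {a b} : V H
    M     : List (V H)
    inner≥1 : 1 ≤ length M
    cyc   : Cycles.Cycle H a M b
    D     : V H → Set
    conn  : Cycles.Connected H D
    off   : ∀ {z} → D z → ¬ (z ∈ Cycles.verts H a M b)
    att   : Cycles.Attached H D (Cycles.verts H a M b)

model-K4 : Model (K 4)
model-K4 = record
  { a = zero ; b = suc (suc zero) ; M = suc zero ∷ [] ; inner≥1 = s≤s z≤n
  ; cyc = Cycles.cycle (Paths.cons {x = zero} {y = suc zero} refl (λ { (here refl) () })
      (Paths.edge (K 4) {x = suc zero} {y = suc (suc zero)} refl)) refl
  ; D = _≡ suc (suc (suc zero)) ; conn = record { root = suc (suc (suc zero)) ; joins = λ { refl → _ , Paths.stop refl } }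
  ; off = λ { refl (here ()) ; refl (there (here ())) ; refl (there (there (here ()))) ; refl (there (there (there ()))) }
  ; att = record { a = zero ; b = suc zero ; c = suc (suc zero) ; da = suc (suc (suc zero)) ; db = suc (suc (suc zero)) ; dc = suc
      (suc (suc zero)) ; a∈ = here refl ; b∈ = there (here refl) ; c∈ = there (there (here refl)) ; a≢b = λ () ; b≢c = λ () ;
      a≢c = λ ()
                 ; Da = refl ; Db = refl ; Dc = refl ; ea = refl ; eb = refl ; ec = refl } }

module Subdivided (H : Graph) (v w : V H) (e : adj H v w ≡ true) where
  private
    H′ : Graph
    H′ = subdivide H v w e
  module P = Paths H
  module P′ = Paths H′
  open Detect H using (hit-no; eqb-yes; ∨-t)
  open Cycles

  Hit : V H → V H → Set
  Hit x y = (x ≡ v × y ≡ w) ⊎ (x ≡ w × y ≡ v)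

  hit? : ∀ x y → Dec (Hit x y)
  hit? x y = ((x ≟ v) ×-dec (y ≟ w)) ⊎-dec ((x ≟ w) ×-dec (y ≟ v))

  keep : ∀ {x y} → P.E x y → ¬ Hit x y → P′.E (suc x) (suc y)
  keep e′ ¬h = cong₂ (λ p q → p ∧ not q) e′ (hit-no (¬h ∘ inj₁) (¬h ∘ inj₂))

  new-v : P′.E zero (suc v)
  new-v rewrite eqb-yes {x = v} refl = refl

  new-w : P′.E zero (suc w)
  new-w rewrite eqb-yes {x = w} refl = ∨-t _

  new : ∀ {x y} → Hit x y → P′.E zero (suc x) × P′.E zero (suc y)
  new (inj₁ (refl , refl)) = new-v , new-w
  new (inj₂ (refl , refl)) = new-w , new-v

  lift : ∀ {l} → P.SPath l → P′.SPath (map suc l) ⊎ (∃[ X ] ∃[ x ] ∃[ y ] ∃[ Y ] (l ≡ X ++ x ∷ y ∷ Y × Hit x y))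
  lift P.nil = inj₁ P′.nil
  lift P.one = inj₁ P′.one
  lift (P.cons {x} {y} {l} e′ f p) with lift p | hit? x y
  ... | inj₂ (X , x′ , y′ , Y , eq , h) | _ = inj₂ (x ∷ X , x′ , y′ , Y , cong (x ∷_) eq , h)
  ... | inj₁ _ | yes h = inj₂ ([] , x , y , l , refl , h)
  ... | inj₁ p′ | no ¬h = inj₁ (P′.cons (keep e′ ¬h) far p′)
    where
    far : ∀ {z} → z ∈ map suc l → suc x ≢ z
    far i refl with ∈-map⁻ suc i
    ... | _ , j , refl = f j refl

  -- `zero-hit` keeps set and cycle disjoint after lifting: the new vertex joins the set when v or w
  -- belongs to it, but lies on the cycle only if both v and w do.
  record LiftedCycle (old : List (V H)) : Set where
    field
      {a′ b′} : V H′
      M′   : List (V H′)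
      in≥1 : 1 ≤ length M′
      cyc′ : Cycle H′ a′ M′ b′
      keeps : ∀ {z} → z ∈ old → suc z ∈ verts H′ a′ M′ b′
      comes : ∀ {z} → suc z ∈ verts H′ a′ M′ b′ → z ∈ old
      zero-hit : zero ∈ verts H′ a′ M′ b′ → v ∈ old × w ∈ old

  -- The new vertex is appended to the path. The path does not use the subdivided edge as well,
  -- because its ends a and b are not consecutive on it; this is where `1 ≤ length M` enters.
  lift-closing : ∀ {a M b} → 1 ≤ length M → Cycle H a M b → Hit b a → LiftedCycle (verts H a M b)
  lift-closing {a} {M} {b} ne cy h with lift (Cycle.path cy)
  ... | inj₂ (X , x , y , Y , eq , h′) = ⊥-elim (bad X eq (same h h′))
    where
    same : ∀ {x y} → Hit b a → Hit x y → (x ≡ a × y ≡ b) ⊎ (x ≡ b × y ≡ a)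
    same (inj₁ (refl , refl)) (inj₁ (refl , refl)) = inj₂ (refl , refl)
    same (inj₁ (refl , refl)) (inj₂ (refl , refl)) = inj₁ (refl , refl)
    same (inj₂ (refl , refl)) (inj₁ (refl , refl)) = inj₁ (refl , refl)
    same (inj₂ (refl , refl)) (inj₂ (refl , refl)) = inj₂ (refl , refl)
    a∉ : ¬ (a ∈ M ++ b ∷ [])
    a∉ i = sp-disjoint H (a ∷ []) (Cycle.path cy) (here refl) i refl
    b∉ : ¬ (b ∈ M)
    b∉ i = sp-disjoint H (a ∷ M) (Cycle.path cy) (there i) (here refl) refl
    head≢b : ∀ M {Y} → 1 ≤ length M → ¬ (b ∈ M) → M ++ b ∷ [] ≡ b ∷ Y → ⊥
    head≢b (m ∷ M) _ b∉ eq = b∉ (here (sym (proj₁ (∷-injective eq))))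
    bad : ∀ X {x y Y} → verts H a M b ≡ X ++ x ∷ y ∷ Y → (x ≡ a × y ≡ b) ⊎ (x ≡ b × y ≡ a) → ⊥
    bad [] eq (inj₁ (refl , refl)) = head≢b M ne b∉ (proj₂ (∷-injective eq))
    bad [] eq (inj₂ (refl , refl)) = a∉ (subst (a ∈_) (sym (proj₂ (∷-injective eq))) (here refl))
    bad (_ ∷ X) eq (inj₁ (refl , refl)) = a∉ (subst (a ∈_) (sym (proj₂ (∷-injective eq))) (∈-mid X))
    bad (_ ∷ X) eq (inj₂ (refl , refl)) = a∉ (subst (a ∈_) (sym (proj₂ (∷-injective eq))) (∈-++⁺ʳ X (there (here refl))))
  ... | inj₁ p′ = record
      { M′ = map suc (M ++ b ∷ []) ; in≥1 = nonempty M ; cyc′ = cycle path′ (proj₂ (new h))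
      ; keeps = λ i → ∈-++⁺ˡ (∈-map⁺ suc i)
      ; comes = comes′ ; zero-hit = λ _ → both h }
    where
    nonempty : ∀ (M : List (V H)) → 1 ≤ length (map suc (M ++ b ∷ []))
    nonempty [] = s≤s z≤n
    nonempty (_ ∷ _) = s≤s z≤n
    eq′ : map suc (verts H a M b) ≡ (suc a ∷ map suc M) ++ suc b ∷ []
    eq′ = cong (suc a ∷_) (map-++ suc M (b ∷ []))
    path′ : P′.SPath (suc a ∷ map suc (M ++ b ∷ []) ++ zero ∷ [])
    path′ = subst P′.SPath (trans (sym (++-assoc (suc a ∷ map suc M) (suc b ∷ []) (zero ∷ []))) (cong (_++ zero ∷ []) (sym eq′)))
      (sp-cat H′ (suc a ∷ map suc M) (subst P′.SPath eq′ p′) (P′.E-sym {zero} {suc b} (proj₁ (new h))) P′.one dis)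
      where
      dis : P′.Across _≢_ ((suc a ∷ map suc M) ++ suc b ∷ []) (zero ∷ [])
      dis {x} i (here refl) r with ∈-map⁻ suc (subst (x ∈_) (sym eq′) i)
      dis i (here refl) () | _ , _ , refl
    comes′ : ∀ {z} → suc z ∈ verts H′ (suc a) (map suc (M ++ b ∷ [])) zero → z ∈ verts H a M b
    comes′ i with ∈-++⁻ (map suc (verts H a M b)) i
    ... | inj₁ j with ∈-map⁻ suc j
    ...   | _ , k , refl = k
    comes′ i | inj₂ (here ())
    comes′ i | inj₂ (there ())
    both : Hit b a → v ∈ verts H a M b × w ∈ verts H a M b
    both (inj₁ (refl , refl)) = ∈-mid (a ∷ M) , here refl
    both (inj₂ (refl , refl)) = here refl , ∈-mid (a ∷ M)

  -- A subdivided edge inside the path becomes the closing edge after rotating the cycle.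
  lift-cycle : ∀ {a M b} → 1 ≤ length M → Cycle H a M b → LiftedCycle (verts H a M b)
  lift-cycle {a} {M} {b} ne cy with hit? b a
  ... | yes h = lift-closing ne cy h
  ... | no ¬h with lift (Cycle.path cy)
  ...   | inj₁ p′ = record
      { M′ = map suc M ; in≥1 = subst (1 ≤_) (sym (length-map suc M)) ne
      ; cyc′ = cycle (subst P′.SPath eq′ p′) (keep (Cycle.close cy) ¬h)
      ; keeps = λ {z} i → subst (suc z ∈_) eq′ (∈-map⁺ suc i) ; comes = comes′ ; zero-hit = zero′ }
    where
    eq′ : map suc (verts H a M b) ≡ suc a ∷ map suc M ++ suc b ∷ []
    eq′ = cong (suc a ∷_) (map-++ suc M (b ∷ []))
    comes′ : ∀ {z} → suc z ∈ suc a ∷ map suc M ++ suc b ∷ [] → z ∈ verts H a M b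
    comes′ {z} i with ∈-map⁻ suc (subst (suc z ∈_) (sym eq′) i)
    ... | _ , k , refl = k
    zero′ : zero ∈ suc a ∷ map suc M ++ suc b ∷ [] → v ∈ verts H a M b × w ∈ verts H a M b
    zero′ i with ∈-map⁻ suc (subst (zero ∈_) (sym eq′) i)
    ... | _ , _ , ()
  ...   | inj₂ (X , x , y , Y , eq , h) with cycle-turn H X Y eq cy
  ...     | cy₁ , fwd , bwd = record
      { M′ = LiftedCycle.M′ r ; in≥1 = LiftedCycle.in≥1 r ; cyc′ = LiftedCycle.cyc′ r
      ; keeps = λ i → LiftedCycle.keeps r (bwd i) ; comes = λ i → fwd (LiftedCycle.comes r i)
      ; zero-hit = λ i → fwd (proj₁ (LiftedCycle.zero-hit r i)) , fwd (proj₂ (LiftedCycle.zero-hit r i)) }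
    where
    ne′ : 1 ≤ length (Y ++ X)
    ne′ = subst (1 ≤_) eqlen ne
      where
      eqlen : length M ≡ length (Y ++ X)
      eqlen = suc-injective (suc-injective (trans (sym (cong suc (trans (length-++ M) (+-comm (length M) 1))))
          (trans (cong length eq)
        (trans (length-++ X) (trans (+-suc (length X) (suc (length Y)))
            (cong suc (trans (+-suc (length X) (length Y)) (cong suc
            (trans (+-comm (length X) (length Y)) (sym (length-++ Y)))))))))))
    r : LiftedCycle (verts H y (Y ++ X) x)
    r = lift-closing ne′ cy₁ h

  lift-model : Model H → Model H′
  lift-model m = record
      { M = M′ ; inner≥1 = in≥1 ; cyc = cyc′ ; D = D′ ; conn = conn′ ; off = off′ ; att = att′ }
    where
    open Model m
    open LiftedCycle (lift-cycle inner≥1 cyc)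
    D′ : V H′ → Set
    -- One end in the set is enough: the new vertex then serves a subdivided edge within the set as
    -- well as one leading from the set to the cycle.
    D′ zero = D v ⊎ D w
    D′ (suc x) = D x
    off′ : ∀ {z} → D′ z → ¬ (z ∈ verts H′ a′ M′ b′)
    off′ {zero} d i = [ (λ dv → off dv (proj₁ (zero-hit i))) , (λ dw → off dw (proj₂ (zero-hit i))) ]′ d
    off′ {suc x} d i = off d (comes i)
    D-hit : ∀ {x y} → D x → Hit x y → D′ zero
    D-hit d (inj₁ (refl , _)) = inj₁ d
    D-hit d (inj₂ (refl , _)) = inj₂ d
    walk′ : ∀ {x l y} → P.Walk D x l y → ∃[ l′ ] P′.Walk D′ (suc x) l′ (suc y)
    walk′ (P.stop d) = _ , P′.stop d
    walk′ (P.go {u} {v₁} d e′ wk) with walk′ wk | hit? u v₁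
    ... | l , wk′ | no ¬h = _ , P′.go d (keep e′ ¬h) wk′
    ... | l , wk′ | yes h = _ , P′.go d (P′.E-sym {zero} {suc u} (proj₁ (new h)))
            (P′.go {u = zero} (D-hit d h) (proj₂ (new h)) wk′)
    conn′ : Connected H′ D′
    Connected.root conn′ = suc (Connected.root conn)
    Connected.joins conn′ {suc x} d = walk′ (proj₂ (Connected.joins conn d))
    Connected.joins conn′ {zero} (inj₁ d) = _ , P′.go (inj₁ d) new-v (proj₂ (walk′ (proj₂ (Connected.joins conn d))))
    Connected.joins conn′ {zero} (inj₂ d) = _ , P′.go (inj₂ d) new-w (proj₂ (walk′ (proj₂ (Connected.joins conn d))))
    seen : ∀ {d x} → D d → P.E d x → ∃[ d′ ] (D′ d′ × P′.E d′ (suc x))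
    seen {d} {x} Dd e′ with hit? d x
    ... | no ¬h = suc d , Dd , keep e′ ¬h
    ... | yes h = zero , D-hit Dd h , proj₂ (new h)
    inj-suc : ∀ {k} {x y : Fin k} → suc x ≡ suc y → x ≡ y
    inj-suc refl = refl
    att′ : Attached H′ D′ (verts H′ a′ M′ b′)
    att′ = record { da = proj₁ (seen A.Da A.ea) ; db = proj₁ (seen A.Db A.eb) ; dc = proj₁ (seen A.Dc A.ec) ; a∈ = keeps A.a∈ ;
        b∈ = keeps A.b∈ ; c∈ = keeps A.c∈
      ; a≢b = A.a≢b ∘ inj-suc ; b≢c = A.b≢c ∘ inj-suc ; a≢c = A.a≢c ∘ inj-suc
      ; Da = proj₁ (proj₂ (seen A.Da A.ea)) ; Db = proj₁ (proj₂ (seen A.Db A.eb)) ; Dc = proj₁ (proj₂ (seen A.Dc A.ec))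
      ; ea = proj₂ (proj₂ (seen A.Da A.ea)) ; eb = proj₂ (proj₂ (seen A.Db A.eb)) ; ec = proj₂ (proj₂ (seen A.Dc A.ec)) }
      where module A = Attached att

subdivision-model : ∀ {H} → SubdivisionOf (K 4) H → Model H
subdivision-model base = model-K4
subdivision-model (step {H} s v w e) = Subdivided.lift-model H v w e (subdivision-model s)

model-map : ∀ {H G} → H ⊆ₛ G → Model H → Model G
model-map {H} {G} sub m = record
    { M = map f M ; inner≥1 = subst (1 ≤_) (sym (length-map f M)) inner≥1
    ; cyc = cycle (subst Q.SPath eq (path-map (Cycle.path cyc))) (fE (Cycle.close cyc))
    ; D = D′ ; conn = conn′ ; off = off′ ; att = att′ }
  where
  open Model m
  open Cycles
  module P = Paths H
  module Q = Paths G
  f : V H → V G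
  f = _⊆ₛ_.emb sub
  f-inj : ∀ {x y} → f x ≡ f y → x ≡ y
  f-inj = _⊆ₛ_.emb-inj sub
  fE : ∀ {x y} → P.E x y → Q.E (f x) (f y)
  fE = _⊆ₛ_.emb-adj sub _ _
  path-map : ∀ {l} → P.SPath l → Q.SPath (map f l)
  path-map P.nil = Q.nil
  path-map P.one = Q.one
  path-map (P.cons {x} {y} {l} e far p) = Q.cons (fE e) far′ (path-map p)
    where
    far′ : ∀ {z} → z ∈ map f l → f x ≢ z
    far′ i r with ∈-map⁻ f i
    ... | _ , j , refl = far j (f-inj r)
  eq : map f (verts H a M b) ≡ verts G (f a) (map f M) (f b)
  eq = cong (f a ∷_) (map-++ f M (b ∷ []))
  D′ : V G → Set
  D′ z = ∃[ h ] (D h × f h ≡ z)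
  off′ : ∀ {z} → D′ z → ¬ (z ∈ verts G (f a) (map f M) (f b))
  off′ (h , d , refl) i with ∈-map⁻ f (subst (f h ∈_) (sym eq) i)
  ... | h′ , j , r rewrite f-inj r = off d j
  walk-f : ∀ {x l y} → P.Walk D x l y → ∃[ l′ ] Q.Walk D′ (f x) l′ (f y)
  walk-f (P.stop d) = _ , Q.stop (_ , d , refl)
  walk-f (P.go d e w) = _ , Q.go (_ , d , refl) (fE e) (proj₂ (walk-f w))
  conn′ : Connected G D′
  Connected.root conn′ = f (Connected.root conn)
  Connected.joins conn′ (h , d , refl) = walk-f (proj₂ (Connected.joins conn d))
  att′ : Attached G D′ (verts G (f a) (map f M) (f b))
  att′ = record { a∈ = mv A.a∈ ; b∈ = mv A.b∈ ; c∈ = mv A.c∈ ; a≢b = A.a≢b ∘ f-inj ; b≢c = A.b≢c ∘ f-inj ; a≢c = A.a≢c ∘ f-inj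
    ; Da = _ , A.Da , refl ; Db = _ , A.Db , refl ; Dc = _ , A.Dc , refl ; ea = fE A.ea ; eb = fE A.eb ; ec = fE A.ec }
    where
    module A = Attached att
    mv : ∀ {z} → z ∈ verts H a M b → f z ∈ verts G (f a) (map f M) (f b)
    mv {z} i = subst (f z ∈_) eq (∈-map⁺ f i)

-- Maximal bicliques and small clique cutsets.

module Bicliques (G : Graph) (tri : Paths.TriangleFree G) (isk : ¬ ContainsISK4 G) where
  open Paths G
  open Detect G
  open Wheels G tri isk
  open IsHole

  record Biclique (A B : V G → Set) : Set where
    field
      cross : ∀ {a b} → A a → B b → E a b
      {a₁ a₂ a₃ b₁ b₂ b₃} : V G
      A₁ : A a₁
      A₂ : A a₂
      A₃ : A a₃
      B₁ : B b₁
      B₂ : B b₂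
      B₃ : B b₃
      a₁₂ : a₁ ≢ a₂
      a₂₃ : a₂ ≢ a₃
      a₁₃ : a₁ ≢ a₃
      b₁₂ : b₁ ≢ b₂
      b₂₃ : b₂ ≢ b₃
      b₁₃ : b₁ ≢ b₃
      maxA : ∀ {v} → ¬ B v → ∃[ a ] (A a × ¬ E v a)
      maxB : ∀ {v} → ¬ A v → ∃[ b ] (B b × ¬ E v b)

  open Biclique

  flip-biclique : ∀ {A B} → Biclique A B → Biclique B A
  flip-biclique k = record { cross = λ b a → E-sym (cross k a b) ; A₁ = B₁ k ; A₂ = B₂ k ; A₃ = B₃ k ; B₁ = A₁ k ; B₂ = A₂ k ;
      B₃ = A₃ k
    ; a₁₂ = b₁₂ k ; a₂₃ = b₂₃ k ; a₁₃ = b₁₃ k ; b₁₂ = a₁₂ k ; b₂₃ = a₂₃ k ; b₁₃ = a₁₃ k ; maxA = maxB k ; maxB = maxA k }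

  Out : (A B : V G → Set) → V G → Set
  Out A B z = ¬ A z × ¬ B z

  -- Both sides are treated at once, since a shortest path between two vertices of A is also
  -- compared with paths between vertices of B.
  NoShort : (A B : V G → Set) → ℕ → Set
  NoShort A B k = ∀ {p q c d l} → Walk (Out A B) p l q → E p c → E q d → (A c × A d) ⊎ (B c × B d) → c ≢ d → length l < k → ⊥

  stable : ∀ {A B} → Biclique A B → ∀ {a a′} → A a → A a′ → ¬ E a a′
  stable k i j e = tri e (cross k j (B₁ k)) (cross k i (B₁ k))

  third : ∀ {A B} → Biclique A B → ∀ x y → ∃[ a ] (A a × a ≢ x × a ≢ y)
  third k x y with a₁ k ≟ x | a₁ k ≟ y | a₂ k ≟ x | a₂ k ≟ y
  ... | no p | no q | _ | _ = _ , A₁ k , p , q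
  ... | _ | _ | no p | no q = _ , A₂ k , p , q
  ... | yes p | _ | yes q | _ = ⊥-elim (a₁₂ k (trans p (sym q)))
  ... | _ | yes p | _ | yes q = ⊥-elim (a₁₂ k (trans p (sym q)))
  ... | yes p | _ | no _ | yes q = _ , A₃ k , (λ r → a₁₃ k (trans p (sym r))) , λ r → a₂₃ k (trans q (sym r))
  ... | no _ | yes p | yes q | _ = _ , A₃ k , (λ r → a₂₃ k (trans q (sym r))) , λ r → a₁₃ k (trans p (sym r))

  two-free : ∀ {A B} → Biclique A B → ∀ {P} → (∀ {b b′} → B b → B b′ → b ≢ b′ → 1 ≤ cnt b P → 1 ≤ cnt b′ P → ⊥) →
    ∃[ b ] ∃[ b′ ] (B b × B b′ × b ≢ b′ × None b P × None b′ P)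
  two-free k {P} once with 1 ≤? cnt (b₁ k) P | 1 ≤? cnt (b₂ k) P | 1 ≤? cnt (b₃ k) P
  ... | no p | no q | _ = _ , _ , B₁ k , B₂ k , b₁₂ k , not-cnt P p , not-cnt P q
  ... | no p | yes _ | no q = _ , _ , B₁ k , B₃ k , b₁₃ k , not-cnt P p , not-cnt P q
  ... | yes _ | no p | no q = _ , _ , B₂ k , B₃ k , b₂₃ k , not-cnt P p , not-cnt P q
  ... | yes p | yes q | _ = ⊥-elim (once (B₁ k) (B₂ k) (b₁₂ k) p q)
  ... | yes p | no _ | yes q = ⊥-elim (once (B₁ k) (B₃ k) (b₁₃ k) p q)
  ... | no _ | yes p | yes q = ⊥-elim (once (B₂ k) (B₃ k) (b₂₃ k) p q)

  -- K₃,₃ minus an edge is a subdivision of K₄: a path P joining c to d plays the part of the third vertex b.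
  almost-K₃₃ : ∀ {A B c d a b b′} P → Biclique A B → IPath (c ∷ P ++ d ∷ []) → A c → A d → A a → B b → B b′ → c ≢ d → a ≢ c → a ≢
      d → b ≢ b′ →
    (∀ {z} → z ∈ P → Out A B z) → None a P → None b P → None b′ P → ⊥
  almost-K₃₃ {A} {B} {c} {d} {a} {b} {b′} P k pP Ac Ad Aa Bb Bb′ c≢d a≢c a≢d b≢b′ out aP bP b′P =
    isk (tripod hole (there (here refl)) (there (there (there (here refl)))) (here refl) b≢b′ (E⇒≢ (E-sym (cross k Ac Bb′)))
        (E⇒≢ (E-sym (cross k Ac Bb)))
      (direct (cross k Ad Bb)) (direct (cross k Ad Bb′)) (ip-rev′ P pP , off) (λ ()) (λ ()) (λ ()) td)
    where
    nbb : N b b′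
    nbb = b≢b′ , stable (flip-biclique k) Bb Bb′
    hole : IsHole (c ∷ b ∷ a ∷ b′ ∷ [])
    hole = mkHole [] (b′ ∷ []) (edge (cross k Ac Bb)) (edge (E-sym (cross k Aa Bb)))
      (cons (cross k Aa Bb′) (λ { (here refl) → a≢c , stable k Aa Ac }) (edge (E-sym (cross k Ac Bb′))))
      (λ { (here refl) (here refl) → nbb }) (s≤s (s≤s (s≤s (s≤s z≤n))))
    off : ∀ {r z} → r ∈ reverse P → z ∈ c ∷ b ∷ a ∷ b′ ∷ [] → z ≢ c → N r z
    off i (here e) ne = ⊥-elim (ne e)
    off i (there (here refl)) _ = (λ { refl → proj₂ (out (∈-rev⁻ P i)) Bb }) , bP (∈-rev⁻ P i) ∘ E-sym
    off i (there (there (here refl))) _ = (λ { refl → proj₁ (out (∈-rev⁻ P i)) Aa }) , aP (∈-rev⁻ P i) ∘ E-sym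
    off i (there (there (there (here refl)))) _ = (λ { refl → proj₂ (out (∈-rev⁻ P i)) Bb′ }) , b′P (∈-rev⁻ P i) ∘ E-sym
    td : ∀ {z} → z ∈ c ∷ b ∷ a ∷ b′ ∷ [] → z ≢ b → z ≢ b′ → z ≢ c → N d z
    td (here e) _ _ nc = ⊥-elim (nc e)
    td (there (here e)) nb _ _ = ⊥-elim (nb e)
    td (there (there (here refl))) _ _ _ = a≢d ∘ sym , stable k Ad Aa
    td (there (there (there (here e)))) _ nb _ = ⊥-elim (nb e)

  -- For a path of one vertex p, maximality supplies the vertex a of A that p misses; for a longer
  -- one any a besides c and d works, as an attachment of a would give a shorter path. A vertex of B
  -- seen by p or q would close a triangle with c or d, and two vertices of B attached in between
  -- would be joined by a shorter path. So two of three vertices of B miss the path.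
  bridge : ∀ {A B p q c d l} → Biclique A B → IPath l → Walk (Out A B) p l q → E p c → E q d → A c → A d → c ≢ d → NoShort A B
      (length l) → ⊥
  bridge {A} {B} {p} {q} {c} {d} {l} k pl wk pc qd Ac Ad c≢d short = by-shape (walk-view wk)
    where
    out : ∀ {z} → z ∈ l → Out A B z
    out = walk-all wk
    by-shape : _ → ⊥
    by-shape (inj₁ (refl , refl)) with maxA k (proj₂ (out (here refl))) | two-free k {p ∷ []} (λ Bb _ _ t _ → at-p Bb t)
      where
      at-p : ∀ {b} → B b → 1 ≤ cnt b (p ∷ []) → ⊥
      at-p {b} Bb t with cnt-first b (p ∷ []) t
      ... | [] , _ , _ , refl , e , _ = tri (E-sym pc) (E-sym e) (cross k Ac Bb)
      ... | _ ∷ [] , _ , _ , () , _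
      ... | _ ∷ _ ∷ _ , _ , _ , () , _
    ... | a , Aa , ¬pa | b , b′ , Bb , Bb′ , b≢b′ , bP , b′P =
        almost-K₃₃ (p ∷ []) k (cons (E-sym pc) (λ { (here refl) → c≢d , stable k Ac Ad }) (edge qd)) Ac Ad Aa Bb Bb′ c≢d
          (λ { refl → ¬pa pc }) (λ { refl → ¬pa qd }) b≢b′ out (λ { (here refl) e → ¬pa (E-sym e) }) bP b′P
    by-shape (inj₂ (M , refl)) with third k c d | two-free k {p ∷ M ++ q ∷ []} once
      where
      in-M : ∀ {b z} → B b → z ∈ p ∷ M ++ q ∷ [] → E b z → z ∈ M
      in-M Bb (here refl) e = ⊥-elim (tri (E-sym pc) (E-sym e) (cross k Ac Bb))
      in-M Bb (there i) e with ∈-++⁻ M i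
      ... | inj₁ j = j
      ... | inj₂ (here refl) = ⊥-elim (tri (E-sym qd) (E-sym e) (cross k Ad Bb))
      once : ∀ {b b′} → B b → B b′ → b ≢ b′ → 1 ≤ cnt b (p ∷ M ++ q ∷ []) → 1 ≤ cnt b′ (p ∷ M ++ q ∷ []) → ⊥
      once {b} {b′} Bb Bb′ ne t t′ with cnt-first b (p ∷ M ++ q ∷ []) t | cnt-first b′ (p ∷ M ++ q ∷ []) t′
      ... | X , z , _ , eq , e , _ | X′ , z′ , _ , eq′ , e′ , _ with ip-between (ip-l M (ip-r (p ∷ []) pl))
              (λ i → out (there (∈-++⁺ˡ i)))
              (in-M Bb (subst (z ∈_) (sym eq) (∈-mid X)) e) (in-M Bb′ (subst (z′ ∈_) (sym eq′) (∈-mid X′)) e′)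
      ...   | l′ , wk′ , le = short wk′ (E-sym e) (E-sym e′) (inj₂ (Bb , Bb′)) ne
                (≤-trans (s≤s le) (s≤s (≤-trans (m≤m+n (length M) 1) (≤-reflexive (sym (length-++ M))))))
    ... | a , Aa , a≢c , a≢d | b , b′ , Bb , Bb′ , b≢b′ , bP , b′P =
        almost-K₃₃ (p ∷ M ++ q ∷ []) k full Ac Ad Aa Bb Bb′ c≢d a≢c a≢d b≢b′ out aP bP b′P
      where
      left : ∀ {y g} → y ∈ p ∷ M → E y g → A g → g ≢ c → ⊥
      left {y} i e Ag g≢c with ip-between (ip-l (p ∷ M) pl) (λ j → out (∈-++⁺ˡ j)) (here refl) i
      ... | l′ , wk′ , le = short wk′ pc e (inj₁ (Ac , Ag)) (g≢c ∘ sym)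
              (s≤s (≤-trans le (≤-reflexive (trans (+-comm 1 (length M)) (sym (length-++ M))))))
      right : ∀ {y g} → y ∈ M ++ q ∷ [] → E y g → A g → g ≢ d → ⊥
      right {y} i e Ag g≢d with ip-between (ip-r (p ∷ []) pl) (λ j → out (there j)) i (∈-mid M)
      ... | l′ , wk′ , le = short wk′ e qd (inj₁ (Ag , Ad)) g≢d (s≤s le)
      aP : None a (p ∷ M ++ q ∷ [])
      aP i e with ∈-++⁻ (p ∷ M) i
      ... | inj₁ j = left j (E-sym e) Aa a≢c
      ... | inj₂ (here refl) = right (∈-mid M) (E-sym e) Aa a≢d
      full : IPath (c ∷ (p ∷ M ++ q ∷ []) ++ d ∷ [])
      full = cons (E-sym pc) far (ip-snoc (p ∷ M) pl qd λ { i (here refl) → (λ { refl → proj₁ (out (∈-++⁺ˡ i)) Ad }) , λ e → left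
          i e Ad (c≢d ∘ sym) })
        where
        far : ∀ {z} → z ∈ (M ++ q ∷ []) ++ d ∷ [] → N c z
        far i with ∈-++⁻ (M ++ q ∷ []) i
        ... | inj₁ j = (λ { refl → proj₁ (out (there j)) Ac }) , λ e → right j (E-sym e) Ac c≢d
        ... | inj₂ (here refl) = c≢d , stable k Ac Ad

  no-short : ∀ {A B} → Biclique A B → ∀ n → NoShort A B n
  no-short k zero _ _ _ _ _ ()
  no-short {A} {B} k (suc n) wk pc qd s c≢d lt with shorten wk
  ... | l′ , pl , wk′ , le = [ (λ { (Ac , Ad) → bridge k pl wk′ pc qd Ac Ad c≢d short })
      , (λ { (Bc , Bd) → bridge (flip-biclique k) pl (walk-map (λ { _ (x , y) → y , x }) wk′) pc qd Bc Bd c≢d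
          λ w e e′ s′ ne lt′ → short (walk-map (λ { _ (x , y) → y , x }) w) e e′ ([ inj₂ , inj₁ ]′ s′) ne lt′ }) ]′ s
    where
    short : NoShort A B (length l′)
    short w e e′ s′ ne lt′ = no-short k n w e e′ s′ ne (≤-trans lt′ (≤-trans le (≤-pred lt)))

  module Closure (not-CB : ¬ CompleteBipartite G) (no-SCC : ¬ HasSmallCliqueCutset G)
    {A B : V G → Set} (A? : ∀ v → Dec (A v)) (B? : ∀ v → Dec (B v)) (k : Biclique A B) where

    In : V G → Set
    In z = A z ⊎ B z

    AB : ∀ {z} → A z → ¬ B z
    AB i j = E-irrefl (cross k i j)

    side : V G → Bool
    side v = does (A? v)

    some-out : ∃[ v ] Out A B v
    some-out with all? (λ v → A? v ⊎-dec B? v)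
    ... | no ¬all with ¬∀⟶∃¬ _ _ (λ v → A? v ⊎-dec B? v) ¬all
    ...   | v , ¬in = v , ¬in ∘ inj₁ , ¬in ∘ inj₂
    some-out | yes all = ⊥-elim (not-CB (side , (_ , yes-side (A₁ k)) , (_ , no-side (B₁ k)) , agree))
      where
      yes-side : ∀ {v} → A v → side v ≡ true
      yes-side {v} i with A? v
      ... | yes _ = refl
      ... | no ¬i = ⊥-elim (¬i i)
      no-side : ∀ {v} → B v → side v ≡ false
      no-side {v} i with A? v
      ... | yes j = ⊥-elim (AB j i)
      ... | no _ = refl
      agree : ∀ u v → adj G u v ≡ (side u xor side v)
      agree u v with all u | all v
      ... | inj₁ i | inj₁ j rewrite yes-side i | yes-side j = ¬true (stable k i j)
      ... | inj₁ i | inj₂ j rewrite yes-side i | no-side j = cross k i j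
      ... | inj₂ i | inj₁ j rewrite no-side i | yes-side j = E-sym (cross k j i)
      ... | inj₂ i | inj₂ j rewrite no-side i | no-side j = ¬true (stable (flip-biclique k) i j)

    v₀ : V G
    v₀ = proj₁ some-out

    D : V G → Set
    D z = ∃[ l ] Walk (Out A B) v₀ l z

    Att : V G → Set
    Att c = In c × ∃[ d ] (D d × E d c)

    att-clique : ∀ {c c′} → Att c → Att c′ → c ≢ c′ → E c c′
    att-clique {c} {c′} (i , d , (l , w) , e) (j , d′ , (l′ , w′) , e′) ne with E? c c′
    ... | yes r = r
    ... | no ¬r = ⊥-elim (no-short k _ (proj₂ joined) e e′ (same i j) ne ≤-refl)
      where
      same : In c → In c′ → (A c × A c′) ⊎ (B c × B c′)
      same (inj₁ x) (inj₁ y) = inj₁ (x , y)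
      same (inj₂ x) (inj₂ y) = inj₂ (x , y)
      same (inj₁ x) (inj₂ y) = ⊥-elim (¬r (cross k x y))
      same (inj₂ x) (inj₁ y) = ⊥-elim (¬r (E-sym (cross k y x)))
      joined : ∃[ l ] Walk (Out A B) d l d′
      joined = walk-trans (walk-rev w) w′

    -- The list holds exactly the attachments of the component of `v₀`. These are pairwise adjacent,
    -- so they do not include both `a₁` and `a₂`, and a vertex of A is left on the other side.
    cut-by : ∀ cs → length cs ≤ 2 → (∀ {c} → c ∈ cs → Att c) → (∀ {c} → Att c → c ∈ cs) → ⊥
    cut-by cs len cs⊆ ⊆cs = no-SCC (cs , len , (λ u v i j → att-clique (cs⊆ i) (cs⊆ j)) , v₀ , proj₁ target , v₀∉ , proj₂
        (proj₂ target) , separated)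
      where
      v₀∉ : ¬ (v₀ ∈ cs)
      v₀∉ i = [ proj₁ (proj₂ some-out) , proj₂ (proj₂ some-out) ]′ (proj₁ (cs⊆ i))
      target : ∃[ t ] (A t × ¬ (t ∈ cs))
      target with mem? _≟_ (a₁ k) cs | mem? _≟_ (a₂ k) cs
      ... | no p | _ = _ , A₁ k , p
      ... | yes _ | no p = _ , A₂ k , p
      ... | yes p | yes q = ⊥-elim (stable k (A₁ k) (A₂ k) (att-clique (cs⊆ p) (cs⊆ q) (a₁₂ k)))
      head∉ : ∀ {y t} → Reach G (λ y → ¬ (y ∈ cs)) y t → ¬ (y ∈ cs)
      head∉ (here p) = p
      head∉ (step p _ _) = p
      trapped : ∀ {z t} → D z → Reach G (λ y → ¬ (y ∈ cs)) z t → D t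
      trapped d (here _) = d
      trapped {z} (l , w) (step {v = y} _ e r) with A? y | B? y
      ... | yes i | _ = ⊥-elim (head∉ r (⊆cs (inj₁ i , z , (l , w) , e)))
      ... | no _ | yes i = ⊥-elim (head∉ r (⊆cs (inj₂ i , z , (l , w) , e)))
      ... | no ¬a | no ¬b = trapped (_ , walk-++ w e (stop (¬a , ¬b))) r
      separated : ¬ Reach G (λ y → ¬ (y ∈ cs)) v₀ (proj₁ target)
      separated r with trapped (_ , stop (proj₂ some-out)) r
      ... | l , w = proj₁ (walk-all w (walk-end∈ w)) (proj₁ (proj₂ target))

    -- Case distinction on the number of attachments, which is harmless since the goal is ⊥.
    impossible : ⊥
    impossible = some-att λ { (c₁ , t₁) → cut-by (c₁ ∷ []) (s≤s z≤n) (λ { (here refl) → t₁ }) (single c₁ t₁) }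
      where
      pair : ∀ {c₁ c₂} → Att c₁ → Att c₂ → c₁ ≢ c₂ → ∀ {c} → Att c → c ∈ c₁ ∷ c₂ ∷ []
      pair {c₁} {c₂} t₁ t₂ ne {c} t with c ≟ c₁ | c ≟ c₂
      ... | yes e | _ = here e
      ... | no _ | yes e = there (here e)
      ... | no n₁ | no n₂ = ⊥-elim (tri (att-clique t₁ t₂ ne) (att-clique t₂ t (n₂ ∘ sym)) (att-clique t₁ t (n₁ ∘ sym)))
      single : ∀ c₁ → Att c₁ → ∀ {c} → Att c → c ∈ c₁ ∷ []
      single c₁ t₁ {c} t with c ≟ c₁
      ... | yes e = here e
      ... | no ne = ⊥-elim (cut-by (c₁ ∷ c ∷ []) (s≤s (s≤s z≤n)) (λ { (here refl) → t₁ ; (there (here refl)) → t })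
              (pair t₁ t (ne ∘ sym)))
      some-att : ¬ ¬ (∃[ c ] Att c)
      some-att none = cut-by [] z≤n (λ ()) λ {c} t → ⊥-elim (none (c , t))

  no-K₃₃ : ¬ CompleteBipartite G → ¬ HasSmallCliqueCutset G → ∀ {a b c d e f} → E a d → E a e → E a f → E b d → E b e → E b f →
    E c d → E c e → E c f → a ≢ b → b ≢ c → a ≢ c → d ≢ e → e ≢ f → d ≢ f → ⊥
  no-K₃₃ not-CB no-SCC {a} {b} {c} {d} {e} {f} ad ae af bd be bf cd ce cf a≢b b≢c a≢c d≢e e≢f d≢f =
    Closure.impossible not-CB no-SCC A? B? (record
      { cross = λ i j → i _ j ; A₁ = λ _ → proj₁ ; A₂ = λ _ → proj₁ ∘ proj₂ ; A₃ = λ _ → proj₂ ∘ proj₂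
      ; B₁ = ad , bd , cd ; B₂ = ae , be , ce ; B₃ = af , bf , cf
      ; a₁₂ = a≢b ; a₂₃ = b≢c ; a₁₃ = a≢c ; b₁₂ = d≢e ; b₂₃ = e≢f ; b₁₃ = d≢f
      ; maxA = maxA′ ; maxB = maxB′ })
    where
    -- Taking common neighbourhoods twice makes the biclique maximal.
    B A : V G → Set
    B v = E a v × E b v × E c v
    A v = ∀ u → B u → E v u
    B? : ∀ v → Dec (B v)
    B? v = E? a v ×-dec E? b v ×-dec E? c v
    A? : ∀ v → Dec (A v)
    A? v = all? (λ u → B? u →-dec E? v u)
    maxA′ : ∀ {v} → ¬ B v → ∃[ x ] (A x × ¬ E v x)
    maxA′ {v} ¬Bv with E? a v | E? b v | E? c v
    ... | no p | _ | _ = a , (λ _ → proj₁) , p ∘ E-sym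
    ... | yes _ | no p | _ = b , (λ _ → proj₁ ∘ proj₂) , p ∘ E-sym
    ... | yes _ | yes _ | no p = c , (λ _ → proj₂ ∘ proj₂) , p ∘ E-sym
    ... | yes p | yes q | yes r = ⊥-elim (¬Bv (p , q , r))
    maxB′ : ∀ {v} → ¬ A v → ∃[ y ] (B y × ¬ E v y)
    maxB′ {v} ¬Av with ¬∀⟶∃¬ _ _ (λ u → B? u →-dec E? v u) ¬Av
    ... | u , ¬imp with B? u
    ...   | yes Bu = u , Bu , λ r → ¬imp (λ _ → r)
    ...   | no ¬Bu = ⊥-elim (¬imp (λ Bu → ⊥-elim (¬Bu Bu)))

-- From rims given as lists to indexed holes.

module _ {X : Set} where

  nth : X → List X → ℕ → X
  nth d [] _ = d
  nth d (x ∷ l) zero = x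
  nth d (x ∷ l) (suc i) = nth d l i

  nth-at : ∀ d A {y : X} {B} → nth d (A ++ y ∷ B) (length A) ≡ y
  nth-at d [] = refl
  nth-at d (_ ∷ A) = nth-at d A

  split-at : ∀ (L : List X) i → i < length L → ∃[ A ] ∃[ y ] ∃[ B ] (L ≡ A ++ y ∷ B × length A ≡ i)
  split-at (x ∷ L) zero _ = [] , x , L , refl , refl
  split-at (x ∷ L) (suc i) (s≤s lt) with split-at L i lt
  ... | A , y , B , refl , refl = x ∷ A , y , B , refl , refl

  at-< : ∀ (A : List X) {y B} → length A < length (A ++ y ∷ B)
  at-< A {y} {B} = subst (length A <_) (sym (length-++ A)) (≤-trans (s≤s (m≤m+n (length A) (length B)))
      (≤-reflexive (sym (+-suc (length A) (length B)))))

module OfList (G : Graph) (u : V G) (M : List (V G)) where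
  open Paths G

  L : List (V G)
  L = u ∷ M

  -- Reducing the index modulo the length makes the sequence periodic and in range, so the default u
  -- of `nth` is never what is read.
  vt : ℕ → V G
  vt i = nth u L (i % suc (length M))

  vt-at : ∀ A {y B} → L ≡ A ++ y ∷ B → vt (length A) ≡ y
  vt-at A {y} {B} eq = trans (cong (nth u L) (m<n⇒m%n≡m (subst (λ K → length A < length K) (sym eq) (at-< A {y} {B}))))
    (trans (cong (λ K → nth u K (length A)) eq) (nth-at u A))

  vt-split : ∀ i → i < length L → ∃[ A ] ∃[ B ] (L ≡ A ++ vt i ∷ B × length A ≡ i)
  vt-split i lt with split-at L i lt
  ... | A , y , B , eq , refl = A , B , trans eq (cong (λ z → A ++ z ∷ B) (sym (vt-at A eq))) , refl

  vt-periodic : ∀ i → vt (length L + i) ≡ vt i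
  vt-periodic i = cong (nth u L) (trans (cong (_% suc (length M)) (+-comm (length L) i)) ([m+n]%n≡m%n i (suc (length M))))

  vt∈ : ∀ {i} → i < length L → vt i ∈ L
  vt∈ {i} lt with vt-split i lt
  ... | A , B , eq , _ = subst (vt i ∈_) (sym eq) (∈-mid A)

  ∈⇒vt : ∀ {z} → z ∈ L → ∃[ i ] (i < length L × z ≡ vt i)
  ∈⇒vt {z} i with ∈-∃++ i
  ... | A , B , eq = length A , subst (λ K → length A < length K) (sym eq) (at-< A {z} {B}) , sym (vt-at A eq)

  -- With one vertex between x and y and another outside, deleting the outer one leaves an induced
  -- path on which x and y are not consecutive.
  chord-of-hole : ∀ A {x} K {y} B → IsHole (A ++ x ∷ K ++ y ∷ B) → E x y → K ≡ [] ⊎ (A ≡ [] × B ≡ [])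
  chord-of-hole A [] B h e = inj₁ refl
  chord-of-hole A {x} (m ∷ K) {y} B h e = [ (λ z → inj₂ (empty-r B A z , empty-l B A z)) , (λ { (z , i) → ⊥-elim (chord i) }) ]′
      (emptiness (B ++ A))
    where
    h′ : IsHole (x ∷ (m ∷ K) ++ y ∷ B ++ A)
    h′ = subst IsHole (cong (x ∷_) (++-assoc (m ∷ K) (y ∷ B) A)) (rot A h)
    chord : ∀ {z} → z ∈ B ++ A → ⊥
    chord i with hole-arc (m ∷ K) h′ i
    ... | cons _ far _ = proj₂ (far (∈-mid K)) e
    emptiness : ∀ (Z : List (V G)) → Z ≡ [] ⊎ ∃[ z ] z ∈ Z
    emptiness [] = inj₁ refl
    emptiness (z ∷ Z) = inj₂ (z , here refl)
    empty-l : ∀ (B A : List (V G)) → B ++ A ≡ [] → B ≡ []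
    empty-l [] A _ = refl
    empty-r : ∀ (B A : List (V G)) → B ++ A ≡ [] → A ≡ []
    empty-r [] A e = e

  split-unique : ∀ A {x B} A′ {B′} → IsHole (A ++ x ∷ B) → A ++ x ∷ B ≡ A′ ++ x ∷ B′ → length A ≡ length A′
  split-unique A {x} {B} A′ h eq with ++-split A (x ∷ B) {A′} eq
  ... | inj₁ (N′ , refl , _) = ⊥-elim (hole-∉ (rot A h) (∈-++⁺ʳ B (∈-mid A′)))
  ... | inj₂ ([] , refl , _) = cong length (sym (++-identityʳ A))
  ... | inj₂ (_ ∷ X , refl , eqB) = ⊥-elim (hole-∉ (rot A h) (∈-++⁺ˡ (subst (x ∈_) (sym (proj₂ (∷-injective eqB))) (∈-mid X))))

  module _ (h : IsHole L) where

    private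
      ℓ = length L

    vt-distinct : ∀ i j → i < ℓ → j < ℓ → vt i ≡ vt j → i ≡ j
    vt-distinct i j i< j< e with vt-split i i< | vt-split j j<
    ... | A , B , eq , refl | A′ , B′ , eq′ , refl =
      split-unique A A′ (subst IsHole eq h) (trans (sym eq) (trans eq′ (cong (λ z → A′ ++ z ∷ B′) (sym e))))

    pair : ∀ {i j} → i < j → j < ℓ → ∃[ A ] ∃[ K ] ∃[ B ] (L ≡ A ++ vt i ∷ K ++ vt j ∷ B × length A ≡ i × suc (i + length K) ≡ j)
    pair {i} {j} i<j j< with vt-split i (≤-trans i<j (<⇒≤ j<)) | vt-split j j<
    ... | A , B , eq , refl | A′ , B′ , eq′ , refl with ++-split A′ (vt (length A′) ∷ B′) {A} (trans (sym eq′) eq)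
    ...   | inj₁ (K , eqA′ , eqB) = A , K , B′ , trans eq (cong (λ Z → A ++ vt (length A) ∷ Z) eqB) , refl ,
              sym (trans (cong length eqA′) (trans (length-++ A) (+-suc (length A) (length K))))
    ...   | inj₂ (X , eqA , _) = ⊥-elim (<⇒≱ i<j (≤-trans (m≤m+n (length A′) (length X))
            (≤-reflexive (sym (trans (cong length eqA) (length-++ A′))))))

    chordless-< : ∀ {i j} → i < j → j < ℓ → (E (vt i) (vt j) → Consec ℓ i j) × (Consec ℓ i j → E (vt i) (vt j))
    chordless-< {i} {j} i<j j< with pair i<j j<
    ... | A , K , B , eq , refl , sz = to , from
      where
      h′ : IsHole (A ++ vt (length A) ∷ K ++ vt j ∷ B)
      h′ = subst IsHole eq h
      lenL : ℓ ≡ length A + suc (length K + suc (length B))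
      lenL = trans (cong length eq) (trans (length-++ A) (cong (λ k → length A + suc k) (length-++ K)))
      to : E (vt (length A)) (vt j) → Consec ℓ (length A) j
      to e with chord-of-hole A K B h′ e
      ... | inj₁ refl = inj₁ (trans (cong suc (sym (+-identityʳ (length A)))) sz)
      ... | inj₂ (refl , refl) = inj₂ (inj₂ (inj₂ (trans (trans (cong suc (sym sz)) (cong suc (+-comm 1 (length K)))) (sym lenL) ,
              refl)))
      empty : ∀ (Z : List (V G)) → length Z ≡ 0 → Z ≡ []
      empty [] _ = refl
      adjacent : K ≡ [] → E (vt (length A)) (vt j)
      adjacent e = go′ K e h′
        where
        go′ : ∀ K → K ≡ [] → IsHole (A ++ vt (length A) ∷ K ++ vt j ∷ B) → E (vt (length A)) (vt j)
        go′ [] _ h″ = hole-edge₀ (rot A h″)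
      closing : A ≡ [] → B ≡ [] → E (vt (length A)) (vt j)
      closing eA eB = E-sym (go′ A B eA eB h′)
        where
        go′ : ∀ A′ B′ → A′ ≡ [] → B′ ≡ [] → IsHole (A′ ++ vt (length A) ∷ K ++ vt j ∷ B′) → E (vt j) (vt (length A))
        go′ [] [] _ _ h″ = hole-edgeₑ K h″
      from : Consec ℓ (length A) j → E (vt (length A)) (vt j)
      from (inj₁ e) = adjacent (empty K (+-cancelˡ-≡ (length A) _ _
          (suc-injective (trans sz (trans (sym e) (cong suc (sym (+-identityʳ (length A)))))))))
      from (inj₂ (inj₁ e)) = ⊥-elim (<⇒≱ i<j (≤-trans (n≤1+n j) (≤-reflexive e)))
      from (inj₂ (inj₂ (inj₁ (_ , refl)))) = ⊥-elim (absurd i<j)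
        where
        absurd : ∀ {k} → ¬ (k < 0)
        absurd ()
      from (inj₂ (inj₂ (inj₂ (e , eA)))) = closing (empty A eA) (empty B (suc-injective (suc-injective (suc-len))))
        where
        suc-len : suc (suc (length B)) ≡ 2
        suc-len = sym (+-cancelˡ-≡ (length K) 2 (suc (suc (length B)))
          (trans (trans (+-suc (length K) 1) (cong suc (+-suc (length K) 0)))
            (trans (cong (2 +_) (+-identityʳ (length K)))
              (trans (trans (cong (λ k → suc (suc (k + length K))) (sym eA)) (cong suc sz))
                (trans e (trans lenL (trans (cong (_+ suc (length K + suc (length B))) eA)
                    (sym (+-suc (length K) (suc (length B)))))))))))

    consec-sym : ∀ {i j} → Consec ℓ i j → Consec ℓ j i
    consec-sym (inj₁ e) = inj₂ (inj₁ e)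
    consec-sym (inj₂ (inj₁ e)) = inj₁ e
    consec-sym (inj₂ (inj₂ (inj₁ e))) = inj₂ (inj₂ (inj₂ e))
    consec-sym (inj₂ (inj₂ (inj₂ e))) = inj₂ (inj₂ (inj₁ e))

    vt-chordless : ∀ i j → i < ℓ → j < ℓ → (E (vt i) (vt j) → Consec ℓ i j) × (Consec ℓ i j → E (vt i) (vt j))
    vt-chordless i j i< j< with <-cmp i j
    ... | tri< lt _ _ = chordless-< lt j<
    ... | tri> _ _ gt = (λ e → consec-sym (proj₁ (chordless-< gt i<) (E-sym e))) , λ c → E-sym
            (proj₂ (chordless-< gt i<) (consec-sym c))
    ... | tri≈ _ refl _ = (λ e → ⊥-elim (E-irrefl e)) , λ c → ⊥-elim (self c)
      where
      loop : ∀ {k} → suc k ≢ k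
      loop ()
      short : ∀ {k} → suc k ≡ ℓ → k ≢ 0
      short refl e with subst (λ k → 4 ≤ suc k) e (IsHole.len4 h)
      ... | s≤s ()
      self : ¬ Consec ℓ i i
      self (inj₁ e) = loop e
      self (inj₂ (inj₁ e)) = loop e
      self (inj₂ (inj₂ (inj₁ (e , z)))) = short e z
      self (inj₂ (inj₂ (inj₂ (e , z)))) = short e z

    holeOf : Hole G
    holeOf = record { len = ℓ ; len≥4 = IsHole.len4 h ; vtx = vt ; periodic = vt-periodic ; distinct = vt-distinct ; chordless =
        vt-chordless }

    isWheel : ∀ {x} → ¬ (x ∈ L) → 3 ≤ cnt x L → IsWheel G holeOf x
    isWheel {x} x∉ c with cnt-first x L (≤-trans (s≤s z≤n) c)
    ... | X₁ , a , Y₁ , eq₁ , ea , _ , c₁ with cnt-first x Y₁ (≤-trans (s≤s z≤n) (≤-pred (subst (3 ≤_) c₁ c)))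
    ... | X₂ , b , Y₂ , refl , eb , _ , c₂ with cnt-first x Y₂ (≤-pred (≤-pred (subst (3 ≤_) (trans c₁ (cong suc c₂)) c)))
    ... | X₃ , d , Y₃ , refl , ed , _ = (λ { (i , lt , refl) → x∉ (vt∈ lt) }) ,
        length X₁ , length (X₁ ++ a ∷ X₂) , length (X₁ ++ a ∷ X₂ ++ b ∷ X₃) ,
        at-< X₁ , subst (λ Z → length (X₁ ++ a ∷ X₂) < length Z) (++-assoc X₁ (a ∷ X₂) (b ∷ X₃)) (at-< (X₁ ++ a ∷ X₂)) ,
        subst (λ Z → length (X₁ ++ a ∷ X₂ ++ b ∷ X₃) < length Z) (sym eq₃) (at-< (X₁ ++ a ∷ X₂ ++ b ∷ X₃)) ,
        subst (E x) (sym (vt-at X₁ eq₁)) ea , subst (E x) (sym (vt-at (X₁ ++ a ∷ X₂) eq₂)) eb ,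
        subst (E x) (sym (vt-at (X₁ ++ a ∷ X₂ ++ b ∷ X₃) eq₃)) ed
      where
      eq₂ : L ≡ (X₁ ++ a ∷ X₂) ++ b ∷ X₃ ++ d ∷ Y₃
      eq₂ = trans eq₁ (sym (++-assoc X₁ (a ∷ X₂) _))
      eq₃ : L ≡ (X₁ ++ a ∷ X₂ ++ b ∷ X₃) ++ d ∷ Y₃
      eq₃ = trans eq₂ (trans (sym (++-assoc (X₁ ++ a ∷ X₂) (b ∷ X₃) (d ∷ Y₃)))
          (cong (_++ d ∷ Y₃) (++-assoc X₁ (a ∷ X₂) (b ∷ X₃))))

    -- By `reads`, `vt (p + k)` is the entry at position k of the rotation starting at p, so a
    -- sector that wraps around the list becomes a prefix.
    record Rotated (p : ℕ) : Set where
      field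
        J      : List (V G)
        hole   : IsHole J
        perm   : J ↭ L
        reads  : ∀ X {z Y} → J ≡ X ++ z ∷ Y → vt (p + length X) ≡ z

    rotate : ∀ p → p < ℓ → Rotated p
    rotate p p< with split-at L p p<
    ... | A , y , B , eq , refl = record
        { J = (y ∷ B) ++ A ; hole = rot A (subst IsHole eq h)
        ; perm = ↭-trans (↭-++-comm (y ∷ B) A) (↭-reflexive (sym eq)) ; reads = reads′ }
      where
      reads′ : ∀ X {z Y} → (y ∷ B) ++ A ≡ X ++ z ∷ Y → vt (length A + length X) ≡ z
      reads′ X {z} {Y} e with ++-split (y ∷ B) A {X} e
      ... | inj₁ (B′ , eqB , _) = trans (cong vt (sym (length-++ A)))
              (vt-at (A ++ X) (trans eq (trans (cong (A ++_) eqB) (sym (++-assoc A X (z ∷ B′))))))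
      ... | inj₂ (X′ , refl , eqA) = trans (cong vt len′) (trans (vt-periodic (length X′))
              (vt-at X′ (trans eq (trans (cong (_++ y ∷ B) eqA) (++-assoc X′ (z ∷ Y) (y ∷ B))))))
        where
        len′ : length A + length ((y ∷ B) ++ X′) ≡ ℓ + length X′
        len′ = trans (cong (length A +_) (length-++ (y ∷ B))) (trans (sym (+-assoc (length A) (length (y ∷ B)) (length X′)))
          (cong (_+ length X′) (sym (trans (cong length eq) (length-++ A)))))

-- Sectors are cut off when no outside walk has separated ends.

module Sectors (G : Graph) (tri : Paths.TriangleFree G) (isk : ¬ ContainsISK4 G) where
  open Paths G
  open Wheels G tri isk
  open GoodWheels G tri isk
  open Wheel

  module Sector {u M x} (w : Wheel (u ∷ M) x)
    (no-violation : ∀ {p q a b l} → Walk (Free (u ∷ M) x) p l q → E p a → E q b → ¬ Rings.Sep (u ∷ M) x a b)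
    (p d : ℕ) {s C t D} (h : IsHole (s ∷ C ++ t ∷ D)) (perm : s ∷ C ++ t ∷ D ↭ u ∷ M)
    (reads : ∀ X {z Y} → s ∷ C ++ t ∷ D ≡ X ++ z ∷ Y → OfList.vt G u M (p + length X) ≡ z)
    (size : length (s ∷ C) ≡ d) (xs : E x s) (xt : E x t) (xC : None x C) where
    open OfList G u M
    open Rings (u ∷ M) x

    H : Hole G
    H = holeOf (rim w)

    J : List (V G)
    J = s ∷ C ++ t ∷ D

    eq-s : vt p ≡ s
    eq-s = trans (cong vt (sym (+-identityʳ p))) (reads [] refl)

    eq-t : vt (p + d) ≡ t
    eq-t = trans (cong (λ k → vt (p + k)) (sym size)) (reads (s ∷ C) refl)

    on : ∀ {z} → z ∈ J → OnHole H z
    on i = ∈⇒vt (∈-resp-↭ perm i)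

    on⁻ : ∀ {z} → OnHole H z → z ∈ J
    on⁻ (i , lt , refl) = ∈-resp-↭ (↭-sym perm) (vt∈ lt)

    sector⁻ : ∀ {z} → SectorSet H p d z → z ∈ s ∷ C ++ t ∷ []
    sector⁻ (e , e≤d , refl) with split-at J e (≤-trans (s≤s (≤-trans e≤d (≤-reflexive (sym size)))) (at-< (s ∷ C)))
    ... | X , y , Y , eq , refl rewrite reads X eq with ++-split (s ∷ C) (t ∷ D) {X} eq
    ...   | inj₁ (_ , eqC , _) = ∈-++⁺ˡ (subst (y ∈_) (sym eqC) (∈-mid X))
    ...   | inj₂ ([] , _ , eqD) = ∈-++⁺ʳ (s ∷ C) (here (sym (proj₁ (∷-injective eqD))))
    ...   | inj₂ (c ∷ X′ , eqX , _) = ⊥-elim (<⇒≱ big e≤d)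
      where
      big : d < length X
      big = ≤-trans (≤-reflexive (cong suc (sym size))) (≤-trans (≤-reflexive (+-comm 1 (length (s ∷ C))))
          (≤-trans (+-monoʳ-≤ (length (s ∷ C)) (s≤s z≤n)) (≤-reflexive (sym (trans (cong length eqX) (length-++ (s ∷ C)))))))

    sector⁺ : ∀ {z} → z ∈ s ∷ C ++ t ∷ [] → SectorSet H p d z
    sector⁺ {z} i with ∈-∃++ i
    ... | X , Y , eq = length X , ≤-pred (≤-trans (subst (λ K → length X < length K) (sym eq) (at-< X {z} {Y}))
          (≤-reflexive (trans (length-++ (s ∷ C)) (trans (+-comm (length (s ∷ C)) 1) (cong suc size))))) ,
        sym (reads X (trans (sym (++-assoc (s ∷ C) (t ∷ []) D)) (trans (cong (_++ D) eq) (++-assoc X (z ∷ Y) D))))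

    Cut : V G → Set
    Cut = SectorCut G H x p d

    hD : IsHole (t ∷ D ++ s ∷ C)
    hD = rot (s ∷ C) h

    s-or-t : ∀ {z} → z ≡ s ⊎ z ≡ t → Cut z
    s-or-t (inj₁ refl) = inj₂ (inj₁ (sym eq-s))
    s-or-t (inj₂ refl) = inj₂ (inj₂ (sym eq-t))

    -- The invariant of a walk that starts in the sector interior and avoids the cutset: it is in C,
    -- or outside the rim and N[x] at a vertex reached from an attachment of C.
    State : V G → Set
    State z = z ∈ C ⊎ (∃[ q ] ∃[ l ] ∃[ c ] (c ∈ C × E q c × Walk (Free (u ∷ M) x) q l z))

    -- The ends s and t of the sector are spokes, one on each arc between c and z.
    sep : ∀ {c z} → c ∈ C → z ∈ D → Sep c z
    sep {c} {z} i j with ∈-∃++ i | ∈-∃++ j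
    ... | C₁ , C₂ , refl | D₁ , D₂ , refl = C₂ ++ t ∷ D₁ , D₂ ++ s ∷ C₁ , ring (subst IsHole eq h′)
            (↭-trans (↭-reflexive (sym eq)) perm′)
          (≤-trans (cnt-∈ (t ∷ D₁) (here refl) xt) (cnt-≤ʳ x C₂)) (≤-trans (cnt-∈ (s ∷ C₁) (here refl) xs) (cnt-≤ʳ x D₂))
      where
      eq₀ : s ∷ (C₁ ++ c ∷ C₂) ++ t ∷ D₁ ++ z ∷ D₂ ≡ (s ∷ C₁) ++ c ∷ C₂ ++ t ∷ D₁ ++ z ∷ D₂
      eq₀ = cong (s ∷_) (++-assoc C₁ (c ∷ C₂) _)
      h′ : IsHole ((c ∷ C₂ ++ t ∷ D₁ ++ z ∷ D₂) ++ s ∷ C₁)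
      h′ = rot (s ∷ C₁) (subst IsHole eq₀ h)
      perm′ : (c ∷ C₂ ++ t ∷ D₁ ++ z ∷ D₂) ++ s ∷ C₁ ↭ u ∷ M
      perm′ = ↭-trans (↭-++-comm (c ∷ C₂ ++ t ∷ D₁ ++ z ∷ D₂) (s ∷ C₁)) (↭-trans (↭-reflexive (sym eq₀)) perm)
      eq : (c ∷ C₂ ++ t ∷ D₁ ++ z ∷ D₂) ++ s ∷ C₁ ≡ c ∷ (C₂ ++ t ∷ D₁) ++ z ∷ D₂ ++ s ∷ C₁
      eq = cong (c ∷_) (trans (++-assoc C₂ (t ∷ D₁ ++ z ∷ D₂) (s ∷ C₁))
          (trans (cong (λ K → C₂ ++ t ∷ K) (++-assoc D₁ (z ∷ D₂) (s ∷ C₁))) (sym (++-assoc C₂ (t ∷ D₁) _))))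

    -- An edge from outside onto D would complete a walk between separated rim vertices, and an edge
    -- from C to D would be a chord of the hole.
    advance : ∀ {z z′} → State z → E z z′ → ¬ Cut z′ → State z′
    advance {z} {z′} st e ¬cut with mem? _≟_ z′ J
    advance {z} {z′} st e ¬cut | no z′∉ = inj₂ (outside st)
      where
      free : Free (u ∷ M) x z′
      free = (λ i → z′∉ (∈-resp-↭ (↭-sym perm) i)) , (λ r → ¬cut (inj₁ (inj₂ r , z′∉ ∘ on⁻))) , λ r → ¬cut
          (inj₁ (inj₁ (E-sym r) , z′∉ ∘ on⁻))
      outside : State z → ∃[ q ] ∃[ l ] ∃[ c ] (c ∈ C × E q c × Walk (Free (u ∷ M) x) q l z′)
      outside (inj₁ i) = z′ , z′ ∷ [] , z , i , E-sym e , stop free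
      outside (inj₂ (q , l , c , i , qc , wk)) = q , _ , c , i , qc , walk-++ wk e (stop free)
    advance {z} {z′} st e ¬cut | yes (here r) = ⊥-elim (¬cut (s-or-t (inj₁ r)))
    advance {z} {z′} st e ¬cut | yes (there i) with ∈-++⁻ C i
    ... | inj₁ j = inj₁ j
    ... | inj₂ (here r) = ⊥-elim (¬cut (s-or-t (inj₂ r)))
    ... | inj₂ (there j) = ⊥-elim (crossed st)
      where
      crossed : State z → ⊥
      crossed (inj₁ k) = proj₂ (hole-## C h k j) e
      crossed (inj₂ (q , l , c , k , qc , wk)) = no-violation wk qc e (sep k j)

    stuck : ∀ {z y} → State z → Reach G (λ v → ¬ Cut v) z y → State y
    stuck st (here _) = st
    stuck st (step _ e r) = stuck (advance st e (head r)) r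
      where
      head : ∀ {z y} → Reach G (λ v → ¬ Cut v) z y → ¬ Cut z
      head (here c) = c
      head (step c _ _) = c

    separates : ∀ {z y} → z ∈ C → y ∈ D → ¬ Reach G (λ v → ¬ Cut v) z y
    separates i j r with stuck (inj₁ i) r
    ... | inj₁ k = proj₁ (hole-## C h k j) refl
    ... | inj₂ (_ , _ , _ , _ , _ , wk) = proj₁ (walk-all wk (walk-end∈ wk)) (∈-resp-↭ perm (there (∈-++⁺ʳ C (there j))))

    C-uncut : ∀ {z} → z ∈ C → ¬ Cut z
    C-uncut i (inj₁ (_ , ¬on)) = ¬on (on (there (∈-++⁺ˡ i)))
    C-uncut i (inj₂ (inj₁ refl)) = hole-∉ h (∈-++⁺ˡ (subst (_∈ C) eq-s i))
    C-uncut i (inj₂ (inj₂ refl)) = hole-∉ hD (∈-++⁺ʳ D (there (subst (_∈ C) eq-t i)))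

    D-uncut : ∀ {z} → z ∈ D → ¬ Cut z
    D-uncut i (inj₁ (_ , ¬on)) = ¬on (on (there (∈-++⁺ʳ C (there i))))
    D-uncut i (inj₂ (inj₁ refl)) = hole-∉ h (∈-++⁺ʳ C (there (subst (_∈ D) eq-s i)))
    D-uncut i (inj₂ (inj₂ refl)) = hole-∉ hD (∈-++⁺ˡ (subst (_∈ D) eq-t i))

    some-C : ∃[ z ] z ∈ C
    some-C = view C h
      where
      view : ∀ C → IsHole (s ∷ C ++ t ∷ D) → ∃[ z ] z ∈ C
      view [] h = ⊥-elim (tri xs (hole-edge₀ h) xt)
      view (z ∷ _) _ = z , here refl

    some-D : ∃[ z ] (z ∈ D × E x z)
    some-D = cnt-mem D (≤-pred (≤-pred (subst (3 ≤_) eq (spokes w))))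
      where
      eq : cnt x (u ∷ M) ≡ 2 + cnt x D
      eq = trans (sym (cnt-↭ x perm)) (trans (cnt-yes (C ++ t ∷ D) xs)
          (cong suc (trans (cnt-++ x C (t ∷ D)) (trans (cong (_+ cnt x (t ∷ D)) (cnt-none C xC)) (cnt-yes D xt)))))

    -- Both sides are inhabited: C because adjacent s and t would form a triangle with x, and D
    -- because it contains the remaining spokes.
    separating : CutsetSeparating G Cut (SectorSet H p d) (λ z → OnHole H z × ¬ SectorSet H p d z)
    separating = (proj₁ some-C , proj₁ some-D , C-uncut (proj₂ some-C) , D-uncut (proj₁ (proj₂ some-D)) , separates (proj₂ some-C)
        (proj₁ (proj₂ some-D))) ,
      λ a b Sa (onb , ¬Sb) ¬Ca ¬Cb → separates (inC (sector⁻ Sa) ¬Ca) (inD (on⁻ onb) ¬Sb)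
      where
      inC : ∀ {z} → z ∈ s ∷ C ++ t ∷ [] → ¬ Cut z → z ∈ C
      inC (here e) ¬c = ⊥-elim (¬c (s-or-t (inj₁ e)))
      inC (there i) ¬c = [ (λ j → j) , (λ { (here e) → ⊥-elim (¬c (s-or-t (inj₂ e))) }) ]′ (∈-++⁻ C i)
      inD : ∀ {z} → z ∈ J → ¬ SectorSet H p d z → z ∈ D
      inD (here e) ¬S = ⊥-elim (¬S (sector⁺ (here e)))
      inD (there i) ¬S with ∈-++⁻ C i
      ... | inj₁ j = ⊥-elim (¬S (sector⁺ (there (∈-++⁺ˡ j))))
      ... | inj₂ (here e) = ⊥-elim (¬S (sector⁺ (∈-++⁺ʳ (s ∷ C) (here e))))
      ... | inj₂ (there j) = j

  sector-cut : ∀ {u M x} (w : Wheel (u ∷ M) x) →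
    (∀ {p q a b l} → Walk (Free (u ∷ M) x) p l q → E p a → E q b → ¬ Rings.Sep (u ∷ M) x a b) →
    ∀ p d → let H = OfList.holeOf G u M (rim w) in IsSector G H x p d →
    CutsetSeparating G (SectorCut G H x p d) (SectorSet H p d) (λ z → OnHole H z × ¬ SectorSet H p d z)
  sector-cut {u} {M} {x} w nv p d (p< , 1≤d , d< , ep , ed , none) = build (OfList.rotate G u M (rim w) p p<)
    where
    open OfList G u M
    build : Rotated (rim w) p → _
    build r with split-at (Rotated.J r) d (subst (d <_) (sym (↭-length (Rotated.perm r))) d<)
    ... | [] , t , D , eq , size = ⊥-elim (absurd (subst (1 ≤_) (sym size) 1≤d))
      where
      absurd : ¬ (1 ≤ 0)
      absurd ()
    ... | s ∷ C , t , D , eq , size = Sector.separating w nv p d (subst IsHole eq (Rotated.hole r))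
            (↭-trans (↭-reflexive (sym eq)) (Rotated.perm r))
          reads′ size (subst (E x) (trans (cong vt (sym (+-identityʳ p))) (reads′ [] refl)) ep)
          (subst (E x) (trans (cong (λ k → vt (p + k)) (sym size)) (reads′ (s ∷ C) refl)) ed) xC
      where
      reads′ : ∀ X {z Y} → s ∷ C ++ t ∷ D ≡ X ++ z ∷ Y → vt (p + length X) ≡ z
      reads′ X e = Rotated.reads r X (trans eq e)
      xC : None x C
      xC {z} i e with ∈-∃++ i
      ... | C₁ , C₂ , refl with trans (sym e) (subst (λ y → adj G x y ≡ false)
              (reads′ (s ∷ C₁) (cong (s ∷_) (++-assoc C₁ (z ∷ C₂) (t ∷ D))))
              (none (suc (length C₁)) (s≤s z≤n) (≤-trans (s≤s (at-< C₁ {z} {C₂})) (≤-reflexive size))))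
      ...   | ()

-- Decidability of the outcomes.

module Decide (G : Graph) where
  open Paths G

  some-list? : ∀ {P : List (V G) → Set} → (∀ l → Dec (P l)) → ∀ k → Dec (∃[ l ] (length l ≤ k × P l))
  some-list? P? zero = map′ (λ p → [] , z≤n , p) (λ { ([] , _ , p) → p }) (P? [])
  some-list? P? (suc k) = map′ to from (P? [] ⊎-dec any? (λ x → some-list? (λ l → P? (x ∷ l)) k))
    where
    to : _ → _
    to (inj₁ p) = [] , z≤n , p
    to (inj₂ (x , l , le , p)) = x ∷ l , s≤s le , p
    from : _ → _
    from ([] , _ , p) = inj₁ p
    from (x ∷ l , s≤s le , p) = inj₂ (x , l , le , p)

  path-unique : ∀ {l} → IPath l → Unique l
  path-unique nil = AllPairs.[]
  path-unique one = All.[] AllPairs.∷ AllPairs.[]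
  path-unique (cons e far p) = (E⇒≢ e All.∷ All.tabulate (λ i → proj₁ (far i))) AllPairs.∷ path-unique p

  hole-unique : ∀ {u M} → IsHole (u ∷ M) → Unique (u ∷ M)
  hole-unique h = All.tabulate (λ { i refl → hole-∉ h i }) AllPairs.∷ path-unique (hole-tail h)

  lookup-injective : ∀ {l : List (V G)} → Unique l → ∀ {i j} → lookup l i ≡ lookup l j → i ≡ j
  lookup-injective (_ AllPairs.∷ _) {zero} {zero} _ = refl
  lookup-injective {_ ∷ l} (x≢ AllPairs.∷ _) {zero} {suc j} e = ⊥-elim (All.lookup x≢ (∈-lookup j) e)
  lookup-injective {_ ∷ l} (x≢ AllPairs.∷ _) {suc i} {zero} e = ⊥-elim (All.lookup x≢ (∈-lookup i) (sym e))
  lookup-injective (_ AllPairs.∷ un) {suc i} {suc j} e = cong suc (lookup-injective un e)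

  unique-length : ∀ {l : List (V G)} → Unique l → length l ≤ n G
  unique-length un = injective⇒≤ (lookup-injective un)

  walk? : ∀ {A : V G → Set} → (∀ z → Dec (A z)) → ∀ u l v → Dec (Walk A u l v)
  walk? A? u [] v = no λ ()
  walk? A? u (x ∷ []) v with x ≟ u | u ≟ v | A? u
  ... | yes refl | yes refl | yes a = yes (stop a)
  ... | no ne | _ | _ = no λ { (stop _) → ne refl ; (go _ _ ()) }
  ... | yes refl | no ne | _ = no λ { (stop _) → ne refl ; (go _ _ ()) }
  ... | yes refl | yes refl | no ¬a = no λ { (stop a) → ¬a a ; (go _ _ ()) }
  walk? A? u (x ∷ y ∷ l) v with x ≟ u | A? u | E? u y | walk? A? y (y ∷ l) v
  ... | yes refl | yes a | yes e | yes w = yes (go a e w)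
  ... | no ne | _ | _ | _ = no λ { (go _ _ _) → ne refl }
  ... | yes refl | no ¬a | _ | _ = no λ { (go a _ _) → ¬a a }
  ... | yes refl | yes _ | no ¬e | _ = no λ { (go _ e (stop _)) → ¬e e ; (go _ e (go _ _ _)) → ¬e e }
  ... | yes refl | yes _ | yes _ | no ¬w = no λ { (go _ _ w@(stop _)) → ¬w w ; (go _ _ w@(go _ _ _)) → ¬w w }

  -- Reachability is witnessed by an induced walk. Its vertices are distinct, so lists of length at
  -- most `n G` suffice.
  reach? : ∀ {A : V G → Set} → (∀ z → Dec (A z)) → ∀ u v → Dec (Reach G A u v)
  reach? A? u v = map′ (λ { (_ , _ , w) → walk⇒reach w }) bounded (some-list? (λ l → walk? A? u l v) (n G))
    where
    bounded : _ → _
    bounded r with shorten (proj₂ (reach⇒walk r))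
    ... | l , p , w , _ = l , unique-length (path-unique p) , w

  cutset? : ∀ {C : V G → Set} → (∀ z → Dec (C z)) → Dec (IsCutset G C)
  cutset? C? = any? λ u → any? λ v → ¬? (C? u) ×-dec ¬? (C? v) ×-dec ¬? (reach? (λ z → ¬? (C? z)) u v)

  small-clique-cutset? : Dec (HasSmallCliqueCutset G)
  small-clique-cutset? = some-list? (λ cs → all? (λ u → all? λ v → mem? _≟_ u cs →-dec mem? _≟_ v cs →-dec ¬? (u ≟ v) →-dec E? u
      v)
    ×-dec cutset? (λ z → mem? _≟_ z cs)) 2

  -- If a lies on the true side then the side of v is read off the adjacency between a and v.
  complete-bipartite? : Dec (CompleteBipartite G)
  complete-bipartite? = map′ to from (any? λ a → any? λ b → E? a b ×-dec all? λ u → all? λ v → adj G u v Bool.≟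
      (side a u xor side a v))
    where
    side : V G → V G → Bool
    side a v = not (adj G a v)
    to : _ → CompleteBipartite G
    to (a , b , e , agree) = side a , (a , cong not (adj-irrefl G a)) , (b , cong not e) , agree
    from : CompleteBipartite G → _
    from (σ , (a , σa) , (b , σb) , agree) = a , b , trans (adj-a b) (cong not σb) , λ u v → trans (agree u v)
        (sym (cong₂ _xor_ (side-σ u) (side-σ v)))
      where
      adj-a : ∀ v → adj G a v ≡ not (σ v)
      adj-a v = trans (agree a v) (cong (_xor σ v) σa)
      side-σ : ∀ v → side a v ≡ σ v
      side-σ v = trans (cong not (adj-a v)) (Bool.not-involutive (σ v))

  path? : ∀ l → Dec (IPath l)
  path? [] = yes nil
  path? (x ∷ []) = yes one
  path? (x ∷ y ∷ l) with E? x y | All.all? (λ z → ¬? (x ≟ z) ×-dec ¬? (E? x z)) l | path? (y ∷ l)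
  ... | yes e | yes f | yes p = yes (cons e (All.lookup f) p)
  ... | no ¬e | _ | _ = no λ { (cons e _ _) → ¬e e }
  ... | yes _ | no ¬f | _ = no λ { (cons _ f _) → ¬f (All.tabulate f) }
  ... | yes _ | yes _ | no ¬p = no λ { (cons _ _ p) → ¬p p }

  -- A hole is recognised by the two induced paths that omit one of its first and last vertices,
  -- together with the edge between these two: `mkHole` with an empty second arc.
  hole? : ∀ L → Dec (IsHole L)
  hole? L with 4 ≤? length L
  ... | no ¬l = no λ h → ¬l (IsHole.len4 h)
  hole? (a ∷ p ∷ m ∷ L) | yes l with snoc-view m L
  ... | P , b , eq with path? (a ∷ p ∷ P) | path? (p ∷ P ++ b ∷ []) | E? b a
  ...   | yes p₁ | yes p₂ | yes e = yes (subst (λ K → IsHole (a ∷ p ∷ K)) (sym eq)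
          (mkHole P [] p₁ p₂ (edge e) (λ _ ()) (subst (λ K → 4 ≤ 2 + length K) eq l)))
  ...   | no ¬p | _ | _ = no λ h → ¬p (IsHole.cut h (a ∷ p ∷ P) b [] (cong (λ K → a ∷ p ∷ K) eq))
  ...   | yes _ | no ¬p | _ = no λ h → ¬p (subst (λ K → IPath (p ∷ K)) eq (hole-tail h))
  ...   | yes _ | yes _ | no ¬e = no λ h → ¬e (hole-edgeₑ (p ∷ P) (subst (λ K → IsHole (a ∷ p ∷ K)) eq h))
  hole? [] | yes ()
  hole? (_ ∷ []) | yes (s≤s ())
  hole? (_ ∷ _ ∷ []) | yes (s≤s (s≤s ()))

  module _ (H : Hole G) (x : V G) where

    onHole? : ∀ z → Dec (OnHole H z)
    onHole? z = anyUpTo? (λ i → z ≟ vtx H i) (len H)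

    sector? : ∀ p d → Dec (IsSector G H x p d)
    sector? p d = (p <? len H) ×-dec (1 ≤? d) ×-dec (d <? len H) ×-dec E? x (vtx H p) ×-dec E? x (vtx H (p + d)) ×-dec
      map′ (λ f e l r → f {e} r l) (λ f {e} r l → f e l r) (allUpTo? (λ e → (1 ≤? e) →-dec (adj G x (vtx H (p + e)) Bool.≟ false))
          d)

    sectorSet? : ∀ p d z → Dec (SectorSet H p d z)
    sectorSet? p d z = map′ (λ { (e , s≤s l , r) → e , l , r }) (λ { (e , l , r) → e , s≤s l , r })
        (anyUpTo? (λ e → z ≟ vtx H (p + e)) (suc d))

    sectorCut? : ∀ p d z → Dec (SectorCut G H x p d z)
    sectorCut? p d z = ((E? x z ⊎-dec (z ≟ x)) ×-dec ¬? (onHole? z)) ⊎-dec (z ≟ vtx H p) ⊎-dec (z ≟ vtx H (p + d))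

    SectorsCut : Set
    SectorsCut = ∀ p d → IsSector G H x p d →
      CutsetSeparating G (SectorCut G H x p d) (SectorSet H p d) (λ z → OnHole H z × ¬ SectorSet H p d z)

    -- `IsSector` puts p and d below the length of the hole, which makes both quantifiers finite.
    sectors-cut? : Dec SectorsCut
    sectors-cut? = map′ (λ f p d s → f {p} (proj₁ s) {d} (proj₁ (proj₂ (proj₂ s))) s) (λ f {p} _ {d} _ s → f p d s)
      (allUpTo? (λ p → allUpTo? (λ d → sector? p d →-dec separating? p d) (len H)) (len H))
      where
      separating? : ∀ p d → Dec (CutsetSeparating G (SectorCut G H x p d) (SectorSet H p d)
          (λ z → OnHole H z × ¬ SectorSet H p d z))
      separating? p d = cutset? (sectorCut? p d) ×-dec all? λ u → all? λ v → sectorSet? p d u →-dec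
          (onHole? v ×-dec ¬? (sectorSet? p d v)) →-dec
        ¬? (sectorCut? p d u) →-dec ¬? (sectorCut? p d v) →-dec ¬? (reach? (λ z → ¬? (sectorCut? p d z)) u v)

  -- A `Hole` stores a function on all naturals, so the search runs over rims given as lists. A
  -- negative answer for these is what the proof by contradiction uses.
  WheelOn : List (V G) → Set
  WheelOn [] = ⊥
  WheelOn (u ∷ M) = Σ (IsHole (u ∷ M)) λ h → ∃[ x ] (¬ (x ∈ u ∷ M) × 3 ≤ cnt x (u ∷ M) × SectorsCut (OfList.holeOf G u M h) x)

  wheelOn? : ∀ L → Dec (WheelOn L)
  wheelOn? [] = no λ ()
  wheelOn? (u ∷ M) with hole? (u ∷ M)
  ... | no ¬h = no λ { (h , _) → ¬h h }
  ... | yes h = map′ (λ r → h , r) proj₂ (any? λ x → ¬? (mem? _≟_ x (u ∷ M)) ×-dec (3 ≤? cnt x (u ∷ M)) ×-dec sectors-cut?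
          (OfList.holeOf G u M h) x)

  wheel-on? : Dec (∃[ L ] (length L ≤ n G × WheelOn L))
  wheel-on? = some-list? wheelOn? (n G)

  decomposition : ∀ {L} → WheelOn L → HasWheelDecomposition G
  decomposition {u ∷ M} (h , x , x∉ , c , cuts) = OfList.holeOf G u M h , x , OfList.isWheel G u M h x∉ c , cuts

-- The two minimisations and the final assembly.

module NoWheels (G : Graph) (tri : Paths.TriangleFree G) (isk : ¬ ContainsISK4 G)
  (no-decomposition : ∀ {L} → ¬ Decide.WheelOn G L) where
  open Paths G
  open Wheels G tri isk
  open GoodWheels G tri isk
  open Sectors G tri isk
  open Wheel

  -- Induction on the number of spokes provides the assumption `fewer` of `Violations`; the length
  -- of the rim is not controlled here.
  no-good : ∀ k {L x} → cnt x L < k → Wheel L x → ¬ Good L x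
  no-good _ {[]} _ w _ with IsHole.len4 (rim w)
  ... | ()
  no-good (suc k) {u ∷ M} {x} (s≤s lt) w good = no-decomposition {u ∷ M} (rim w , x , hub∉ w , spokes w ,
    sector-cut w (Violations.no-violation w good λ w′ good′ lt′ → no-good k (≤-trans lt′ lt) w′ good′))

  -- The induction on the length of the rim serves to make the wheel good, after which `no-good`
  -- takes over.
  no-wheel′ : ∀ k {L x} → length L < k → ¬ Wheel L x
  no-wheel′ (suc k) {L} {x} (s≤s lt) w = no-good (suc (cnt x L)) ≤-refl w
      (smallest⇒good w λ w′ lt′ → no-wheel′ k (≤-trans lt′ lt) w′)

  no-wheel : ∀ {L z} → IsHole L → ¬ (z ∈ L) → cnt z L ≤ 2
  no-wheel {L} {z} h z∉ with cnt z L ≤? 2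
  ... | yes c = c
  ... | no ¬c = ⊥-elim (no-wheel′ (suc (length L)) ≤-refl (mkWheel h z∉ (≰⇒> ¬c)))

triangle-free : ∀ {G} → ¬ (K 3 ⊑ G) → ∀ {a b c} → Paths.E G a b → Paths.E G b c → ¬ Paths.E G a c
triangle-free {G} no-K3 {a} {b} {c} ab bc ac = no-K3 (record { emb = f ; emb-inj = f-inj ; emb-adj = f-adj })
  where
  open Paths G
  f : Fin 3 → V G
  f zero = a
  f (suc zero) = b
  f (suc (suc zero)) = c
  f-inj : ∀ {x y} → f x ≡ f y → x ≡ y
  f-inj {zero} {zero} _ = refl
  f-inj {suc zero} {suc zero} _ = refl
  f-inj {suc (suc zero)} {suc (suc zero)} _ = refl
  f-inj {zero} {suc zero} e = ⊥-elim (E⇒≢ ab e)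
  f-inj {suc zero} {zero} e = ⊥-elim (E⇒≢ ab (sym e))
  f-inj {suc zero} {suc (suc zero)} e = ⊥-elim (E⇒≢ bc e)
  f-inj {suc (suc zero)} {suc zero} e = ⊥-elim (E⇒≢ bc (sym e))
  f-inj {zero} {suc (suc zero)} e = ⊥-elim (E⇒≢ ac e)
  f-inj {suc (suc zero)} {zero} e = ⊥-elim (E⇒≢ ac (sym e))
  f-adj : ∀ x y → adj (K 3) x y ≡ adj G (f x) (f y)
  f-adj zero zero = sym (adj-irrefl G a)
  f-adj (suc zero) (suc zero) = sym (adj-irrefl G b)
  f-adj (suc (suc zero)) (suc (suc zero)) = sym (adj-irrefl G c)
  f-adj zero (suc zero) = sym ab
  f-adj (suc zero) zero = sym (E-sym ab)
  f-adj (suc zero) (suc (suc zero)) = sym bc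
  f-adj (suc (suc zero)) (suc zero) = sym (E-sym bc)
  f-adj zero (suc (suc zero)) = sym ac
  f-adj (suc (suc zero)) zero = sym (E-sym ac)

theorem3p8 : (G : Graph) → ¬ (K 3 ⊑ G) → ¬ ContainsISK4 G →
    SeriesParallel G ⊎ CompleteBipartite G ⊎ HasSmallCliqueCutset G ⊎ HasWheelDecomposition G
theorem3p8 G no-K3 isk with Decide.complete-bipartite? G | Decide.small-clique-cutset? G | Decide.wheel-on? G
... | yes cb | _ | _ = inj₂ (inj₁ cb)
... | no _ | yes scc | _ = inj₂ (inj₂ (inj₁ scc))
... | no _ | no _ | yes (L , _ , wd) = inj₂ (inj₂ (inj₂ (Decide.decomposition G {L} wd)))
... | no ¬cb | no ¬scc | no ¬wd = inj₁ series-parallel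
  where
  tri : ∀ {a b c} → Paths.E G a b → Paths.E G b c → ¬ Paths.E G a c
  tri = triangle-free no-K3
  no-dec : ∀ {L} → ¬ Decide.WheelOn G L
  -- The search was bounded by the number of vertices; a rim has no repetition and so stays within
  -- the bound.
  no-dec {L} wd = ¬wd (L , bound L wd , wd)
    where
    bound : ∀ L → Decide.WheelOn G L → length L ≤ n G
    bound (u ∷ M) (h , _) = Decide.unique-length G (Decide.hole-unique G h)
  series-parallel : SeriesParallel G
  series-parallel (H , sub , emb) = Components.cycle-attached G tri isk (NoWheels.no-wheel G tri isk no-dec)
      (Bicliques.no-K₃₃ G tri isk ¬cb ¬scc) (suc (length M)) ≤-refl cyc conn off att
    where open Model (model-map emb (subdivision-model sub))
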